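{- Let $K$ be an (unknown) positive integer, let $0<\mu<1$, and let $\lambda\ge\max\left(\frac{2^{56}}{\mu^2},\ \sqrt[5]{\frac{48}{\mu}\ln K}\right)$. Let $(p,q,\omega)$ be a triple produced by the algorithm described below on input $\lambda$. Then the probability that $q$ divides $K$ is at most $\mu$.
   Context: The algorithm, given $\lambda$ and a failure parameter $\epsilon\in(0,1)$ with $\lambda\ge 2^{58}/\epsilon^2$, proceeds as follows (primality being tested by a deterministic polynomial-time primality test): (1) sample at most $\frac{5}{6}\ln\frac{4}{\epsilon}\ln\lambda$ independent uniformly random odd integers $p\in(\lambda,2\lambda)$ until one is prime; return \textsc{fail} if none is prime. (2) Sample at most $12\ln\frac{4}{\epsilon}\ln\lambda$ independent uniformly random even integers $a\in[1,\lambda^5]$ until $q=ap+1$ is prime; return \textsc{fail} if none gives a prime. (3) Sample at most $\log_p\frac{4}{\epsilon}$ independent uniformly random elements $\zeta\in\mathbb{F}_q^\times$ until $\omega=\zeta^{(q-1)/p}\ne 1$; return \textsc{fail} if $\omega=1$ for every sampled $\zeta$. (4) Return $(p,q,\omega)$. With probability at least $1-\epsilon$ this returns a triple in which $p$ is a uniformly random prime in $(\lambda,2\lambda)$, $q\le\lambda^6$ is a prime with $p\mid q-1$, and $\omega$ is a primitive $p$-th root of unity in $\mathbb{F}_q$. -}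

module Defs where

open import Data.Integer as ℤ using ()
open import Data.List as List using (List; []; _∷_)
open import Data.List.Membership.Propositional using (_∈_)
open import Data.List.NonEmpty as List⁺ using (List⁺; _∷_; toList)
open import Data.List.Relation.Unary.Unique.Propositional using (Unique)
open import Data.Maybe using (Maybe; just; nothing; Is-just)
open import Data.Maybe.Relation.Unary.Any as Maybe using ()
open import Data.Nat as ℕ using (ℕ; zero; suc; _∸_; _!)
open import Data.Nat.Divisibility using (_∣_; _∤_; _∣?_)
open import Data.Nat.DivMod as ℕ using ()
open import Data.Nat.Primality using (Prime; prime?; prime⇒nonZero)
import Data.Nat.Properties as ℕ
open import Data.Product using (Σ; ∃; ∃-syntax; Σ-syntax; _×_; _,_; proj₁; proj₂)
open import Data.Rational as ℚ using (ℚ; 0ℚ; 1ℚ; ½; Positive; 1/_)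
import Data.Rational.Properties as ℚ
open import Data.Rational.Solver using (module +-*-Solver)
open import Data.Unit using (tt)
open import Function.Base using (it)
open import Function.Bundles using (_⇔_)
open import Relation.Binary.PropositionalEquality
open import Relation.Nullary using (Dec; does; yes; no; contradiction)
open import Relation.Nullary.Decidable using (¬?)
open import Relation.Unary using (Pred; Decidable)
open import Relation.Unary.Properties using (_∩?_)
open import Data.Bool using (if_then_else_)
open import Level using (0ℓ)

Cauchy : (ℕ → ℚ) → Set
Cauchy s = ∀ e → .{{Positive e}} →
  ∃[ N ] ∀ {m n} → N ℕ.≤ m → N ℕ.≤ n → ℚ.∣ s m ℚ.- s n ∣ ℚ.< e

record ℝ : Set where
  constructor mkℝ
  field
    seq    : ℕ → ℚ
    cauchy : Cauchy seq

open ℝ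

infix 4 _≤_ _<_ _≈_

_≤_ : ℝ → ℝ → Set
x ≤ y = ∀ e → .{{Positive e}} → ∃[ N ] ∀ {n} → N ℕ.≤ n → seq x n ℚ.≤ seq y n ℚ.+ e

_≈_ : ℝ → ℝ → Set
x ≈ y = (x ≤ y) × (y ≤ x)

record _<_ (x y : ℝ) : Set where
  field
    gap           : ℚ
    gap-pos       : Positive gap
    from          : ℕ
    gap-separates : ∀ {n} → from ℕ.≤ n → seq x n ℚ.+ gap ℚ.≤ seq y n

open _<_

private
  open +-*-Solver

  sub-+ : ∀ a b c d → (a ℚ.+ b) ℚ.- (c ℚ.+ d) ≡ (a ℚ.- c) ℚ.+ (b ℚ.- d)
  sub-+ = solve 4 (λ a b c d → (a :+ b) :- (c :+ d) := (a :- c) :+ (b :- d)) refl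

  add-sub : ∀ a b → a ≡ b ℚ.+ (a ℚ.- b)
  add-sub = solve 2 (λ a b → a := b :+ (a :- b)) refl

  sub-* : ∀ a b c d → a ℚ.* b ℚ.- c ℚ.* d ≡ a ℚ.* (b ℚ.- d) ℚ.+ d ℚ.* (a ℚ.- c)
  sub-* = solve 4 (λ a b c d → a :* b :- c :* d := a :* (b :- d) :+ d :* (a :- c)) refl

  quotient : ∀ c e → .(Positive c) → .(Positive e) → Σ[ d ∈ ℚ ] Positive d × c ℚ.* d ≡ e
  quotient c e c>0 e>0 = i ℚ.* e , ℚ.pos*pos⇒pos i {{ℚ.1/pos⇒pos c {{c>0}}}} e {{e>0}} ,
    trans (sym (ℚ.*-assoc c i e)) (trans (cong (ℚ._* e) (ℚ.*-inverseʳ c {{c≢0}})) (ℚ.*-identityˡ e))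
    where
    .c≢0 : ℚ.NonZero c
    c≢0 = ℚ.pos⇒nonZero c {{c>0}}
    i = (1/ c) {{c≢0}}

  clear-denominators : ∀ i j a b →
    (i ℚ.- j) ℚ.* (a ℚ.* b) ≡ (i ℚ.* a) ℚ.* b ℚ.- (j ℚ.* b) ℚ.* a
  clear-denominators =
    solve 4 (λ i j a b → (i :- j) :* (a :* b) := (i :* a) :* b :- (j :* b) :* a) refl

  positive-halves : ∀ e → .{{Positive e}} → Positive (½ ℚ.* e)
  positive-halves e = ℚ.pos*pos⇒pos ½ e

  add-halves : ∀ e → ½ ℚ.* e ℚ.+ ½ ℚ.* e ≡ e
  add-halves e = trans (sym (ℚ.*-distribʳ-+ e ½ ½)) (ℚ.*-identityˡ e)

  max-≤ˡ : ∀ {a b n} → a ℕ.⊔ b ℕ.≤ n → a ℕ.≤ n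
  max-≤ˡ {a} {b} = ℕ.≤-trans (ℕ.m≤m⊔n a b)

  max-≤ʳ : ∀ {a b n} → a ℕ.⊔ b ℕ.≤ n → b ℕ.≤ n
  max-≤ʳ {a} {b} = ℕ.≤-trans (ℕ.m≤n⊔m a b)

  cauchy-const : ∀ q → Cauchy (λ _ → q)
  cauchy-const q e = 0 , λ _ _ →
    subst (λ z → ℚ.∣ z ∣ ℚ.< e) (sym (ℚ.+-inverseʳ q)) (ℚ.positive⁻¹ e)

  cauchy-+ : ∀ {s t} → Cauchy s → Cauchy t → Cauchy (λ n → s n ℚ.+ t n)
  cauchy-+ {s} {t} cs ct e = N ℕ.⊔ M , λ {m} {n} p q → begin-strict
      ℚ.∣ (s m ℚ.+ t m) ℚ.- (s n ℚ.+ t n) ∣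
        ≡⟨ cong ℚ.∣_∣ (sub-+ (s m) (t m) (s n) (t n)) ⟩
      ℚ.∣ (s m ℚ.- s n) ℚ.+ (t m ℚ.- t n) ∣
        ≤⟨ ℚ.∣p+q∣≤∣p∣+∣q∣ (s m ℚ.- s n) (t m ℚ.- t n) ⟩
      ℚ.∣ s m ℚ.- s n ∣ ℚ.+ ℚ.∣ t m ℚ.- t n ∣
        <⟨ ℚ.+-mono-< (proj₂ S (max-≤ˡ p) (max-≤ˡ q)) (proj₂ T (max-≤ʳ {N} p) (max-≤ʳ {N} q)) ⟩
      ½ ℚ.* e ℚ.+ ½ ℚ.* e
        ≡⟨ add-halves e ⟩
      e ∎
    where
    open ℚ.≤-Reasoning
    S = cs (½ ℚ.* e) {{positive-halves e}}
    T = ct (½ ℚ.* e) {{positive-halves e}}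
    N = proj₁ S
    M = proj₁ T

  Bounded : (ℕ → ℚ) → Set
  Bounded s = Σ[ B ∈ ℚ ] Positive B × (∃[ N ] ∀ {n} → N ℕ.≤ n → ℚ.∣ s n ∣ ℚ.≤ B)

  cauchy⇒bounded : ∀ {s} → Cauchy s → Bounded s
  cauchy⇒bounded {s} cs = ℚ.∣ s N ∣ ℚ.+ 1ℚ
      , ℚ.nonNeg+pos⇒pos ℚ.∣ s N ∣ {{ℚ.∣-∣-nonNeg (s N)}} 1ℚ
      , N , λ {n} p → begin
        ℚ.∣ s n ∣                          ≡⟨ cong ℚ.∣_∣ (add-sub (s n) (s N)) ⟩
        ℚ.∣ s N ℚ.+ (s n ℚ.- s N) ∣        ≤⟨ ℚ.∣p+q∣≤∣p∣+∣q∣ (s N) (s n ℚ.- s N) ⟩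
        ℚ.∣ s N ∣ ℚ.+ ℚ.∣ s n ℚ.- s N ∣    ≤⟨ ℚ.+-monoʳ-≤ ℚ.∣ s N ∣ (ℚ.<⇒≤ (proj₂ C p ℕ.≤-refl)) ⟩
        ℚ.∣ s N ∣ ℚ.+ 1ℚ                   ∎
    where
    open ℚ.≤-Reasoning
    C = cs 1ℚ
    N = proj₁ C

  combine : ∀ a b u v A B d → .(Positive A) → .(Positive B) →
            ℚ.∣ a ∣ ℚ.≤ A → ℚ.∣ b ∣ ℚ.≤ B → ℚ.∣ u ∣ ℚ.< d → ℚ.∣ v ∣ ℚ.< d →
            ℚ.∣ a ℚ.* u ℚ.+ b ℚ.* v ∣ ℚ.< (A ℚ.+ B) ℚ.* d
  combine a b u v A B d A>0 B>0 a≤A b≤B u<d v<d = begin-strict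
    ℚ.∣ a ℚ.* u ℚ.+ b ℚ.* v ∣
      ≤⟨ ℚ.∣p+q∣≤∣p∣+∣q∣ (a ℚ.* u) (b ℚ.* v) ⟩
    ℚ.∣ a ℚ.* u ∣ ℚ.+ ℚ.∣ b ℚ.* v ∣
      ≡⟨ cong₂ ℚ._+_ (ℚ.∣p*q∣≡∣p∣*∣q∣ a u) (ℚ.∣p*q∣≡∣p∣*∣q∣ b v) ⟩
    ℚ.∣ a ∣ ℚ.* ℚ.∣ u ∣ ℚ.+ ℚ.∣ b ∣ ℚ.* ℚ.∣ v ∣
      ≤⟨ ℚ.+-mono-≤ {ℚ.∣ a ∣ ℚ.* ℚ.∣ u ∣} {A ℚ.* ℚ.∣ u ∣} {ℚ.∣ b ∣ ℚ.* ℚ.∣ v ∣} {B ℚ.* ℚ.∣ v ∣}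
           (ℚ.*-monoʳ-≤-nonNeg ℚ.∣ u ∣ {{ℚ.∣-∣-nonNeg u}} {ℚ.∣ a ∣} {A} a≤A)
           (ℚ.*-monoʳ-≤-nonNeg ℚ.∣ v ∣ {{ℚ.∣-∣-nonNeg v}} {ℚ.∣ b ∣} {B} b≤B) ⟩
    A ℚ.* ℚ.∣ u ∣ ℚ.+ B ℚ.* ℚ.∣ v ∣
      <⟨ ℚ.+-mono-< {A ℚ.* ℚ.∣ u ∣} {A ℚ.* d} {B ℚ.* ℚ.∣ v ∣} {B ℚ.* d}
           (ℚ.*-monoʳ-<-pos A {{A>0}} {ℚ.∣ u ∣} {d} u<d)
           (ℚ.*-monoʳ-<-pos B {{B>0}} {ℚ.∣ v ∣} {d} v<d) ⟩
    A ℚ.* d ℚ.+ B ℚ.* d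
      ≡⟨ sym (ℚ.*-distribʳ-+ d A B) ⟩
    (A ℚ.+ B) ℚ.* d ∎
    where open ℚ.≤-Reasoning

  cauchy-* : ∀ {s t} → Cauchy s → Cauchy t → Cauchy (λ n → s n ℚ.* t n)
  cauchy-* {s} {t} cs ct e =
      (N₁ ℕ.⊔ N₂) ℕ.⊔ (M₁ ℕ.⊔ M₂) , λ {m} {n} p q →
        subst₂ (λ x y → ℚ.∣ x ∣ ℚ.< y) (sym (sub-* (s m) (t m) (s n) (t n))) (proj₂ (proj₂ D))
          (combine (s m) (t n) (t m ℚ.- t n) (s m ℚ.- s n) A B d A>0 B>0
            (proj₂ (proj₂ (proj₂ S)) (max-≤ˡ {N₁} {N₂} (max-≤ˡ {N₁ ℕ.⊔ N₂} p)))
            (proj₂ (proj₂ (proj₂ T)) (max-≤ʳ {N₁} {N₂} (max-≤ˡ {N₁ ℕ.⊔ N₂} q)))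
            (proj₂ T′ (max-≤ʳ {M₁} (max-≤ʳ {N₁ ℕ.⊔ N₂} p)) (max-≤ʳ {M₁} (max-≤ʳ {N₁ ℕ.⊔ N₂} q)))
            (proj₂ S′ (max-≤ˡ {M₁} (max-≤ʳ {N₁ ℕ.⊔ N₂} p)) (max-≤ˡ {M₁} (max-≤ʳ {N₁ ℕ.⊔ N₂} q))))
    where
    S = cauchy⇒bounded {s} cs
    T = cauchy⇒bounded {t} ct
    A = proj₁ S
    B = proj₁ T
    A>0 = proj₁ (proj₂ S)
    B>0 = proj₁ (proj₂ T)
    N₁ = proj₁ (proj₂ (proj₂ S))
    N₂ = proj₁ (proj₂ (proj₂ T))
    D = quotient (A ℚ.+ B) e (ℚ.pos+pos⇒pos A {{A>0}} B {{B>0}}) it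
    d = proj₁ D
    S′ = cs d {{proj₁ (proj₂ D)}}
    T′ = ct d {{proj₁ (proj₂ D)}}
    M₁ = proj₁ S′
    M₂ = proj₁ T′

-- The rational reciprocal, with the convention that the reciprocal of 0 is 0.
inv : ℚ → ℚ
inv q with q ℚ.≟ 0ℚ
... | yes _   = 0ℚ
... | no  q≢0 = (1/ q) {{ℚ.≢-nonZero q≢0}}

private
  inv-inverse : ∀ {q} → 0ℚ ℚ.< q → inv q ℚ.* q ≡ 1ℚ
  inv-inverse {q} 0<q with q ℚ.≟ 0ℚ
  ... | yes q≡0 = contradiction (sym q≡0) (ℚ.<⇒≢ 0<q)
  ... | no  q≢0 = ℚ.*-inverseˡ q {{ℚ.≢-nonZero q≢0}}

  cauchy-inv : ∀ {s} δ → .(Positive δ) → ∀ M → (∀ {n} → M ℕ.≤ n → δ ℚ.≤ s n) →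
               Cauchy s → Cauchy (λ n → inv (s n))
  cauchy-inv {s} δ δ>0 M δ≤s cs e = M ℕ.⊔ proj₁ S , λ {m} {n} p q →
      let a = s m ; b = s n
          δ≤a = δ≤s (max-≤ˡ p) ; δ≤b = δ≤s (max-≤ˡ q)
          0<a = ℚ.<-≤-trans 0<δ δ≤a ; 0<b = ℚ.<-≤-trans 0<δ δ≤b
          0≤a = ℚ.<⇒≤ 0<a
          0≤ab : 0ℚ ℚ.≤ a ℚ.* b
          0≤ab = ℚ.<⇒≤ (ℚ.positive⁻¹ _ {{ℚ.pos*pos⇒pos a {{ℚ.positive 0<a}} b {{ℚ.positive 0<b}}}})
          x = inv a ℚ.- inv b
      in ℚ.*-cancelʳ-<-nonNeg (δ ℚ.* δ) {{ℚ.pos⇒nonNeg (δ ℚ.* δ) {{δδ>0}}}} (begin-strict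
        ℚ.∣ x ∣ ℚ.* (δ ℚ.* δ)
          ≤⟨ ℚ.*-monoˡ-≤-nonNeg ℚ.∣ x ∣ {{ℚ.∣-∣-nonNeg x}} (ℚ.≤-trans
               (ℚ.*-monoˡ-≤-nonNeg δ {{ℚ.pos⇒nonNeg δ {{δ>0}}}} δ≤b)
               (ℚ.*-monoʳ-≤-nonNeg b {{ℚ.nonNegative (ℚ.<⇒≤ 0<b)}} δ≤a)) ⟩
        ℚ.∣ x ∣ ℚ.* (a ℚ.* b)
          ≡⟨ cong (ℚ.∣ x ∣ ℚ.*_) (sym (ℚ.0≤p⇒∣p∣≡p 0≤ab)) ⟩
        ℚ.∣ x ∣ ℚ.* ℚ.∣ a ℚ.* b ∣
          ≡⟨ sym (ℚ.∣p*q∣≡∣p∣*∣q∣ x (a ℚ.* b)) ⟩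
        ℚ.∣ x ℚ.* (a ℚ.* b) ∣
          ≡⟨ cong ℚ.∣_∣ (clear-denominators (inv a) (inv b) a b) ⟩
        ℚ.∣ (inv a ℚ.* a) ℚ.* b ℚ.- (inv b ℚ.* b) ℚ.* a ∣
          ≡⟨ cong₂ (λ i j → ℚ.∣ i ℚ.* b ℚ.- j ℚ.* a ∣) (inv-inverse 0<a) (inv-inverse 0<b) ⟩
        ℚ.∣ 1ℚ ℚ.* b ℚ.- 1ℚ ℚ.* a ∣
          ≡⟨ cong₂ (λ i j → ℚ.∣ i ℚ.- j ∣) (ℚ.*-identityˡ b) (ℚ.*-identityˡ a) ⟩
        ℚ.∣ b ℚ.- a ∣
          <⟨ proj₂ S (max-≤ʳ {M} q) (max-≤ʳ {M} p) ⟩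
        e ℚ.* (δ ℚ.* δ) ∎)
    where
    open ℚ.≤-Reasoning
    δδ>0 : Positive (δ ℚ.* δ)
    δδ>0 = ℚ.pos*pos⇒pos δ {{ℚ.positive (ℚ.positive⁻¹ δ {{δ>0}})}} δ {{ℚ.positive (ℚ.positive⁻¹ δ {{δ>0}})}}
    0<δ : 0ℚ ℚ.< δ
    0<δ = ℚ.positive⁻¹ δ {{δ>0}}
    S = cs (e ℚ.* (δ ℚ.* δ)) {{ℚ.pos*pos⇒pos e (δ ℚ.* δ) {{δδ>0}}}}

infixl 6 _+_
infixl 7 _*_ _÷_
infixr 8 _^_

fromℚ : ℚ → ℝ
fromℚ q = mkℝ (λ _ → q) (cauchy-const q)

fromℕ : ℕ → ℝ
fromℕ n = fromℚ (ℤ.+ n ℚ./ 1)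

_+_ : ℝ → ℝ → ℝ
x + y = mkℝ (λ n → seq x n ℚ.+ seq y n) (cauchy-+ {seq x} {seq y} (cauchy x) (cauchy y))

_*_ : ℝ → ℝ → ℝ
x * y = mkℝ (λ n → seq x n ℚ.* seq y n) (cauchy-* {seq x} {seq y} (cauchy x) (cauchy y))

_^_ : ℝ → ℕ → ℝ
x ^ zero  = fromℕ 1
x ^ suc n = x * x ^ n

_÷_ : (x y : ℝ) {{_ : fromℕ 0 < y}} → ℝ
_÷_ x y {{0<y}} = x * mkℝ (λ n → inv (seq y n))
  (cauchy-inv (gap 0<y) (gap-pos 0<y) (from 0<y)
    (λ {n} p → subst (ℚ._≤ seq y n) (ℚ.+-identityˡ (gap 0<y)) (gap-separates 0<y p))
    (cauchy y))

^-positive : ∀ x n → {{fromℕ 0 < x}} → fromℕ 0 < x ^ n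
^-positive x zero = record
  { gap = 1ℚ ; gap-pos = _ ; from = 0 ; gap-separates = λ _ → ℚ.≤-refl }
^-positive x (suc n) {{0<x}} = record
  { gap           = a ℚ.* b
  ; gap-pos       = ℚ.pos*pos⇒pos a {{gap-pos 0<x}} b {{gap-pos 0<xⁿ}}
  ; from          = from 0<x ℕ.⊔ from 0<xⁿ
  ; gap-separates = λ {k} p →
      let a≤ = subst (ℚ._≤ seq x k) (ℚ.+-identityˡ a) (gap-separates 0<x (max-≤ˡ p))
          b≤ = subst (ℚ._≤ seq (x ^ n) k) (ℚ.+-identityˡ b) (gap-separates 0<xⁿ (max-≤ʳ {from 0<x} p))
          0≤a = ℚ.<⇒≤ (ℚ.positive⁻¹ a {{gap-pos 0<x}})
          0≤b = ℚ.<⇒≤ (ℚ.positive⁻¹ b {{gap-pos 0<xⁿ}})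
      in subst (ℚ._≤ seq (x ^ suc n) k) (sym (ℚ.+-identityˡ (a ℚ.* b)))
           (ℚ.≤-trans
             (ℚ.*-monoˡ-≤-nonNeg a {{ℚ.nonNegative 0≤a}} b≤)
             (ℚ.*-monoʳ-≤-nonNeg (seq (x ^ n) k)
               {{ℚ.nonNegative (ℚ.≤-trans 0≤b b≤)}} a≤))
  }
  where
  0<xⁿ = ^-positive x n
  a = gap 0<x
  b = gap 0<xⁿ

-- Roots, logarithms and ceilings are given as relations; a constructive
-- function computing the ceiling of an arbitrary real does not exist.

IsLimit : (ℕ → ℝ) → ℝ → Set
IsLimit s x = ∀ e → .{{Positive e}} →
  ∃[ N ] ∀ {n} → N ℕ.≤ n → (s n ≤ x + fromℚ e) × (x ≤ s n + fromℚ e)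

expSum : ℝ → ℕ → ℝ
expSum x zero    = fromℕ 0
expSum x (suc k) = expSum x k + x ^ k * fromℚ ((ℤ.+ 1 ℚ./ (k !)) {{k !≢0}})
  where open import Data.Nat.Properties using (_!≢0)

-- IsLn x l means l = ln x, that is, exp l = x.
IsLn : ℝ → ℝ → Set
IsLn x l = IsLimit (expSum l) x

-- IsLog b x l means l = log_b x = ln x / ln b, for b > 1.
IsLog : ℝ → ℝ → ℝ → Set
IsLog b x l = ∃[ lnb ] ∃[ lnx ] Σ[ 0<lnb ∈ fromℕ 0 < lnb ]
  IsLn b lnb × IsLn x lnx × (l ≈ _÷_ lnx lnb {{0<lnb}})

IsRoot : ℕ → ℝ → ℝ → Set
IsRoot n x r = (fromℕ 0 ≤ r) × (r ^ n ≈ x)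

IsCeiling : ℝ → ℕ → Set
IsCeiling x n = (x ≤ fromℕ n) × (fromℕ n < x + fromℕ 1)

data Rand (A : Set) : Set where
  return : A → Rand A
  draw   : List⁺ ℕ → (ℕ → Rand A) → Rand A

infixl 1 _>>=_

_>>=_ : ∀ {A B : Set} → Rand A → (A → Rand B) → Rand B
return a  >>= f = f a
draw xs k >>= f = draw xs (λ x → k x >>= f)

mean : List⁺ ℚ → ℚ
mean xs = List.foldr ℚ._+_ 0ℚ (toList xs) ℚ.* (ℤ.+ 1 ℚ./ List⁺.length xs)

Pr : ∀ {A : Set} {P : Pred A 0ℓ} → Decidable P → Rand A → ℚ
Pr P? (return a)  = if does (P? a) then 1ℚ else 0ℚ
Pr P? (draw xs k) = mean (List⁺.map (λ x → Pr P? (k x)) xs)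

-- The probability of P given Q, which is 0 by convention if Q has probability 0.
condPr : ∀ {A : Set} {P Q : Pred A 0ℓ} → Decidable P → Decidable Q → Rand A → ℚ
condPr P? Q? r = Pr (P? ∩? Q?) r ℚ.* inv (Pr Q? r)

drawUntil : ∀ {P : Pred ℕ 0ℓ} → Decidable P → ℕ → List⁺ ℕ → Rand (Maybe (∃ P))
drawUntil     P? zero    xs = return nothing
drawUntil {P} P? (suc n) xs = draw xs λ x → check x (P? x)
  where
  check : ∀ x → Dec (P x) → Rand (Maybe (∃ P))
  check x (yes Px) = return (just (x , Px))
  check x (no  _)  = drawUntil P? n xs

orFail : ∀ {A B : Set} → (A → Rand (Maybe B)) → Maybe A → Rand (Maybe B)
orFail f nothing  = return nothing
orFail f (just a) = f a

-- xs lists the elements of P without repetition, so that drawing from xs is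
-- drawing uniformly from P.
Lists : List⁺ ℕ → Pred ℕ 0ℓ → Set
Lists xs P = Unique (toList xs) × (∀ n → n ∈ toList xs ⇔ P n)

record Parameters : Set where
  field
    odds evens    : List⁺ ℕ
    draws₁ draws₂ : ℕ
    draws₃        : ℕ → ℕ

-- The sample spaces and numbers of draws prescribed by the inputs lam (the
-- paper's λ) and ε.  A bound "at most x draws" with x real is read as ⌈ x ⌉
-- draws: rounding down would give no draw of ζ at all, since p > λ ≥ 2⁵⁸/ε²
-- makes log_p (4/ε) smaller than 1.
PrescribedBy : (lam ε : ℝ) {{_ : fromℕ 0 < ε}} → Parameters → Set
PrescribedBy lam ε params =
  Lists odds  (λ p → 2 ∤ p × (lam < fromℕ p) × (fromℕ p < fromℕ 2 * lam)) ×
  Lists evens (λ a → 2 ∣ a × (fromℕ 1 ≤ fromℕ a) × (fromℕ a ≤ lam ^ 5)) ×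
  ∃[ lnλ ] ∃[ ln4/ε ]
    IsLn lam lnλ × IsLn (fromℕ 4 ÷ ε) ln4/ε ×
    IsCeiling (fromℚ (ℤ.+ 5 ℚ./ 6) * ln4/ε * lnλ) draws₁ ×
    IsCeiling (fromℕ 12 * ln4/ε * lnλ) draws₂ ×
    (∀ {p} → Prime p → ∃[ l ] IsLog (fromℕ p) (fromℕ 4 ÷ ε) l × IsCeiling l (draws₃ p))
  where open Parameters params

-- 1 , … , q - 1, representing the elements of 𝔽_q^× for a prime q.
units : ℕ → List⁺ ℕ
units q = 1 ∷ List.applyUpTo (2 ℕ.+_) (q ∸ 2)

-- ζ^((q - 1) / p) in 𝔽_q.
rootOfUnity : ∀ {p q} → Prime p → Prime q → ℕ → ℕ
rootOfUnity {p} {q} p-prime q-prime ζ = (ζ ℕ.^ ((q ∸ 1) ℕ./ p)) ℕ.% q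
  where
  instance
    p≢0 = prime⇒nonZero p-prime
    q≢0 = prime⇒nonZero q-prime

-- The output is a triple (p , q , ω), or nothing in case of failure.
algorithm : Parameters → Rand (Maybe (ℕ × ℕ × ℕ))
algorithm params =
  drawUntil prime? draws₁ odds >>= orFail λ (p , p-prime) →
  drawUntil (λ a → prime? (a ℕ.* p ℕ.+ 1)) draws₂ evens >>= orFail λ (a , q-prime) →
  let q    = a ℕ.* p ℕ.+ 1
      root = rootOfUnity p-prime q-prime
  in
  drawUntil (λ ζ → ¬? (root ζ ℕ.≟ 1)) (draws₃ p) (units q) >>= orFail λ (ζ , _) →
  return (just (p , q , root ζ))
  where open Parameters params

Triple : Pred (Maybe (ℕ × ℕ × ℕ)) 0ℓ
Triple = Is-just

triple? : Decidable Triple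
triple? = Maybe.dec (λ _ → yes tt)

qDivides : ℕ → Pred (Maybe (ℕ × ℕ × ℕ)) 0ℓ
qDivides K = Maybe.Any λ (p , q , ω) → q ∣ K

qDivides? : ∀ K → Decidable (qDivides K)
qDivides? K = Maybe.dec λ (p , q , ω) → q ∣? K

{-# OPTIONS --safe #-}
-- Call (p , q) a pair if p and q are primes with z < p < 2 z and p ∣ q - 1, where z is an
-- integer close to λ.  The first two stages give all pairs in their range the same weight
-- up to a factor of draws₂, and the third stage succeeds with probability at least ½, since
-- x ^ k = 1 has at most k solutions modulo q.  So it suffices that few pairs have q ∣ K and
-- that there are many pairs.  The former holds because q ∣ K for at most log₂ K primes q,
-- each in at most 6 pairs.  For the latter let H p n be the excess of n ≡ 1 (mod p) over
-- its average.  The primes q between z³ and Y = z⁶ are the integers free of prime factors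
-- below z, minus those that also have a prime factor below z³, and the latter are written
-- as products by Ramaré's weights.  This splits the sum of H p q over all p and q into
-- sums over m of H p (d m), which are small because H p sums to 0 over a period, and
-- bilinear sums, which the average over p makes small: after squaring out one variable,
-- the sums of H p (k n m) H p′ (k n′ m) over m cancel unless p = p′ and n ≡ n′ (mod p).
-- So the primes q are distributed evenly enough, and Chebyshev's bounds count them.
module Submission where

open import Data.List using (List)
open import Data.List.Membership.Propositional using (_∈_)
open import Data.List.Relation.Unary.Unique.Propositional using (Unique)
import Data.Integer as ℤ
import Data.Nat as ℕ
open ℕ using (ℕ)
import Data.Nat.Divisibility as ℕ
open import Data.Nat.Primality using (Prime)
open import Data.Product using (_×_)
open import Relation.Nullary using (Dec)
import Defs

-- The estimate has to be explicit already for z near 2⁵⁸, so the constants decide the method. Only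
-- a lower bound, on average over p, is needed, and averaging over P moduli saves about √P in each
-- bilinear sum. The range Y = z⁶ fits the sample space, because q < z⁶ and p > z force a ≤ z⁵ for q
-- = a p + 1; it makes every rough n have at most five prime factors; and since Y = z³ · z³, a
-- number below Y without prime factors below z³ is prime. Logarithms are replaced by an integer h
-- with z < 2ʰ ≤ 2 z: the total loss is a power of h against √P, which 58 ≤ h affords. Reals are
-- Cauchy sequences without a floor function, so λ enters only through an integer z with z ≤ λ ≤ z +
-- 2, and ln only through truncated exponential series, with ½ ≤ ln 2 ≤ 1 in place of its value. If
-- d primes divide K, the pairs give a probability of at most 12 d / z⁵, and d ≤ 2 ln K turns this
-- into 24 ln K / z⁵. The constant 48 of the hypothesis leaves a factor 2, which pays for the
-- passage from λ⁵ to z⁵.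

-- Finite integer sums and indicators.

module FiniteSums where
  open import Data.Nat as ℕ using (ℕ; zero; suc)
  import Data.Nat.Properties as ℕ
  open import Data.Integer hiding (suc)
  open import Data.Integer.Properties
  open import Data.Integer.Tactic.RingSolver using (solve-∀)
  open import Data.Product using (∃-syntax; _×_; _,_; proj₂)
  open import Relation.Nullary using (Dec; yes; no; ¬_; contradiction)
  open import Relation.Binary.PropositionalEquality
  open import Relation.Nullary.Decidable using (_×-dec_)
  open import Function using (_∘_)

  infix 10 ∑
  ∑ : ℕ → (ℕ → ℤ) → ℤ
  ∑ zero    f = 0ℤ
  ∑ (suc n) f = ∑ n f + f n

  syntax ∑ n (λ i → e) = ∑[ i < n ] e

  0≤1 : 0ℤ ≤ 1ℤ
  0≤1 = +≤+ ℕ.z≤n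

  abstract
    -- The Iverson bracket. It is sealed so that decisions such as primality are never evaluated;
    -- proofs know its value only through the laws below.
    ⟦_⟧ : ∀ {a} {A : Set a} → Dec A → ℤ
    ⟦ yes _ ⟧ = 1ℤ
    ⟦ no  _ ⟧ = 0ℤ

    ⟦⟧-yes : ∀ {a} {A : Set a} (d : Dec A) → A → ⟦ d ⟧ ≡ 1ℤ
    ⟦⟧-yes (yes _) _ = refl
    ⟦⟧-yes (no ¬a) a = contradiction a ¬a

    ⟦⟧-no : ∀ {a} {A : Set a} (d : Dec A) → ¬ A → ⟦ d ⟧ ≡ 0ℤ
    ⟦⟧-no (yes a) ¬a = contradiction a ¬a
    ⟦⟧-no (no _)  _  = refl

    0≤⟦⟧ : ∀ {a} {A : Set a} (d : Dec A) → 0ℤ ≤ ⟦ d ⟧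
    0≤⟦⟧ (yes _) = 0≤1
    0≤⟦⟧ (no  _) = ≤-refl

    ⟦⟧≤1 : ∀ {a} {A : Set a} (d : Dec A) → ⟦ d ⟧ ≤ 1ℤ
    ⟦⟧≤1 (yes _) = ≤-refl
    ⟦⟧≤1 (no  _) = 0≤1

    ⟦⟧-cong : ∀ {a b} {A : Set a} {B : Set b} (d : Dec A) (e : Dec B) → (A → B) → (B → A) → ⟦ d ⟧ ≡ ⟦ e ⟧
    ⟦⟧-cong (yes a) e to from = sym (⟦⟧-yes e (to a))
    ⟦⟧-cong (no ¬a) e to from = sym (⟦⟧-no e (¬a ∘ from))

    ⟦⟧-× : ∀ {a b} {A : Set a} {B : Set b} (d : Dec A) (e : Dec B) → ⟦ d ⟧ * ⟦ e ⟧ ≡ ⟦ d ×-dec e ⟧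
    ⟦⟧-× (yes _) (yes _) = refl
    ⟦⟧-× (yes _) (no _)  = refl
    ⟦⟧-× (no _)  (yes _) = refl
    ⟦⟧-× (no _)  (no _)  = refl

  0≤+ : ∀ {n} → 0ℤ ≤ + n
  0≤+ = +≤+ ℕ.z≤n

  ≤-by : ∀ {a b} d → 0ℤ ≤ d → b ≡ a + d → a ≤ b
  ≤-by {a} d 0≤d refl = subst (_≤ a + d) (+-identityʳ a) (+-monoʳ-≤ a 0≤d)

  0≤-+ : ∀ {a b} → 0ℤ ≤ a → 0ℤ ≤ b → 0ℤ ≤ a + b
  0≤-+ = +-mono-≤

  0≤-* : ∀ {a b} → 0ℤ ≤ a → 0ℤ ≤ b → 0ℤ ≤ a * b
  0≤-* {+ a} {+ b} _ _ = subst (0ℤ ≤_) (pos-* a b) 0≤+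

  ≤⇒0≤- : ∀ {a b} → a ≤ b → 0ℤ ≤ b - a
  ≤⇒0≤- = i≤j⇒0≤j-i

  *-monoˡ : ∀ {a b c} → 0ℤ ≤ c → a ≤ b → c * a ≤ c * b
  *-monoˡ {c = + c} _ = *-monoˡ-≤-nonNeg (+ c)

  *-monoʳ : ∀ {a b c} → 0ℤ ≤ c → a ≤ b → a * c ≤ b * c
  *-monoʳ {c = + c} _ = *-monoʳ-≤-nonNeg (+ c)

  *-mono : ∀ {a b c d} → 0ℤ ≤ a → a ≤ b → 0ℤ ≤ c → c ≤ d → a * c ≤ b * d
  *-mono 0≤a a≤b 0≤c c≤d = ≤-trans (*-monoʳ 0≤c a≤b) (*-monoˡ (≤-trans 0≤a a≤b) c≤d)

  0≤sq : ∀ a → 0ℤ ≤ a * a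
  0≤sq (+ a)    = subst (0ℤ ≤_) (pos-* a a) 0≤+
  0≤sq -[1+ a ] = 0≤+

  infix 4 _∣≤∣_
  -- The bound |x| ≤ b, kept as two linear inequalities so that it passes through sums and products
  -- without absolute values.
  _∣≤∣_ : ℤ → ℤ → Set
  x ∣≤∣ b = (- b ≤ x) × (x ≤ b)

  ∣≤∣-0 : 0ℤ ∣≤∣ 0ℤ
  ∣≤∣-0 = ≤-refl , ≤-refl

  ∣≤∣-of-nonneg : ∀ {x b} → 0ℤ ≤ x → x ≤ b → x ∣≤∣ b
  ∣≤∣-of-nonneg 0≤x x≤b = ≤-trans (neg-mono-≤ (≤-trans 0≤x x≤b)) 0≤x , x≤b

  ∣≤∣⇒0≤ : ∀ {x b} → x ∣≤∣ b → 0ℤ ≤ b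
  ∣≤∣⇒0≤ {x} {+ b} _ = 0≤+
  ∣≤∣⇒0≤ {x} { -[1+ b ]} (l , u) with ≤-trans l u
  ... | ()

  ∣≤∣-mono : ∀ {x b c} → b ≤ c → x ∣≤∣ b → x ∣≤∣ c
  ∣≤∣-mono b≤c (l , u) = ≤-trans (neg-mono-≤ b≤c) l , ≤-trans u b≤c

  ∣≤∣-+ : ∀ {x y a b} → x ∣≤∣ a → y ∣≤∣ b → x + y ∣≤∣ a + b
  ∣≤∣-+ {x} {y} {a} {b} (l , u) (l′ , u′) =
    subst (_≤ x + y) (sym (neg-distrib-+ a b)) (+-mono-≤ l l′) , +-mono-≤ u u′

  ∣≤∣-neg : ∀ {x b} → x ∣≤∣ b → - x ∣≤∣ b
  ∣≤∣-neg {x} {b} (l , u) = neg-mono-≤ u , subst (- x ≤_) (neg-involutive b) (neg-mono-≤ l)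

  ∣≤∣-- : ∀ {x y a b} → x ∣≤∣ a → y ∣≤∣ b → x - y ∣≤∣ a + b
  ∣≤∣-- p q = ∣≤∣-+ p (∣≤∣-neg q)

  private
    scale : ∀ {c x b} → 0ℤ ≤ c → x ∣≤∣ b → c * x ∣≤∣ c * b
    scale {c} {x} {b} 0≤c (l , u) =
      subst (_≤ c * x) (sym (neg-distribʳ-* c b)) (*-monoˡ 0≤c l) , *-monoˡ 0≤c u

  ∣≤∣-* : ∀ {x y a b} → x ∣≤∣ a → y ∣≤∣ b → x * y ∣≤∣ a * b
  ∣≤∣-* {+ n} {y} {a} {b} (_ , u) q =
    ∣≤∣-mono (*-monoʳ (∣≤∣⇒0≤ q) u) (scale {+ n} 0≤+ q)
  ∣≤∣-* {x@(-[1+ n ])} {y} {a} {b} p q =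
    subst (_∣≤∣ a * b) (trans (neg-distribˡ-* (- x) y) (cong (_* y) (neg-involutive x)))
      (∣≤∣-neg (∣≤∣-mono (*-monoʳ (∣≤∣⇒0≤ q) (proj₂ (∣≤∣-neg {x} p))) (scale {+ suc n} 0≤+ q)))

  ∑-cong : ∀ n {f g} → (∀ i → i ℕ.< n → f i ≡ g i) → ∑ n f ≡ ∑ n g
  ∑-cong zero    eq = refl
  ∑-cong (suc n) eq = cong₂ _+_ (∑-cong n λ i i<n → eq i (ℕ.m<n⇒m<1+n i<n)) (eq n (ℕ.n<1+n n))

  ∑-cong′ : ∀ n {f g} → (∀ i → f i ≡ g i) → ∑ n f ≡ ∑ n g
  ∑-cong′ n eq = ∑-cong n λ i _ → eq i

  ∑-mono : ∀ n {f g} → (∀ i → i ℕ.< n → f i ≤ g i) → ∑ n f ≤ ∑ n g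
  ∑-mono zero    le = ≤-refl
  ∑-mono (suc n) le = +-mono-≤ (∑-mono n λ i i<n → le i (ℕ.m<n⇒m<1+n i<n)) (le n (ℕ.n<1+n n))

  ∑-∣≤∣ : ∀ n {f g} → (∀ i → i ℕ.< n → f i ∣≤∣ g i) → ∑ n f ∣≤∣ ∑ n g
  ∑-∣≤∣ zero    le = ∣≤∣-0
  ∑-∣≤∣ (suc n) le = ∣≤∣-+ (∑-∣≤∣ n λ i i<n → le i (ℕ.m<n⇒m<1+n i<n)) (le n (ℕ.n<1+n n))

  ∑-zero : ∀ n {f} → (∀ i → i ℕ.< n → f i ≡ 0ℤ) → ∑ n f ≡ 0ℤ
  ∑-zero zero    eq = refl
  ∑-zero (suc n) eq = cong₂ _+_ (∑-zero n λ i i<n → eq i (ℕ.m<n⇒m<1+n i<n)) (eq n (ℕ.n<1+n n))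

  ∑-nonneg : ∀ n {f} → (∀ i → 0ℤ ≤ f i) → 0ℤ ≤ ∑ n f
  ∑-nonneg zero    le = ≤-refl
  ∑-nonneg (suc n) le = 0≤-+ (∑-nonneg n le) (le n)

  ∑-+ : ∀ n (f g : ℕ → ℤ) → ∑[ i < n ] (f i + g i) ≡ ∑ n f + ∑ n g
  ∑-+ zero    f g = refl
  ∑-+ (suc n) f g = trans (cong (_+ (f n + g n)) (∑-+ n f g)) (lemma (∑ n f) (∑ n g) (f n) (g n))
    where
    lemma : ∀ a b c d → a + b + (c + d) ≡ a + c + (b + d)
    lemma = solve-∀

  ∑-*ˡ : ∀ n c (f : ℕ → ℤ) → ∑[ i < n ] (c * f i) ≡ c * ∑ n f
  ∑-*ˡ zero    c f = sym (*-zeroʳ c)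
  ∑-*ˡ (suc n) c f = trans (cong (_+ c * f n) (∑-*ˡ n c f)) (sym (*-distribˡ-+ c (∑ n f) (f n)))

  ∑-*ʳ : ∀ n c (f : ℕ → ℤ) → ∑[ i < n ] (f i * c) ≡ ∑ n f * c
  ∑-*ʳ n c f = trans (∑-cong′ n λ i → *-comm (f i) c) (trans (∑-*ˡ n c f) (*-comm c (∑ n f)))

  ∑-neg : ∀ n (f : ℕ → ℤ) → ∑[ i < n ] (- f i) ≡ - ∑ n f
  ∑-neg zero    f = refl
  ∑-neg (suc n) f = trans (cong (_+ - f n) (∑-neg n f)) (sym (neg-distrib-+ (∑ n f) (f n)))

  ∑-- : ∀ n (f g : ℕ → ℤ) → ∑[ i < n ] (f i - g i) ≡ ∑ n f - ∑ n g
  ∑-- n f g = trans (∑-+ n f (λ i → - g i)) (cong (_+_ (∑ n f)) (∑-neg n g))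

  ∑-const : ∀ n c → ∑[ _ < n ] c ≡ + n * c
  ∑-const zero    c = sym (*-zeroˡ c)
  ∑-const (suc n) c = trans (cong (_+ c) (∑-const n c)) (lemma (+ n) c)
    where
    lemma : ∀ n c → n * c + c ≡ (1ℤ + n) * c
    lemma = solve-∀

  ∑-swap : ∀ m n (f : ℕ → ℕ → ℤ) → ∑[ i < m ] ∑[ j < n ] f i j ≡ ∑[ j < n ] ∑[ i < m ] f i j
  ∑-swap zero    n f = sym (∑-zero n λ _ _ → refl)
  ∑-swap (suc m) n f = trans (cong (_+ ∑ n (f m)) (∑-swap m n f)) (sym (∑-+ n (λ j → ∑[ i < m ] f i j) (f m)))

  ∑-split : ∀ m n f → ∑ (m ℕ.+ n) f ≡ ∑ m f + ∑[ i < n ] f (m ℕ.+ i)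
  ∑-split m zero    f = trans (cong (λ k → ∑ k f) (ℕ.+-identityʳ m)) (sym (+-identityʳ _))
  ∑-split m (suc n) f = trans (cong (λ k → ∑ k f) (ℕ.+-suc m n))
    (trans (cong (_+ f (m ℕ.+ n)) (∑-split m n f)) (+-assoc (∑ m f) _ _))

  ∑-suc : ∀ n f → ∑ (suc n) f ≡ f 0 + ∑[ i < n ] f (suc i)
  ∑-suc n f = trans (∑-split 1 n f) (cong (_+ ∑ n (f ∘ suc)) (+-identityˡ (f 0)))

  ∑-extend : ∀ {m n} f → m ℕ.≤ n → (∀ i → m ℕ.≤ i → i ℕ.< n → f i ≡ 0ℤ) → ∑ n f ≡ ∑ m f
  ∑-extend {m} {n} f m≤n eq = subst (λ k → ∑ k f ≡ ∑ m f) (ℕ.m+[n∸m]≡n m≤n)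
    (trans (∑-split m (n ℕ.∸ m) f) (trans (cong (_+_ (∑ m f))
      (∑-zero (n ℕ.∸ m) λ i i< → eq (m ℕ.+ i) (ℕ.m≤m+n m i)
        (subst (m ℕ.+ i ℕ.<_) (ℕ.m+[n∸m]≡n m≤n) (ℕ.+-monoʳ-< m i<)))) (+-identityʳ _)))

  ∑-≤-extend : ∀ {m n} f → m ℕ.≤ n → (∀ i → 0ℤ ≤ f i) → ∑ m f ≤ ∑ n f
  ∑-≤-extend {m} {n} f m≤n le = subst (λ k → ∑ m f ≤ ∑ k f) (ℕ.m+[n∸m]≡n m≤n)
    (≤-by (∑[ i < n ℕ.∸ m ] f (m ℕ.+ i)) (∑-nonneg (n ℕ.∸ m) λ i → le (m ℕ.+ i)) (∑-split m (n ℕ.∸ m) f))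

  ∑-single : ∀ n j f → j ℕ.< n → (∀ i → i ℕ.< n → i ≢ j → f i ≡ 0ℤ) → ∑ n f ≡ f j
  ∑-single (suc n) j f j<1+n eq with j ℕ.≟ n
  ... | yes refl = trans (cong (_+ f j) (∑-zero n λ i i<n → eq i (ℕ.m<n⇒m<1+n i<n) (ℕ.<⇒≢ i<n))) (+-identityˡ (f j))
  ... | no  j≢n  = trans (cong₂ _+_ (∑-single n j f (ℕ.≤∧≢⇒< (ℕ.≤-pred j<1+n) j≢n) λ i i<n → eq i (ℕ.m<n⇒m<1+n i<n))
                                    (eq n (ℕ.n<1+n n) (j≢n ∘ sym)))
                           (+-identityʳ (f j))

  ∑-∑-* : ∀ m n (f g : ℕ → ℤ) → ∑[ i < m ] ∑[ j < n ] (f i * g j) ≡ ∑ m f * ∑ n g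
  ∑-∑-* m n f g = trans (∑-cong′ m λ i → ∑-*ˡ n (f i) g) (∑-*ʳ m (∑ n g) f)

  ∑-blocks : ∀ n m f → ∑ (n ℕ.* m) f ≡ ∑[ j < n ] ∑[ i < m ] f (j ℕ.* m ℕ.+ i)
  ∑-blocks zero    m f = refl
  ∑-blocks (suc n) m f = trans (cong (λ k → ∑ k f) (ℕ.+-comm m (n ℕ.* m)))
    (trans (∑-split (n ℕ.* m) m f) (cong (_+ ∑[ i < m ] f (n ℕ.* m ℕ.+ i)) (∑-blocks n m f)))

  -- A property inherited by smaller numbers holds exactly below some c. This turns a sum with the
  -- cutoff k n m < Y into an ordinary partial sum over m, to which periodicity applies.
  ∑-initial : ∀ {q} {Q : ℕ → Set q} (Q? : ∀ m → Dec (Q m)) → (∀ m → Q (suc m) → Q m) → ∀ n →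
              ∃[ c ] c ℕ.≤ n × (∀ f → ∑[ m < n ] (⟦ Q? m ⟧ * f m) ≡ ∑ c f)
  ∑-initial Q? down zero    = 0 , ℕ.z≤n , λ f → refl
  ∑-initial {Q = Q} Q? down (suc n) = step (Q? n)
    where
    below : ∀ n → Q n → ∀ i → i ℕ.≤ n → Q i
    below n qn i i≤n with i ℕ.≟ n
    ... | yes refl = qn
    below zero qn zero i≤n | no i≢n = contradiction refl i≢n
    below (suc n) qn i i≤n | no i≢n = below n (down n qn) i (ℕ.≤-pred (ℕ.≤∧≢⇒< i≤n i≢n))
    step : Dec (Q n) → ∃[ c ] c ℕ.≤ suc n × (∀ f → ∑[ m < suc n ] (⟦ Q? m ⟧ * f m) ≡ ∑ c f)
    step (yes qn) = suc n , ℕ.≤-refl , λ f → ∑-cong (suc n) λ i i≤n →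
      trans (cong (_* f i) (⟦⟧-yes (Q? i) (below n qn i (ℕ.≤-pred i≤n)))) (*-identityˡ (f i))
    step (no ¬qn) = let c , c≤n , h = ∑-initial Q? down n in
      c , ℕ.m≤n⇒m≤1+n c≤n , λ f →
        trans (cong₂ _+_ (h f) (trans (cong (_* f n) (⟦⟧-no (Q? n) ¬qn)) (*-zeroˡ (f n)))) (+-identityʳ _)

  abstract
    -- The indicator as a natural number, so that it can be an exponent: the powers b ^ tick (Q? p)
    -- build products over the p with Q.
    tick : ∀ {a} {A : Set a} → Dec A → ℕ
    tick (yes _) = 1
    tick (no  _) = 0

    tick-yes : ∀ {a} {A : Set a} (d : Dec A) → A → tick d ≡ 1
    tick-yes (yes _) _ = refl
    tick-yes (no ¬a) a = contradiction a ¬a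

    tick-no : ∀ {a} {A : Set a} (d : Dec A) → ¬ A → tick d ≡ 0
    tick-no (yes a) ¬a = contradiction a ¬a
    tick-no (no _)  _  = refl

    +tick : ∀ {a} {A : Set a} (d : Dec A) → + tick d ≡ ⟦ d ⟧
    +tick d@(yes a) = sym (⟦⟧-yes d a)
    +tick d@(no ¬a) = sym (⟦⟧-no d ¬a)

  count : ∀ {q} {Q : ℕ → Set q} → (∀ m → Dec (Q m)) → ℕ → ℕ
  count Q? zero    = 0
  count Q? (suc n) = count Q? n ℕ.+ tick (Q? n)

  +count : ∀ {q} {Q : ℕ → Set q} (Q? : ∀ m → Dec (Q m)) n → + count Q? n ≡ ∑[ m < n ] ⟦ Q? m ⟧
  +count Q? zero    = refl
  +count Q? (suc n) = cong₂ _+_ (+count Q? n) (+tick (Q? n))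

  count-0 : ∀ {q} {Q : ℕ → Set q} (Q? : ∀ m → Dec (Q m)) n → (∀ m → m ℕ.< n → ¬ Q m) → count Q? n ≡ 0
  count-0 Q? zero    none = refl
  count-0 Q? (suc n) none = cong₂ ℕ._+_ (count-0 Q? n λ m m<n → none m (ℕ.m<n⇒m<1+n m<n)) (tick-no (Q? n) (none n (ℕ.n<1+n n)))

  0<count : ∀ {q} {Q : ℕ → Set q} (Q? : ∀ m → Dec (Q m)) n {m} → m ℕ.< n → Q m → 0 ℕ.< count Q? n
  0<count Q? (suc n) {m} m<1+n qm with m ℕ.≟ n
  ... | yes refl = ℕ.<-≤-trans (ℕ.≤-reflexive (sym (tick-yes (Q? m) qm))) (ℕ.m≤n+m (tick (Q? m)) (count Q? m))
  ... | no  m≢n  = ℕ.<-≤-trans (0<count Q? n (ℕ.≤∧≢⇒< (ℕ.≤-pred m<1+n) m≢n) qm) (ℕ.m≤m+n (count Q? n) (tick (Q? n)))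

  count-none : ∀ {q} {Q : ℕ → Set q} (Q? : ∀ m → Dec (Q m)) n → count Q? n ≡ 0 → ∀ m → m ℕ.< n → ¬ Q m
  count-none Q? n c≡0 m m<n qm = ℕ.<⇒≢ (0<count Q? n m<n qm) (sym c≡0)

-- Arithmetic progressions modulo a prime.

module Residues where
  open import Data.Nat as ℕ using (ℕ; zero; suc)
  import Data.Nat.Properties as ℕ
  import Data.Nat.Divisibility as ℕ∣
  open import Data.Nat.Coprimality using (Coprime; coprime-Bézout)
  open import Data.Nat.GCD using (module Bézout)
  open import Data.Nat.Induction using (<-wellFounded)
  open import Induction.WellFounded using (Acc; acc)
  open import Data.Nat.Primality using (Prime; euclidsLemma; prime⇒irreducible; prime⇒nonZero; prime⇒nonTrivial)
  open import Data.Integer hiding (suc) renaming (∣_∣ to abs)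
  open import Data.Integer.Properties
  open import Data.Integer.DivMod using (n%ℕd<d; a≡a%ℕn+[a/ℕn]*n)
  open import Data.Integer.Divisibility.Signed
  open import Data.Integer.Tactic.RingSolver using (solve-∀)
  open import Data.Product using (∃-syntax; _×_; _,_; proj₁; proj₂)
  open import Data.Sum using (_⊎_; inj₁; inj₂)
  open import Relation.Nullary using (yes; no; ¬_; contradiction)
  open import Relation.Binary.PropositionalEquality
  open import Function using (_∘_)
  open FiniteSums

  prime-∣* : ∀ {p} → Prime p → ∀ a b → + p ∣ a * b → + p ∣ a ⊎ + p ∣ b
  prime-∣* {p} pp a b p∣ab with euclidsLemma (abs a) (abs b) pp (subst (p ℕ∣.∣_) (abs-* a b) (∣⇒∣ᵤ p∣ab))
  ... | inj₁ p∣a = inj₁ (∣ᵤ⇒∣ p∣a)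
  ... | inj₂ p∣b = inj₂ (∣ᵤ⇒∣ p∣b)

  prime-∤1 : ∀ {p} → Prime p → ¬ (+ p ∣ 1ℤ)
  prime-∤1 pp p∣1 = ℕ.nonTrivial⇒≢1 {{prime⇒nonTrivial pp}} (ℕ∣.∣1⇒≡1 (∣⇒∣ᵤ p∣1))

  prime-coprime : ∀ {p n} → Prime p → ¬ (p ℕ∣.∣ n) → Coprime p n
  prime-coprime pp p∤n (d∣p , d∣n) with prime⇒irreducible pp d∣p
  ... | inj₁ d≡1  = d≡1
  ... | inj₂ refl = contradiction d∣n p∤n

  ∣-+ : ∀ k m n → k ∣ m → k ∣ n → k ∣ m + n
  ∣-+ k m n = ∣m∣n⇒∣m+n {k} {m} {n}

  ∣-- : ∀ k m n → k ∣ m → k ∣ n → k ∣ m - n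
  ∣-- k m n = ∣m∣n⇒∣m-n {k} {m} {n}

  ∣-*ˡ : ∀ k m n → k ∣ n → k ∣ m * n
  ∣-*ˡ k m n = ∣n⇒∣m*n {k} m {n}

  ∣-*ʳ : ∀ k m n → k ∣ m → k ∣ m * n
  ∣-*ʳ k m n = ∣m⇒∣m*n {k} {m} n

  ∣-sub-self : ∀ {p} x y → p ∣ x → p ∣ x - y → p ∣ y
  ∣-sub-self {p} x y p∣x p∣x-y = subst (p ∣_) (eq x y) (∣-- p x (x - y) p∣x p∣x-y)
    where
    eq : ∀ x y → x - (x - y) ≡ y
    eq = solve-∀

  <p-∣-≡ : ∀ {p} i j → i ℕ.< p → j ℕ.≤ i → + p ∣ + i - + j → i ≡ j
  <p-∣-≡ {p} i j i<p j≤i p∣ = sym (ℕ.≤-antisym j≤i (ℕ.m∸n≡0⇒m≤n (zero-of (i ℕ.∸ j) (ℕ.≤-<-trans (ℕ.m∸n≤m i j) i<p)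
      (∣⇒∣ᵤ (subst (+ p ∣_) (trans (m-n≡m⊖n i j) (⊖-≥ j≤i)) p∣)))))
    where
    zero-of : ∀ d → d ℕ.< p → p ℕ∣.∣ d → d ≡ 0
    zero-of zero    _   _   = refl
    zero-of (suc d) d<p p∣d = contradiction (ℕ∣.∣⇒≤ p∣d) (ℕ.<⇒≱ d<p)

  prime-∣*ʳ : ∀ {p} → Prime p → ∀ a b → ¬ (+ p ∣ a) → + p ∣ a * b → + p ∣ b
  prime-∣*ʳ pp a b p∤a p∣ab with prime-∣* pp a b p∣ab
  ... | inj₁ p∣a = contradiction p∣a p∤a
  ... | inj₂ p∣b = p∣b

  private
    affine-difference : ∀ s t x y → (s * x + t) - (s * y + t) ≡ s * (x - y)
    affine-difference = solve-∀

  residue-difference : ∀ {p} → Prime p → ∀ s t → ¬ (+ p ∣ s) → ∀ x y →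
                       + p ∣ s * x + t → + p ∣ s * y + t → + p ∣ x - y
  residue-difference {p} pp s t p∤s x y px py = prime-∣*ʳ pp s (x - y) p∤s
    (subst (+ p ∣_) (affine-difference s t x y) (∣-- (+ p) (s * x + t) (s * y + t) px py))

  residue-unique : ∀ {p} → Prime p → ∀ s t → ¬ (+ p ∣ s) → ∀ i j → i ℕ.< p → j ℕ.< p →
                   + p ∣ s * + i + t → + p ∣ s * + j + t → i ≡ j
  residue-unique {p} pp s t p∤s i j i<p j<p p∣i p∣j with ℕ.≤-total j i
  ... | inj₁ j≤i = <p-∣-≡ i j i<p j≤i (residue-difference pp s t p∤s (+ i) (+ j) p∣i p∣j)
  ... | inj₂ i≤j = sym (<p-∣-≡ j i j<p i≤j (residue-difference pp s t p∤s (+ j) (+ i) p∣j p∣i))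

  -- Bézout coefficients are found for the natural number |s|; negating the inverse covers negative
  -- s.
  inverse-of-∣∣ : ∀ {p} s v → + p ∣ + (abs s) * v - 1ℤ → ∃[ v ] (+ p ∣ s * v - 1ℤ)
  inverse-of-∣∣ {p} s v d with +∣i∣≡i⊎+∣i∣≡-i s
  ... | inj₁ e = v , subst (λ a → + p ∣ a * v - 1ℤ) e d
  ... | inj₂ e = - v , subst (+ p ∣_) (l s v) (subst (λ a → + p ∣ a * v - 1ℤ) e d)
    where
    l : ∀ s v → - s * v - 1ℤ ≡ s * (- v) - 1ℤ
    l = solve-∀

  residue-inverse : ∀ {p} → Prime p → ∀ s → ¬ (+ p ∣ s) → ∃[ v ] (+ p ∣ s * v - 1ℤ)
  residue-inverse {p} pp s p∤s with coprime-Bézout (prime-coprime {p} {abs s} pp (p∤s ∘ ∣ᵤ⇒∣))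
  ... | Bézout.+- x y eq = inverse-of-∣∣ s (- (+ y)) (divides (- + x) (lemma (+ (abs s)) (+ y) (+ x) (+ p) (cast eq)))
    where
    lemma : ∀ a y x p → 1ℤ + y * a ≡ x * p → a * (- y) - 1ℤ ≡ - x * p
    lemma a y x p eq = trans (l₁ a y) (trans (cong -_ eq) (neg-distribˡ-* x p))
      where
      l₁ : ∀ a y → a * (- y) - 1ℤ ≡ - (1ℤ + y * a)
      l₁ = solve-∀
    cast : 1 ℕ.+ y ℕ.* (abs s) ≡ x ℕ.* p → 1ℤ + + y * + (abs s) ≡ + x * + p
    cast eq = trans (cong (_+_ 1ℤ) (sym (pos-* y (abs s)))) (trans (cong (λ z → + z) eq) (pos-* x p))
  ... | Bézout.-+ x y eq = inverse-of-∣∣ s (+ y) (divides (+ x) (lemma (+ (abs s)) (+ y) (+ x) (+ p) (cast eq)))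
    where
    lemma : ∀ a y x p → 1ℤ + x * p ≡ y * a → a * y - 1ℤ ≡ x * p
    lemma a y x p eq = trans (cong (_- 1ℤ) (trans (*-comm a y) (sym eq))) (l₁ x p)
      where
      l₁ : ∀ x p → 1ℤ + x * p - 1ℤ ≡ x * p
      l₁ = solve-∀
    cast : 1 ℕ.+ x ℕ.* p ≡ y ℕ.* (abs s) → 1ℤ + + x * + p ≡ + y * + (abs s)
    cast eq = trans (cong (_+_ 1ℤ) (sym (pos-* x p))) (trans (cong (λ z → + z) eq) (pos-* y (abs s)))

  ∣-%-self : ∀ p (x : ℤ) .{{_ : ℕ.NonZero p}} → ∃[ j ] j ℕ.< p × (+ p ∣ x - + j)
  ∣-%-self p x = x %ℕ p , n%ℕd<d x p , divides (x /ℕ p)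
    (trans (cong (_- + (x %ℕ p)) (a≡a%ℕn+[a/ℕn]*n x p)) (l (+ (x %ℕ p)) (x /ℕ p * + p)))
    where
    l : ∀ r q → r + q - r ≡ q
    l = solve-∀

  residue-exists : ∀ {p} → Prime p → ∀ s t → ¬ (+ p ∣ s) → ∃[ j ] j ℕ.< p × (+ p ∣ s * + j + t)
  residue-exists {p} pp s t p∤s = j , j<p , subst (+ p ∣_) (eq s t v (+ j))
      (∣-- (+ p) (- t * (s * v - 1ℤ)) (s * (v * - t - + j)) (∣-*ˡ (+ p) (- t) (s * v - 1ℤ) p∣sv-1) (∣-*ˡ (+ p) s (v * - t - + j) p∣vj))
    where
    instance _ = prime⇒nonZero pp
    v = proj₁ (residue-inverse pp s p∤s)
    p∣sv-1 = proj₂ (residue-inverse pp s p∤s)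
    r = ∣-%-self p (v * - t)
    j = proj₁ r
    j<p = proj₁ (proj₂ r)
    p∣vj = proj₂ (proj₂ r)
    eq : ∀ s t v j → - t * (s * v - 1ℤ) - s * (v * - t - j) ≡ s * j + t
    eq = solve-∀

  abstract
    zer : ℕ → ℤ → ℤ
    zer p x = ⟦ + p ∣? x ⟧

    zer-yes : ∀ p x → + p ∣ x → zer p x ≡ 1ℤ
    zer-yes p x = ⟦⟧-yes (+ p ∣? x)

    zer-no : ∀ p x → ¬ (+ p ∣ x) → zer p x ≡ 0ℤ
    zer-no p x = ⟦⟧-no (+ p ∣? x)

    zer-cong : ∀ p x y → (+ p ∣ x → + p ∣ y) → (+ p ∣ y → + p ∣ x) → zer p x ≡ zer p y
    zer-cong p x y = ⟦⟧-cong (+ p ∣? x) (+ p ∣? y)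

    0≤zer : ∀ p x → 0ℤ ≤ zer p x
    0≤zer p x = 0≤⟦⟧ (+ p ∣? x)

    zer≤1 : ∀ p x → zer p x ≤ 1ℤ
    zer≤1 p x = ⟦⟧≤1 (+ p ∣? x)

  one : ℕ → ℤ → ℤ
  one p x = zer p (x - 1ℤ)

  -- The excess of x ≡ 1 over its average among the residues prime to p; it sums to 0
  -- over a period.
  H : ℕ → ℤ → ℤ
  H p x = (+ p - 1ℤ) * one p x + zer p x - 1ℤ

  -- As p ∤ s, the map j ↦ s j + t permutes the residues modulo p, so exactly one j < p is sent to
  -- 0.
  ∑-residue : ∀ {p} → Prime p → ∀ s t → ¬ (+ p ∣ s) → ∑[ j < p ] zer p (s * + j + t) ≡ 1ℤ
  ∑-residue {p} pp s t p∤s = trans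
      (∑-single p j (λ i → zer p (s * + i + t)) j<p λ i i<p i≢j →
        zer-no p (s * + i + t) λ p∣i → i≢j (residue-unique pp s t p∤s i j i<p j<p p∣i p∣j))
      (zer-yes p (s * + j + t) p∣j)
    where
    j = proj₁ (residue-exists pp s t p∤s)
    j<p = proj₁ (proj₂ (residue-exists pp s t p∤s))
    p∣j = proj₂ (proj₂ (residue-exists pp s t p∤s))

  one-none : ∀ {p} → Prime p → ∀ x → + p ∣ x → one p x ≡ 0ℤ
  one-none {p} pp x p∣x = zer-no p (x - 1ℤ) λ p∣x-1 → prime-∤1 pp (∣-sub-self x 1ℤ p∣x p∣x-1)

  -- This is the purpose of the summand `zer` in `H`: multiples of p can never be 1 modulo p, so
  -- they have to be weighted 0 for the mean to vanish.
  H-none : ∀ {p} → Prime p → ∀ x → + p ∣ x → H p x ≡ 0ℤ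
  H-none {p} pp x p∣x = trans (cong₂ (λ a b → (+ p - 1ℤ) * a + b - 1ℤ) (one-none pp x p∣x) (zer-yes p x p∣x)) (l (+ p))
    where
    l : ∀ p → (p - 1ℤ) * 0ℤ + 1ℤ - 1ℤ ≡ 0ℤ
    l = solve-∀

  ∣-affine : ∀ {p} s t j → (+ p ∣ s) → (+ p ∣ t) → + p ∣ s * j + t
  ∣-affine {p} s t j p∣s p∣t = ∣-+ (+ p) (s * j) t (∣-*ʳ (+ p) s j p∣s) p∣t

  -- If p ∣ s the progression is constant modulo p, and the last hypothesis makes it constantly 0,
  -- where `one` vanishes. Without it, s = 0 and t = 1 would give the sum p.
  ∑-one-affine : ∀ {p} → Prime p → ∀ s t → (+ p ∣ s → + p ∣ t) → ∑[ j < p ] one p (s * + j + t) ≤ 1ℤ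
  ∑-one-affine {p} pp s t s⇒t with + p ∣? s
  ... | yes p∣s = ≤-trans (≤-reflexive (∑-zero p λ j _ → one-none pp (s * + j + t) (∣-affine s t (+ j) p∣s (s⇒t p∣s)))) 0≤1
  ... | no  p∤s = ≤-reflexive (trans (∑-cong′ p λ j → cong (zer p) (+-assoc (s * + j) t (- 1ℤ))) (∑-residue pp s (t - 1ℤ) p∤s))

  -- For p ∤ s the progression meets the classes 1 and 0 once each: (p - 1) + 1 - p = 0.
  ∑-H-affine : ∀ {p} → Prime p → ∀ s t → (+ p ∣ s → + p ∣ t) → ∑[ j < p ] H p (s * + j + t) ≡ 0ℤ
  ∑-H-affine {p} pp s t s⇒t with + p ∣? s
  ... | yes p∣s = ∑-zero p λ j _ → H-none pp (s * + j + t) (∣-affine s t (+ j) p∣s (s⇒t p∣s))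
  ... | no  p∤s = begin
    ∑[ j < p ] H p (s * + j + t)
      ≡⟨ ∑-+ p (λ j → (+ p - 1ℤ) * o j + z j) (λ _ → - 1ℤ) ⟩
    ∑[ j < p ] ((+ p - 1ℤ) * o j + z j) + ∑[ _ < p ] (- 1ℤ)
      ≡⟨ cong₂ _+_ (trans (∑-+ p (λ j → (+ p - 1ℤ) * o j) z) (cong₂ _+_ (trans (∑-*ˡ p (+ p - 1ℤ) o) (cong ((+ p - 1ℤ) *_) ∑o)) (∑-residue pp s t p∤s)))
          (∑-const p (- 1ℤ)) ⟩
    (+ p - 1ℤ) * 1ℤ + 1ℤ + + p * (- 1ℤ)
      ≡⟨ l (+ p) ⟩
    0ℤ ∎
    where
    open ≡-Reasoning
    o z : ℕ → ℤ
    o j = one p (s * + j + t)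
    z j = zer p (s * + j + t)
    ∑o : ∑ p o ≡ 1ℤ
    ∑o = trans (∑-cong′ p λ j → cong (zer p) (+-assoc (s * + j) t (- 1ℤ))) (∑-residue pp s (t - 1ℤ) p∤s)
    l : ∀ p → (p - 1ℤ) * 1ℤ + 1ℤ + p * (- 1ℤ) ≡ 0ℤ
    l = solve-∀

  ∣-shift : ∀ p x y → + p ∣ y → + p ∣ x → + p ∣ x + y
  ∣-shift p x y p∣y p∣x = ∣-+ (+ p) x y p∣x p∣y

  ∣-unshift : ∀ p x y → + p ∣ y → + p ∣ x + y → + p ∣ x
  ∣-unshift p x y p∣y p∣xy = ∣m+n∣n⇒∣m {+ p} {x} {y} p∣xy p∣y

  zer-shift : ∀ p x y → + p ∣ y → zer p (x + y) ≡ zer p x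
  zer-shift p x y p∣y = zer-cong p (x + y) x (∣-unshift p x y p∣y) (∣-shift p x y p∣y)

  one-shift : ∀ p x y → + p ∣ y → one p (x + y) ≡ one p x
  one-shift p x y p∣y = trans (cong (zer p) (l x y)) (zer-shift p (x - 1ℤ) y p∣y)
    where
    l : ∀ x y → x + y - 1ℤ ≡ x - 1ℤ + y
    l = solve-∀

  H-shift : ∀ p x y → + p ∣ y → H p (x + y) ≡ H p x
  H-shift p x y p∣y = cong₂ (λ a b → (+ p - 1ℤ) * a + b - 1ℤ) (one-shift p x y p∣y) (zer-shift p x y p∣y)

  -- Whole periods contribute 0 and are removed; what is left is shorter than a period and is
  -- bounded by the full period of the majorant g.
  ∑-period-bound : ∀ k (f g : ℕ → ℤ) → (∀ i → f (k ℕ.+ i) ≡ f i) → ∑ k f ≡ 0ℤ → (∀ i → f i ∣≤∣ g i) →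
                   (∀ i → 0ℤ ≤ g i) → 0 ℕ.< k → ∀ n → ∑ n f ∣≤∣ ∑ k g
  ∑-period-bound k f g period zero-sum f≤g 0≤g 0<k n = go n (<-wellFounded n)
    where
    go : ∀ n → Acc ℕ._<_ n → ∑ n f ∣≤∣ ∑ k g
    go n (acc rec) with k ℕ.≤? n
    ... | no  k≰n = ∣≤∣-mono (∑-≤-extend g (ℕ.<⇒≤ (ℕ.≰⇒> k≰n)) 0≤g) (∑-∣≤∣ n λ i _ → f≤g i)
    ... | yes k≤n = subst (_∣≤∣ ∑ k g) (sym eq) (go (n ℕ.∸ k) (rec (ℕ.∸-monoʳ-< 0<k k≤n)))
      where
      eq : ∑ n f ≡ ∑ (n ℕ.∸ k) f
      eq = trans (cong (λ m → ∑ m f) (sym (ℕ.m+[n∸m]≡n k≤n))) (trans (∑-split k (n ℕ.∸ k) f)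
        (trans (cong₂ _+_ zero-sum (∑-cong′ (n ℕ.∸ k) period)) (+-identityˡ _)))

  -- At most one unit in each of the at most n / k + 1 periods begun; multiplying by k avoids the
  -- division.
  ∑-period-count : ∀ k (f : ℕ → ℤ) → (∀ i → f (k ℕ.+ i) ≡ f i) → ∑ k f ≤ 1ℤ → (∀ i → 0ℤ ≤ f i) →
                   0 ℕ.< k → ∀ n → + k * ∑ n f ≤ + n + + k
  ∑-period-count k f period sum≤1 0≤f 0<k n = go n (<-wellFounded n)
    where
    go : ∀ n → Acc ℕ._<_ n → + k * ∑ n f ≤ + n + + k
    go n (acc rec) with k ℕ.≤? n
    ... | no  k≰n = ≤-trans (*-monoˡ {∑ n f} {1ℤ} {+ k} 0≤+ (≤-trans (∑-≤-extend f (ℕ.<⇒≤ (ℕ.≰⇒> k≰n)) 0≤f) sum≤1))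
                      (≤-by (+ n) 0≤+ (l (+ n) (+ k)))
      where
      l : ∀ n k → n + k ≡ k * 1ℤ + n
      l = solve-∀
    ... | yes k≤n = subst₂ _≤_ (sym eq) n-eq
          (+-mono-≤ (*-monoˡ {∑ k f} {1ℤ} {+ k} 0≤+ sum≤1) (go (n ℕ.∸ k) (rec (ℕ.∸-monoʳ-< 0<k k≤n))))
      where
      eq : + k * ∑ n f ≡ + k * ∑ k f + + k * ∑ (n ℕ.∸ k) f
      eq = trans (cong (+ k *_) (trans (cong (λ m → ∑ m f) (sym (ℕ.m+[n∸m]≡n k≤n))) (trans (∑-split k (n ℕ.∸ k) f)
        (cong (_+_ (∑ k f)) (∑-cong′ (n ℕ.∸ k) period))))) (*-distribˡ-+ (+ k) (∑ k f) (∑ (n ℕ.∸ k) f))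
      l : ∀ k m → k * 1ℤ + (m + k) ≡ (k + m) + k
      l = solve-∀
      n-eq : + k * 1ℤ + (+ (n ℕ.∸ k) + + k) ≡ + n + + k
      n-eq = trans (l (+ k) (+ (n ℕ.∸ k))) (cong (λ m → + m + + k) (ℕ.m+[n∸m]≡n k≤n))

-- Partial sums of H along multiples of a number.

module PartialSums where
  open import Data.Nat as ℕ using (ℕ; suc)
  import Data.Nat.Properties as ℕ
  open import Data.Nat.Primality using (Prime; prime⇒irreducible; prime⇒nonZero; prime⇒nonTrivial)
  open import Data.Integer hiding (suc) renaming (∣_∣ to abs)
  open import Data.Integer.Properties
  open import Data.Integer.Divisibility.Signed
  open import Data.Integer.Tactic.RingSolver using (solve-∀)
  open import Data.Product using (_,_)
  open import Data.Sum using (inj₁; inj₂)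
  open import Relation.Nullary using (¬_; contradiction)
  open import Relation.Binary.PropositionalEquality
  open FiniteSums
  open Residues

  primes-∤ : ∀ {p q} → Prime p → Prime q → p ≢ q → ¬ (+ q ∣ + p)
  primes-∤ pp pq p≢q q∣p with prime⇒irreducible pp (∣⇒∣ᵤ q∣p)
  ... | inj₁ q≡1 = ℕ.nonTrivial⇒≢1 {{prime⇒nonTrivial pq}} q≡1
  ... | inj₂ q≡p = p≢q (sym q≡p)

  0<prime : ∀ {p} → Prime p → 0 ℕ.< p
  0<prime {p} pp = ℕ.>-nonZero⁻¹ p {{prime⇒nonZero pp}}

  1≤prime : ∀ {p} → Prime p → 1ℤ ≤ + p
  1≤prime pp = +≤+ (0<prime pp)

  -- The multiple c (i + 1), in the affine form s i + t with s = t = c, for which the condition p ∣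
  -- s → p ∣ t is trivial.
  pt : ℤ → ℕ → ℤ
  pt c i = c * + i + c

  pt-suc : ∀ c i → c * + suc i ≡ pt c i
  pt-suc c i = l c (+ i)
    where
    l : ∀ c i → c * (1ℤ + i) ≡ c * i + c
    l = solve-∀

  ∣-pt : ∀ {p} c i → + p ∣ c → + p ∣ pt c i
  ∣-pt c i p∣c = ∣-affine c c (+ i) p∣c p∣c

  pt-+ : ∀ c k i → pt c (k ℕ.+ i) ≡ pt c i + c * + k
  pt-+ c k i = l c (+ k) (+ i)
    where
    l : ∀ c k i → c * (k + i) + c ≡ c * i + c + c * k
    l = solve-∀

  -- A nonnegative majorant of |H p x|. Over a period it sums to at most 2 p, against the 0 of `H`,
  -- so it measures the error of an incomplete period.
  K : ℕ → ℤ → ℤ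
  K p x = + p * one p x + 1ℤ

  0≤one : ∀ p x → 0ℤ ≤ one p x
  0≤one p x = 0≤zer p (x - 1ℤ)

  1≤K : ∀ p x → 1ℤ ≤ K p x
  1≤K p x = ≤-by (+ p * one p x) (0≤-* {+ p} {one p x} 0≤+ (0≤one p x)) (+-comm (+ p * one p x) 1ℤ)

  0≤K : ∀ p x → 0ℤ ≤ K p x
  0≤K p x = ≤-trans 0≤1 (1≤K p x)

  H-≤-K : ∀ {p} → Prime p → ∀ x → H p x ∣≤∣ K p x
  H-≤-K {p} pp x = lower , upper
    where
    o = one p x
    z = zer p x
    0≤p-1 : 0ℤ ≤ + p - 1ℤ
    0≤p-1 = ≤⇒0≤- (1≤prime pp)
    lower : - K p x ≤ H p x
    lower = ≤-by (+ p * o + (+ p - 1ℤ) * o + z)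
      (0≤-+ (0≤-+ (0≤-* {+ p} {o} 0≤+ (0≤one p x)) (0≤-* {+ p - 1ℤ} {o} 0≤p-1 (0≤one p x))) (0≤zer p x))
      (l (+ p) o z)
      where
      l : ∀ p o z → (p - 1ℤ) * o + z - 1ℤ ≡ - (p * o + 1ℤ) + (p * o + (p - 1ℤ) * o + z)
      l = solve-∀
    upper : H p x ≤ K p x
    upper = ≤-by (o + (1ℤ - z) + 1ℤ) (0≤-+ (0≤-+ (0≤one p x) (≤⇒0≤- (zer≤1 p x))) 0≤1) (l (+ p) o z)
      where
      l : ∀ p o z → p * o + 1ℤ ≡ (p - 1ℤ) * o + z - 1ℤ + (o + (1ℤ - z) + 1ℤ)
      l = solve-∀

  ∑-K-affine : ∀ {p} → Prime p → ∀ s t → (+ p ∣ s → + p ∣ t) → ∑[ j < p ] K p (s * + j + t) ≤ + p * + 2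
  ∑-K-affine {p} pp s t s⇒t = ≤-trans (≤-reflexive eq)
      (≤-trans (+-monoˡ-≤ (+ p * 1ℤ) (*-monoˡ {∑[ j < p ] one p (s * + j + t)} {1ℤ} {+ p} 0≤+ (∑-one-affine pp s t s⇒t)))
        (≤-reflexive (l (+ p))))
    where
    eq : ∑[ j < p ] K p (s * + j + t) ≡ + p * ∑[ j < p ] one p (s * + j + t) + + p * 1ℤ
    eq = trans (∑-+ p (λ j → + p * one p (s * + j + t)) (λ _ → 1ℤ))
      (cong₂ _+_ (∑-*ˡ p (+ p) (λ j → one p (s * + j + t))) (∑-const p 1ℤ))
    l : ∀ p → p * 1ℤ + p * 1ℤ ≡ p * + 2
    l = solve-∀

  ∣-*+self : ∀ p c → + p ∣ c * + p
  ∣-*+self p c = ∣-*ˡ (+ p) c (+ p) ∣-refl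

  H-partial : ∀ {p} → Prime p → ∀ c n → ∑[ i < n ] H p (pt c i) ∣≤∣ + p * + 2
  H-partial {p} pp c n = ∣≤∣-mono (∑-K-affine pp c c (λ d → d))
    (∑-period-bound p (λ i → H p (pt c i)) (λ i → K p (pt c i))
      (λ i → trans (cong (H p) (pt-+ c p i)) (H-shift p (pt c i) (c * + p) (∣-*+self p c)))
      (∑-H-affine pp c c (λ d → d)) (λ i → H-≤-K pp (pt c i)) (λ i → 0≤K p (pt c i)) (0<prime pp) n)

  one-count : ∀ {p} → Prime p → ∀ c n → + p * ∑[ i < n ] one p (pt c i) ≤ + n + + p
  one-count {p} pp c n = ∑-period-count p (λ i → one p (pt c i))
    (λ i → trans (cong (one p) (pt-+ c p i)) (one-shift p (pt c i) (c * + p) (∣-*+self p c)))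
    (∑-one-affine pp c c (λ d → d)) (λ i → 0≤one p (pt c i)) (0<prime pp) n

  module _ {p q} (pp : Prime p) (pq : Prime q) (p≢q : p ≢ q) (c d : ℤ) where
    private
      pt-block : ∀ j i → pt d (j ℕ.* p ℕ.+ i) ≡ d * + p * + j + pt d i
      pt-block j i = trans (pt-+ d (j ℕ.* p) i) (trans (cong (λ w → pt d i + d * w) (pos-* j p)) (l (pt d i) d (+ p) (+ j)))
        where
        l : ∀ w d p j → w + d * (j * p) ≡ d * p * j + w
        l = solve-∀

      pt-block′ : ∀ j i → pt c (j ℕ.* p ℕ.+ i) ≡ pt c i + c * + j * + p
      pt-block′ j i = trans (pt-+ c (j ℕ.* p) i) (cong (_+_ (pt c i)) (trans (cong (c *_) (pos-* j p)) (sym (*-assoc c (+ j) (+ p)))))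

      shift-ok : ∀ i → + q ∣ d * + p → + q ∣ pt d i
      shift-ok i q∣dp with prime-∣* pq d (+ p) q∣dp
      ... | inj₁ q∣d = ∣-pt d i q∣d
      ... | inj₂ q∣p = contradiction q∣p (primes-∤ pp pq p≢q)

      -- Write m = j p + i: modulo p the first argument depends on i alone, and the second is affine
      -- in j, so the inner sum over j runs through a full period modulo q.
      ∑-block : (f g : ℤ → ℤ) → (∀ x y → + p ∣ y → f (x + y) ≡ f x) →
                ∑[ m < q ℕ.* p ] (f (pt c m) * g (pt d m)) ≡
                ∑[ i < p ] (f (pt c i) * ∑[ j < q ] g (d * + p * + j + pt d i))
      ∑-block f g f-shift = trans (∑-blocks q p (λ m → f (pt c m) * g (pt d m)))
        (trans (∑-swap q p (λ j i → f (pt c (j ℕ.* p ℕ.+ i)) * g (pt d (j ℕ.* p ℕ.+ i))))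
        (∑-cong′ p λ i → trans (∑-cong′ q λ j → cong₂ _*_
            (trans (cong f (pt-block′ j i)) (f-shift (pt c i) (c * + j * + p) (∣-*+self p (c * + j))))
            (cong g (pt-block j i)))
          (∑-*ˡ q (f (pt c i)) (λ j → g (d * + p * + j + pt d i)))))

      ∑-HH : ∑[ m < q ℕ.* p ] (H p (pt c m) * H q (pt d m)) ≡ 0ℤ
      ∑-HH = trans (∑-block (H p) (H q) (H-shift p)) (∑-zero p λ i _ →
        trans (cong (H p (pt c i) *_) (∑-H-affine pq (d * + p) (pt d i) (shift-ok i))) (*-zeroʳ (H p (pt c i))))

      K-shift : ∀ x y → + p ∣ y → K p (x + y) ≡ K p x
      K-shift x y p∣y = cong (λ o → + p * o + 1ℤ) (one-shift p x y p∣y)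

      ∑-KK : ∑[ m < q ℕ.* p ] (K p (pt c m) * K q (pt d m)) ≤ + p * + 2 * (+ q * + 2)
      ∑-KK = ≤-trans (≤-reflexive (∑-block (K p) (K q) K-shift))
        (≤-trans (∑-mono p λ i _ → *-monoˡ {∑[ j < q ] K q (d * + p * + j + pt d i)} {+ q * + 2} {K p (pt c i)}
            (0≤K p (pt c i)) (∑-K-affine pq (d * + p) (pt d i) (shift-ok i)))
          (≤-trans (≤-reflexive (∑-*ʳ p (+ q * + 2) (λ i → K p (pt c i))))
            (*-monoʳ {∑[ i < p ] K p (pt c i)} {+ p * + 2} {+ q * + 2} (subst (0ℤ ≤_) (pos-* q 2) 0≤+) (∑-K-affine pp c c (λ z → z)))))

    -- The product has period q p and sums to 0 over it, since for p ≠ q the sum over each inner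
    -- period of `H q` vanishes. An incomplete period costs at most the corresponding sum of
    -- majorants, 2 p · 2 q.
    HH-partial : ∀ n → ∑[ i < n ] (H p (pt c i) * H q (pt d i)) ∣≤∣ + p * + 2 * (+ q * + 2)
    HH-partial n = ∣≤∣-mono ∑-KK (∑-period-bound (q ℕ.* p)
      (λ i → H p (pt c i) * H q (pt d i)) (λ i → K p (pt c i) * K q (pt d i))
      (λ i → cong₂ _*_
        (trans (cong (H p) (pt-+ c (q ℕ.* p) i)) (H-shift p (pt c i) (c * + (q ℕ.* p)) (∣-*ˡ (+ p) c (+ (q ℕ.* p)) (subst (+ p ∣_) (sym (pos-* q p)) (∣-*+self p (+ q))))))
        (trans (cong (H q) (pt-+ d (q ℕ.* p) i)) (H-shift q (pt d i) (d * + (q ℕ.* p)) (∣-*ˡ (+ q) d (+ (q ℕ.* p)) (subst (+ q ∣_) (sym (pos-* q p)) (∣-*ʳ (+ q) (+ q) (+ p) ∣-refl))))))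
      ∑-HH (λ i → ∣≤∣-* {H p (pt c i)} {H q (pt d i)} {K p (pt c i)} {K q (pt d i)} (H-≤-K pp (pt c i)) (H-≤-K pq (pt d i)))
      (λ i → 0≤-* {K p (pt c i)} {K q (pt d i)} (0≤K p (pt c i)) (0≤K q (pt d i)))
      (ℕ.*-mono-≤ (0<prime pq) (0<prime pp)) n)

-- Bilinear sums over one dyadic block.

module TypeII (z : ℕ) {Good : ℕ → Set} (good? : ∀ p → Dec (Good p))
  (good : ∀ {p} → Good p → Prime p × z ℕ.< p × p ℕ.< 2 ℕ.* z) where

  open import Data.Nat as ℕ using (ℕ; suc)
  open import Data.Nat.Primality using (Prime)
  open import Relation.Nullary using (Dec; yes; no; ¬_)
  open import Data.Product using (_×_; _,_; proj₁; proj₂)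
  import Data.Nat.Properties as ℕ
  open import Data.Integer hiding (suc) renaming (∣_∣ to abs)
  open import Data.Integer.Properties
  open import Data.Integer.Divisibility.Signed
  open import Data.Integer.Tactic.RingSolver using (solve-∀)
  open import Relation.Binary.PropositionalEquality
  open import Function using (_∘_)
  open FiniteSums
  open Residues
  open PartialSums

  π : ℕ → ℤ
  π p = ⟦ good? p ⟧

  P : ℤ
  P = ∑ (2 ℕ.* z) π

  abstract
    G : ℤ → ℤ
    G x = ∑[ p < 2 ℕ.* z ] (π p * H p x)

    G-def : ∀ x → G x ≡ ∑[ p < 2 ℕ.* z ] (π p * H p x)
    G-def x = refl

  0≤π : ∀ p → 0ℤ ≤ π p
  0≤π p = 0≤⟦⟧ (good? p)

  0≤P : 0ℤ ≤ P
  0≤P = ∑-nonneg (2 ℕ.* z) 0≤π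

  P≤z : P ≤ + z
  P≤z = begin
    ∑ (2 ℕ.* z) π                             ≡⟨ ∑-split z (z ℕ.+ 0) π ⟩
    ∑ z π + ∑[ i < z ℕ.+ 0 ] π (z ℕ.+ i)      ≡⟨ cong₂ _+_ (∑-zero z λ p p<z → ⟦⟧-no (good? p) λ g → ℕ.<-asym p<z (proj₁ (proj₂ (good g)))) refl ⟩
    0ℤ + ∑[ i < z ℕ.+ 0 ] π (z ℕ.+ i)         ≡⟨ +-identityˡ (∑[ i < z ℕ.+ 0 ] π (z ℕ.+ i)) ⟩
    ∑[ i < z ℕ.+ 0 ] π (z ℕ.+ i)              ≤⟨ ∑-mono (z ℕ.+ 0) (λ i _ → ⟦⟧≤1 (good? (z ℕ.+ i))) ⟩
    ∑[ i < z ℕ.+ 0 ] 1ℤ                       ≡⟨ trans (∑-const (z ℕ.+ 0) 1ℤ) (*-identityʳ (+ (z ℕ.+ 0))) ⟩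
    + (z ℕ.+ 0)                               ≡⟨ cong (λ z → + z) (ℕ.+-identityʳ z) ⟩
    + z                                       ∎
    where open ≤-Reasoning

  π-scale : ∀ p x b → (Good p → x ∣≤∣ b) → π p * x ∣≤∣ π p * b
  π-scale p x b h = go (good? p)
    where
    go : Dec (Good p) → π p * x ∣≤∣ π p * b
    go (yes g) = subst₂ _∣≤∣_ (eq x) (eq b) (h g)
      where
      eq : ∀ y → y ≡ π p * y
      eq y = sym (trans (cong (_* y) (⟦⟧-yes (good? p) g)) (*-identityˡ y))
    go (no ¬g) = subst₂ _∣≤∣_ (eq x) (eq b) ∣≤∣-0
      where
      eq : ∀ y → 0ℤ ≡ π p * y
      eq y = sym (trans (cong (_* y) (⟦⟧-no (good? p) ¬g)) (*-zeroˡ y))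

  -- One dyadic block: n = N + i runs through N , ... , 2 N - 1 with coefficients b, and suc m
  -- through 1 , ... , M with coefficients a. The number s is an integer stand-in for √(27 P); a
  -- trivial estimate would have a multiple of P in its place.
  module Bin (k N M : ℕ) (Y : ℕ) (b a : ℕ → ℤ) (A s : ℤ)
    (∣b∣≤1 : ∀ i → b i ∣≤∣ 1ℤ) (∣a∣≤A : ∀ m → a m ∣≤∣ A)
    (z≤N : z ℕ.≤ N) (2z≤M : 2 ℕ.* z ℕ.≤ M) (z³≤M : + z * + z * + z ≤ + M)
    (s-big : + 27 * P ≤ s * s) (0<N : 0 ℕ.< N) (0<s : 0ℤ < s) (0<A : 0ℤ < A) where

    x : ℕ → ℕ → ℕ
    x i m = k ℕ.* (N ℕ.+ i) ℕ.* suc m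

    c : ℕ → ℤ
    c i = + (k ℕ.* (N ℕ.+ i))

    x-pt : ∀ i m → + x i m ≡ pt (c i) m
    x-pt i m = trans (pos-* (k ℕ.* (N ℕ.+ i)) (suc m)) (pt-suc (c i) m)

    inside? : ∀ i m → Dec (x i m ℕ.< Y)
    inside? i m = x i m ℕ.<? Y

    U : ℕ → ℕ → ℤ
    U i m = ⟦ inside? i m ⟧ * G (+ x i m)

    V : ℕ → ℤ
    V m = ∑[ i < N ] (b i * U i m)

    S : ℤ
    S = ∑[ m < M ] (a m * V m)

    cgr : ℕ → ℕ → ℕ → ℤ
    cgr p i i′ = zer p (+ i - + i′)

    -- If k n m and k n′ m are both 1 modulo p, then k m is invertible and divides out of the
    -- difference, which leaves n ≡ n′. This is the only correlation that survives for p = p′.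
    one-one : ∀ {p} → Prime p → ∀ i i′ m → one p (pt (c i) m) * one p (pt (c i′) m) ≤ cgr p i i′ * one p (pt (c i) m)
    one-one {p} pp i i′ m with + p ∣? (pt (c i) m - 1ℤ) | + p ∣? (pt (c i′) m - 1ℤ)
    ... | no ∤₁ | _ = ≤-reflexive (trans (cong (_* one p (pt (c i′) m)) e) (trans (*-zeroˡ (one p (pt (c i′) m)))
                        (sym (trans (cong (cgr p i i′ *_) e) (*-zeroʳ (cgr p i i′))))))
      where e = zer-no p (pt (c i) m - 1ℤ) ∤₁
    ... | yes _ | no ∤₂ = ≤-trans (≤-reflexive (trans (cong (one p (pt (c i) m) *_) (zer-no p (pt (c i′) m - 1ℤ) ∤₂)) (*-zeroʳ (one p (pt (c i) m)))))
                            (0≤-* {cgr p i i′} {one p (pt (c i) m)} (0≤zer p (+ i - + i′)) (0≤one p (pt (c i) m)))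
    ... | yes d₁ | yes d₂ = ≤-reflexive (trans (*-comm (one p (pt (c i) m)) (one p (pt (c i′) m)))
          (cong (_* one p (pt (c i) m)) (trans (zer-yes p (pt (c i′) m - 1ℤ) d₂) (sym (zer-yes p (+ i - + i′) p∣i-i′)))))
      where
      w = + k * + suc m
      point : ∀ i → pt (c i) m ≡ (+ N + + i) * w
      point i = trans (sym (pt-suc (c i) m)) (trans (cong (_* + suc m) (pos-* k (N ℕ.+ i))) (l (+ k) (+ N + + i) (+ suc m)))
        where
        l : ∀ k n m → k * n * m ≡ n * (k * m)
        l = solve-∀
      p∤w : ¬ (+ p ∣ w)
      p∤w p∣w = prime-∤1 pp (∣-sub-self (pt (c i) m) 1ℤ (subst (+ p ∣_) (sym (point i)) (∣-*ˡ (+ p) (+ N + + i) w p∣w)) d₁)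
      l₂ : ∀ n w x y → (n + x) * w - 1ℤ - ((n + y) * w - 1ℤ) ≡ w * (x - y)
      l₂ = solve-∀
      p∣i-i′ : + p ∣ + i - + i′
      p∣i-i′ = prime-∣*ʳ pp w (+ i - + i′) p∤w (subst (+ p ∣_)
        (trans (cong₂ (λ u v → u - 1ℤ - (v - 1ℤ)) (point i) (point i′)) (l₂ (+ N) w (+ i) (+ i′)))
        (∣-- (+ p) (pt (c i) m - 1ℤ) (pt (c i′) m - 1ℤ) d₁ d₂))

    +p≤+M : ∀ {p} → Good p → + p ≤ + M
    +p≤+M g = +≤+ (ℕ.≤-trans (ℕ.<⇒≤ (proj₂ (proj₂ (good g)))) 2z≤M)

    -- With a single modulus the correlation does not cancel, so the majorants are multiplied out.
    -- Both points are 1 modulo p only if i ≡ i′, by `one-one`, and a single condition holds for at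
    -- most (M + p) / p ≤ 2 M / p of the m.
    diagonal : ∀ {p} → Good p → ∀ i i′ n → n ℕ.≤ M →
               ∑[ m < n ] (H p (pt (c i) m) * H p (pt (c i′) m)) ∣≤∣ + 2 * + M * (+ p * cgr p i i′) + + 5 * + M
    diagonal {p} g i i′ n n≤M = ∣≤∣-mono bound (∑-∣≤∣ n λ m _ →
        ∣≤∣-* {H p (pt (c i) m)} {H p (pt (c i′) m)} {K p (pt (c i) m)} {K p (pt (c i′) m)} (H-≤-K pp (pt (c i) m)) (H-≤-K pp (pt (c i′) m)))
      where
      pp = proj₁ (good g)
      o o′ : ℕ → ℤ
      o m = one p (pt (c i) m)
      o′ m = one p (pt (c i′) m)
      e = cgr p i i′
      0≤e : 0ℤ ≤ e
      0≤e = 0≤zer p (+ i - + i′)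
      termwise : ∀ m → K p (pt (c i) m) * K p (pt (c i′) m) ≤ + p * (+ p * e + 1ℤ) * o m + (+ p * o′ m + 1ℤ)
      termwise m = ≤-by (+ p * + p * (e * o m - o m * o′ m))
        (0≤-* {+ p * + p} {e * o m - o m * o′ m} (0≤sq (+ p)) (≤⇒0≤- (one-one pp i i′ m))) (l (+ p) e (o m) (o′ m))
        where
        l : ∀ p e o o′ → p * (p * e + 1ℤ) * o + (p * o′ + 1ℤ) ≡ (p * o + 1ℤ) * (p * o′ + 1ℤ) + p * p * (e * o - o * o′)
        l = solve-∀
      counted : ∀ i → + p * ∑[ m < n ] one p (pt (c i) m) ≤ + 2 * + M
      counted i = ≤-trans (one-count pp (c i) n) (≤-trans (+-mono-≤ (+≤+ n≤M) (+p≤+M g)) (≤-reflexive (l (+ M))))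
        where
        l : ∀ m → m + m ≡ + 2 * m
        l = solve-∀
      ∑-expand : ∑[ m < n ] (+ p * (+ p * e + 1ℤ) * o m + (+ p * o′ m + 1ℤ)) ≡
                 (+ p * e + 1ℤ) * (+ p * ∑ n o) + (+ p * ∑ n o′ + + n * 1ℤ)
      ∑-expand = trans (∑-+ n (λ m → + p * (+ p * e + 1ℤ) * o m) (λ m → + p * o′ m + 1ℤ))
        (cong₂ _+_ (trans (∑-*ˡ n (+ p * (+ p * e + 1ℤ)) o) (l (+ p) (+ p * e + 1ℤ) (∑ n o)))
          (trans (∑-+ n (λ m → + p * o′ m) (λ _ → 1ℤ)) (cong₂ _+_ (∑-*ˡ n (+ p) o′) (∑-const n 1ℤ))))
        where
        l : ∀ p e x → p * e * x ≡ e * (p * x)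
        l = solve-∀
      bound : ∑[ m < n ] (K p (pt (c i) m) * K p (pt (c i′) m)) ≤ + 2 * + M * (+ p * e) + + 5 * + M
      bound = begin
        ∑[ m < n ] (K p (pt (c i) m) * K p (pt (c i′) m))                   ≤⟨ ∑-mono n (λ m _ → termwise m) ⟩
        ∑[ m < n ] (+ p * (+ p * e + 1ℤ) * o m + (+ p * o′ m + 1ℤ))         ≡⟨ ∑-expand ⟩
        (+ p * e + 1ℤ) * (+ p * ∑ n o) + (+ p * ∑ n o′ + + n * 1ℤ)
          ≤⟨ +-mono-≤ (*-monoˡ {+ p * ∑ n o} {+ 2 * + M} {+ p * e + 1ℤ} (0≤-+ (0≤-* {+ p} {e} 0≤+ 0≤e) 0≤1) (counted i))
               (+-mono-≤ (counted i′) (≤-trans (≤-reflexive (*-identityʳ (+ n))) (+≤+ n≤M))) ⟩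
        (+ p * e + 1ℤ) * (+ 2 * + M) + (+ 2 * + M + + M)                    ≡⟨ l (+ p * e) (+ M) ⟩
        + 2 * + M * (+ p * e) + + 5 * + M                                   ∎
        where
        open ≤-Reasoning
        l : ∀ x m → (x + 1ℤ) * (+ 2 * m) + (+ 2 * m + m) ≡ + 2 * m * x + + 5 * m
        l = solve-∀

    δ : ℕ → ℕ → ℤ
    δ p q = ⟦ p ℕ.≟ q ⟧

    -- The first term covers p ≠ q, where 2 p · 2 q ≤ 16 z² as both are below 2 z; δ adds the
    -- diagonal term.
    pairBound : ℕ → ℕ → ℕ → ℕ → ℤ
    pairBound i i′ p q = + 16 * (+ z * + z) + δ p q * (+ 2 * + M * (+ p * cgr p i i′) + + 5 * + M)

    +p≤2z : ∀ {p} → Good p → + p ≤ + 2 * + z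
    +p≤2z g = ≤-trans (+≤+ (ℕ.<⇒≤ (proj₂ (proj₂ (good g))))) (≤-reflexive (pos-* 2 z))

    0≤diag : ∀ p i i′ → 0ℤ ≤ + 2 * + M * (+ p * cgr p i i′) + + 5 * + M
    0≤diag p i i′ = 0≤-+ (0≤-* {+ 2 * + M} {+ p * cgr p i i′} (0≤-* {+ 2} {+ M} 0≤+ 0≤+) (0≤-* {+ p} {cgr p i i′} 0≤+ (0≤zer p (+ i - + i′))))
      (0≤-* {+ 5} {+ M} 0≤+ 0≤+)

    pair : ∀ {p q} → Good p → Good q → ∀ i i′ n → n ℕ.≤ M →
           ∑[ m < n ] (H p (pt (c i) m) * H q (pt (c i′) m)) ∣≤∣ pairBound i i′ p q
    pair {p} {q} gp gq i i′ n n≤M = go (p ℕ.≟ q)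
      where
      D = + 2 * + M * (+ p * cgr p i i′) + + 5 * + M
      go : Dec (p ≡ q) → ∑[ m < n ] (H p (pt (c i) m) * H q (pt (c i′) m)) ∣≤∣ pairBound i i′ p q
      go (yes refl) = ∣≤∣-mono (≤-by (+ 16 * (+ z * + z)) (0≤-* {+ 16} {+ z * + z} 0≤+ (0≤sq (+ z)))
            (trans (cong (λ w → + 16 * (+ z * + z) + w * D) (⟦⟧-yes (p ℕ.≟ p) refl)) (l (+ 16 * (+ z * + z)) D)))
          (diagonal gp i i′ n n≤M)
        where
        l : ∀ a d → a + 1ℤ * d ≡ d + a
        l = solve-∀
      go (no p≢q) = ∣≤∣-mono (≤-trans bound (≤-reflexive (sym (trans (cong (λ w → + 16 * (+ z * + z) + w * D) (⟦⟧-no (p ℕ.≟ q) p≢q)) (l (+ 16 * (+ z * + z)) D)))))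
          (HH-partial (proj₁ (good gp)) (proj₁ (good gq)) p≢q (c i) (c i′) n)
        where
        l : ∀ a d → a + 0ℤ * d ≡ a
        l = solve-∀
        l₂ : ∀ z → + 2 * z * + 2 * (+ 2 * z * + 2) ≡ + 16 * (z * z)
        l₂ = solve-∀
        bound : + p * + 2 * (+ q * + 2) ≤ + 16 * (+ z * + z)
        bound = ≤-trans (*-mono {+ p * + 2} {+ 2 * + z * + 2} {+ q * + 2} {+ 2 * + z * + 2}
            (0≤-* {+ p} {+ 2} 0≤+ 0≤+) (*-monoʳ {+ p} {+ 2 * + z} {+ 2} 0≤+ (+p≤2z gp))
            (0≤-* {+ q} {+ 2} 0≤+ 0≤+) (*-monoʳ {+ q} {+ 2 * + z} {+ 2} 0≤+ (+p≤2z gq)))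
          (≤-reflexive (l₂ (+ z)))

    B : ℕ → ℕ → ℤ
    B i i′ = ∑[ p < 2 ℕ.* z ] ∑[ q < 2 ℕ.* z ] (π p * (π q * pairBound i i′ p q))

    GG : ∀ i i′ n → n ℕ.≤ M → ∑[ m < n ] (G (pt (c i) m) * G (pt (c i′) m)) ∣≤∣ B i i′
    GG i i′ n n≤M = subst (_∣≤∣ B i i′) (sym expand)
        (∑-∣≤∣ (2 ℕ.* z) λ p _ → ∑-∣≤∣ (2 ℕ.* z) λ q _ →
          π-scale p (π q * HH p q) (π q * pairBound i i′ p q) λ gp → π-scale q (HH p q) (pairBound i i′ p q) λ gq → pair gp gq i i′ n n≤M)
      where
      h h′ : ℕ → ℕ → ℤ
      h m p = H p (pt (c i) m)
      h′ m q = H q (pt (c i′) m)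
      HH : ℕ → ℕ → ℤ
      HH p q = ∑[ m < n ] (h m p * h′ m q)
      l : ∀ a x b y → a * x * (b * y) ≡ a * (b * (x * y))
      l = solve-∀
      term : ℕ → ℕ → ℕ → ℤ
      term m p q = π p * (π q * (h m p * h′ m q))
      product : ∀ m → G (pt (c i) m) * G (pt (c i′) m) ≡ ∑[ p < 2 ℕ.* z ] ∑[ q < 2 ℕ.* z ] term m p q
      product m = trans (cong₂ _*_ (G-def (pt (c i) m)) (G-def (pt (c i′) m)))
        (trans (sym (∑-∑-* (2 ℕ.* z) (2 ℕ.* z) (λ p → π p * h m p) (λ q → π q * h′ m q)))
          (∑-cong′ (2 ℕ.* z) λ p → ∑-cong′ (2 ℕ.* z) λ q → l (π p) (h m p) (π q) (h′ m q)))
      expand : ∑[ m < n ] (G (pt (c i) m) * G (pt (c i′) m)) ≡ ∑[ p < 2 ℕ.* z ] ∑[ q < 2 ℕ.* z ] (π p * (π q * HH p q))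
      expand = trans (∑-cong′ n product) (trans (∑-swap n (2 ℕ.* z) (λ m p → ∑[ q < 2 ℕ.* z ] term m p q))
        (∑-cong′ (2 ℕ.* z) λ p → trans (∑-swap n (2 ℕ.* z) (λ m q → term m p q))
          (∑-cong′ (2 ℕ.* z) λ q → trans (∑-*ˡ n (π p) (λ m → π q * (h m p * h′ m q)))
            (cong (π p *_) (∑-*ˡ n (π q) (λ m → h m p * h′ m q))))))

    Q : ℕ → ℕ → ℤ
    Q i i′ = ∑[ m < M ] (U i m * U i′ m)

    -- Each of the two cutoffs holds on an initial range of m, hence so do both together, and the
    -- cut off correlation is a partial sum as in `GG`.
    Q≤B : ∀ i i′ → Q i i′ ∣≤∣ B i i′
    Q≤B i i′ = subst (_∣≤∣ B i i′) (sym eq) (GG i i′ n n≤M)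
      where
      open import Relation.Nullary.Decidable using (_×-dec_)
      both? : ∀ m → Dec (x i m ℕ.< Y × x i′ m ℕ.< Y)
      both? m = inside? i m ×-dec inside? i′ m
      step : ∀ i m → x i m ℕ.≤ x i (suc m)
      step i m = ℕ.*-monoʳ-≤ (k ℕ.* (N ℕ.+ i)) (ℕ.n≤1+n (suc m))
      down : ∀ m → x i (suc m) ℕ.< Y × x i′ (suc m) ℕ.< Y → x i m ℕ.< Y × x i′ m ℕ.< Y
      down m (u , v) = ℕ.≤-<-trans (step i m) u , ℕ.≤-<-trans (step i′ m) v
      init = ∑-initial both? down M
      n = proj₁ init
      n≤M = proj₁ (proj₂ init)
      l : ∀ d e g g′ → d * g * (e * g′) ≡ d * e * (g * g′)
      l = solve-∀
      eq : Q i i′ ≡ ∑[ m < n ] (G (pt (c i) m) * G (pt (c i′) m))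
      eq = trans (∑-cong′ M λ m → trans (l ⟦ inside? i m ⟧ ⟦ inside? i′ m ⟧ (G (+ x i m)) (G (+ x i′ m)))
          (cong₂ _*_ (⟦⟧-× (inside? i m) (inside? i′ m)) (cong₂ (λ u v → G u * G v) (x-pt i m) (x-pt i′ m))))
        (proj₂ (proj₂ init) (λ m → G (pt (c i) m) * G (pt (c i′) m)))

    D : ℕ → ℕ → ℕ → ℤ
    D i i′ p = + 2 * + M * (+ p * cgr p i i′) + + 5 * + M

    A₀ : ℤ
    A₀ = + 16 * (+ z * + z)

    B-≤ : ∀ i i′ → B i i′ ≤ A₀ * P * P + ∑[ p < 2 ℕ.* z ] (π p * D i i′ p)
    B-≤ i i′ = ≤-trans (∑-mono (2 ℕ.* z) row)
        (≤-reflexive (trans (∑-+ (2 ℕ.* z) (λ p → π p * (A₀ * P)) (λ p → π p * D i i′ p))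
          (cong (_+ ∑[ p < 2 ℕ.* z ] (π p * D i i′ p)) (trans (∑-*ʳ (2 ℕ.* z) (A₀ * P) π) (*-comm P (A₀ * P))))))
      where
      inner : ∀ p → p ℕ.< 2 ℕ.* z → ∑[ q < 2 ℕ.* z ] (π q * pairBound i i′ p q) ≡ A₀ * P + π p * D i i′ p
      inner p p<2z = trans (∑-cong′ (2 ℕ.* z) λ q → l (π q) A₀ (δ p q) (D i i′ p))
        (trans (∑-+ (2 ℕ.* z) (λ q → A₀ * π q) (λ q → δ p q * (π q * D i i′ p)))
          (cong₂ _+_ (∑-*ˡ (2 ℕ.* z) A₀ π)
            (trans (∑-single (2 ℕ.* z) p (λ q → δ p q * (π q * D i i′ p)) p<2z
                λ q _ q≢p → trans (cong (_* (π q * D i i′ p)) (⟦⟧-no (p ℕ.≟ q) (q≢p ∘ sym))) (*-zeroˡ (π q * D i i′ p)))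
              (trans (cong (_* (π p * D i i′ p)) (⟦⟧-yes (p ℕ.≟ p) refl)) (*-identityˡ (π p * D i i′ p))))))
        where
        l : ∀ π a d w → π * (a + d * w) ≡ a * π + d * (π * w)
        l = solve-∀
      row : ∀ p → p ℕ.< 2 ℕ.* z → ∑[ q < 2 ℕ.* z ] (π p * (π q * pairBound i i′ p q)) ≤ π p * (A₀ * P) + π p * D i i′ p
      row p p<2z = ≤-trans (≤-reflexive (trans (∑-*ˡ (2 ℕ.* z) (π p) (λ q → π q * pairBound i i′ p q)) (cong (π p *_) (inner p p<2z))))
        (≤-by ((1ℤ - π p) * (π p * D i i′ p))
          (0≤-* {1ℤ - π p} {π p * D i i′ p} (≤⇒0≤- (⟦⟧≤1 (good? p))) (0≤-* {π p} {D i i′ p} (0≤π p) (0≤diag p i i′)))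
          (l (π p) (A₀ * P) (D i i′ p)))
        where
        l : ∀ π a d → π * a + π * d ≡ π * (a + π * d) + (1ℤ - π) * (π * d)
        l = solve-∀

    +z≤+N : + z ≤ + N
    +z≤+N = +≤+ z≤N

    -- Among p consecutive i′ one is congruent to i; the incomplete period costs p ≤ 2 z ≤ 2 N.
    cgr-count : ∀ {p} → Good p → ∀ i → + p * ∑[ i′ < N ] cgr p i i′ ≤ + 3 * + N
    cgr-count {p} g i = ≤-trans
        (∑-period-count p (cgr p i) period (≤-reflexive full) (λ i′ → 0≤zer p (+ i - + i′)) (0<prime pp) N)
        (≤-trans (+-monoʳ-≤ (+ N) (≤-trans (+p≤2z g) (*-monoˡ {+ z} {+ N} {+ 2} 0≤+ +z≤+N))) (≤-reflexive (l (+ N))))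
      where
      pp = proj₁ (good g)
      l : ∀ n → n + + 2 * n ≡ + 3 * n
      l = solve-∀
      l₁ : ∀ i p j → i - (p + j) ≡ i - j + (- p)
      l₁ = solve-∀
      l₂ : ∀ i j → i - j ≡ - 1ℤ * j + i
      l₂ = solve-∀
      period : ∀ i′ → cgr p i (p ℕ.+ i′) ≡ cgr p i i′
      period i′ = trans (cong (zer p) (l₁ (+ i) (+ p) (+ i′))) (zer-shift p (+ i - + i′) (- + p) (∣m⇒∣-m {+ p} {+ p} ∣-refl))
      full : ∑ p (cgr p i) ≡ 1ℤ
      full = trans (∑-cong′ p λ j → cong (zer p) (l₂ (+ i) (+ j)))
        (∑-residue pp (- 1ℤ) (+ i) λ p∣-1 → prime-∤1 pp (∣m⇒∣-m {+ p} { - 1ℤ} p∣-1))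

    -- 27 = 16 + 11. The pairs p ≠ q give 16 z² P² ≤ 16 M P, by P ≤ z and z³ ≤ M; the diagonal gives
    -- 2 · 3 + 5 = 11 for each p, the 3 coming from `cgr-count`.
    ∑B : ∀ i → ∑ N (B i) ≤ + 27 * + M * + N * P
    ∑B i = begin
      ∑ N (B i)                                                                     ≤⟨ ∑-mono N (λ i′ _ → B-≤ i i′) ⟩
      ∑[ i′ < N ] (A₀ * P * P + ∑[ p < 2 ℕ.* z ] (π p * D i i′ p))
        ≡⟨ trans (∑-+ N (λ _ → A₀ * P * P) (λ i′ → ∑[ p < 2 ℕ.* z ] (π p * D i i′ p)))
             (cong₂ _+_ (∑-const N (A₀ * P * P)) (trans (∑-swap N (2 ℕ.* z) (λ i′ p → π p * D i i′ p))
               (∑-cong′ (2 ℕ.* z) λ p → trans (∑-*ˡ N (π p) (λ i′ → D i i′ p)) (cong (π p *_) (∑D p))))) ⟩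
      + N * (A₀ * P * P) + ∑[ p < 2 ℕ.* z ] (π p * E p)
        ≤⟨ +-mono-≤ (*-monoˡ {A₀ * P * P} {+ 16 * + M * P} {+ N} 0≤+ first)
             (∑-mono (2 ℕ.* z) λ p _ → proj₂ (π-scale p (E p) (+ 11 * + M * + N) (λ g → ∣≤∣-of-nonneg (0≤E p) (second p g)))) ⟩
      + N * (+ 16 * + M * P) + ∑[ p < 2 ℕ.* z ] (π p * (+ 11 * + M * + N))
        ≡⟨ cong (_+_ (+ N * (+ 16 * + M * P))) (∑-*ʳ (2 ℕ.* z) (+ 11 * + M * + N) π) ⟩
      + N * (+ 16 * + M * P) + P * (+ 11 * + M * + N)                               ≡⟨ l (+ N) (+ M) P ⟩
      + 27 * + M * + N * P                                                          ∎
      where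
      open ≤-Reasoning
      l : ∀ n m p → n * (+ 16 * m * p) + p * (+ 11 * m * n) ≡ + 27 * m * n * p
      l = solve-∀
      E : ℕ → ℤ
      E p = + 2 * + M * (+ p * ∑ N (cgr p i)) + + N * (+ 5 * + M)
      ∑D : ∀ p → ∑[ i′ < N ] D i i′ p ≡ E p
      ∑D p = trans (∑-+ N (λ i′ → + 2 * + M * (+ p * cgr p i i′)) (λ _ → + 5 * + M))
        (cong₂ _+_ (trans (∑-*ˡ N (+ 2 * + M) (λ i′ → + p * cgr p i i′)) (cong (+ 2 * + M *_) (∑-*ˡ N (+ p) (cgr p i))))
          (∑-const N (+ 5 * + M)))
      0≤E : ∀ p → 0ℤ ≤ E p
      0≤E p = subst (0ℤ ≤_) (∑D p) (∑-nonneg N λ i′ → 0≤diag p i i′)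
      second : ∀ p → Good p → E p ≤ + 11 * + M * + N
      second p g = ≤-trans (+-monoˡ-≤ (+ N * (+ 5 * + M)) (*-monoˡ {+ p * ∑ N (cgr p i)} {+ 3 * + N} {+ 2 * + M} (0≤-* {+ 2} {+ M} 0≤+ 0≤+) (cgr-count g i)))
        (≤-reflexive (l₂ (+ M) (+ N)))
        where
        l₂ : ∀ m n → + 2 * m * (+ 3 * n) + n * (+ 5 * m) ≡ + 11 * m * n
        l₂ = solve-∀
      first : A₀ * P * P ≤ + 16 * + M * P
      first = ≤-trans (≤-by (+ 16 * (+ z * + z) * P * (+ z - P))
          (0≤-* {+ 16 * (+ z * + z) * P} {+ z - P} (0≤-* {+ 16 * (+ z * + z)} {P} (0≤-* {+ 16} {+ z * + z} 0≤+ (0≤sq (+ z))) 0≤P) (≤⇒0≤- P≤z))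
          (l₃ (+ z) P))
        (*-monoʳ {+ 16 * (+ z * + z * + z)} {+ 16 * + M} {P} 0≤P (*-monoˡ {+ z * + z * + z} {+ M} {+ 16} 0≤+ z³≤M))
        where
        l₃ : ∀ z p → + 16 * (z * z * z) * p ≡ + 16 * (z * z) * p * p + + 16 * (z * z) * p * (z - p)
        l₃ = solve-∀

    ∑V² : ∑[ m < M ] (V m * V m) ≤ + 27 * + M * + N * P * + N
    ∑V² = begin
      ∑[ m < M ] (V m * V m)                                    ≡⟨ expand ⟩
      ∑[ i < N ] ∑[ i′ < N ] (b i * (b i′ * Q i i′))            ≤⟨ ∑-mono N (λ i _ → ∑-mono N λ i′ _ → bound i i′) ⟩
      ∑[ i < N ] ∑ N (B i)                                      ≤⟨ ∑-mono N (λ i _ → ∑B i) ⟩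
      ∑[ i < N ] (+ 27 * + M * + N * P)                         ≡⟨ trans (∑-const N (+ 27 * + M * + N * P)) (*-comm (+ N) (+ 27 * + M * + N * P)) ⟩
      + 27 * + M * + N * P * + N                                ∎
      where
      open ≤-Reasoning
      l : ∀ a x b y → a * x * (b * y) ≡ a * (b * (x * y))
      l = solve-∀
      expand : ∑[ m < M ] (V m * V m) ≡ ∑[ i < N ] ∑[ i′ < N ] (b i * (b i′ * Q i i′))
      expand = trans (∑-cong′ M λ m → sym (∑-∑-* N N (λ i → b i * U i m) (λ i → b i * U i m)))
        (trans (∑-swap M N (λ m i → ∑[ i′ < N ] (b i * U i m * (b i′ * U i′ m))))
        (∑-cong′ N λ i → trans (∑-swap M N (λ m i′ → b i * U i m * (b i′ * U i′ m)))
        (∑-cong′ N λ i′ → trans (∑-cong′ M λ m → l (b i) (U i m) (b i′) (U i′ m))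
          (trans (∑-*ˡ M (b i) (λ m → b i′ * (U i m * U i′ m))) (cong (b i *_) (∑-*ˡ M (b i′) (λ m → U i m * U i′ m)))))))
      bound : ∀ i i′ → b i * (b i′ * Q i i′) ≤ B i i′
      bound i i′ = ≤-trans (proj₂ (∣≤∣-* {b i} {b i′ * Q i i′} {1ℤ} {1ℤ * B i i′} (∣b∣≤1 i) (∣≤∣-* {b i′} {Q i i′} {1ℤ} {B i i′} (∣b∣≤1 i′) (Q≤B i i′))))
        (≤-reflexive (trans (*-identityˡ (1ℤ * B i i′)) (*-identityˡ (B i i′))))

    -- Dispersion: 2 t A a V ≤ A² (t² + V²) removes the coefficients a and leaves the
    -- correlations in ∑ V²; t balances the two terms.
    S-≤ : S ≤ A * (+ M * + N * s)
    S-≤ = *-cancelˡ-≤-pos S (A * (+ M * + N * s)) (A * (+ 2 * (+ N * s))) {{positive 0<2ANs}} (begin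
      A * (+ 2 * t) * S                                             ≡⟨ sym (∑-*ˡ M (A * (+ 2 * t)) (λ m → a m * V m)) ⟩
      ∑[ m < M ] (A * (+ 2 * t) * (a m * V m))                      ≤⟨ ∑-mono M (λ m _ → am-gm m) ⟩
      ∑[ m < M ] (A * A * (t * t + V m * V m))                      ≡⟨ trans (∑-*ˡ M (A * A) (λ m → t * t + V m * V m)) (cong (A * A *_)
                                                                         (trans (∑-+ M (λ _ → t * t) (λ m → V m * V m)) (cong (_+ ∑[ m < M ] (V m * V m)) (∑-const M (t * t))))) ⟩
      A * A * (+ M * (t * t) + ∑[ m < M ] (V m * V m))              ≤⟨ *-monoˡ {+ M * (t * t) + ∑[ m < M ] (V m * V m)} {+ M * (t * t) + + M * (+ N * + N) * (s * s)} {A * A} (0≤sq A) ∑t²+V² ⟩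
      A * A * (+ M * (t * t) + + M * (+ N * + N) * (s * s))         ≡⟨ l₂ A (+ M) (+ N) s ⟩
      A * (+ 2 * t) * (A * (+ M * + N * s))                         ∎)
      where
      open ≤-Reasoning
      t = + N * s
      pos*pos : ∀ {i j} → Positive i → Positive j → Positive (i * j)
      pos*pos {+[1+ _ ]} {+[1+ _ ]} _ _ = _
      0<2ANs : 0ℤ < A * (+ 2 * t)
      0<2ANs = positive⁻¹ (A * (+ 2 * t)) {{pos*pos {A} {+ 2 * t} (positive 0<A) (pos*pos {+ 2} {t} (positive (+<+ (ℕ.s≤s ℕ.z≤n))) (pos*pos {+ N} {s} (positive (+<+ 0<N)) (positive 0<s)))}}
      l₁ : ∀ m n p → + 27 * m * n * p * n ≡ m * (n * n) * (+ 27 * p)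
      l₁ = solve-∀
      l₂ : ∀ a m n s → a * a * (m * (n * s * (n * s)) + m * (n * n) * (s * s)) ≡ a * (+ 2 * (n * s)) * (a * (m * n * s))
      l₂ = solve-∀
      ∑t²+V² : + M * (t * t) + ∑[ m < M ] (V m * V m) ≤ + M * (t * t) + + M * (+ N * + N) * (s * s)
      ∑t²+V² = +-monoʳ-≤ (+ M * (t * t)) (≤-trans ∑V² (≤-trans (≤-reflexive (l₁ (+ M) (+ N) P))
        (*-monoˡ {+ 27 * P} {s * s} {+ M * (+ N * + N)} (0≤-* {+ M} {+ N * + N} 0≤+ (0≤sq (+ N))) s-big)))
      l₃ : ∀ c t a v → c * c * (t * t + v * v) ≡ c * (+ 2 * t) * (a * v) + ((t * a - c * v) * (t * a - c * v) + t * t * (c * c - a * a))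
      l₃ = solve-∀
      am-gm : ∀ m → A * (+ 2 * t) * (a m * V m) ≤ A * A * (t * t + V m * V m)
      am-gm m = ≤-by ((t * a m - A * V m) * (t * a m - A * V m) + t * t * (A * A - a m * a m))
        (0≤-+ (0≤sq (t * a m - A * V m)) (0≤-* {t * t} {A * A - a m * a m} (0≤sq t)
          (≤⇒0≤- (square-≤ (a m) A (∣a∣≤A m)))))
        (l₃ A t (a m) (V m))
        where
        square-≤ : ∀ x y → x ∣≤∣ y → x * x ≤ y * y
        square-≤ x y h = proj₂ (∣≤∣-* {x} {x} {y} {y} h h)

-- Bilinear sums with a cutoff, split into dyadic blocks.

module Bilinear (z : ℕ) {Good : ℕ → Set} (good? : ∀ p → Dec (Good p))
  (good : ∀ {p} → Good p → Prime p × z ℕ.< p × p ℕ.< 2 ℕ.* z)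
  (1<z : 1 ℕ.< z) where

  open import Data.Nat as ℕ using (ℕ; zero; suc)
  open import Data.Nat.Primality using (Prime)
  open import Relation.Nullary using (Dec; yes; no; contradiction)
  open import Data.Product using (_×_; _,_; proj₁; proj₂)
  import Data.Nat.Properties as ℕ
  import Data.Nat.DivMod as ℕ
  open import Data.Integer hiding (suc) renaming (∣_∣ to abs)
  open import Data.Integer.Properties
  open import Data.Integer.Divisibility.Signed
  open import Data.Integer.Tactic.RingSolver using (solve-∀)
  open import Data.Sum using (_⊎_; inj₁; inj₂)
  open import Relation.Binary.PropositionalEquality
  open FiniteSums
  open Residues
  open TypeII z good? good

  z³ Y : ℕ
  z³ = z ℕ.* z ℕ.* z
  Y = z³ ℕ.* z³

  G-0 : G 0ℤ ≡ 0ℤ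
  G-0 = trans (G-def 0ℤ) (∑-zero (2 ℕ.* z) λ p _ → ≤-antisym (proj₂ (term p)) (proj₁ (term p)))
    where
    term : ∀ p → π p * H p 0ℤ ∣≤∣ 0ℤ
    term p = subst (π p * H p 0ℤ ∣≤∣_) (*-zeroʳ (π p)) (π-scale p (H p 0ℤ) 0ℤ λ g →
      subst (_∣≤∣ 0ℤ) (sym (H-none (proj₁ (good g)) 0ℤ (divides 0ℤ refl))) ∣≤∣-0)

  W : ℕ → ℤ
  W n = ⟦ n ℕ.<? Y ⟧ * G (+ n)

  W-0 : W 0 ≡ 0ℤ
  W-0 = trans (cong (⟦ 0 ℕ.<? Y ⟧ *_) G-0) (*-zeroʳ ⟦ 0 ℕ.<? Y ⟧)

  W-big : ∀ n → Y ℕ.≤ n → W n ≡ 0ℤ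
  W-big n Y≤n = trans (cong (_* G (+ n)) (⟦⟧-no (n ℕ.<? Y) (ℕ.≤⇒≯ Y≤n))) (*-zeroˡ (G (+ n)))

  inner : ℕ → (ℕ → ℤ) → ℕ → ℤ
  inner k g u = ∑[ m < suc Y ] (g m * W (k ℕ.* u ℕ.* m))

  Bil : ℕ → (ℕ → ℤ) → (ℕ → ℤ) → ℤ
  Bil k f g = ∑[ u < suc Y ] (f u * inner k g u)

  2z≤z³ : 2 ℕ.* z ℕ.≤ z³
  2z≤z³ = ℕ.*-monoˡ-≤ z (ℕ.≤-trans (ℕ.≤-reflexive (sym (ℕ.*-identityʳ 2))) (ℕ.*-mono-≤ 1<z (ℕ.<⇒≤ 1<z)))

  0<z : 0 ℕ.< z
  0<z = ℕ.<-trans (ℕ.s≤s ℕ.z≤n) 1<z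

  z≤z³ : z ℕ.≤ z³
  z≤z³ = ℕ.≤-trans (ℕ.m≤m+n z (z ℕ.+ 0)) 2z≤z³

  0<z³ : 0 ℕ.< z³
  0<z³ = ℕ.<-≤-trans 0<z z≤z³

  <-suc-quotient : ∀ m n .{{_ : ℕ.NonZero n}} → m ℕ.< n ℕ.* suc (m ℕ./ n)
  <-suc-quotient m n = subst₂ ℕ._<_ (sym (ℕ.m≡m%n+[m/n]*n m n)) (trans (cong (n ℕ.+_) (ℕ.*-comm (m ℕ./ n) n)) (sym (ℕ.*-suc n (m ℕ./ n))))
    (ℕ.+-monoˡ-< (m ℕ./ n ℕ.* n) (ℕ.m%n<n m n))

  module _ (s : ℕ) (0<s : 0 ℕ.< s) (s-big : + 27 * P ≤ + s * + s)
           (k A : ℕ) (0<k : 0 ℕ.< k) (0<A : 0 ℕ.< A) (f g : ℕ → ℤ)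
           (∣f∣≤1 : ∀ u → f u ∣≤∣ 1ℤ) (∣g∣≤A : ∀ m → g m ∣≤∣ + A) where

    private
      C : ℤ
      C = + A * (+ Y * + s)

      0≤C : 0ℤ ≤ C
      0≤C = 0≤-* {+ A} {+ Y * + s} 0≤+ (0≤-* {+ Y} {+ s} 0≤+ 0≤+)

      T : ℕ → ℤ
      T u = f u * inner k g u

      module _ (N : ℕ) (z≤N : z ℕ.≤ N) (small : k ℕ.* N ℕ.* z³ ℕ.≤ Y) where
        0<N : 0 ℕ.< N
        0<N = ℕ.<-≤-trans 0<z z≤N

        instance
          kN≢0 : ℕ.NonZero (k ℕ.* N)
          kN≢0 = ℕ.>-nonZero (ℕ.*-mono-≤ 0<k 0<N)

        M : ℕ
        M = Y ℕ./ (k ℕ.* N)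

        z³≤M : z³ ℕ.≤ M
        z³≤M = ℕ.≤-trans (ℕ.≤-reflexive (sym (ℕ.m*n/n≡m z³ (k ℕ.* N)))) (ℕ./-monoˡ-≤ (k ℕ.* N) (ℕ.≤-trans (ℕ.≤-reflexive (ℕ.*-comm z³ (k ℕ.* N))) small))

        +z³≤M : + z * + z * + z ≤ + M
        +z³≤M = ≤-trans (≤-reflexive (trans (cong (_* + z) (sym (pos-* z z))) (sym (pos-* (z ℕ.* z) z)))) (+≤+ z³≤M)

        M≤Y : M ℕ.≤ Y
        M≤Y = ℕ.m/n≤m Y (k ℕ.* N)

        a : ℕ → ℤ
        a m = g (suc m)

        -- The dispersion estimate bounds sums only from above, so the lower bound is obtained as
        -- the upper bound for -f.
        module Lo = Bin k N M Y (λ i → - f (N ℕ.+ i)) a (+ A) (+ s) (λ i → ∣≤∣-neg (∣f∣≤1 (N ℕ.+ i))) (λ m → ∣g∣≤A (suc m))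
          z≤N (ℕ.≤-trans 2z≤z³ z³≤M) +z³≤M s-big 0<N (+<+ 0<s) (+<+ 0<A)
        module Up = Bin k N M Y (λ i → f (N ℕ.+ i)) a (+ A) (+ s) (λ i → ∣f∣≤1 (N ℕ.+ i)) (λ m → ∣g∣≤A (suc m))
          z≤N (ℕ.≤-trans 2z≤z³ z³≤M) +z³≤M s-big 0<N (+<+ 0<s) (+<+ 0<A)

        bigBin : ℤ
        bigBin = ∑[ i < N ] T (N ℕ.+ i)

        x : ℕ → ℕ → ℕ
        x i m = k ℕ.* (N ℕ.+ i) ℕ.* suc m

        x-big : ∀ i m → M ℕ.≤ m → Y ℕ.≤ x i m
        x-big i m M≤m = ℕ.<⇒≤ (ℕ.<-≤-trans (<-suc-quotient Y (k ℕ.* N))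
          (ℕ.*-mono-≤ (ℕ.*-monoʳ-≤ k (ℕ.m≤m+n N i)) (ℕ.s≤s M≤m)))

        inner-short : ∀ i → inner k g (N ℕ.+ i) ≡ ∑[ m < M ] (a m * W (x i m))
        inner-short i = trans (∑-suc Y (λ m → g m * W (k ℕ.* (N ℕ.+ i) ℕ.* m)))
          (trans (cong₂ _+_ (trans (cong (g 0 *_) (trans (cong W (ℕ.*-zeroʳ (k ℕ.* (N ℕ.+ i)))) W-0)) (*-zeroʳ (g 0)))
              (∑-extend (λ m → a m * W (x i m)) M≤Y λ m M≤m _ → trans (cong (a m *_) (W-big (x i m) (x-big i m M≤m))) (*-zeroʳ (a m))))
            (+-identityˡ (∑[ m < M ] (a m * W (x i m)))))

        bin-sum : ∀ (b : ℕ → ℤ) → ∑[ i < N ] (b i * inner k g (N ℕ.+ i)) ≡ ∑[ m < M ] (a m * ∑[ i < N ] (b i * W (x i m)))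
        bin-sum b = trans (∑-cong′ N λ i → trans (cong (b i *_) (inner-short i)) (sym (∑-*ˡ M (b i) (λ m → a m * W (x i m)))))
          (trans (∑-swap N M (λ i m → b i * (a m * W (x i m))))
            (∑-cong′ M λ m → trans (∑-cong′ N λ i → l (b i) (a m) (W (x i m))) (∑-*ˡ N (a m) (λ i → b i * W (x i m)))))
          where
          l : ∀ b a w → b * (a * w) ≡ a * (b * w)
          l = solve-∀

        size : + k * (+ A * (+ M * + N * + s)) ≤ C
        size = ≤-trans (≤-reflexive (l (+ k) (+ A) (+ M) (+ N) (+ s)))
          (*-monoˡ {+ M * (+ k * + N) * + s} {+ Y * + s} {+ A} 0≤+ (*-monoʳ {+ M * (+ k * + N)} {+ Y} {+ s} 0≤+
            (≤-trans (≤-reflexive (trans (cong (+ M *_) (sym (pos-* k N))) (sym (pos-* M (k ℕ.* N))))) (+≤+ (ℕ.m/n*n≤m Y (k ℕ.* N))))))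
          where
          l : ∀ k a m n s → k * (a * (m * n * s)) ≡ a * (m * (k * n) * s)
          l = solve-∀

        bin-small : + k * bigBin ∣≤∣ C
        bin-small = lower , upper
          where
          upper : + k * bigBin ≤ C
          upper = ≤-trans (*-monoˡ {bigBin} {+ A * (+ M * + N * + s)} {+ k} 0≤+ (≤-trans (≤-reflexive (bin-sum (λ i → f (N ℕ.+ i)))) Up.S-≤)) size
          neg-bin : - bigBin ≡ Lo.S
          neg-bin = trans (sym (∑-neg N (λ i → T (N ℕ.+ i)))) (trans (∑-cong′ N λ i → neg-distribˡ-* (f (N ℕ.+ i)) (inner k g (N ℕ.+ i)))
            (bin-sum (λ i → - f (N ℕ.+ i))))
          lower′ : + k * (- bigBin) ≤ C
          lower′ = ≤-trans (*-monoˡ { - bigBin} {+ A * (+ M * + N * + s)} {+ k} 0≤+ (≤-trans (≤-reflexive neg-bin) Lo.S-≤)) size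
          lower : - C ≤ + k * bigBin
          lower = subst (- C ≤_) (trans (cong -_ (sym (neg-distribʳ-* (+ k) bigBin))) (neg-involutive (+ k * bigBin))) (neg-mono-≤ lower′)

    module _ (J : ℕ) (support : ∀ u → f u ≡ 0ℤ ⊎ (z ℕ.≤ u × k ℕ.* u ℕ.* z³ ℕ.≤ Y × u ℕ.< z ℕ.* 2 ℕ.^ J)) where
      private
        T-0 : ∀ u → f u ≡ 0ℤ → T u ≡ 0ℤ
        T-0 u fu≡0 = trans (cong (_* inner k g u) fu≡0) (*-zeroˡ (inner k g u))

        bin : ∀ N → z ℕ.≤ N → + k * ∑[ i < N ] T (N ℕ.+ i) ∣≤∣ C
        bin N z≤N = go (k ℕ.* N ℕ.* z³ ℕ.≤? Y)
          where
          go : Dec (k ℕ.* N ℕ.* z³ ℕ.≤ Y) → + k * ∑[ i < N ] T (N ℕ.+ i) ∣≤∣ C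
          go (yes small) = bin-small N z≤N small
          go (no  large) = subst (_∣≤∣ C) (sym (trans (cong (+ k *_) (∑-zero N λ i _ → T-0 (N ℕ.+ i) (zero′ i))) (*-zeroʳ (+ k))))
            (∣≤∣-of-nonneg ≤-refl 0≤C)
            where
            zero′ : ∀ i → f (N ℕ.+ i) ≡ 0ℤ
            zero′ i with support (N ℕ.+ i)
            ... | inj₁ eq = eq
            ... | inj₂ (_ , small , _) = contradiction (ℕ.≤-trans (ℕ.*-monoˡ-≤ z³ (ℕ.*-monoʳ-≤ k (ℕ.m≤m+n N i))) small) large

        bins : ∀ j → + k * ∑ (z ℕ.* 2 ℕ.^ j) T ∣≤∣ + j * C
        bins zero = subst₂ _∣≤∣_ (sym (trans (cong (+ k *_) (trans (cong (λ n → ∑ n T) (ℕ.*-identityʳ z)) (∑-zero z λ u u<z → T-0 u (zero′ u u<z)))) (*-zeroʳ (+ k))))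
            (sym (*-zeroˡ C)) ∣≤∣-0
          where
          zero′ : ∀ u → u ℕ.< z → f u ≡ 0ℤ
          zero′ u u<z with support u
          ... | inj₁ eq = eq
          ... | inj₂ (z≤u , _) = contradiction z≤u (ℕ.<⇒≱ u<z)
        bins (suc j) = subst₂ _∣≤∣_ (sym eq) (l (+ j) C) (∣≤∣-+ (bins j) (bin N (ℕ.m≤m*n z (2 ℕ.^ j) {{ℕ.m^n≢0 2 j}})))
          where
          N = z ℕ.* 2 ℕ.^ j
          l : ∀ j c → j * c + c ≡ (1ℤ + j) * c
          l = solve-∀
          l₂ : ∀ z e → z ℕ.* (2 ℕ.* e) ≡ z ℕ.* e ℕ.+ z ℕ.* e
          l₂ z e = trans (cong (z ℕ.*_) (cong (e ℕ.+_) (ℕ.+-identityʳ e))) (ℕ.*-distribˡ-+ z e e)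
          eq : + k * ∑ (z ℕ.* 2 ℕ.^ suc j) T ≡ + k * ∑ N T + + k * ∑[ i < N ] T (N ℕ.+ i)
          eq = trans (cong (+ k *_) (trans (cong (λ n → ∑ n T) (l₂ z (2 ℕ.^ j))) (∑-split N N T))) (*-distribˡ-+ (+ k) (∑ N T) (∑[ i < N ] T (N ℕ.+ i)))

        N∞ : ℕ
        N∞ = z ℕ.* 2 ℕ.^ J

        u≤kuz³ : ∀ u → u ℕ.≤ k ℕ.* u ℕ.* z³
        u≤kuz³ u = ℕ.≤-trans (ℕ.m≤n*m u k {{ℕ.>-nonZero 0<k}}) (ℕ.m≤m*n (k ℕ.* u) z³ {{ℕ.>-nonZero 0<z³}})

        same : ∑ (suc Y) T ≡ ∑ N∞ T
        same = trans (sym (∑-extend T (ℕ.m≤m+n (suc Y) N∞) λ u Y<u _ → T-0 u (high u Y<u)))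
                     (∑-extend T (ℕ.m≤n+m N∞ (suc Y)) λ u N∞≤u _ → T-0 u (far u N∞≤u))
          where
          high : ∀ u → Y ℕ.< u → f u ≡ 0ℤ
          high u Y<u with support u
          ... | inj₁ eq = eq
          ... | inj₂ (_ , small , _) = contradiction (ℕ.≤-trans (u≤kuz³ u) small) (ℕ.<⇒≱ Y<u)
          far : ∀ u → N∞ ℕ.≤ u → f u ≡ 0ℤ
          far u N∞≤u with support u
          ... | inj₁ eq = eq
          ... | inj₂ (_ , _ , u<) = contradiction N∞≤u (ℕ.<⇒≱ u<)

      -- Each of the J blocks N = z 2ʲ costs C / k whatever its position, because k M N ≤ Y for M =
      -- ⌊Y / (k N)⌋. A block with k N z³ > Y is empty by the support of f; in the others M ≥ z³, as
      -- the estimate for a block requires.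
      Bil-bound : + k * Bil k f g ∣≤∣ + J * (+ A * (+ Y * + s))
      Bil-bound = subst (λ w → + k * w ∣≤∣ + J * C) (sym same) (bins J)

-- The sieve by primes below z.

module Sieve (z : ℕ) {Good : ℕ → Set} (good? : ∀ p → Dec (Good p))
  (good : ∀ {p} → Good p → Prime p × z ℕ.< p × p ℕ.< 2 ℕ.* z)
  (1<z : 1 ℕ.< z) where

  open import Data.Nat as ℕ using (ℕ; zero; suc)
  open import Data.Nat.Primality using (Prime; prime?; prime⇒nonZero; euclidsLemma; prime⇒irreducible; prime⇒nonTrivial)
  open import Relation.Nullary using (Dec; yes; no; ¬_; contradiction)
  open import Data.Product using (_×_; _,_; proj₁; proj₂)
  import Data.Nat.Properties as ℕ
  import Data.Nat.DivMod as ℕ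
  import Data.Nat.Divisibility as ℕ∣
  open import Data.Integer hiding (suc) renaming (∣_∣ to abs)
  open import Data.Integer.Properties
  open import Data.Integer.Tactic.RingSolver using (solve-∀)
  open import Data.Sum using (_⊎_; inj₁; inj₂)
  open import Relation.Binary.PropositionalEquality
  open FiniteSums
  open Residues
  open PartialSums
  open TypeII z good? good
  open Bilinear z good? good 1<z

  pr : ℕ → ℤ
  pr k = ⟦ prime? k ⟧

  pr-yes : ∀ {k} → Prime k → pr k ≡ 1ℤ
  pr-yes {k} = ⟦⟧-yes (prime? k)

  pr-no : ∀ {k} → ¬ Prime k → pr k ≡ 0ℤ
  pr-no {k} = ⟦⟧-no (prime? k)

  -- μ k is the Möbius function restricted to products of primes below k.
  μ : ℕ → ℕ → ℤ
  μ zero    d = ⟦ d ℕ.≟ 1 ⟧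
  μ (suc k) d = μ k d - pr k * ∑[ e < suc d ] (⟦ e ℕ.* k ℕ.≟ d ⟧ * μ k e)

  -- R j k is the indicator of having no prime factor in [k , k + j).
  R : ℕ → ℕ → ℕ → ℤ
  R zero    k m = 1ℤ
  R (suc j) k m = (1ℤ - pr k * ⟦ k ℕ∣.∣? m ⟧) * R j (suc k) m

  distinct-primes : ∀ {q k} → Prime q → Prime k → q ℕ∣.∣ k → q ≡ k
  distinct-primes pq pk q∣k with prime⇒irreducible pk q∣k
  ... | inj₁ q≡1 = contradiction q≡1 (ℕ.nonTrivial⇒≢1 {{prime⇒nonTrivial pq}})
  ... | inj₂ q≡k = q≡k

  μ-no : ∀ {k} d → ¬ Prime k → μ (suc k) d ≡ μ k d
  μ-no {k} d ¬pk = trans (cong (λ w → μ k d - w * ∑[ e < suc d ] (⟦ e ℕ.* k ℕ.≟ d ⟧ * μ k e)) (pr-no ¬pk)) (l (μ k d) (∑[ e < suc d ] (⟦ e ℕ.* k ℕ.≟ d ⟧ * μ k e)))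
    where
    l : ∀ m x → m - 0ℤ * x ≡ m
    l = solve-∀

  μ-yes : ∀ {k} d → Prime k → μ (suc k) d ≡ μ k d - ∑[ e < suc d ] (⟦ e ℕ.* k ℕ.≟ d ⟧ * μ k e)
  μ-yes {k} d pk = cong (_-_ (μ k d)) (trans (cong (_* x) (pr-yes pk)) (*-identityˡ x))
    where x = ∑[ e < suc d ] (⟦ e ℕ.* k ℕ.≟ d ⟧ * μ k e)

  ⟦⟧*-zero : ∀ {A : Set} (d : Dec A) x → (A → x ≡ 0ℤ) → ⟦ d ⟧ * x ≡ 0ℤ
  ⟦⟧*-zero d x h = go d
    where
    go : Dec _ → ⟦ d ⟧ * x ≡ 0ℤ
    go (yes a) = trans (cong (⟦ d ⟧ *_) (h a)) (*-zeroʳ ⟦ d ⟧)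
    go (no ¬a) = trans (cong (_* x) (⟦⟧-no d ¬a)) (*-zeroˡ x)

  -- Only products of primes below k are ever given a nonzero value: a prime q > k that divides e k
  -- divides e.
  μ-vanish : ∀ k {q} d → Prime q → k ℕ.≤ q → q ℕ∣.∣ d → μ k d ≡ 0ℤ
  μ-vanish zero    d pq _ q∣d = ⟦⟧-no (d ℕ.≟ 1) λ { refl → ℕ.nonTrivial⇒≢1 {{prime⇒nonTrivial pq}} (ℕ∣.∣1⇒≡1 q∣d) }
  μ-vanish (suc k) {q} d pq k<q q∣d = go (prime? k)
    where
    here : μ k d ≡ 0ℤ
    here = μ-vanish k d pq (ℕ.<⇒≤ k<q) q∣d
    go : Dec (Prime k) → μ (suc k) d ≡ 0ℤ
    go (no ¬pk) = trans (μ-no d ¬pk) here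
    go (yes pk) = trans (μ-yes d pk) (cong₂ _-_ here (∑-zero (suc d) λ e _ → ⟦⟧*-zero (e ℕ.* k ℕ.≟ d) (μ k e) (below e)))
      where
      below : ∀ e → e ℕ.* k ≡ d → μ k e ≡ 0ℤ
      below e refl with euclidsLemma e k pq q∣d
      ... | inj₁ q∣e = μ-vanish k e pq (ℕ.<⇒≤ k<q) q∣e
      ... | inj₂ q∣k = contradiction (sym (distinct-primes pq pk q∣k)) (ℕ.<⇒≢ k<q)

  -- The two terms of the recursion never meet: if k ∣ d the old value is 0 by `μ-vanish` and
  -- exactly one e contributes, and otherwise the new sum is empty.
  ∣μ∣≤1 : ∀ k d → μ k d ∣≤∣ 1ℤ
  ∣μ∣≤1 zero    d = ∣≤∣-of-nonneg (0≤⟦⟧ (d ℕ.≟ 1)) (⟦⟧≤1 (d ℕ.≟ 1))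
  ∣μ∣≤1 (suc k) d = go (prime? k)
    where
    go : Dec (Prime k) → μ (suc k) d ∣≤∣ 1ℤ
    go (no ¬pk) = subst (_∣≤∣ 1ℤ) (sym (μ-no d ¬pk)) (∣μ∣≤1 k d)
    go (yes pk) = go′ (k ℕ∣.∣? d)
      where
      X = ∑[ e < suc d ] (⟦ e ℕ.* k ℕ.≟ d ⟧ * μ k e)
      instance _ = prime⇒nonZero pk
      go′ : Dec (k ℕ∣.∣ d) → μ (suc k) d ∣≤∣ 1ℤ
      go′ (no k∤d) = subst (_∣≤∣ 1ℤ) (sym (trans (μ-yes d pk) (trans (cong (_-_ (μ k d)) X≡0) (+-identityʳ (μ k d))))) (∣μ∣≤1 k d)
        where
        X≡0 : X ≡ 0ℤ
        X≡0 = ∑-zero (suc d) λ e _ → ⟦⟧*-zero (e ℕ.* k ℕ.≟ d) (μ k e) λ ek≡d → contradiction (ℕ∣.divides e (sym ek≡d)) k∤d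
      go′ (yes (ℕ∣.divides e₀ d≡e₀k)) = subst (_∣≤∣ 1ℤ) (sym (trans (μ-yes d pk) (trans (cong₂ _-_ (μ-vanish k d pk ℕ.≤-refl (ℕ∣.divides e₀ d≡e₀k)) X≡) (+-identityˡ (- μ k e₀)))))
          (∣≤∣-neg (∣μ∣≤1 k e₀))
        where
        e₀≤d : e₀ ℕ.≤ d
        e₀≤d = ℕ.≤-trans (ℕ.m≤m*n e₀ k) (ℕ.≤-reflexive (sym d≡e₀k))
        X≡ : X ≡ μ k e₀
        X≡ = trans (∑-single (suc d) e₀ (λ e → ⟦ e ℕ.* k ℕ.≟ d ⟧ * μ k e) (ℕ.s≤s e₀≤d)
            λ e _ e≢e₀ → ⟦⟧*-zero (e ℕ.* k ℕ.≟ d) (μ k e) λ ek≡d → contradiction (ℕ.*-cancelʳ-≡ e e₀ k (trans ek≡d d≡e₀k)) e≢e₀)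
          (trans (cong (_* μ k e₀) (⟦⟧-yes (e₀ ℕ.* k ℕ.≟ d) (sym d≡e₀k))) (*-identityˡ (μ k e₀)))

  R-no : ∀ {k} j m → ¬ Prime k → R (suc j) k m ≡ R j (suc k) m
  R-no {k} j m ¬pk = trans (cong (λ w → (1ℤ - w * ⟦ k ℕ∣.∣? m ⟧) * R j (suc k) m) (pr-no ¬pk)) (l ⟦ k ℕ∣.∣? m ⟧ (R j (suc k) m))
    where
    l : ∀ d r → (1ℤ - 0ℤ * d) * r ≡ r
    l = solve-∀

  R-yes : ∀ {k} j m → Prime k → R (suc j) k m ≡ R j (suc k) m - ⟦ k ℕ∣.∣? m ⟧ * R j (suc k) m
  R-yes {k} j m pk = trans (cong (λ w → (1ℤ - w * ⟦ k ℕ∣.∣? m ⟧) * R j (suc k) m) (pr-yes pk)) (l ⟦ k ℕ∣.∣? m ⟧ (R j (suc k) m))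
    where
    l : ∀ d r → (1ℤ - 1ℤ * d) * r ≡ r - d * r
    l = solve-∀

  ⟦⟧-cases : ∀ {A : Set} (d : Dec A) → ⟦ d ⟧ ≡ 0ℤ ⊎ ⟦ d ⟧ ≡ 1ℤ
  ⟦⟧-cases d = go d
    where
    go : Dec _ → ⟦ d ⟧ ≡ 0ℤ ⊎ ⟦ d ⟧ ≡ 1ℤ
    go (yes a) = inj₂ (⟦⟧-yes d a)
    go (no ¬a) = inj₁ (⟦⟧-no d ¬a)

  R-cases : ∀ j k m → R j k m ≡ 0ℤ ⊎ R j k m ≡ 1ℤ
  R-cases zero    k m = inj₂ refl
  R-cases (suc j) k m with ⟦⟧-cases (prime? k) | ⟦⟧-cases (k ℕ∣.∣? m) | R-cases j (suc k) m
  ... | a | b | c = go a b c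
    where
    go : pr k ≡ 0ℤ ⊎ pr k ≡ 1ℤ → ⟦ k ℕ∣.∣? m ⟧ ≡ 0ℤ ⊎ ⟦ k ℕ∣.∣? m ⟧ ≡ 1ℤ → R j (suc k) m ≡ 0ℤ ⊎ R j (suc k) m ≡ 1ℤ →
         R (suc j) k m ≡ 0ℤ ⊎ R (suc j) k m ≡ 1ℤ
    go _        _        (inj₁ e) = inj₁ (trans (cong ((1ℤ - pr k * ⟦ k ℕ∣.∣? m ⟧) *_) e) (*-zeroʳ (1ℤ - pr k * ⟦ k ℕ∣.∣? m ⟧)))
    go (inj₁ p) _        (inj₂ e) = inj₂ (trans (cong₂ (λ a b → (1ℤ - a * ⟦ k ℕ∣.∣? m ⟧) * b) p e) (cong (λ w → (1ℤ - w) * 1ℤ) (*-zeroˡ ⟦ k ℕ∣.∣? m ⟧)))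
    go (inj₂ p) (inj₁ d) (inj₂ e) = inj₂ (cong₂ _*_ (cong₂ (λ a b → 1ℤ - a * b) p d) e)
    go (inj₂ p) (inj₂ d) (inj₂ e) = inj₁ (cong₂ _*_ (cong₂ (λ a b → 1ℤ - a * b) p d) e)

  0≤R : ∀ j k m → 0ℤ ≤ R j k m
  0≤R j k m with R-cases j k m
  ... | inj₁ e = ≤-reflexive (sym e)
  ... | inj₂ e = ≤-trans 0≤1 (≤-reflexive (sym e))

  R≤1 : ∀ j k m → R j k m ≤ 1ℤ
  R≤1 j k m with R-cases j k m
  ... | inj₁ e = ≤-trans (≤-reflexive e) 0≤1
  ... | inj₂ e = ≤-reflexive e

  ∣R∣≤1 : ∀ j k m → R j k m ∣≤∣ 1ℤ
  ∣R∣≤1 j k m = ∣≤∣-of-nonneg (0≤R j k m) (R≤1 j k m)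

  R-* : ∀ j l {k} m → Prime k → k ℕ.< l → R j l (k ℕ.* m) ≡ R j l m
  R-* zero    l m pk k<l = refl
  R-* (suc j) l {k} m pk k<l = go (prime? l)
    where
    rest : R j (suc l) (k ℕ.* m) ≡ R j (suc l) m
    rest = R-* j (suc l) m pk (ℕ.m<n⇒m<1+n k<l)
    go : Dec (Prime l) → R (suc j) l (k ℕ.* m) ≡ R (suc j) l m
    go (no ¬pl) = trans (R-no j (k ℕ.* m) ¬pl) (trans rest (sym (R-no j m ¬pl)))
    go (yes pl) = cong₂ (λ a b → (1ℤ - pr l * a) * b) (⟦⟧-cong (l ℕ∣.∣? (k ℕ.* m)) (l ℕ∣.∣? m) down (ℕ∣.∣n⇒∣m*n k)) rest
      where
      down : l ℕ∣.∣ k ℕ.* m → l ℕ∣.∣ m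
      down l∣km with euclidsLemma k m pl l∣km
      ... | inj₁ l∣k = contradiction (sym (distinct-primes pl pk l∣k)) (ℕ.<⇒≢ k<l)
      ... | inj₂ l∣m = l∣m

  -- The substitution m = k m′. The range may stay the same on both sides because F vanishes beyond
  -- it.
  ∑-multiples : ∀ k .{{_ : ℕ.NonZero k}} n (F : ℕ → ℤ) → (∀ m → n ℕ.≤ m → F m ≡ 0ℤ) →
                ∑[ m < n ] (⟦ k ℕ∣.∣? m ⟧ * F m) ≡ ∑[ m < n ] F (k ℕ.* m)
  ∑-multiples k n F F-0 = begin
    ∑[ m < n ] (⟦ k ℕ∣.∣? m ⟧ * F m)                          ≡⟨ ∑-cong n (λ m m<n → sym (left m m<n)) ⟩
    ∑[ m < n ] ∑[ m′ < n ] (⟦ k ℕ.* m′ ℕ.≟ m ⟧ * F m)         ≡⟨ ∑-swap n n (λ m m′ → ⟦ k ℕ.* m′ ℕ.≟ m ⟧ * F m) ⟩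
    ∑[ m′ < n ] ∑[ m < n ] (⟦ k ℕ.* m′ ℕ.≟ m ⟧ * F m)         ≡⟨ ∑-cong′ n right ⟩
    ∑[ m < n ] F (k ℕ.* m)                                     ∎
    where
    open ≡-Reasoning
    left : ∀ m → m ℕ.< n → ∑[ m′ < n ] (⟦ k ℕ.* m′ ℕ.≟ m ⟧ * F m) ≡ ⟦ k ℕ∣.∣? m ⟧ * F m
    left m m<n = go (k ℕ∣.∣? m)
      where
      go : Dec (k ℕ∣.∣ m) → ∑[ m′ < n ] (⟦ k ℕ.* m′ ℕ.≟ m ⟧ * F m) ≡ ⟦ k ℕ∣.∣? m ⟧ * F m
      go (no k∤m) = trans (∑-zero n λ m′ _ → ⟦⟧*-zero (k ℕ.* m′ ℕ.≟ m) (F m) λ e → contradiction (ℕ∣.divides m′ (trans (sym e) (ℕ.*-comm k m′))) k∤m)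
        (sym (trans (cong (_* F m) (⟦⟧-no (k ℕ∣.∣? m) k∤m)) (*-zeroˡ (F m))))
      go (yes k∣m@(ℕ∣.divides m₀ m≡m₀k)) = trans (∑-single n m₀ (λ m′ → ⟦ k ℕ.* m′ ℕ.≟ m ⟧ * F m)
          (ℕ.≤-<-trans (ℕ.≤-trans (ℕ.m≤m*n m₀ k) (ℕ.≤-reflexive (sym m≡m₀k))) m<n)
          λ m′ _ m′≢m₀ → ⟦⟧*-zero (k ℕ.* m′ ℕ.≟ m) (F m) λ e → contradiction (ℕ.*-cancelˡ-≡ m′ m₀ k (trans e (trans m≡m₀k (ℕ.*-comm m₀ k)))) m′≢m₀)
        (cong (_* F m) (trans (⟦⟧-yes (k ℕ.* m₀ ℕ.≟ m) (trans (ℕ.*-comm k m₀) (sym m≡m₀k))) (sym (⟦⟧-yes (k ℕ∣.∣? m) k∣m))))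
    right : ∀ m′ → ∑[ m < n ] (⟦ k ℕ.* m′ ℕ.≟ m ⟧ * F m) ≡ F (k ℕ.* m′)
    right m′ = go (k ℕ.* m′ ℕ.<? n)
      where
      go : Dec (k ℕ.* m′ ℕ.< n) → ∑[ m < n ] (⟦ k ℕ.* m′ ℕ.≟ m ⟧ * F m) ≡ F (k ℕ.* m′)
      go (yes small) = trans (∑-single n (k ℕ.* m′) (λ m → ⟦ k ℕ.* m′ ℕ.≟ m ⟧ * F m) small
          λ m _ m≢ → ⟦⟧*-zero (k ℕ.* m′ ℕ.≟ m) (F m) λ e → contradiction (sym e) m≢)
        (trans (cong (_* F (k ℕ.* m′)) (⟦⟧-yes (k ℕ.* m′ ℕ.≟ k ℕ.* m′) refl)) (*-identityˡ (F (k ℕ.* m′))))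
      go (no large) = trans (∑-zero n λ m m<n → ⟦⟧*-zero (k ℕ.* m′ ℕ.≟ m) (F m) λ { refl → contradiction m<n large })
        (sym (F-0 (k ℕ.* m′) (ℕ.≮⇒≥ large)))

  L : ℕ
  L = z ℕ.* z

  L≤z³ : L ℕ.≤ z³
  L≤z³ = ℕ.m≤m*n L z {{ℕ.>-nonZero 0<z}}

  L≤Y : L ℕ.≤ Y
  L≤Y = ℕ.≤-trans L≤z³ (ℕ.m≤m*n z³ z³ {{ℕ.>-nonZero 0<z³}})

  low : ℕ → ℤ
  low d = ⟦ d ℕ.≤? L ⟧

  -- The sum of W over n = d m with d ≤ L, weighted by μ k d and the condition that m
  -- has no prime factor in [k , k + j).
  Zsum : ℕ → ℕ → ℤ
  Zsum j k = Bil 1 (λ d → low d * μ k d) (R j k)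

  -- Buchstab's step: the m divisible by k are subtracted, written as k m′. The cofactor m′ inherits
  -- only the condition on primes beyond k and may be divisible by k again.
  inner-step : ∀ j {k} d → Prime k → inner 1 (R (suc j) k) d ≡ inner 1 (R j (suc k)) d - inner k (R j (suc k)) d
  inner-step j {k} d pk = begin
    ∑[ m < suc Y ] (R (suc j) k m * w m)                       ≡⟨ ∑-cong′ (suc Y) (λ m → trans (cong (_* w m) (R-yes j m pk)) (l (r m) ⟦ k ℕ∣.∣? m ⟧ (w m))) ⟩
    ∑[ m < suc Y ] (r m * w m - ⟦ k ℕ∣.∣? m ⟧ * (r m * w m))   ≡⟨ ∑-- (suc Y) (λ m → r m * w m) (λ m → ⟦ k ℕ∣.∣? m ⟧ * (r m * w m)) ⟩
    ∑[ m < suc Y ] (r m * w m) - ∑[ m < suc Y ] (⟦ k ℕ∣.∣? m ⟧ * (r m * w m))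
      ≡⟨ cong (_-_ (∑[ m < suc Y ] (r m * w m))) (trans (∑-multiples k (suc Y) (λ m → r m * w m) vanish)
           (∑-cong′ (suc Y) λ m → cong₂ _*_ (R-* j (suc k) m pk (ℕ.n<1+n k)) (cong W (rearrange d k m)))) ⟩
    ∑[ m < suc Y ] (r m * w m) - ∑[ m < suc Y ] (r m * W (k ℕ.* d ℕ.* m))  ∎
    where
    open ≡-Reasoning
    instance _ = prime⇒nonZero pk
    r w : ℕ → ℤ
    r m = R j (suc k) m
    w m = W (1 ℕ.* d ℕ.* m)
    l : ∀ r d w → (r - d * r) * w ≡ r * w - d * (r * w)
    l = solve-∀
    rearrange : ∀ d k m → 1 ℕ.* d ℕ.* (k ℕ.* m) ≡ k ℕ.* d ℕ.* m
    rearrange d k m = trans (cong (ℕ._* (k ℕ.* m)) (ℕ.*-identityˡ d)) (trans (sym (ℕ.*-assoc d k m)) (cong (ℕ._* m) (ℕ.*-comm d k)))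
    w-vanish : ∀ d m → suc Y ℕ.≤ m → W (1 ℕ.* d ℕ.* m) ≡ 0ℤ
    w-vanish zero    m _   = W-0
    w-vanish (suc d) m Y<m = W-big (1 ℕ.* suc d ℕ.* m) (ℕ.≤-trans (ℕ.<⇒≤ Y<m) (ℕ.m≤n*m m (1 ℕ.* suc d)))
    vanish : ∀ m → suc Y ℕ.≤ m → r m * w m ≡ 0ℤ
    vanish m Y<m = trans (cong (r m *_) (w-vanish d m Y<m)) (*-zeroʳ (r m))

  -- Dividing out k moves d ≤ L to d k ≤ L.
  band : ℕ → ℕ → ℤ
  band k e = (low e - low (e ℕ.* k)) * μ k e

  -- Moving the prime k from the condition on m into the divisor d would change nothing if d were
  -- unrestricted. With d ≤ L the terms fail to cancel only where e ≤ L < e k, and these form a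
  -- bilinear sum.
  Zsum-prime : ∀ j {k} → Prime k → Zsum (suc j) k - Zsum j (suc k) ≡ - Bil k (band k) (R j (suc k))
  Zsum-prime j {k} pk = begin
    Zsum (suc j) k - Zsum j (suc k)
      ≡⟨ cong₂ _-_ first second ⟩
    (X - ∑[ d < n ] (low d * μ k d * Iₖ d)) - (X - ∑[ e < n ] (low (e ℕ.* k) * μ k e * Iₖ e))
      ≡⟨ l₃ X (∑[ d < n ] (low d * μ k d * Iₖ d)) (∑[ e < n ] (low (e ℕ.* k) * μ k e * Iₖ e)) ⟩
    - (∑[ d < n ] (low d * μ k d * Iₖ d) - ∑[ e < n ] (low (e ℕ.* k) * μ k e * Iₖ e))
      ≡⟨ cong -_ (trans (sym (∑-- n (λ d → low d * μ k d * Iₖ d) (λ e → low (e ℕ.* k) * μ k e * Iₖ e)))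
           (∑-cong′ n λ e → l₄ (low e) (low (e ℕ.* k)) (μ k e) (Iₖ e))) ⟩
    - Bil k (band k) (R j (suc k)) ∎
    where
    open ≡-Reasoning
    instance _ = prime⇒nonZero pk
    n = suc Y
    I Iₖ : ℕ → ℤ
    I = inner 1 (R j (suc k))
    Iₖ = inner k (R j (suc k))
    X = ∑[ d < n ] (low d * μ k d * I d)
    l₁ : ∀ a x y → a * (x - y) ≡ a * x - a * y
    l₁ = solve-∀
    l₂ : ∀ a x y i → a * (x - y) * i ≡ a * x * i - a * i * y
    l₂ = solve-∀
    l₃ : ∀ x a b → (x - a) - (x - b) ≡ - (a - b)
    l₃ = solve-∀
    l₄ : ∀ a b m i → a * m * i - b * m * i ≡ (a - b) * m * i
    l₄ = solve-∀
    l₅ : ∀ a e m i → a * i * (e * m) ≡ e * (a * m * i)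
    l₅ = solve-∀
    first : Zsum (suc j) k ≡ X - ∑[ d < n ] (low d * μ k d * Iₖ d)
    first = trans (∑-cong′ n λ d → trans (cong (low d * μ k d *_) (inner-step j d pk)) (l₁ (low d * μ k d) (I d) (Iₖ d)))
      (∑-- n (λ d → low d * μ k d * I d) (λ d → low d * μ k d * Iₖ d))
    I-* : ∀ e → I (e ℕ.* k) ≡ Iₖ e
    I-* e = ∑-cong′ n λ m → cong (λ x → R j (suc k) m * W (x ℕ.* m)) (trans (ℕ.*-identityˡ (e ℕ.* k)) (ℕ.*-comm e k))
    widen : ∀ d → d ℕ.< n → ∑[ e < suc d ] (⟦ e ℕ.* k ℕ.≟ d ⟧ * μ k e) ≡ ∑[ e < n ] (⟦ e ℕ.* k ℕ.≟ d ⟧ * μ k e)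
    widen d d<n = sym (∑-extend (λ e → ⟦ e ℕ.* k ℕ.≟ d ⟧ * μ k e) d<n λ e d<e _ →
      ⟦⟧*-zero (e ℕ.* k ℕ.≟ d) (μ k e) λ ek≡d → contradiction (ℕ.≤-trans (ℕ.m≤m*n e k) (ℕ.≤-reflexive ek≡d)) (ℕ.<⇒≱ d<e))
    term : ℕ → ℕ → ℤ
    term d e = ⟦ e ℕ.* k ℕ.≟ d ⟧ * (low d * μ k e * I d)
    column : ∀ e → ∑[ d < n ] term d e ≡ low (e ℕ.* k) * μ k e * Iₖ e
    column e = go (e ℕ.* k ℕ.<? n)
      where
      go : Dec (e ℕ.* k ℕ.< n) → ∑[ d < n ] term d e ≡ low (e ℕ.* k) * μ k e * Iₖ e
      go (yes small) = trans (∑-single n (e ℕ.* k) (λ d → term d e) small λ d _ d≢ →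
          ⟦⟧*-zero (e ℕ.* k ℕ.≟ d) (low d * μ k e * I d) λ eq → contradiction (sym eq) d≢)
        (trans (cong (_* (low (e ℕ.* k) * μ k e * I (e ℕ.* k))) (⟦⟧-yes (e ℕ.* k ℕ.≟ e ℕ.* k) refl))
          (trans (*-identityˡ (low (e ℕ.* k) * μ k e * I (e ℕ.* k))) (cong (low (e ℕ.* k) * μ k e *_) (I-* e))))
      go (no large) = trans (∑-zero n λ d d<n → ⟦⟧*-zero (e ℕ.* k ℕ.≟ d) (low d * μ k e * I d) λ { refl → contradiction d<n large })
        (sym (trans (cong (λ w → w * μ k e * Iₖ e) (⟦⟧-no (e ℕ.* k ℕ.≤? L) λ ek≤L → large (ℕ.s≤s (ℕ.≤-trans ek≤L L≤Y)))) (l₆ (μ k e) (Iₖ e))))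
        where
        l₆ : ∀ m i → 0ℤ * m * i ≡ 0ℤ
        l₆ = solve-∀
    second : Zsum j (suc k) ≡ X - ∑[ e < n ] (low (e ℕ.* k) * μ k e * Iₖ e)
    second = trans (∑-cong n λ d d<n → trans (cong (λ w → low d * w * I d) (trans (μ-yes d pk) (cong (_-_ (μ k d)) (widen d d<n))))
        (l₂ (low d) (μ k d) (∑[ e < n ] (⟦ e ℕ.* k ℕ.≟ d ⟧ * μ k e)) (I d)))
      (trans (∑-- n (λ d → low d * μ k d * I d) (λ d → low d * I d * ∑[ e < n ] (⟦ e ℕ.* k ℕ.≟ d ⟧ * μ k e)))
        (cong (_-_ X) (trans (∑-cong′ n λ d → trans (sym (∑-*ˡ n (low d * I d) (λ e → ⟦ e ℕ.* k ℕ.≟ d ⟧ * μ k e)))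
            (∑-cong′ n λ e → l₅ (low d) ⟦ e ℕ.* k ℕ.≟ d ⟧ (μ k e) (I d)))
          (trans (∑-swap n n term) (∑-cong′ n column)))))

  Zsum-composite : ∀ j {k} → ¬ Prime k → Zsum (suc j) k ≡ Zsum j (suc k)
  Zsum-composite j {k} ¬pk = ∑-cong′ (suc Y) λ d → cong₂ _*_ (cong (low d *_) (sym (μ-no d ¬pk)))
    (∑-cong′ (suc Y) λ m → cong (_* W (1 ℕ.* d ℕ.* m)) (R-no j m ¬pk))

  quotient-bound : ∀ k C x → + suc k * x ∣≤∣ + C → x ∣≤∣ + (C ℕ./ suc k)
  quotient-bound k C x (l , u) = lower , upper x u
    where
    upper : ∀ x → + suc k * x ≤ + C → x ≤ + (C ℕ./ suc k)
    upper (+ n) h = +≤+ (subst (ℕ._≤ C ℕ./ suc k) (ℕ.m*n/n≡m n (suc k))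
      (ℕ./-monoˡ-≤ (suc k) (subst (ℕ._≤ C) (ℕ.*-comm (suc k) n) (drop‿+≤+ (≤-trans (≤-reflexive (pos-* (suc k) n)) h)))))
    upper -[1+ n ] _ = -≤+
    lower : - + (C ℕ./ suc k) ≤ x
    lower = subst (- + (C ℕ./ suc k) ≤_) (neg-involutive x) (neg-mono-≤ (upper (- x)
      (subst₂ _≤_ (neg-distribʳ-* (+ suc k) x) (neg-involutive (+ C)) (neg-mono-≤ l))))

  share : ℕ → ℕ → ℤ
  share C zero    = 0ℤ
  share C (suc k) = + (C ℕ./ suc k)

  0≤share : ∀ C k → 0ℤ ≤ share C k
  0≤share C zero    = ≤-refl
  0≤share C (suc k) = 0≤+

  share-* : ∀ C n k → n ℕ.≤ k → + n * share C k ≤ + C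
  share-* C n zero    _   = ≤-trans (≤-reflexive (*-zeroʳ (+ n))) 0≤+
  share-* C n (suc k) n≤k = ≤-trans (≤-reflexive (sym (pos-* n (C ℕ./ suc k))))
    (+≤+ (ℕ.≤-trans (ℕ.*-monoˡ-≤ (C ℕ./ suc k) n≤k) (ℕ.≤-trans (ℕ.≤-reflexive (ℕ.*-comm (suc k) (C ℕ./ suc k))) (ℕ.m/n*n≤m C (suc k)))))

  -- The harmonic sum by dyadic blocks: the N terms from N to 2 N - 1 are each at most C / N. A cost
  -- C / k for every prime k therefore adds up to a factor i only.
  ∑-share : ∀ C i → ∑ (2 ℕ.^ i) (share C) ≤ + i * + C
  ∑-share C zero    = ≤-reflexive (sym (*-zeroˡ (+ C)))
  ∑-share C (suc i) = begin
    ∑ (2 ℕ.* N) (share C)                            ≡⟨ trans (cong (λ n → ∑ (N ℕ.+ n) (share C)) (ℕ.+-identityʳ N)) (∑-split N N (share C)) ⟩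
    ∑ N (share C) + ∑[ u < N ] share C (N ℕ.+ u)     ≤⟨ +-mono-≤ (∑-share C i) block ⟩
    + i * + C + + C                                  ≡⟨ l (+ i) (+ C) ⟩
    + suc i * + C                                    ∎
    where
    open ≤-Reasoning
    N = 2 ℕ.^ i
    l : ∀ i c → i * c + c ≡ (1ℤ + i) * c
    l = solve-∀
    shrink : ∀ m n → 0 ℕ.< m → m ℕ.≤ n → share C n ≤ share C m
    shrink (suc m) (suc n) _ m≤n = +≤+ (ℕ./-monoʳ-≤ C m≤n)
    block : ∑[ u < N ] share C (N ℕ.+ u) ≤ + C
    block = ≤-trans (∑-mono N λ u _ → shrink N (N ℕ.+ u) (ℕ.>-nonZero⁻¹ N {{ℕ.m^n≢0 2 i}}) (ℕ.m≤m+n N u))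
      (≤-trans (≤-reflexive (∑-const N (share C N))) (share-* C N N ℕ.≤-refl))

  ρ : ℕ → ℤ
  ρ = R z 0

  module _ (s h : ℕ) (0<s : 0 ℕ.< s) (s-big : + 27 * P ≤ + s * + s) (z<2^h : z ℕ.< 2 ℕ.^ h) where

    C : ℕ
    C = h ℕ.* (Y ℕ.* s)

    private
      +C : + C ≡ + h * (1ℤ * (+ Y * + s))
      +C = trans (pos-* h (Y ℕ.* s)) (cong (+ h *_) (trans (pos-* Y s) (sym (*-identityˡ (+ Y * + s)))))

      low-mono : ∀ e {k} → 0 ℕ.< k → ¬ (e ℕ.≤ L) → ¬ (e ℕ.* k ℕ.≤ L)
      low-mono e {k} 0<k e≰L ek≤L = e≰L (ℕ.≤-trans (ℕ.m≤m*n e k {{ℕ.>-nonZero 0<k}}) ek≤L)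

      ∣band∣≤1 : ∀ {k} → 0 ℕ.< k → ∀ e → band k e ∣≤∣ 1ℤ
      ∣band∣≤1 {k} 0<k e = subst (band k e ∣≤∣_) (*-identityˡ 1ℤ) (∣≤∣-* {low e - low (e ℕ.* k)} {μ k e} {1ℤ} {1ℤ}
        (difference (0≤⟦⟧ (e ℕ.≤? L)) (⟦⟧≤1 (e ℕ.≤? L)) (0≤⟦⟧ (e ℕ.* k ℕ.≤? L)) (⟦⟧≤1 (e ℕ.* k ℕ.≤? L))) (∣μ∣≤1 k e))
        where
        difference : ∀ {a b} → 0ℤ ≤ a → a ≤ 1ℤ → 0ℤ ≤ b → b ≤ 1ℤ → a - b ∣≤∣ 1ℤ
        difference {a} {b} 0≤a a≤1 0≤b b≤1 = ≤-by (a + (1ℤ - b)) (0≤-+ 0≤a (≤⇒0≤- b≤1)) (l₁ a b) , ≤-by (1ℤ - a + b) (0≤-+ (≤⇒0≤- a≤1) 0≤b) (l₂ a b)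
          where
          l₁ : ∀ a b → a - b ≡ - 1ℤ + (a + (1ℤ - b))
          l₁ = solve-∀
          l₂ : ∀ a b → 1ℤ ≡ a - b + (1ℤ - a + b)
          l₂ = solve-∀

      -- This determines L = z²: from e ≤ z² < e k and k < z follow z ≤ e and k e ≤ z³, so both
      -- variables are long enough for `Bil-bound`. As e ≤ z² < z 2ʰ, there are h dyadic blocks.
      band-support : ∀ {k} → 0 ℕ.< k → k ℕ.< z → ∀ e →
                     band k e ≡ 0ℤ ⊎ (z ℕ.≤ e × k ℕ.* e ℕ.* z³ ℕ.≤ Y × e ℕ.< z ℕ.* 2 ℕ.^ h)
      band-support {k} 0<k k<z e = go (e ℕ.≤? L) (e ℕ.* k ℕ.≤? L)
        where
        l₁ : ∀ m → (1ℤ - 1ℤ) * m ≡ 0ℤ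
        l₁ = solve-∀
        go : Dec (e ℕ.≤ L) → Dec (e ℕ.* k ℕ.≤ L) → band k e ≡ 0ℤ ⊎ (z ℕ.≤ e × k ℕ.* e ℕ.* z³ ℕ.≤ Y × e ℕ.< z ℕ.* 2 ℕ.^ h)
        go (yes a) (yes b) = inj₁ (trans (cong₂ (λ x y → (x - y) * μ k e) (⟦⟧-yes (e ℕ.≤? L) a) (⟦⟧-yes (e ℕ.* k ℕ.≤? L) b)) (l₁ (μ k e)))
        go (no a)  _       = inj₁ (cong₂ (λ x y → (x - y) * μ k e) (⟦⟧-no (e ℕ.≤? L) a) (⟦⟧-no (e ℕ.* k ℕ.≤? L) (low-mono e 0<k a)))
        go (yes a) (no b)  = inj₂ (z≤e , ℕ.*-monoˡ-≤ z³ ke≤z³ , ℕ.≤-<-trans a (ℕ.*-monoʳ-< z {{ℕ.>-nonZero 0<z}} z<2^h))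
          where
          z≤e : z ℕ.≤ e
          z≤e = ℕ.≮⇒≥ λ e<z → b (ℕ.*-mono-≤ (ℕ.<⇒≤ e<z) (ℕ.<⇒≤ k<z))
          ke≤z³ : k ℕ.* e ℕ.≤ z³
          ke≤z³ = ℕ.≤-trans (ℕ.*-mono-≤ (ℕ.<⇒≤ k<z) a) (ℕ.≤-reflexive (ℕ.*-comm z L))

      step : ∀ j k → k ℕ.< z → Zsum (suc j) k - Zsum j (suc k) ∣≤∣ share C k
      step j k k<z = go (prime? k)
        where
        go : Dec (Prime k) → Zsum (suc j) k - Zsum j (suc k) ∣≤∣ share C k
        go (no ¬pk) = subst (_∣≤∣ share C k) (sym (trans (cong (_- Zsum j (suc k)) (Zsum-composite j ¬pk)) (+-inverseʳ (Zsum j (suc k)))))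
          (∣≤∣-of-nonneg ≤-refl (0≤share C k))
        go (yes pk) = subst (_∣≤∣ share C k) (sym (Zsum-prime j pk)) (∣≤∣-neg (quotient k (0<prime pk)
            (Bil-bound s 0<s s-big k 1 (0<prime pk) (ℕ.s≤s ℕ.z≤n) (band k) (R j (suc k)) (∣band∣≤1 (0<prime pk)) (∣R∣≤1 j (suc k)) h (band-support (0<prime pk) k<z))))
          where
          quotient : ∀ k {x} → 0 ℕ.< k → + k * x ∣≤∣ + h * (1ℤ * (+ Y * + s)) → x ∣≤∣ share C k
          quotient (suc k) {x} _ b = quotient-bound k C x (subst (+ suc k * x ∣≤∣_) (sym +C) b)

      telescope : ∀ i j k → i ℕ.+ k ℕ.≤ z → Zsum (i ℕ.+ j) k - Zsum j (i ℕ.+ k) ∣≤∣ ∑[ t < i ] share C (t ℕ.+ k)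
      telescope zero    j k _ = subst (_∣≤∣ 0ℤ) (sym (+-inverseʳ (Zsum j k))) ∣≤∣-0
      telescope (suc i) j k i+k<z = subst (_∣≤∣ (∑[ t < i ] share C (t ℕ.+ k) + share C (i ℕ.+ k))) (l (Zsum (suc i ℕ.+ j) k) (Zsum (suc j) (i ℕ.+ k)) (Zsum j (suc (i ℕ.+ k))))
          (∣≤∣-+ first (step j (i ℕ.+ k) i+k<z))
        where
        l : ∀ a b c → a - b + (b - c) ≡ a - c
        l = solve-∀
        first : Zsum (suc i ℕ.+ j) k - Zsum (suc j) (i ℕ.+ k) ∣≤∣ ∑[ t < i ] share C (t ℕ.+ k)
        first = subst (λ n → Zsum n k - Zsum (suc j) (i ℕ.+ k) ∣≤∣ ∑[ t < i ] share C (t ℕ.+ k)) (ℕ.+-suc i j) (telescope i (suc j) k (ℕ.<⇒≤ i+k<z))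

      -- One prime k costs C / k, and summing over all k < z < 2ʰ costs another factor h.
      sieve-loss : Zsum z 0 - Zsum 0 z ∣≤∣ + h * + C
      sieve-loss = subst₂ (λ a b → Zsum a 0 - Zsum 0 b ∣≤∣ + h * + C) (ℕ.+-identityʳ z) (ℕ.+-identityʳ z)
        (∣≤∣-mono (≤-trans (≤-reflexive (∑-cong′ z λ t → cong (share C) (ℕ.+-identityʳ t)))
            (≤-trans (∑-≤-extend (share C) (ℕ.<⇒≤ z<2^h) (0≤share C)) (∑-share C h)))
          (telescope z 0 0 (ℕ.≤-reflexive (ℕ.+-identityʳ z))))

      Dₚ : ℤ
      Dₚ = P * (+ (2 ℕ.* z) * + 2)

      ∑G-bound : ∀ c n → ∑[ m < n ] G (pt c m) ∣≤∣ Dₚ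
      ∑G-bound c n = subst₂ _∣≤∣_ (sym expand) (∑-*ʳ (2 ℕ.* z) (+ (2 ℕ.* z) * + 2) π)
          (∑-∣≤∣ (2 ℕ.* z) λ p _ → π-scale p (∑[ m < n ] H p (pt c m)) (+ (2 ℕ.* z) * + 2) λ g →
            ∣≤∣-mono (*-monoʳ {+ p} {+ (2 ℕ.* z)} {+ 2} 0≤+ (+≤+ (ℕ.<⇒≤ (proj₂ (proj₂ (good g)))))) (H-partial (proj₁ (good g)) c n))
        where
        expand : ∑[ m < n ] G (pt c m) ≡ ∑[ p < 2 ℕ.* z ] (π p * ∑[ m < n ] H p (pt c m))
        expand = trans (∑-cong′ n λ m → G-def (pt c m)) (trans (∑-swap n (2 ℕ.* z) (λ m p → π p * H p (pt c m)))
          (∑-cong′ (2 ℕ.* z) λ p → ∑-*ˡ n (π p) (λ m → H p (pt c m))))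

      inner-1 : ∀ d → inner 1 (R 0 z) d ∣≤∣ Dₚ
      inner-1 d = subst (_∣≤∣ Dₚ) (sym eq) (∑G-bound (+ d) n)
        where
        x : ℕ → ℕ
        x m = 1 ℕ.* d ℕ.* suc m
        init = ∑-initial {Q = λ m → x m ℕ.< Y} (λ m → x m ℕ.<? Y) (λ m → ℕ.≤-<-trans (ℕ.*-monoʳ-≤ (1 ℕ.* d) (ℕ.n≤1+n (suc m)))) Y
        n = proj₁ init
        x-pt : ∀ m → + x m ≡ pt (+ d) m
        x-pt m = trans (cong (λ e → + (e ℕ.* suc m)) (ℕ.*-identityˡ d)) (trans (pos-* d (suc m)) (pt-suc (+ d) m))
        eq : inner 1 (R 0 z) d ≡ ∑[ m < n ] G (pt (+ d) m)
        eq = trans (∑-suc Y (λ m → 1ℤ * W (1 ℕ.* d ℕ.* m)))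
          (trans (cong₂ _+_ (cong (1ℤ *_) (trans (cong W (ℕ.*-zeroʳ (1 ℕ.* d))) W-0))
              (trans (∑-cong′ Y λ m → trans (*-identityˡ (W (x m))) (cong (λ w → ⟦ x m ℕ.<? Y ⟧ * G w) (x-pt m))) (proj₂ (proj₂ init) (λ m → G (pt (+ d) m)))))
            (+-identityˡ (∑[ m < n ] G (pt (+ d) m))))

      -- At the end of the sieve m is free, so for each of the d ≤ z² the sum over m is a partial
      -- sum of `G` along the multiples of d.
      type-I : Zsum 0 z ∣≤∣ + suc L * Dₚ
      type-I = ∣≤∣-mono (≤-reflexive total) (∑-∣≤∣ (suc Y) λ d _ → ∣≤∣-* {low d * μ z d} {inner 1 (R 0 z) d} {low d} {Dₚ} (coefficient d) (inner-1 d))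
        where
        coefficient : ∀ d → low d * μ z d ∣≤∣ low d
        coefficient d = subst (low d * μ z d ∣≤∣_) (*-identityʳ (low d))
          (∣≤∣-* {low d} {μ z d} {low d} {1ℤ} (∣≤∣-of-nonneg (0≤⟦⟧ (d ℕ.≤? L)) ≤-refl) (∣μ∣≤1 z d))
        total : ∑[ d < suc Y ] (low d * Dₚ) ≡ + suc L * Dₚ
        total = trans (∑-*ʳ (suc Y) Dₚ low) (cong (_* Dₚ) (trans (∑-extend low (ℕ.s≤s L≤Y) λ d L<d _ → ⟦⟧-no (d ℕ.≤? L) (ℕ.<⇒≱ L<d))
          (trans (∑-cong (suc L) λ d d≤L → ⟦⟧-yes (d ℕ.≤? L) (ℕ.≤-pred d≤L)) (trans (∑-const (suc L) 1ℤ) (*-identityʳ (+ suc L))))))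

      -- At the start of the sieve μ 0 is supported at d = 1, and the whole condition rests on m.
      Zsum-ρ : Zsum z 0 ≡ ∑[ m < suc Y ] (ρ m * W m)
      Zsum-ρ = trans (∑-single (suc Y) 1 (λ d → low d * ⟦ d ℕ.≟ 1 ⟧ * inner 1 ρ d) (ℕ.s≤s (ℕ.≤-trans 0<z (ℕ.≤-trans z≤z³ (ℕ.m≤m*n z³ z³ {{ℕ.>-nonZero 0<z³}}))))
          λ d _ d≢1 → trans (cong (λ w → low d * w * inner 1 ρ d) (⟦⟧-no (d ℕ.≟ 1) d≢1)) (l (low d) (inner 1 ρ d)))
        (trans (cong₂ (λ a b → a * b * inner 1 ρ 1) (⟦⟧-yes (1 ℕ.≤? L) (ℕ.*-mono-≤ 0<z 0<z)) (⟦⟧-yes (1 ℕ.≟ 1) refl))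
          (trans (*-identityˡ (inner 1 ρ 1)) (∑-cong′ (suc Y) λ m → cong (λ w → ρ m * W w) (ℕ.*-identityˡ m))))
        where
        l : ∀ a i → a * 0ℤ * i ≡ 0ℤ
        l = solve-∀

    ρ-bound : ∑[ m < suc Y ] (ρ m * W m) ∣≤∣ + h * + C + + suc L * (P * (+ (2 ℕ.* z) * + 2))
    ρ-bound = subst (_∣≤∣ (+ h * + C + + suc L * Dₚ)) (trans (l (Zsum z 0) (Zsum 0 z)) Zsum-ρ) (∣≤∣-+ sieve-loss type-I)
      where
      l : ∀ a b → a - b + b ≡ a
      l = solve-∀

-- Counting the prime divisors of a number.

module PrimeDivisors where
  open import Data.Nat
  open import Data.Nat.Properties
  open import Data.Nat.Divisibility
  open import Data.Nat.Coprimality using (Coprime; coprime-divisor)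
  open import Data.Nat.Primality
  open import Data.List using ([]; _∷_)
  open import Data.Nat.ListAction using (product)
  import Data.List.Relation.Unary.All as All
  open import Data.Nat.Primality.Factorisation using (factorise; module PrimeFactorisation)
  open import Data.Product using (∃-syntax; _×_; _,_; proj₁; proj₂)
  open import Data.Sum using (inj₁; inj₂)
  open import Relation.Nullary using (Dec; yes; no; contradiction)
  open import Relation.Binary.PropositionalEquality
  open FiniteSums using (count; tick-yes; tick-no)
  open Residues using (prime-coprime)

  coprime-*∣ : ∀ {a b n} → Coprime a b → a ∣ n → b ∣ n → a * b ∣ n
  coprime-*∣ {a} {b} c (divides k refl) b∣ka with coprime-divisor {n = a} (λ (x , y) → c (y , x)) (subst (b ∣_) (*-comm k a) b∣ka)
  ... | divides l refl = divides l (trans (*-assoc l b a) (cong (l *_) (*-comm b a)))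

  -- The witness d is the product of the selected primes below N. Recording that its prime factors
  -- stay below N makes the next prime N coprime to d, so that N d still divides n.
  power-count-∣ : ∀ {b n} {Q : ℕ → Set} (Q? : ∀ q → Dec (Q q)) → (∀ {q} → Q q → Prime q × b ≤ q × q ∣ n) → ∀ N →
                  ∃[ d ] d ∣ n × b ^ count Q? N ≤ d × (∀ {p} → Prime p → p ∣ d → p < N)
  power-count-∣ Q? spec zero = 1 , 1∣ _ , ≤-refl , λ pp p∣1 → contradiction (∣1⇒≡1 p∣1) (nonTrivial⇒≢1 {{prime⇒nonTrivial pp}})
  power-count-∣ {b} {n} {Q} Q? spec (suc N) = go (Q? N)
    where
    ih = power-count-∣ Q? spec N
    d = proj₁ ih
    d∣n = proj₁ (proj₂ ih)
    b^≤d = proj₁ (proj₂ (proj₂ ih))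
    below = proj₂ (proj₂ (proj₂ ih))
    go : Dec (Q N) → ∃[ d ] d ∣ n × b ^ count Q? (suc N) ≤ d × (∀ {p} → Prime p → p ∣ d → p < suc N)
    go (no ¬q) = d , d∣n , subst (λ e → b ^ e ≤ d) (sym (trans (cong (count Q? N +_) (tick-no (Q? N) ¬q)) (+-identityʳ (count Q? N)))) b^≤d ,
      λ pp p∣d → m<n⇒m<1+n (below pp p∣d)
    go (yes q) = N * d , coprime-*∣ (prime-coprime pN λ N∣d → <-irrefl refl (below pN N∣d)) N∣n d∣n ,
        subst (λ e → b ^ e ≤ N * d) (sym (trans (cong (count Q? N +_) (tick-yes (Q? N) q)) (+-comm (count Q? N) 1))) (*-mono-≤ b≤N b^≤d) , bound
      where
      pN = proj₁ (spec q)
      b≤N = proj₁ (proj₂ (spec q))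
      N∣n = proj₂ (proj₂ (spec q))
      bound : ∀ {p} → Prime p → p ∣ N * d → p < suc N
      bound pp p∣ with euclidsLemma N d pp p∣
      ... | inj₁ p∣N = s≤s (∣⇒≤ {{prime⇒nonZero pN}} p∣N)
      ... | inj₂ p∣d = m<n⇒m<1+n (below pp p∣d)

  power-count-≤ : ∀ {b n} .{{_ : NonZero n}} {Q : ℕ → Set} (Q? : ∀ q → Dec (Q q)) →
                  (∀ {q} → Q q → Prime q × b ≤ q × q ∣ n) → ∀ N → b ^ count Q? N ≤ n
  power-count-≤ Q? spec N with power-count-∣ Q? spec N
  ... | d , d∣n , b^≤d , _ = ≤-trans b^≤d (∣⇒≤ d∣n)

  count-< : ∀ {b n} → 1 < b → .{{_ : NonZero n}} {Q : ℕ → Set} (Q? : ∀ q → Dec (Q q)) →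
            (∀ {q} → Q q → Prime q × b ≤ q × q ∣ n) → ∀ N e → n < b ^ e → count Q? N < e
  count-< {b} {n} 1<b Q? spec N e n<b^e = ≰⇒> λ e≤c →
    <⇒≱ n<b^e (≤-trans (^-monoʳ-≤ b {{>-nonZero (<-trans (s≤s z≤n) 1<b)}} e≤c) (power-count-≤ Q? spec N))

  prime-factor : ∀ n → 1 < n → ∃[ q ] Prime q × q ∣ n
  prime-factor n 1<n = go factors isFactorisation factorsPrime
    where
    open PrimeFactorisation (factorise n {{>-nonZero (<-trans (s≤s z≤n) 1<n)}})
    go : ∀ qs → n ≡ product qs → All.All Prime qs → ∃[ q ] Prime q × q ∣ n
    go []       eq _            = contradiction (sym eq) (<⇒≢ 1<n)
    go (q ∷ qs) eq (pq All.∷ _) = q , pq , subst (q ∣_) (sym eq) (m∣m*n (product qs))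

-- Ramaré's weights and the primes between z³ and z⁶.

module Ramare (z : ℕ) {Good : ℕ → Set} (good? : ∀ p → Dec (Good p))
  (good : ∀ {p} → Good p → Prime p × z ℕ.< p × p ℕ.< 2 ℕ.* z)
  (1<z : 1 ℕ.< z) where

  open import Data.Nat as ℕ using (ℕ; zero; suc)
  open import Data.Nat.Primality using (Prime; prime?; euclidsLemma)
  open import Relation.Nullary using (Dec; yes; no; ¬_; contradiction)
  open import Data.Product using (∃-syntax; _×_; _,_; proj₁; proj₂)
  import Data.Nat.Properties as ℕ
  import Data.Nat.DivMod as ℕ
  import Data.Nat.Divisibility as ℕ∣
  open import Data.Nat.Primality using (rough∧square>⇒prime; _Rough_)
  open import Data.Integer hiding (suc) renaming (∣_∣ to abs)
  open import Data.Integer.Properties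
  open import Data.Integer.Tactic.RingSolver using (solve-∀)
  open import Data.Sum using (inj₁; inj₂)
  open import Relation.Binary.PropositionalEquality
  open import Relation.Nullary.Decidable using (_×-dec_)
  open import Function using (_∘_)
  open FiniteSums
  open PrimeDivisors
  open PartialSums
  open TypeII z good? good
  open Bilinear z good? good 1<z
  open Sieve z good? good 1<z

  R-elim : ∀ j k m → R j k m ≡ 1ℤ → ∀ {q} → Prime q → k ℕ.≤ q → q ℕ.< k ℕ.+ j → ¬ (q ℕ∣.∣ m)
  R-elim zero k m _ _ k≤q q<k _ = contradiction (subst (_ ℕ.<_) (ℕ.+-identityʳ k) q<k) (ℕ.≤⇒≯ k≤q)
  R-elim (suc j) k m Rm≡1 {q} pq k≤q q<k+j q∣m = go (k ℕ.≟ q)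
    where
    rest≡1 : R j (suc k) m ≡ 1ℤ
    rest≡1 with R-cases j (suc k) m
    ... | inj₂ e = e
    ... | inj₁ e = contradiction (trans (sym Rm≡1) (trans (cong ((1ℤ - pr k * ⟦ k ℕ∣.∣? m ⟧) *_) e) (*-zeroʳ (1ℤ - pr k * ⟦ k ℕ∣.∣? m ⟧)))) λ ()
    go : Dec (k ≡ q) → _
    go (no k≢q) = R-elim j (suc k) m rest≡1 pq (ℕ.≤∧≢⇒< k≤q k≢q) (subst (q ℕ.<_) (ℕ.+-suc k j) q<k+j) q∣m
    go (yes refl) = contradiction (trans (sym Rm≡1) (cong₂ (λ a b → (1ℤ - a * b) * R j (suc k) m) (pr-yes pq) (⟦⟧-yes (k ℕ∣.∣? m) q∣m)))
      λ e → 1≢0 (trans e (*-zeroˡ (R j (suc k) m)))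
      where
      1≢0 : 1ℤ ≢ 0ℤ
      1≢0 ()

  R-intro : ∀ j k m → (∀ {q} → Prime q → k ℕ.≤ q → q ℕ.< k ℕ.+ j → ¬ (q ℕ∣.∣ m)) → R j k m ≡ 1ℤ
  R-intro zero    k m _ = refl
  R-intro (suc j) k m none = go (prime? k)
    where
    rest : R j (suc k) m ≡ 1ℤ
    rest = R-intro j (suc k) m λ {q} pq k<q q< → none pq (ℕ.<⇒≤ k<q) (subst (q ℕ.<_) (sym (ℕ.+-suc k j)) q<)
    go : Dec (Prime k) → R (suc j) k m ≡ 1ℤ
    go (no ¬pk) = trans (R-no j m ¬pk) rest
    go (yes pk) = trans (R-yes j m pk) (cong₂ (λ a b → a - b * a) rest
      (⟦⟧-no (k ℕ∣.∣? m) (none pk ℕ.≤-refl (ℕ.m<m+n k (ℕ.s≤s ℕ.z≤n)))))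

  ρ-elim : ∀ m → ρ m ≡ 1ℤ → ∀ {q} → Prime q → q ℕ∣.∣ m → z ℕ.≤ q
  ρ-elim m e pq q∣m = ℕ.≮⇒≥ λ q<z → R-elim z 0 m e pq ℕ.z≤n q<z q∣m

  ρ-intro : ∀ m → (∀ {q} → Prime q → q ℕ∣.∣ m → z ℕ.≤ q) → ρ m ≡ 1ℤ
  ρ-intro m h = R-intro z 0 m λ pq _ q<z q∣m → contradiction (h pq q∣m) (ℕ.<⇒≱ q<z)

  Mid Top : ℕ → Set
  Mid q   = Prime q × z ℕ.≤ q × q ℕ.< z³
  Top n = Prime n × z³ ℕ.≤ n × n ℕ.< Y

  Mid? : ∀ q → Dec (Mid q)
  Mid? q = prime? q ×-dec (z ℕ.≤? q ×-dec q ℕ.<? z³)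

  Top? : ∀ n → Dec (Top n)
  Top? n = prime? n ×-dec (z³ ℕ.≤? n ×-dec n ℕ.<? Y)

  ι κ : ℕ → ℤ
  ι q = ⟦ Mid? q ⟧
  κ n = ⟦ Top? n ⟧

  MidDiv? : ∀ m q → Dec (Mid q × q ℕ∣.∣ m)
  MidDiv? m q = Mid? q ×-dec (q ℕ∣.∣? m)

  ω : ℕ → ℕ
  ω m = count (MidDiv? m) z³

  -- A squarefree n < z⁶ free of prime factors below z, with r ≥ 1 prime factors in [z , z³),
  -- is q m with such a q in r ways, and then ω m = r - 1.  As r ≤ 5 divides 60, the r shares
  -- of 60 / (1 + ω m) add up to 60.
  share60 : ℕ → ℕ
  share60 n = 60 ℕ./ suc n

  γ : ℕ → ℤ
  γ m = ρ m * + share60 (ω m)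

  cof : ℕ → ℕ → ℤ
  cof n q = ∑[ m < suc Y ] (⟦ q ℕ.* m ℕ.≟ n ⟧ * γ m)

  -- The Dirichlet convolution of `ι` and `γ`; its sum against `W` is therefore a bilinear sum, with
  -- a middle prime as one variable.
  ψ : ℕ → ℤ
  ψ n = ∑[ q < suc Y ] (ι q * cof n q)

  Bil-ψ : Bil 1 ι γ ≡ ∑[ n < suc Y ] (ψ n * W n)
  Bil-ψ = begin
    ∑[ q < N ] (ι q * ∑[ m < N ] (γ m * W (1 ℕ.* q ℕ.* m)))
      ≡⟨ ∑-cong′ N (λ q → cong (ι q *_) (trans (∑-cong′ N λ m → trans (cong (γ m *_) (spread q m)) (sym (∑-*ˡ N (γ m) (λ n → ⟦ q ℕ.* m ℕ.≟ n ⟧ * W n))))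
           (∑-swap N N (λ m n → γ m * (⟦ q ℕ.* m ℕ.≟ n ⟧ * W n))))) ⟩
    ∑[ q < N ] (ι q * ∑[ n < N ] ∑[ m < N ] (γ m * (⟦ q ℕ.* m ℕ.≟ n ⟧ * W n)))
      ≡⟨ ∑-cong′ N (λ q → trans (cong (ι q *_) (∑-cong′ N λ n → trans (∑-cong′ N λ m → l (γ m) ⟦ q ℕ.* m ℕ.≟ n ⟧ (W n)) (∑-*ʳ N (W n) (λ m → ⟦ q ℕ.* m ℕ.≟ n ⟧ * γ m))))
           (sym (∑-*ˡ N (ι q) (λ n → cof n q * W n)))) ⟩
    ∑[ q < N ] ∑[ n < N ] (ι q * (cof n q * W n))
      ≡⟨ ∑-swap N N (λ q n → ι q * (cof n q * W n)) ⟩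
    ∑[ n < N ] ∑[ q < N ] (ι q * (cof n q * W n))
      ≡⟨ ∑-cong′ N (λ n → trans (∑-cong′ N λ q → sym (*-assoc (ι q) (cof n q) (W n))) (∑-*ʳ N (W n) (λ q → ι q * cof n q))) ⟩
    ∑[ n < N ] (ψ n * W n) ∎
    where
    open ≡-Reasoning
    N = suc Y
    l : ∀ g d w → g * (d * w) ≡ d * g * w
    l = solve-∀
    spread : ∀ q m → W (1 ℕ.* q ℕ.* m) ≡ ∑[ n < N ] (⟦ q ℕ.* m ℕ.≟ n ⟧ * W n)
    spread q m = trans (cong (λ x → W (x ℕ.* m)) (ℕ.*-identityˡ q)) (go (q ℕ.* m ℕ.<? N))
      where
      go : Dec (q ℕ.* m ℕ.< N) → W (q ℕ.* m) ≡ ∑[ n < N ] (⟦ q ℕ.* m ℕ.≟ n ⟧ * W n)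
      go (yes small) = sym (trans (∑-single N (q ℕ.* m) (λ n → ⟦ q ℕ.* m ℕ.≟ n ⟧ * W n) small
          λ n _ n≢ → ⟦⟧*-zero (q ℕ.* m ℕ.≟ n) (W n) λ e → contradiction (sym e) n≢)
        (trans (cong (_* W (q ℕ.* m)) (⟦⟧-yes (q ℕ.* m ℕ.≟ q ℕ.* m) refl)) (*-identityˡ (W (q ℕ.* m)))))
      go (no large) = trans (W-big (q ℕ.* m) (ℕ.<⇒≤ (ℕ.≮⇒≥ large)))
        (sym (∑-zero N λ n n<N → ⟦⟧*-zero (q ℕ.* m ℕ.≟ n) (W n) λ { refl → contradiction n<N large }))

  cof-∣ : ∀ {q} n m₀ → 0 ℕ.< q → m₀ ℕ.< suc Y → n ≡ q ℕ.* m₀ → cof n q ≡ γ m₀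
  cof-∣ {q} n m₀ 0<q m₀≤Y n≡ = trans (∑-single (suc Y) m₀ (λ m → ⟦ q ℕ.* m ℕ.≟ n ⟧ * γ m) m₀≤Y
      λ m _ m≢m₀ → ⟦⟧*-zero (q ℕ.* m ℕ.≟ n) (γ m) λ e → contradiction (ℕ.*-cancelˡ-≡ m m₀ q {{ℕ.>-nonZero 0<q}} (trans e n≡)) m≢m₀)
    (trans (cong (_* γ m₀) (⟦⟧-yes (q ℕ.* m₀ ℕ.≟ n) (sym n≡))) (*-identityˡ (γ m₀)))

  cof-∤ : ∀ {q} n → ¬ (q ℕ∣.∣ n) → cof n q ≡ 0ℤ
  cof-∤ {q} n q∤n = ∑-zero (suc Y) λ m _ → ⟦⟧*-zero (q ℕ.* m ℕ.≟ n) (γ m) λ e →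
    contradiction (ℕ∣.divides m (trans (sym e) (ℕ.*-comm q m))) q∤n

  square? : ∀ n q → Dec (z ℕ.≤ q × q ℕ.* q ℕ∣.∣ n)
  square? n q = z ℕ.≤? q ×-dec (q ℕ.* q ℕ∣.∣? n)

  -- Counts q in the middle range with q² ∣ n, prime or not. A rough n that has a middle prime, but
  -- whose shares do not add up to 60, has such a q; this bounds the exceptions without a condition
  -- of primality.
  sq : ℕ → ℤ
  sq n = ∑[ q < z³ ] ⟦ square? n q ⟧

  0≤sq′ : ∀ n → 0ℤ ≤ sq n
  0≤sq′ n = ∑-nonneg z³ λ q → 0≤⟦⟧ (square? n q)


  q-positive : ∀ {q} → Mid q → 0 ℕ.< q
  q-positive (pq , _) = 0<prime pq

  ρ-cofactor : ∀ {q} m → Mid q → ρ (q ℕ.* m) ≡ 1ℤ → ρ m ≡ 1ℤ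
  ρ-cofactor {q} m _ e = ρ-intro m λ pr q′∣m → ρ-elim (q ℕ.* m) e pr (ℕ∣.∣n⇒∣m*n q q′∣m)

  ρ-multiple : ∀ {q} m → Mid q → ρ m ≡ 1ℤ → ρ (q ℕ.* m) ≡ 1ℤ
  ρ-multiple {q} m (pq , z≤q , _) e = ρ-intro (q ℕ.* m) h
    where
    h : ∀ {l} → Prime l → l ℕ∣.∣ q ℕ.* m → z ℕ.≤ l
    h pl l∣qm with euclidsLemma q m pl l∣qm
    ... | inj₁ l∣q = subst (z ℕ.≤_) (sym (distinct-primes pl pq l∣q)) z≤q
    ... | inj₂ l∣m = ρ-elim m e pl l∣m

  module Term (n : ℕ) (n<Y : n ℕ.< Y) where

    cofactor : ∀ {q} → Mid q → q ℕ∣.∣ n → ∃[ m ] m ℕ.< suc Y × n ≡ q ℕ.* m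
    cofactor {q} jq (ℕ∣.divides m n≡mq) = m , ℕ.s≤s (ℕ.≤-trans (ℕ.m≤m*n m q {{ℕ.>-nonZero (q-positive jq)}}) (ℕ.≤-trans (ℕ.≤-reflexive (sym n≡mq)) (ℕ.<⇒≤ n<Y))) ,
      trans n≡mq (ℕ.*-comm m q)

    term-else : ∀ q → ¬ (Mid q × q ℕ∣.∣ n) → ι q * cof n q ≡ 0ℤ
    term-else q no-q = ⟦⟧*-zero (Mid? q) (cof n q) λ jq → cof-∤ n λ q∣n → no-q (jq , q∣n)

    term-at : ∀ {q m} → Mid q → m ℕ.< suc Y → n ≡ q ℕ.* m → ι q * cof n q ≡ γ m
    term-at {q} {m} jq m≤Y n≡ = trans (cong₂ _*_ (⟦⟧-yes (Mid? q) jq) (cof-∣ n m (q-positive jq) m≤Y n≡)) (*-identityˡ (γ m))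

    z³≤1+Y : z³ ℕ.≤ suc Y
    z³≤1+Y = ℕ.m≤n⇒m≤1+n (ℕ.m≤m*n z³ z³ {{ℕ.>-nonZero 0<z³}})

    ψ-short : ψ n ≡ ∑[ q < z³ ] (ι q * cof n q)
    ψ-short = ∑-extend (λ q → ι q * cof n q) z³≤1+Y λ q z³≤q _ → term-else q λ ((_ , _ , q<z³) , _) → contradiction z³≤q (ℕ.<⇒≱ q<z³)

    ψ-rough-0 : ρ n ≡ 0ℤ → ψ n ≡ 0ℤ
    ψ-rough-0 ρn≡0 = ∑-zero (suc Y) λ q _ → go q (MidDiv? n q)
      where
      go : ∀ q → Dec (Mid q × q ℕ∣.∣ n) → ι q * cof n q ≡ 0ℤ
      go q (no h) = term-else q h
      go q (yes (jq , q∣n)) = trans (term-at jq (proj₁ (proj₂ c)) n≡) (trans (cong (_* + share60 (ω m)) ρm≡0) (*-zeroˡ (+ share60 (ω m))))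
        where
        c = cofactor jq q∣n
        m = proj₁ c
        n≡ = proj₂ (proj₂ c)
        ρm≡0 : ρ m ≡ 0ℤ
        ρm≡0 with R-cases z 0 m
        ... | inj₁ e = e
        ... | inj₂ e = contradiction (trans (sym ρn≡0) (trans (cong ρ n≡) (ρ-multiple m jq e))) λ ()

    ψ-no-divisor : ω n ≡ 0 → ψ n ≡ 0ℤ
    ψ-no-divisor ω≡0 = trans ψ-short (∑-zero z³ λ q q<z³ → term-else q (count-none (MidDiv? n) z³ ω≡0 q q<z³))

    module _ {q m} (jq : Mid q) (n≡ : n ≡ q ℕ.* m) where
      q<z³ : q ℕ.< z³
      q<z³ = proj₂ (proj₂ jq)

      m∣n : m ℕ∣.∣ n
      m∣n = ℕ∣.divides q n≡

      split-≤ : ∀ l → ⟦ MidDiv? n l ⟧ ≤ ⟦ MidDiv? m l ⟧ + ⟦ l ℕ.≟ q ⟧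
      split-≤ l = go (MidDiv? n l) (l ℕ.≟ q)
        where
        go : Dec (Mid l × l ℕ∣.∣ n) → Dec (l ≡ q) → ⟦ MidDiv? n l ⟧ ≤ ⟦ MidDiv? m l ⟧ + ⟦ l ℕ.≟ q ⟧
        go (no h) _ = ≤-trans (≤-reflexive (⟦⟧-no (MidDiv? n l) h)) (0≤-+ (0≤⟦⟧ (MidDiv? m l)) (0≤⟦⟧ (l ℕ.≟ q)))
        go (yes _) (yes e) = ≤-trans (⟦⟧≤1 (MidDiv? n l)) (≤-by ⟦ MidDiv? m l ⟧ (0≤⟦⟧ (MidDiv? m l))
          (trans (cong (_+_ ⟦ MidDiv? m l ⟧) (⟦⟧-yes (l ℕ.≟ q) e)) (+-comm ⟦ MidDiv? m l ⟧ 1ℤ)))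
        go (yes (jl , l∣n)) (no l≢q) = ≤-trans (⟦⟧≤1 (MidDiv? n l)) (≤-by ⟦ l ℕ.≟ q ⟧ (0≤⟦⟧ (l ℕ.≟ q))
            (cong (_+ ⟦ l ℕ.≟ q ⟧) (⟦⟧-yes (MidDiv? m l) (jl , l∣m))))
          where
          l∣m : l ℕ∣.∣ m
          l∣m with euclidsLemma q m (proj₁ jl) (subst (l ℕ∣.∣_) n≡ l∣n)
          ... | inj₁ l∣q = contradiction (distinct-primes (proj₁ jl) (proj₁ jq) l∣q) l≢q
          ... | inj₂ h   = h

      ∑-δ : ∑[ l < z³ ] ⟦ l ℕ.≟ q ⟧ ≡ 1ℤ
      ∑-δ = trans (∑-single z³ q (λ l → ⟦ l ℕ.≟ q ⟧) q<z³ λ l _ l≢q → ⟦⟧-no (l ℕ.≟ q) l≢q) (⟦⟧-yes (q ℕ.≟ q) refl)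

      ω-sum : ∑[ l < z³ ] (⟦ MidDiv? m l ⟧ + ⟦ l ℕ.≟ q ⟧) ≡ + suc (ω m)
      ω-sum = trans (∑-+ z³ (λ l → ⟦ MidDiv? m l ⟧) (λ l → ⟦ l ℕ.≟ q ⟧)) (trans (cong₂ _+_ (sym (+count (MidDiv? m) z³)) ∑-δ) (+-comm (+ ω m) 1ℤ))

      -- Dividing n by q can remove only q itself from its middle primes; it does remove q unless q
      -- ∣ m, which is excluded in `ω-≡`.
      ω-≤ : ω n ℕ.≤ suc (ω m)
      ω-≤ = drop‿+≤+ (≤-trans (≤-reflexive (+count (MidDiv? n) z³)) (≤-trans (∑-mono z³ λ l _ → split-≤ l) (≤-reflexive ω-sum)))

      ω-≡ : ¬ (q ℕ∣.∣ m) → ω n ≡ suc (ω m)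
      ω-≡ q∤m = ℕ.≤-antisym ω-≤ (drop‿+≤+ (≤-trans (≤-reflexive (sym ω-sum)) (≤-trans (∑-mono z³ λ l _ → split-≥ l) (≤-reflexive (sym (+count (MidDiv? n) z³))))))
        where
        split-≥ : ∀ l → ⟦ MidDiv? m l ⟧ + ⟦ l ℕ.≟ q ⟧ ≤ ⟦ MidDiv? n l ⟧
        split-≥ l = go (MidDiv? m l) (l ℕ.≟ q)
          where
          go : Dec (Mid l × l ℕ∣.∣ m) → Dec (l ≡ q) → ⟦ MidDiv? m l ⟧ + ⟦ l ℕ.≟ q ⟧ ≤ ⟦ MidDiv? n l ⟧
          go (yes (_ , l∣m)) (yes refl) = contradiction l∣m q∤m
          go (yes (jl , l∣m)) (no l≢q) = ≤-reflexive (trans (cong₂ _+_ (⟦⟧-yes (MidDiv? m l) (jl , l∣m)) (⟦⟧-no (l ℕ.≟ q) l≢q)) (sym (⟦⟧-yes (MidDiv? n l) (jl , ℕ∣.∣-trans l∣m m∣n))))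
          go (no h) (yes refl) = ≤-reflexive (trans (cong₂ _+_ (⟦⟧-no (MidDiv? m l) h) (⟦⟧-yes (l ℕ.≟ l) refl)) (sym (⟦⟧-yes (MidDiv? n l) (jq , ℕ∣.divides m (trans n≡ (ℕ.*-comm q m))))))
          go (no h) (no l≢q) = ≤-trans (≤-reflexive (cong₂ _+_ (⟦⟧-no (MidDiv? m l) h) (⟦⟧-no (l ℕ.≟ q) l≢q))) (0≤⟦⟧ (MidDiv? n l))

    module Rough (0<n : 0 ℕ.< n) (ρn≡1 : ρ n ≡ 1ℤ) where

      Y≡z⁶ : Y ≡ z ℕ.^ 6
      Y≡z⁶ = l z
        where
        open import Data.Nat.Tactic.RingSolver as ℕSolver using ()
        l : ∀ z → z ℕ.* z ℕ.* z ℕ.* (z ℕ.* z ℕ.* z) ≡ z ℕ.* (z ℕ.* (z ℕ.* (z ℕ.* (z ℕ.* (z ℕ.* 1)))))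
        l = ℕSolver.solve-∀

      ω<6 : ω n ℕ.< 6
      ω<6 = count-< {z} {n} 1<z {{ℕ.>-nonZero 0<n}} (MidDiv? n) (λ ((pq , z≤q , _) , q∣n) → pq , z≤q , q∣n) z³ 6 (subst (n ℕ.<_) Y≡z⁶ n<Y)

      -- The point of 60: it is divisible by each of 1 , ... , 5, and z⁶ > n leaves no other
      -- positive value for the number of middle primes.
      share-ω : ∀ w → w ℕ.< 6 → 0 ℕ.< w → + w * + share60 (ℕ.pred w) ≡ + 60
      share-ω 1 _ _ = refl
      share-ω 2 _ _ = refl
      share-ω 3 _ _ = refl
      share-ω 4 _ _ = refl
      share-ω 5 _ _ = refl
      share-ω (suc (suc (suc (suc (suc (suc w)))))) (ℕ.s≤s (ℕ.s≤s (ℕ.s≤s (ℕ.s≤s (ℕ.s≤s (ℕ.s≤s ())))))) _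

      share-mono : ∀ {a b} → a ℕ.≤ b → share60 b ℕ.≤ share60 a
      share-mono a≤b = ℕ./-monoʳ-≤ 60 (ℕ.s≤s a≤b)

      w₀ : ℕ
      w₀ = share60 (ℕ.pred (ω n))

      term-rough : ∀ {q m} → Mid q → m ℕ.< suc Y → n ≡ q ℕ.* m → ι q * cof n q ≡ + share60 (ω m)
      term-rough {q} {m} jq m≤Y n≡ = trans (term-at jq m≤Y n≡) (trans (cong (_* + share60 (ω m)) (ρ-cofactor m jq (trans (cong ρ (sym n≡)) ρn≡1))) (*-identityˡ (+ share60 (ω m))))

      ∑-w₀ : ∑[ q < z³ ] (⟦ MidDiv? n q ⟧ * + w₀) ≡ + ω n * + w₀
      ∑-w₀ = trans (∑-*ʳ z³ (+ w₀) (λ q → ⟦ MidDiv? n q ⟧)) (cong (_* + w₀) (sym (+count (MidDiv? n) z³)))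

      term-≤ : ∀ q → ι q * cof n q ≤ ⟦ MidDiv? n q ⟧ * + w₀
      term-≤ q = go (MidDiv? n q)
        where
        go : Dec (Mid q × q ℕ∣.∣ n) → ι q * cof n q ≤ ⟦ MidDiv? n q ⟧ * + w₀
        go (no h) = ≤-trans (≤-reflexive (term-else q h)) (0≤-* {⟦ MidDiv? n q ⟧} {+ w₀} (0≤⟦⟧ (MidDiv? n q)) 0≤+)
        go (yes (jq , q∣n)) = ≤-trans (≤-reflexive (term-rough jq (proj₁ (proj₂ c)) n≡))
            (≤-trans (+≤+ (share-mono (ℕ.pred-mono-≤ (ω-≤ jq n≡)))) (≤-reflexive (sym (trans (cong (_* + w₀) (⟦⟧-yes (MidDiv? n q) (jq , q∣n))) (*-identityˡ (+ w₀))))))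
          where
          c = cofactor jq q∣n
          n≡ = proj₂ (proj₂ c)

      term-≡ : (∀ q → q ℕ.< z³ → ¬ (z ℕ.≤ q × q ℕ.* q ℕ∣.∣ n)) → ∀ q → q ℕ.< z³ → ι q * cof n q ≡ ⟦ MidDiv? n q ⟧ * + w₀
      term-≡ no-square q q<z³ = go (MidDiv? n q)
        where
        go : Dec (Mid q × q ℕ∣.∣ n) → ι q * cof n q ≡ ⟦ MidDiv? n q ⟧ * + w₀
        go (no h) = trans (term-else q h) (sym (trans (cong (_* + w₀) (⟦⟧-no (MidDiv? n q) h)) (*-zeroˡ (+ w₀))))
        go (yes (jq , q∣n)) = trans (term-rough jq (proj₁ (proj₂ c)) n≡)
            (trans (cong (λ w → + share60 w) (sym (cong ℕ.pred (ω-≡ jq n≡ q∤m)))) (sym (trans (cong (_* + w₀) (⟦⟧-yes (MidDiv? n q) (jq , q∣n))) (*-identityˡ (+ w₀)))))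
          where
          c = cofactor jq q∣n
          m = proj₁ c
          n≡ = proj₂ (proj₂ c)
          q∤m : ¬ (q ℕ∣.∣ m)
          q∤m (ℕ∣.divides e m≡eq) = no-square q q<z³ (proj₁ (proj₂ jq) ,
            ℕ∣.divides e (trans n≡ (trans (cong (q ℕ.*_) m≡eq) (trans (ℕ.*-comm q (e ℕ.* q)) (ℕ.*-assoc e q q)))))

      -- A repeated factor q keeps ω m at ω n instead of ω n - 1, so the share of that q only
      -- becomes smaller.
      ψ≤60 : 0 ℕ.< ω n → ψ n ≤ + 60
      ψ≤60 0<ω = ≤-trans (≤-reflexive ψ-short) (≤-trans (∑-mono z³ λ q _ → term-≤ q) (≤-reflexive (trans ∑-w₀ (share-ω (ω n) ω<6 0<ω))))

      ψ≡60 : 0 ℕ.< ω n → (∀ q → q ℕ.< z³ → ¬ (z ℕ.≤ q × q ℕ.* q ℕ∣.∣ n)) → ψ n ≡ + 60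
      ψ≡60 0<ω no-square = trans ψ-short (trans (∑-cong z³ (term-≡ no-square)) (trans ∑-w₀ (share-ω (ω n) ω<6 0<ω)))

      -- All prime factors of n are at least z³, and n < z³ · z³ has room for only one of them.
      top : ω n ≡ 0 → 1 ℕ.< n → Top n
      top ω≡0 1<n = rough∧square>⇒prime {n} {z³} {{ℕ.n>1⇒nonTrivial 1<n}} rough n<Y , z³≤n , n<Y
        where
        large : ∀ {q} → Prime q → q ℕ∣.∣ n → z³ ℕ.≤ q
        large {q} pq q∣n = ℕ.≮⇒≥ λ q<z³ → count-none (MidDiv? n) z³ ω≡0 q q<z³ ((pq , ρ-elim n ρn≡1 pq q∣n , q<z³) , q∣n)
        rough : z³ Rough n
        rough (ℕ∣.hasNonTrivialDivisor {divisor = d} {{d>1}} d<z³ d∣n) with prime-factor d (ℕ.nonTrivial⇒n>1 d {{d>1}})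
        ... | q , pq , q∣d = ℕ.<⇒≱ d<z³ (ℕ.≤-trans (large pq (ℕ∣.∣-trans q∣d d∣n))
              (ℕ∣.∣⇒≤ {{ℕ.nonTrivial⇒nonZero d {{d>1}}}} q∣d))
        z³≤n : z³ ℕ.≤ n
        z³≤n with prime-factor n 1<n
        ... | q , pq , q∣n = ℕ.≤-trans (large pq q∣n) (ℕ∣.∣⇒≤ {{ℕ.>-nonZero 0<n}} q∣n)

    top⇒ρ : Top n → ρ n ≡ 1ℤ
    top⇒ρ (pn , z³≤n , _) = ρ-intro n λ pq q∣n → subst (z ℕ.≤_) (sym (distinct-primes pq pn q∣n)) (ℕ.≤-trans z≤z³ z³≤n)

    top⇒ω : Top n → ω n ≡ 0
    top⇒ω (pn , z³≤n , _) = count-0 (MidDiv? n) z³ λ q q<z³ ((pq , _) , q∣n) →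
      ℕ.<⇒≱ q<z³ (subst (z³ ℕ.≤_) (sym (distinct-primes pq pn q∣n)) z³≤n)

    f : ℤ
    f = + 60 * ρ n - ψ n

    0≤κ : 0ℤ ≤ κ n
    0≤κ = 0≤⟦⟧ (Top? n)

    -- For rough n the value f is 60 if there is no middle prime, so for n = 1 and the top primes;
    -- otherwise it is 0, except that a square of some q ≥ z may raise it to at most 60. For other n
    -- it vanishes. These bounds are all that is used of the weights.
    f-bounds : 0 ℕ.< n → (+ 60 * κ n ≤ f) × (f ≤ + 60 * (⟦ n ℕ.≟ 1 ⟧ + κ n + sq n))
    f-bounds 0<n with R-cases z 0 n
    ... | inj₁ ρn≡0 = ≤-reflexive (trans (cong (+ 60 *_) (⟦⟧-no (Top? n) λ t → 0≢1 (trans (sym ρn≡0) (top⇒ρ t)))) (sym f≡0)) ,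
        ≤-trans (≤-reflexive f≡0) (0≤-* {+ 60} {⟦ n ℕ.≟ 1 ⟧ + κ n + sq n} 0≤+ (0≤-+ (0≤-+ (0≤⟦⟧ (n ℕ.≟ 1)) 0≤κ) (0≤sq′ n)))
      where
      0≢1 : 0ℤ ≢ 1ℤ
      0≢1 ()
      f≡0 : f ≡ 0ℤ
      f≡0 = cong₂ (λ a b → + 60 * a - b) ρn≡0 (ψ-rough-0 ρn≡0)
    ... | inj₂ ρn≡1 = go (ω n ℕ.≟ 0)
      where
      open Rough 0<n ρn≡1
      goal : Set
      goal = (+ 60 * κ n ≤ f) × (f ≤ + 60 * (⟦ n ℕ.≟ 1 ⟧ + κ n + sq n))
      f≡ : f ≡ + 60 - ψ n
      f≡ = cong (λ a → + 60 * a - ψ n) ρn≡1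
      go : Dec (ω n ≡ 0) → goal
      go (yes ω≡0) = ≤-trans (*-monoˡ {κ n} {1ℤ} {+ 60} 0≤+ (⟦⟧≤1 (Top? n))) (≤-reflexive (sym f≡60)) ,
          ≤-trans (≤-reflexive f≡60) (*-monoˡ {1ℤ} {⟦ n ℕ.≟ 1 ⟧ + κ n + sq n} {+ 60} 0≤+ (one-of (n ℕ.≟ 1)))
        where
        f≡60 : f ≡ + 60
        f≡60 = trans f≡ (cong (_-_ (+ 60)) (ψ-no-divisor ω≡0))
        one-of : Dec (n ≡ 1) → 1ℤ ≤ ⟦ n ℕ.≟ 1 ⟧ + κ n + sq n
        one-of (yes n≡1) = ≤-by (κ n + sq n) (0≤-+ 0≤κ (0≤sq′ n)) (trans (cong (λ w → w + κ n + sq n) (⟦⟧-yes (n ℕ.≟ 1) n≡1)) (+-assoc 1ℤ (κ n) (sq n)))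
        one-of (no n≢1)  = ≤-by (⟦ n ℕ.≟ 1 ⟧ + sq n) (0≤-+ (0≤⟦⟧ (n ℕ.≟ 1)) (0≤sq′ n))
          (trans (cong (λ w → ⟦ n ℕ.≟ 1 ⟧ + w + sq n) (⟦⟧-yes (Top? n) (top ω≡0 (ℕ.≤∧≢⇒< 0<n (n≢1 ∘ sym))))) (l ⟦ n ℕ.≟ 1 ⟧ (sq n)))
          where
          l : ∀ a b → a + 1ℤ + b ≡ 1ℤ + (a + b)
          l = solve-∀
      go (no ω≢0) = ≤-trans (≤-reflexive (cong (+ 60 *_) (⟦⟧-no (Top? n) (ω≢0 ∘ top⇒ω)))) (≤-trans (≤⇒0≤- (ψ≤60 0<ω)) (≤-reflexive (sym f≡))) ,
          upper (count (square? n) z³ ℕ.≟ 0)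
        where
        0<ω : 0 ℕ.< ω n
        0<ω = ℕ.n≢0⇒n>0 ω≢0
        0≤rest : 0ℤ ≤ ⟦ n ℕ.≟ 1 ⟧ + κ n
        0≤rest = 0≤-+ (0≤⟦⟧ (n ℕ.≟ 1)) 0≤κ
        0≤ψ : 0ℤ ≤ ψ n
        0≤ψ = ∑-nonneg (suc Y) λ q → 0≤-* {ι q} {cof n q} (0≤⟦⟧ (Mid? q)) (∑-nonneg (suc Y) λ m → 0≤-* {⟦ q ℕ.* m ℕ.≟ n ⟧} {γ m} (0≤⟦⟧ (q ℕ.* m ℕ.≟ n)) (0≤-* {ρ m} {+ share60 (ω m)} (0≤R z 0 m) 0≤+))
        upper : Dec (count (square? n) z³ ≡ 0) → f ≤ + 60 * (⟦ n ℕ.≟ 1 ⟧ + κ n + sq n)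
        upper (yes c≡0) = ≤-trans (≤-reflexive (trans f≡ (cong (_-_ (+ 60)) (ψ≡60 0<ω (count-none (square? n) z³ c≡0)))))
          (0≤-* {+ 60} {⟦ n ℕ.≟ 1 ⟧ + κ n + sq n} 0≤+ (0≤-+ 0≤rest (0≤sq′ n)))
        upper (no c≢0) = ≤-trans (≤-reflexive f≡) (≤-trans (≤-by (ψ n) 0≤ψ (l (ψ n)))
            (*-monoˡ {1ℤ} {⟦ n ℕ.≟ 1 ⟧ + κ n + sq n} {+ 60} 0≤+ (≤-trans 1≤sq (≤-by (⟦ n ℕ.≟ 1 ⟧ + κ n) 0≤rest (+-comm (⟦ n ℕ.≟ 1 ⟧ + κ n) (sq n))))))
          where
          l : ∀ x → + 60 * 1ℤ ≡ + 60 - x + x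
          l = solve-∀
          1≤sq : 1ℤ ≤ sq n
          1≤sq = ≤-trans (+≤+ (ℕ.n≢0⇒n>0 c≢0)) (≤-reflexive (+count (square? n) z³))

-- Primes that are 1 modulo p, on average over p.

module Distribution (z : ℕ) {Good : ℕ → Set} (good? : ∀ p → Dec (Good p))
  (good : ∀ {p} → Good p → Prime p × z ℕ.< p × p ℕ.< 2 ℕ.* z)
  (1<z : 1 ℕ.< z) (s h : ℕ) (0<s : 0 ℕ.< s) (s-big : ℤ.+ 27 ℤ.* TypeII.P z good? good ℤ.≤ ℤ.+ s ℤ.* ℤ.+ s)
  (z<2^h : z ℕ.< 2 ℕ.^ h) where

  open import Data.Nat as ℕ using (ℕ; zero; suc)
  open import Data.Nat.Primality using (Prime)
  open import Relation.Nullary using (Dec; yes; no; ¬_; contradiction)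
  open import Data.Product using (_×_; _,_; proj₁; proj₂)
  import Data.Nat.Properties as ℕ
  import Data.Nat.DivMod as ℕ
  import Data.Nat.Divisibility as ℕ∣
  open import Data.Integer hiding (suc) renaming (∣_∣ to abs)
  open import Data.Integer.Properties
  open import Data.Integer.Divisibility.Signed using (∣⇒∣ᵤ; _∣?_) renaming (_∣_ to _∣ℤ_)
  import Data.Integer.Divisibility.Signed as S
  open import Data.Integer.Tactic.RingSolver using (solve-∀)
  open import Data.Sum using (_⊎_; inj₁; inj₂)
  open import Relation.Binary.PropositionalEquality hiding (J)
  open import Function using (_∘_)
  open FiniteSums
  open Residues
  open PartialSums
  open TypeII z good? good
  open Bilinear z good? good 1<z
  open Sieve z good? good 1<z
  open Ramare z good? good 1<z

  private
    N : ℕ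
    N = suc Y

    C₀ : ℕ
    C₀ = C s h 0<s s-big z<2^h

  F : ℕ → ℤ
  F n = + 60 * ρ n - ψ n

  A : ℕ → ℤ
  A n = ⟦ n ℕ.≟ 1 ⟧ + κ n + sq n

  Err : ℤ
  Err = + h * + C₀ + + suc L * (P * (+ (2 ℕ.* z) * + 2)) + (+ (h ℕ.+ h) * (+ Y * + s))

  private
    -- The middle primes lie below z³ ≤ z 2ʰ 2ʰ, which takes 2 h dyadic blocks from z on.
    ι-support : ∀ q → ι q ≡ 0ℤ ⊎ (z ℕ.≤ q × 1 ℕ.* q ℕ.* z³ ℕ.≤ Y × q ℕ.< z ℕ.* 2 ℕ.^ (h ℕ.+ h))
    ι-support q = go (Mid? q)
      where
      go : Dec (Mid q) → ι q ≡ 0ℤ ⊎ (z ℕ.≤ q × 1 ℕ.* q ℕ.* z³ ℕ.≤ Y × q ℕ.< z ℕ.* 2 ℕ.^ (h ℕ.+ h))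
      go (no h) = inj₁ (⟦⟧-no (Mid? q) h)
      go (yes (_ , z≤q , q<z³)) = inj₂ (z≤q , ℕ.*-monoˡ-≤ z³ (ℕ.≤-trans (ℕ.≤-reflexive (ℕ.*-identityˡ q)) (ℕ.<⇒≤ q<z³)) ,
        ℕ.<-≤-trans q<z³ (ℕ.≤-trans (ℕ.≤-reflexive (ℕ.*-assoc z z z)) (ℕ.*-monoʳ-≤ z (ℕ.≤-trans (ℕ.*-mono-≤ (ℕ.<⇒≤ z<2^h) (ℕ.<⇒≤ z<2^h))
          (ℕ.≤-reflexive (sym (ℕ.^-distribˡ-+-* 2 h h)))))))

    ∣γ∣≤60 : ∀ m → γ m ∣≤∣ + 60
    ∣γ∣≤60 m = subst (γ m ∣≤∣_) (*-identityˡ (+ 60)) (∣≤∣-* {ρ m} {+ share60 (ω m)} {1ℤ} {+ 60} (∣R∣≤1 z 0 m)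
      (∣≤∣-of-nonneg 0≤+ (+≤+ (ℕ.m/n≤m 60 (suc (ω m))))))

    Bil-ψ-bound : ∑[ n < N ] (ψ n * W n) ∣≤∣ + (h ℕ.+ h) * (+ 60 * (+ Y * + s))
    Bil-ψ-bound = subst (_∣≤∣ + (h ℕ.+ h) * (+ 60 * (+ Y * + s))) (trans (*-identityˡ (Bil 1 ι γ)) Bil-ψ)
      (Bil-bound s 0<s s-big 1 60 (ℕ.s≤s ℕ.z≤n) (ℕ.s≤s ℕ.z≤n) ι γ
        (λ q → ∣≤∣-of-nonneg (0≤⟦⟧ (Mid? q)) (⟦⟧≤1 (Mid? q))) ∣γ∣≤60 (h ℕ.+ h) ι-support)

    FW-lower : - (+ 60 * Err) ≤ ∑[ n < N ] (F n * W n)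
    FW-lower = ≤-trans (≤-reflexive (cong -_ (l (+ h * + C₀ + + suc L * (P * (+ (2 ℕ.* z) * + 2))) (+ (h ℕ.+ h)) (+ Y * + s))))
      (subst (- (+ 60 * E₁ + E₂) ≤_) (sym eq) (proj₁ (∣≤∣-- {+ 60 * ∑[ n < N ] (ρ n * W n)} {∑[ n < N ] (ψ n * W n)} {+ 60 * E₁} {E₂}
        (∣≤∣-* {+ 60} {∑[ n < N ] (ρ n * W n)} {+ 60} {E₁} (∣≤∣-of-nonneg 0≤+ ≤-refl) (ρ-bound s h 0<s s-big z<2^h)) Bil-ψ-bound)))
      where
      E₁ = + h * + C₀ + + suc L * (P * (+ (2 ℕ.* z) * + 2))
      E₂ = + (h ℕ.+ h) * (+ 60 * (+ Y * + s))
      l : ∀ e h w → + 60 * (e + h * w) ≡ + 60 * e + h * (+ 60 * w)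
      l = solve-∀
      l₂ : ∀ r p w → (+ 60 * r - p) * w ≡ + 60 * (r * w) - p * w
      l₂ = solve-∀
      eq : ∑[ n < N ] (F n * W n) ≡ + 60 * ∑[ n < N ] (ρ n * W n) - ∑[ n < N ] (ψ n * W n)
      eq = trans (∑-cong′ N λ n → l₂ (ρ n) (ψ n) (W n)) (trans (∑-- N (λ n → + 60 * (ρ n * W n)) (λ n → ψ n * W n))
        (cong (_- ∑[ n < N ] (ψ n * W n)) (∑-*ˡ N (+ 60) (λ n → ρ n * W n))))

    0≤A : ∀ n → 0ℤ ≤ A n
    0≤A n = 0≤-+ (0≤-+ (0≤⟦⟧ (n ℕ.≟ 1)) (0≤⟦⟧ (Top? n))) (0≤sq′ n)

    target : ℕ → ℕ → ℤ
    target n p = + 60 * (A n * (+ p * one p (+ n)) - κ n)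

    Apo : ∀ n p → 0ℤ ≤ A n * (+ p * one p (+ n))
    Apo n p = 0≤-* {A n} {+ p * one p (+ n)} (0≤A n) (0≤-* {+ p} {one p (+ n)} 0≤+ (0≤one p (+ n)))

    outside : ∀ n → ¬ (Top n) → ∀ p → 0ℤ ≤ target n p
    outside n ¬top p = 0≤-* {+ 60} {A n * (+ p * one p (+ n)) - κ n} 0≤+
      (subst (λ w → 0ℤ ≤ A n * (+ p * one p (+ n)) - w) (sym (⟦⟧-no (Top? n) ¬top))
        (subst (0ℤ ≤_) (sym (+-identityʳ (A n * (+ p * one p (+ n))))) (Apo n p)))

    ∑-outside : ∀ n → W n ≡ 0ℤ → ¬ (Top n) → F n * W n ≤ ∑[ p < 2 ℕ.* z ] (π p * target n p)
    ∑-outside n W≡0 ¬top = ≤-trans (≤-reflexive (trans (cong (F n *_) W≡0) (*-zeroʳ (F n))))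
      (∑-nonneg (2 ℕ.* z) λ p → 0≤-* {π p} {target n p} (0≤π p) (outside n ¬top p))

    -- F H p n is F (p - 1) on the class 1 and -F on the other classes prime to p. In the positive
    -- part F is replaced by its upper bound 60 A, in the negative part by its lower bound 60 κ. The
    -- correction at multiples of p disappears, as a top prime n ≥ z³ is not divisible by p < 2 z.
    pointwise : ∀ n → n ℕ.< N → F n * W n ≤ ∑[ p < 2 ℕ.* z ] (π p * target n p)
    pointwise zero    _   = ∑-outside 0 W-0 λ (_ , z³≤0 , _) → ℕ.<⇒≱ 0<z³ z³≤0
    pointwise n@(suc _) n<N = go (n ℕ.<? Y)
      where
      go : Dec (n ℕ.< Y) → F n * W n ≤ ∑[ p < 2 ℕ.* z ] (π p * target n p)
      go (no n≮Y) = ∑-outside n (W-big n (ℕ.≮⇒≥ n≮Y)) λ (_ , _ , n<Y) → n≮Y n<Y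
      go (yes n<Y) = ≤-trans (≤-reflexive expand) (∑-mono (2 ℕ.* z) λ p _ → each p)
        where
        open Term n n<Y using (f-bounds)
        expand : F n * W n ≡ ∑[ p < 2 ℕ.* z ] (π p * (F n * H p (+ n)))
        expand = trans (cong (F n *_) (trans (cong (_* G (+ n)) (⟦⟧-yes (n ℕ.<? Y) n<Y)) (trans (*-identityˡ (G (+ n))) (G-def (+ n)))))
          (trans (sym (∑-*ˡ (2 ℕ.* z) (F n) (λ p → π p * H p (+ n)))) (∑-cong′ (2 ℕ.* z) λ p → l (F n) (π p) (H p (+ n))))
          where
          l : ∀ f p h → f * (p * h) ≡ p * (f * h)
          l = solve-∀
        lo = proj₁ (f-bounds (ℕ.s≤s ℕ.z≤n))
        hi = proj₂ (f-bounds (ℕ.s≤s ℕ.z≤n))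
        0≤F : 0ℤ ≤ F n
        0≤F = ≤-trans (0≤-* {+ 60} {κ n} 0≤+ (0≤⟦⟧ (Top? n))) lo
        κ-zer : ∀ {p} → Good p → κ n * zer p (+ n) ≡ 0ℤ
        κ-zer {p} g = ⟦⟧*-zero (Top? n) (zer p (+ n)) λ (pn , z³≤n , _) → zer-no p (+ n) λ p∣n →
          ℕ.<⇒≱ (ℕ.<-≤-trans (proj₂ (proj₂ (good g))) 2z≤z³) (subst (z³ ℕ.≤_) (sym (distinct-primes (proj₁ (good g)) pn (∣⇒∣ᵤ p∣n))) z³≤n)
        each : ∀ p → π p * (F n * H p (+ n)) ≤ π p * target n p
        each p = go′ (good? p)
          where
          o = one p (+ n)
          v = zer p (+ n)
          l : ∀ f a k p o v → + 60 * (a * (p * o) - k) ≡ f * ((p - 1ℤ) * o + v - 1ℤ) + (f * o + (+ 60 * a - f) * (p * o) + (f - + 60 * k) * (1ℤ - v) - + 60 * (k * v))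
          l = solve-∀
          go′ : Dec (Good p) → π p * (F n * H p (+ n)) ≤ π p * target n p
          go′ (no ¬g) = ≤-reflexive (trans (cong (_* (F n * H p (+ n))) (⟦⟧-no (good? p) ¬g)) (trans (*-zeroˡ (F n * H p (+ n)))
            (sym (trans (cong (_* target n p) (⟦⟧-no (good? p) ¬g)) (*-zeroˡ (target n p))))))
          go′ (yes g) = *-monoˡ {F n * H p (+ n)} {target n p} {π p} (0≤π p) (≤-by
              (F n * o + (+ 60 * A n - F n) * (+ p * o) + (F n - + 60 * κ n) * (1ℤ - v) - + 60 * (κ n * v))
              (subst (λ w → 0ℤ ≤ F n * o + (+ 60 * A n - F n) * (+ p * o) + (F n - + 60 * κ n) * (1ℤ - v) - + 60 * w) (sym (κ-zer g))
                (subst (0ℤ ≤_) (sym (+-identityʳ (F n * o + (+ 60 * A n - F n) * (+ p * o) + (F n - + 60 * κ n) * (1ℤ - v))))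
                  (0≤-+ (0≤-+ (0≤-* {F n} {o} 0≤F (0≤one p (+ n)))
                      (0≤-* {+ 60 * A n - F n} {+ p * o} (≤⇒0≤- hi) (0≤-* {+ p} {o} 0≤+ (0≤one p (+ n)))))
                    (0≤-* {F n - + 60 * κ n} {1ℤ - v} (≤⇒0≤- lo) (≤⇒0≤- (zer≤1 p (+ n)))))))
              (l (F n) (A n) (κ n) (+ p) o v))

  π′ : ℤ
  π′ = ∑ N κ

  aps : ℕ → ℤ
  aps p = ∑[ n < N ] (κ n * one p (+ n))

  private
    weight : ℕ → ℤ
    weight p = ∑[ n < N ] (A n * (+ p * one p (+ n)))

    averaged : P * π′ ≤ ∑[ p < 2 ℕ.* z ] (π p * weight p) + Err
    averaged = *-cancelˡ-≤-pos (P * π′) (∑[ p < 2 ℕ.* z ] (π p * weight p) + Err) (+ 60)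
      (subst₂ _≤_ (l₁ (+ 60 * (P * π′)) (∑[ p < 2 ℕ.* z ] (π p * weight p)) Err) (l₂ (∑[ p < 2 ℕ.* z ] (π p * weight p)) Err)
        (+-monoʳ-≤ (+ 60 * (P * π′) + + 60 * Err) (≤-trans FW-lower (≤-trans (∑-mono N pointwise) (≤-reflexive total)))))
      where
      l₁ : ∀ a x e → a + + 60 * e + - (+ 60 * e) ≡ a
      l₁ = solve-∀
      total : ∑[ n < N ] ∑[ p < 2 ℕ.* z ] (π p * target n p) ≡ + 60 * (∑[ p < 2 ℕ.* z ] (π p * weight p) - P * π′)
      total = trans (∑-swap N (2 ℕ.* z) (λ n p → π p * target n p)) (trans (∑-cong′ (2 ℕ.* z) λ p → row p)
        (trans (∑-*ˡ (2 ℕ.* z) (+ 60) (λ p → π p * weight p - π p * π′)) (cong (+ 60 *_)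
          (trans (∑-- (2 ℕ.* z) (λ p → π p * weight p) (λ p → π p * π′)) (cong (_-_ (∑[ p < 2 ℕ.* z ] (π p * weight p))) (∑-*ʳ (2 ℕ.* z) π′ π))))))
        where
        l₃ : ∀ p w k → p * (+ 60 * (w - k)) ≡ + 60 * (p * w - p * k)
        l₃ = solve-∀
        row : ∀ p → ∑[ n < N ] (π p * target n p) ≡ + 60 * (π p * weight p - π p * π′)
        row p = trans (∑-*ˡ N (π p) (λ n → target n p)) (trans (cong (π p *_) (trans (∑-*ˡ N (+ 60) (λ n → A n * (+ p * one p (+ n)) - κ n))
          (cong (+ 60 *_) (∑-- N (λ n → A n * (+ p * one p (+ n))) κ)))) (l₃ (π p) (weight p) π′))
      l₂ : ∀ x e → + 60 * (P * π′) + + 60 * e + + 60 * (x - P * π′) ≡ + 60 * (x + e)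
      l₂ x e = l₄ (P * π′) x e
        where
        l₄ : ∀ a x e → + 60 * a + + 60 * e + + 60 * (x - a) ≡ + 60 * (x + e)
        l₄ = solve-∀

  z⁵ : ℕ
  z⁵ = z³ ℕ.* (z ℕ.* z)

  private
    module Squares {p} (g : Good p) (q : ℕ) where
      pp = proj₁ (good g)

      one-at : ℕ → ℤ
      one-at n = ⟦ n ℕ.<? N ⟧ * one p (+ n)

      -- The multiples of q² up to Y that are 1 modulo p number at most Y / (q² p) + 1. Weighted by
      -- p this is Y / q² + p, and q ≥ z lowers Y / q² to z⁵ / q, whose sum over q is harmonic.
      squares : ∑[ n < N ] (⟦ square? n q ⟧ * (+ p * one p (+ n))) ≤ share z⁵ q + + p
      squares = go (z ℕ.≤? q)
        where
        go : Dec (z ℕ.≤ q) → ∑[ n < N ] (⟦ square? n q ⟧ * (+ p * one p (+ n))) ≤ share z⁵ q + + p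
        go (no z≰q) = ≤-trans (≤-reflexive (∑-zero N λ n _ → trans (cong (_* (+ p * one p (+ n))) (⟦⟧-no (square? n q) (z≰q ∘ proj₁))) (*-zeroˡ (+ p * one p (+ n)))))
          (0≤-+ (0≤share z⁵ q) 0≤+)
        go (yes z≤q) = begin
          ∑[ n < N ] (⟦ square? n q ⟧ * (+ p * one p (+ n)))      ≡⟨ ∑-cong N (λ n n<N → rewrite-term n n<N) ⟩
          ∑[ n < N ] (+ p * (⟦ q² ℕ∣.∣? n ⟧ * one-at n))          ≡⟨ ∑-*ˡ N (+ p) (λ n → ⟦ q² ℕ∣.∣? n ⟧ * one-at n) ⟩
          + p * ∑[ n < N ] (⟦ q² ℕ∣.∣? n ⟧ * one-at n)            ≡⟨ cong (+ p *_) (∑-multiples q² N one-at λ n N≤n → trans (cong (_* one p (+ n)) (⟦⟧-no (n ℕ.<? N) (ℕ.≤⇒≯ N≤n))) (*-zeroˡ (one p (+ n)))) ⟩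
          + p * ∑[ m < N ] one-at (q² ℕ.* m)                      ≡⟨ cong (+ p *_) short ⟩
          + p * ∑[ m < M ] one-at (q² ℕ.* suc m)                  ≤⟨ *-monoˡ {∑[ m < M ] one-at (q² ℕ.* suc m)} {∑[ m < M ] one p (pt (+ q²) m)} {+ p} 0≤+ (∑-mono M λ m _ → drop m) ⟩
          + p * ∑[ m < M ] one p (pt (+ q²) m)                    ≤⟨ one-count pp (+ q²) M ⟩
          + M + + p                                               ≤⟨ +-monoˡ-≤ (+ p) (M-share q z≤q) ⟩
          share z⁵ q + + p                                        ∎
          where
          open ≤-Reasoning
          q² = q ℕ.* q
          0<q = ℕ.<-≤-trans 0<z z≤q
          instance
            q²≢0 : ℕ.NonZero q²
            q²≢0 = ℕ.>-nonZero (ℕ.*-mono-≤ 0<q 0<q)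
          M = Y ℕ./ q²
          l : ∀ a p o → a * (p * o) ≡ p * (a * (1ℤ * o))
          l = solve-∀
          rewrite-term : ∀ n → n ℕ.< N → ⟦ square? n q ⟧ * (+ p * one p (+ n)) ≡ + p * (⟦ q² ℕ∣.∣? n ⟧ * one-at n)
          rewrite-term n n<N = trans (cong (_* (+ p * one p (+ n))) (⟦⟧-cong (square? n q) (q² ℕ∣.∣? n) proj₂ (z≤q ,_)))
            (trans (l ⟦ q² ℕ∣.∣? n ⟧ (+ p) (one p (+ n))) (cong (λ w → + p * (⟦ q² ℕ∣.∣? n ⟧ * (w * one p (+ n)))) (sym (⟦⟧-yes (n ℕ.<? N) n<N))))
          short : ∑[ m < N ] one-at (q² ℕ.* m) ≡ ∑[ m < M ] one-at (q² ℕ.* suc m)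
          short = trans (∑-suc Y (λ m → one-at (q² ℕ.* m))) (trans (cong₂ _+_
              (trans (cong (λ w → ⟦ w ℕ.<? N ⟧ * one p (+ w)) (ℕ.*-zeroʳ q²)) (trans (cong (⟦ 0 ℕ.<? N ⟧ *_) (one-none pp (+ 0) (S.divides 0ℤ refl))) (*-zeroʳ ⟦ 0 ℕ.<? N ⟧)))
              (∑-extend (λ m → one-at (q² ℕ.* suc m)) (ℕ.m/n≤m Y q²) λ m M≤m _ →
                trans (cong (_* one p (+ (q² ℕ.* suc m))) (⟦⟧-no (q² ℕ.* suc m ℕ.<? N) λ small →
                  ℕ.<⇒≱ (ℕ.<-≤-trans (<-suc-quotient Y q²) (ℕ.*-monoʳ-≤ q² (ℕ.s≤s M≤m))) (ℕ.≤-pred small))) (*-zeroˡ (one p (+ (q² ℕ.* suc m))))))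
            (+-identityˡ (∑[ m < M ] one-at (q² ℕ.* suc m))))
          drop : ∀ m → one-at (q² ℕ.* suc m) ≤ one p (pt (+ q²) m)
          drop m = ≤-trans (*-monoʳ {⟦ q² ℕ.* suc m ℕ.<? N ⟧} {1ℤ} {one p (+ (q² ℕ.* suc m))} (0≤one p (+ (q² ℕ.* suc m))) (⟦⟧≤1 (q² ℕ.* suc m ℕ.<? N)))
            (≤-reflexive (trans (*-identityˡ (one p (+ (q² ℕ.* suc m)))) (cong (one p) (trans (pos-* q² (suc m)) (pt-suc (+ q²) m)))))
          M-share : ∀ q → z ℕ.≤ q → .{{_ : ℕ.NonZero (q ℕ.* q)}} → + (Y ℕ./ (q ℕ.* q)) ≤ share z⁵ q
          M-share zero    z≤0 = contradiction z≤0 (ℕ.<⇒≱ 0<z)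
          M-share (suc q) z≤q = +≤+ (ℕ.≤-trans (ℕ./-monoʳ-≤ Y {suc q ℕ.* suc q} {{_}} {{zq≢0}} (ℕ.*-monoˡ-≤ (suc q) z≤q))
            (ℕ.≤-reflexive (trans (ℕ./-congˡ {{zq≢0}} (Y≡ z)) (ℕ.m*n/m*o≡n/o z z⁵ (suc q) {{_}} {{zq≢0}}))))
            where
            zq≢0 : ℕ.NonZero (z ℕ.* suc q)
            zq≢0 = ℕ.>-nonZero (ℕ.*-mono-≤ 0<z (ℕ.s≤s (ℕ.z≤n {q})))
            open import Data.Nat.Tactic.RingSolver as ℕSolver using ()
            Y≡ : ∀ z → z ℕ.* z ℕ.* z ℕ.* (z ℕ.* z ℕ.* z) ≡ z ℕ.* (z ℕ.* z ℕ.* z ℕ.* (z ℕ.* z))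
            Y≡ = ℕSolver.solve-∀

    +p≤2z : ∀ {p} → Good p → + p ≤ + (2 ℕ.* z)
    +p≤2z g = +≤+ (ℕ.<⇒≤ (proj₂ (proj₂ (good g))))

    3h : ℕ
    3h = h ℕ.+ h ℕ.+ h

    z³≤2^3h : z³ ℕ.≤ 2 ℕ.^ 3h
    z³≤2^3h = ℕ.≤-trans (ℕ.*-mono-≤ (ℕ.*-mono-≤ (ℕ.<⇒≤ z<2^h) (ℕ.<⇒≤ z<2^h)) (ℕ.<⇒≤ z<2^h))
      (ℕ.≤-reflexive (sym (trans (ℕ.^-distribˡ-+-* 2 (h ℕ.+ h) h) (cong (ℕ._* 2 ℕ.^ h) (ℕ.^-distribˡ-+-* 2 h h)))))

  Err₂ : ℤ
  Err₂ = + (2 ℕ.* z) + (+ (h ℕ.+ h ℕ.+ h) * + z⁵ + + z³ * + (2 ℕ.* z))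

  private
    weight-≤ : ∀ {p} → Good p → weight p ≤ + p * aps p + Err₂
    weight-≤ {p} g = begin
      ∑[ n < N ] (A n * po n)
        ≡⟨ ∑-cong′ N (λ n → l ⟦ n ℕ.≟ 1 ⟧ (κ n) (sq n) (po n)) ⟩
      ∑[ n < N ] (κ n * po n + (⟦ n ℕ.≟ 1 ⟧ * po n + sq n * po n))
        ≡⟨ trans (∑-+ N (λ n → κ n * po n) (λ n → ⟦ n ℕ.≟ 1 ⟧ * po n + sq n * po n))
             (cong₂ _+_ (trans (∑-cong′ N λ n → l₂ (κ n) (+ p) (one p (+ n))) (∑-*ˡ N (+ p) (λ n → κ n * one p (+ n))))
               (∑-+ N (λ n → ⟦ n ℕ.≟ 1 ⟧ * po n) (λ n → sq n * po n))) ⟩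
      + p * aps p + (∑[ n < N ] (⟦ n ℕ.≟ 1 ⟧ * po n) + ∑[ n < N ] (sq n * po n))
        ≤⟨ +-monoʳ-≤ (+ p * aps p) (+-mono-≤ at-one at-squares) ⟩
      + p * aps p + Err₂ ∎
      where
      open ≤-Reasoning
      po : ℕ → ℤ
      po n = + p * one p (+ n)
      l : ∀ a k s x → (a + k + s) * x ≡ k * x + (a * x + s * x)
      l = solve-∀
      l₂ : ∀ k p o → k * (p * o) ≡ p * (k * o)
      l₂ = solve-∀
      1<N : 1 ℕ.< N
      1<N = ℕ.s≤s (ℕ.*-mono-≤ 0<z³ 0<z³)
      at-one : ∑[ n < N ] (⟦ n ℕ.≟ 1 ⟧ * po n) ≤ + (2 ℕ.* z)
      at-one = ≤-trans (≤-reflexive (trans (∑-single N 1 (λ n → ⟦ n ℕ.≟ 1 ⟧ * po n) 1<N λ n _ n≢1 → ⟦⟧*-zero (n ℕ.≟ 1) (po n) λ e → contradiction e n≢1)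
          (trans (cong (_* po 1) (⟦⟧-yes (1 ℕ.≟ 1) refl)) (*-identityˡ (po 1)))))
        (≤-trans (*-monoˡ {one p (+ 1)} {1ℤ} {+ p} 0≤+ (zer≤1 p (+ 1 - 1ℤ))) (≤-trans (≤-reflexive (*-identityʳ (+ p))) (+p≤2z g)))
      at-squares : ∑[ n < N ] (sq n * po n) ≤ + 3h * + z⁵ + + z³ * + (2 ℕ.* z)
      at-squares = begin
        ∑[ n < N ] (sq n * po n)                                ≡⟨ trans (∑-cong′ N λ n → sym (∑-*ʳ z³ (po n) (λ q → ⟦ square? n q ⟧))) (∑-swap N z³ (λ n q → ⟦ square? n q ⟧ * po n)) ⟩
        ∑[ q < z³ ] ∑[ n < N ] (⟦ square? n q ⟧ * po n)         ≤⟨ ∑-mono z³ (λ q _ → Squares.squares g q) ⟩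
        ∑[ q < z³ ] (share z⁵ q + + p)                          ≡⟨ trans (∑-+ z³ (share z⁵) (λ _ → + p)) (cong (_+_ (∑ z³ (share z⁵))) (∑-const z³ (+ p))) ⟩
        ∑ z³ (share z⁵) + + z³ * + p
          ≤⟨ +-mono-≤ (≤-trans (∑-≤-extend (share z⁵) z³≤2^3h (0≤share z⁵)) (∑-share z⁵ 3h)) (*-monoˡ {+ p} {+ (2 ℕ.* z)} {+ z³} 0≤+ (+p≤2z g)) ⟩
        + 3h * + z⁵ + + z³ * + (2 ℕ.* z) ∎

  -- If the classes prime to p shared the top primes equally, (p - 1) aps p would be π′ for each
  -- good p. So the sum of the p aps p falls short of the expected P π′ by at most the errors, which
  -- is the direction needed to find many pairs.
  progressions : P * π′ ≤ ∑[ p < 2 ℕ.* z ] (π p * (+ p * aps p)) + (P * Err₂ + Err)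
  progressions = ≤-trans averaged (≤-trans (+-monoˡ-≤ Err (≤-trans (∑-mono (2 ℕ.* z) λ p _ → each p)
      (≤-reflexive (trans (∑-+ (2 ℕ.* z) (λ p → π p * (+ p * aps p)) (λ p → π p * Err₂)) (cong (_+_ (∑[ p < 2 ℕ.* z ] (π p * (+ p * aps p)))) (∑-*ʳ (2 ℕ.* z) Err₂ π))))))
      (≤-reflexive (+-assoc (∑[ p < 2 ℕ.* z ] (π p * (+ p * aps p))) (P * Err₂) Err)))
    where
    each : ∀ p → π p * weight p ≤ π p * (+ p * aps p) + π p * Err₂
    each p = go (good? p)
      where
      go : Dec (Good p) → π p * weight p ≤ π p * (+ p * aps p) + π p * Err₂
      go (no ¬g) = ≤-reflexive (trans (cong (_* weight p) (⟦⟧-no (good? p) ¬g)) (trans (*-zeroˡ (weight p)) (sym (trans (cong (λ w → w * (+ p * aps p) + w * Err₂) (⟦⟧-no (good? p) ¬g))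
        (l (+ p * aps p) Err₂)))))
        where
        l : ∀ a b → 0ℤ * a + 0ℤ * b ≡ 0ℤ
        l = solve-∀
      go (yes g) = ≤-trans (*-monoˡ {weight p} {+ p * aps p + Err₂} {π p} (0≤π p) (weight-≤ g)) (≤-reflexive (*-distribˡ-+ (π p) (+ p * aps p) Err₂))

-- Exact prime powers and Legendre's formula.

module Exact where
  open import Data.Nat
  open import Data.Nat.Properties
  open import Data.Nat.Divisibility
  open import Data.Nat.DivMod
  open import Data.Nat.Primality
  open import Data.Nat.Induction using (<-wellFounded)
  open import Data.Nat.Tactic.RingSolver using (solve-∀)
  open import Induction.WellFounded using (Acc; acc)
  open import Data.Product using (∃-syntax; _,_; proj₁; proj₂)
  open import Data.Sum using (inj₁; inj₂)
  open import Relation.Nullary using (Dec; yes; no; ¬_; contradiction)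
  open import Relation.Binary.PropositionalEquality
  open FiniteSums using (tick; tick-yes; tick-no)
  open PrimeDivisors using (prime-factor)

  1<prime : ∀ {p} → Prime p → 1 < p
  1<prime {p} pp = nonTrivial⇒n>1 p {{prime⇒nonTrivial pp}}

  -- The p-adic valuation of m as a relation; keeping the cofactor as data makes it multiplicative
  -- by Euclid's lemma.
  record Exact (p e m : ℕ) : Set where
    constructor exact
    field
      rest  : ℕ
      eq    : m ≡ p ^ e * rest
      p∤rest : ¬ (p ∣ rest)

  exact-* : ∀ {p a b m n} → Prime p → Exact p a m → Exact p b n → Exact p (a + b) (m * n)
  exact-* {p} {a} {b} pp (exact m′ refl p∤m′) (exact n′ refl p∤n′) = exact (m′ * n′) eq p∤m′n′
    where
    l : ∀ x m y n → x * m * (y * n) ≡ x * y * (m * n)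
    l = solve-∀
    eq : p ^ a * m′ * (p ^ b * n′) ≡ p ^ (a + b) * (m′ * n′)
    eq = trans (l (p ^ a) m′ (p ^ b) n′) (cong (_* (m′ * n′)) (sym (^-distribˡ-+-* p a b)))
    p∤m′n′ : ¬ (p ∣ m′ * n′)
    p∤m′n′ h with euclidsLemma m′ n′ pp h
    ... | inj₁ x = p∤m′ x
    ... | inj₂ y = p∤n′ y

  exact-≮ : ∀ {p a b m} → Prime p → Exact p a m → Exact p b m → ¬ (a < b)
  exact-≮ {p} {a} {b} pp (exact m′ m≡ p∤m′) (exact n′ m≡′ _) a<b = p∤m′ (divides (p ^ (b ∸ suc a) * n′)
      (trans (*-cancelˡ-≡ m′ (p ^ suc (b ∸ suc a) * n′) (p ^ a) {{m^n≢0 p a {{prime⇒nonZero pp}}}} (trans (sym m≡) (trans m≡′ eq)))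
        (l p (p ^ (b ∸ suc a)) n′)))
    where
    l : ∀ p x n → p * x * n ≡ x * n * p
    l = solve-∀
    b≡ : b ≡ a + suc (b ∸ suc a)
    b≡ = trans (sym (m+[n∸m]≡n a<b)) (sym (+-suc a (b ∸ suc a)))
    eq : p ^ b * n′ ≡ p ^ a * (p ^ suc (b ∸ suc a) * n′)
    eq = trans (cong (λ k → p ^ k * n′) b≡) (trans (cong (_* n′) (^-distribˡ-+-* p a (suc (b ∸ suc a)))) (*-assoc (p ^ a) (p ^ suc (b ∸ suc a)) n′))

  exact-unique : ∀ {p a b m} → Prime p → Exact p a m → Exact p b m → a ≡ b
  exact-unique pp x y = ≤-antisym (≮⇒≥ (exact-≮ pp y x)) (≮⇒≥ (exact-≮ pp x y))

  exact-exists : ∀ {p} → Prime p → ∀ m → 0 < m → ∃[ e ] Exact p e m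
  exact-exists {p} pp m 0<m = go m 0<m (<-wellFounded m)
    where
    go : ∀ m → 0 < m → Acc _<_ m → ∃[ e ] Exact p e m
    go m 0<m (acc rec) with p ∣? m
    ... | no p∤m = 0 , exact m (sym (*-identityˡ m)) p∤m
    ... | yes (divides k refl) with k | 0<m
    ...   | suc k | _ with go (suc k) (s≤s z≤n) (rec (m<m*n (suc k) p (1<prime pp)))
    ...     | e , exact k′ k≡ p∤k′ = suc e , exact k′ (trans (cong (_* p) k≡) (l p (p ^ e) k′)) p∤k′
      where
      l : ∀ p x k → x * k * p ≡ p * x * k
      l = solve-∀

  ∑ℕ : ℕ → (ℕ → ℕ) → ℕ
  ∑ℕ zero    f = 0
  ∑ℕ (suc n) f = ∑ℕ n f + f n

  ∑ℕ-cong : ∀ n {f g : ℕ → ℕ} → (∀ i → f i ≡ g i) → ∑ℕ n f ≡ ∑ℕ n g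
  ∑ℕ-cong zero    eq = refl
  ∑ℕ-cong (suc n) eq = cong₂ _+_ (∑ℕ-cong n eq) (eq n)

  ∑ℕ-+ : ∀ n (f g : ℕ → ℕ) → ∑ℕ n (λ i → f i + g i) ≡ ∑ℕ n f + ∑ℕ n g
  ∑ℕ-+ zero    f g = refl
  ∑ℕ-+ (suc n) f g = trans (cong (_+ (f n + g n)) (∑ℕ-+ n f g)) (l (∑ℕ n f) (∑ℕ n g) (f n) (g n))
    where
    l : ∀ a b c d → a + b + (c + d) ≡ a + c + (b + d)
    l = solve-∀

  ∑ℕ-zero : ∀ n → ∑ℕ n (λ _ → 0) ≡ 0
  ∑ℕ-zero zero    = refl
  ∑ℕ-zero (suc n) = trans (+-identityʳ (∑ℕ n (λ _ → 0))) (∑ℕ-zero n)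

  ∑ℕ-≤-support : ∀ n j f → (∀ i → f i ≤ 1) → (∀ i → j ≤ i → f i ≡ 0) → ∑ℕ n f ≤ j
  ∑ℕ-≤-support zero    j f ≤1 supp = z≤n
  ∑ℕ-≤-support (suc n) j f ≤1 supp with j ≤? n
  ... | yes j≤n = subst (_≤ j) (sym (trans (cong (∑ℕ n f +_) (supp n j≤n)) (+-identityʳ (∑ℕ n f)))) (∑ℕ-≤-support n j f ≤1 supp)
  ... | no  j≰n = ≤-trans (crude (suc n)) (≰⇒> j≰n)
    where
    crude : ∀ n → ∑ℕ n f ≤ n
    crude zero    = z≤n
    crude (suc n) = ≤-trans (+-mono-≤ (crude n) (≤1 n)) (≤-reflexive (+-comm n 1))

  n<p^n : ∀ {p} → 1 < p → ∀ n → n < p ^ n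
  n<p^n 1<p zero    = s≤s z≤n
  n<p^n {p} 1<p (suc n) = <-≤-trans (s≤s (n<p^n 1<p n)) (≤-trans (+-monoˡ-≤ (p ^ n) (m^n>0 p {{>-nonZero (<-trans (s≤s z≤n) 1<p)}} n))
    (≤-trans (≤-reflexive (l (p ^ n))) (*-monoˡ-≤ (p ^ n) 1<p)))
    where
    l : ∀ x → x + x ≡ 2 * x
    l = solve-∀

  -- Exactly the powers p , ... , pᵉ divide m, so the exponent is counted by divisibility ticks,
  -- capped at I.
  exact-∑ : ∀ {p e m} → Prime p → Exact p e m → ∀ I → ∑ℕ I (λ i → tick (p ^ suc i ∣? m)) ≡ e ⊓ I
  exact-∑ {p} {e} pp ex zero = sym (⊓-zeroʳ e)
  exact-∑ {p} {e} {m} pp ex@(exact m′ m≡ p∤m′) (suc I) with I <? e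
  ... | yes I<e = trans (cong₂ _+_ (trans (exact-∑ pp ex I) (m≥n⇒m⊓n≡n (<⇒≤ I<e))) (tick-yes (p ^ suc I ∣? m) (∣-trans (m≤n⇒p^m∣p^n I<e) (divides m′ (trans m≡ (*-comm (p ^ e) m′))))))
      (trans (+-comm I 1) (sym (m≥n⇒m⊓n≡n I<e)))
    where
    m≤n⇒p^m∣p^n : ∀ {a b} → a ≤ b → p ^ a ∣ p ^ b
    m≤n⇒p^m∣p^n {a} {b} a≤b = subst (λ k → p ^ a ∣ p ^ k) (m+[n∸m]≡n a≤b) (subst (p ^ a ∣_) (sym (^-distribˡ-+-* p a (b ∸ a))) (m∣m*n (p ^ (b ∸ a))))
  ... | no  I≮e = trans (cong₂ _+_ (trans (exact-∑ pp ex I) (m≤n⇒m⊓n≡m (≮⇒≥ I≮e))) (tick-no (p ^ suc I ∣? m) no-divisor))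
      (trans (+-identityʳ e) (sym (m≤n⇒m⊓n≡m (m≤n⇒m≤1+n (≮⇒≥ I≮e)))))
    where
    instance _ = prime⇒nonZero pp
    no-divisor : ¬ (p ^ suc I ∣ m)
    no-divisor h = p∤m′ (∣-trans (divides (p ^ (I ∸ e)) (*-comm p (p ^ (I ∸ e)))) (*-cancelˡ-∣ (p ^ e) {{m^n≢0 p e}}
        (subst₂ _∣_ (trans (cong (p ^_) (sym (trans (+-suc e (I ∸ e)) (cong suc (m+[n∸m]≡n (≮⇒≥ I≮e)))))) (^-distribˡ-+-* p e (suc (I ∸ e)))) m≡ h)))

  -- The increments of ⌊n / d⌋ are the indicators of d ∣ n + 1, which is what makes Legendre's
  -- formula an induction on n.
  div-suc : ∀ n d .{{_ : NonZero d}} → suc n / d ≡ n / d + tick (d ∣? suc n)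
  div-suc n d = go (suc r <? d)
    where
    r = n % d
    q = n / d
    n≡ : suc n ≡ suc r + q * d
    n≡ = cong suc (m≡m%n+[m/n]*n n d)
    split : suc n / d ≡ suc r / d + q
    split = trans (/-congˡ {o = d} n≡) (trans (+-distrib-/-∣ʳ (suc r) (n∣m*n q)) (cong (suc r / d +_) (m*n/n≡m q d)))
    go : Dec (suc r < d) → suc n / d ≡ n / d + tick (d ∣? suc n)
    go (yes small) = trans split (trans (cong (_+ q) (m<n⇒m/n≡0 small)) (trans (sym (+-identityʳ q)) (cong (q +_) (sym (tick-no (d ∣? suc n) λ d∣ →
      contradiction (∣⇒≤ (∣m+n∣m⇒∣n (subst (d ∣_) (trans n≡ (+-comm (suc r) (q * d))) d∣) (n∣m*n q))) (<⇒≱ small))))))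
    go (no large) = trans split (trans (cong (_+ q) (trans (/-congˡ {o = d} 1+r≡d) (n/n≡1 d))) (trans (+-comm 1 q) (cong (q +_) (sym (tick-yes (d ∣? suc n)
        (subst (d ∣_) (sym n≡) (∣m∣n⇒∣m+n (∣-reflexive (sym 1+r≡d)) (n∣m*n q))))))))
      where
      1+r≡d : suc r ≡ d
      1+r≡d = ≤-antisym (m%n<n n d) (≮⇒≥ large)

  legendre : ∀ p .{{_ : NonZero p}} → ℕ → ℕ → ℕ
  legendre p I n = ∑ℕ I (λ i → _/_ n (p ^ suc i) {{m^n≢0 p (suc i)}})

  -- Legendre's formula with I terms for some I ≥ n; the range suffices because pᵉ > e, so no
  -- exponent of a number up to n exceeds I.
  exact-! : ∀ {p} (pp : Prime p) I n → n ≤ I → Exact p (legendre p {{prime⇒nonZero pp}} I n) (n !)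
  exact-! {p} pp I zero    _   = subst (λ e → Exact p e 1) (sym zero-sum) (exact 1 refl λ p∣1 → <⇒≢ (1<prime pp) (sym (∣1⇒≡1 p∣1)))
    where
    instance _ = prime⇒nonZero pp
    zero-sum : legendre p I 0 ≡ 0
    zero-sum = trans (∑ℕ-cong I λ i → 0/n≡0 (p ^ suc i) {{m^n≢0 p (suc i)}}) (∑ℕ-zero I)
  exact-! {p} pp I (suc n) n<I = subst (λ e → Exact p e (suc n * n !)) eq (exact-* pp (proj₂ ex) (exact-! pp I n (<⇒≤ n<I)))
    where
    instance _ = prime⇒nonZero pp
    ex = exact-exists pp (suc n) (s≤s z≤n)
    e = proj₁ ex
    instance
      m′≢0 : NonZero (Exact.rest (proj₂ ex))
      m′≢0 = ≢-nonZero λ m′≡0 → contradiction (trans (Exact.eq (proj₂ ex)) (trans (cong (p ^ e *_) m′≡0) (*-zeroʳ (p ^ e)))) λ ()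
    e≤I : e ≤ I
    e≤I = ≤-trans (<⇒≤ (n<p^n (1<prime pp) e)) (≤-trans (m≤m*n (p ^ e) (Exact.rest (proj₂ ex))) (≤-trans (≤-reflexive (sym (Exact.eq (proj₂ ex)))) n<I))
    eq : e + legendre p I n ≡ legendre p I (suc n)
    eq = trans (cong (_+ legendre p I n) (trans (sym (m≤n⇒m⊓n≡m e≤I)) (sym (exact-∑ pp (proj₂ ex) I))))
      (trans (+-comm (∑ℕ I (λ i → tick (p ^ suc i ∣? suc n))) (legendre p I n))
        (trans (sym (∑ℕ-+ I (λ i → _/_ n (p ^ suc i) {{m^n≢0 p (suc i)}}) (λ i → tick (p ^ suc i ∣? suc n))))
          (∑ℕ-cong I λ i → sym (div-suc n (p ^ suc i) {{m^n≢0 p (suc i)}}))))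

  ∏ : ℕ → (ℕ → ℕ) → ℕ
  ∏ zero    g = 1
  ∏ (suc n) g = ∏ n g * g n

  -- The number m is the product of its exact prime powers, split off from the largest prime
  -- downwards. Requiring 1 ≤ g p lets g be given on all numbers and not only on the primes that
  -- occur.
  prime-power-bound : ∀ N m (g : ℕ → ℕ) → 0 < m → (∀ p → 1 ≤ g p) → (∀ {p} → Prime p → p ∣ m → p < N) →
                      (∀ {p e} → Prime p → Exact p e m → p ^ e ≤ g p) → m ≤ ∏ N g
  prime-power-bound zero m g 0<m 1≤g below bound with m ≤? 1
  ... | yes m≤1 = m≤1
  ... | no  m≰1 with prime-factor m (≰⇒> m≰1)
  ...   | p , pp , p∣m = contradiction (below pp p∣m) λ ()
  prime-power-bound (suc N) m g 0<m 1≤g below bound with prime? N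
  ... | no ¬pN = ≤-trans (prime-power-bound N m g 0<m 1≤g (λ {p} pp p∣m → ≤∧≢⇒< (≤-pred (below pp p∣m)) λ { refl → ¬pN pp }) bound)
                   (m≤m*n (∏ N g) (g N) {{>-nonZero (1≤g N)}})
  ... | yes pN with exact-exists pN m 0<m
  ...   | e , exact m′ m≡ N∤m′ = ≤-trans (≤-reflexive (trans m≡ (*-comm (N ^ e) m′))) (*-mono-≤
            (prime-power-bound N m′ g 0<m′ 1≤g (λ {p} pp p∣m′ → ≤∧≢⇒< (≤-pred (below pp (∣-trans p∣m′ m′∣m))) λ { refl → N∤m′ p∣m′ }) bound′)
            (bound {N} {e} pN (exact m′ m≡ N∤m′)))
    where
    m′∣m : m′ ∣ m
    m′∣m = divides (N ^ e) m≡
    0<m′ : 0 < m′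
    0<m′ = n≢0⇒n>0 λ m′≡0 → <⇒≢ 0<m (sym (trans m≡ (trans (cong (N ^ e *_) m′≡0) (*-zeroʳ (N ^ e)))))
    bound′ : ∀ {p f} → Prime p → Exact p f m′ → p ^ f ≤ g p
    bound′ {p} {f} pp (exact k m′≡ p∤k) with p ≟ N
    ... | yes refl with f
    ...   | zero  = 1≤g p
    ...   | suc f = contradiction (subst (p ∣_) (sym m′≡) (∣m⇒∣m*n k (m∣m*n (p ^ f)))) N∤m′
    bound′ {p} {f} pp (exact k m′≡ p∤k) | no p≢N = bound {p} {f} pp (exact (N ^ e * k) eq p∤)
      where
      l : ∀ x y k → x * (y * k) ≡ y * (x * k)
      l = solve-∀
      eq : m ≡ p ^ f * (N ^ e * k)
      eq = trans m≡ (trans (cong (N ^ e *_) m′≡) (l (N ^ e) (p ^ f) k))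
      p∤ : ¬ (p ∣ N ^ e * k)
      p∤ h with euclidsLemma (N ^ e) k pp h
      ... | inj₂ p∣k = p∤k p∣k
      ... | inj₁ p∣N^e = p≢N (divides-power e p∣N^e)
        where
        divides-power : ∀ e → p ∣ N ^ e → p ≡ N
        divides-power zero    p∣1 = contradiction (∣1⇒≡1 p∣1) (>⇒≢ (1<prime pp))
        divides-power (suc e) h with euclidsLemma N (N ^ e) pp h
        ... | inj₂ r = divides-power e r
        ... | inj₁ p∣N with prime⇒irreducible pN p∣N
        ...   | inj₁ p≡1 = contradiction p≡1 (>⇒≢ (1<prime pp))
        ...   | inj₂ p≡N = p≡N

-- Chebyshev's bounds by central binomial coefficients.

module Chebyshev where
  open import Data.Nat
  open import Data.Nat.Properties
  open import Data.Nat.Divisibility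
  open import Data.Nat.DivMod
  open import Data.Nat.Primality
  open import Data.Nat.Combinatorics
  open import Data.Nat.Induction using (<-wellFounded)
  open import Data.Nat.Tactic.RingSolver using (solve-∀)
  open import Induction.WellFounded using (Acc; acc)
  open import Data.Product using (∃-syntax; _×_; _,_; proj₁; proj₂)
  open import Data.Sum using (_⊎_; inj₁; inj₂)
  open import Relation.Nullary using (Dec; yes; no; ¬_; contradiction)
  open import Relation.Nullary.Decidable using (_×-dec_)
  open import Relation.Binary.PropositionalEquality
  open FiniteSums using (tick; tick-yes; tick-no; count)
  open Residues using (prime-coprime)
  open PrimeDivisors using (coprime-*∣)
  open Exact

  CB : ℕ → ℕ
  CB n = (2 * n) C n

  CB-! : ∀ n → CB n * (n ! * n !) ≡ (2 * n) !
  CB-! n = trans (cong (_* (n ! * n !)) (nCk≡n!/k![n-k]! n≤2n)) (trans (cong ((2 * n) ! / (n ! * (2 * n ∸ n) !) *_) (cong (λ k → n ! * k !) (sym 2n∸n≡n)))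
      (m/n*n≡m (k![n∸k]!∣n! n≤2n)))
    where
    n≤2n : n ≤ 2 * n
    n≤2n = m≤m+n n (n + 0)
    2n∸n≡n : 2 * n ∸ n ≡ n
    2n∸n≡n = trans (m+n∸m≡n n (n + 0)) (+-identityʳ n)
    instance
      _ = (n !* (2 * n ∸ n) !≢0)

  CB-suc : ∀ n → CB (suc n) * suc n ≡ 2 * (2 * n + 1) * CB n
  CB-suc n = *-cancelʳ-≡ (CB (suc n) * suc n) (2 * (2 * n + 1) * CB n) (suc n * (n ! * n !)) (begin
    CB (suc n) * suc n * (suc n * (n ! * n !))             ≡⟨ l₁ (CB (suc n)) (suc n) (n !) ⟩
    CB (suc n) * (suc n ! * suc n !)                       ≡⟨ CB-! (suc n) ⟩
    (2 * suc n) !                                          ≡⟨ cong _! (l₂ n) ⟩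
    suc (suc (2 * n)) * (suc (2 * n) * (2 * n) !)          ≡⟨ cong (λ w → suc (suc (2 * n)) * (suc (2 * n) * w)) (sym (CB-! n)) ⟩
    suc (suc (2 * n)) * (suc (2 * n) * (CB n * (n ! * n !))) ≡⟨ l₃ n (CB n) (n ! * n !) ⟩
    2 * (2 * n + 1) * CB n * (suc n * (n ! * n !))         ∎)
    where
    open ≡-Reasoning
    instance
      nz : NonZero (suc n * (n ! * n !))
      nz = m*n≢0 (suc n) (n ! * n !) {{_}} {{m*n≢0 (n !) (n !) {{n !≢0}} {{n !≢0}}}}
    l₁ : ∀ c s f → c * s * (s * (f * f)) ≡ c * (s * f * (s * f))
    l₁ = solve-∀
    l₂ : ∀ n → 2 * suc n ≡ suc (suc (2 * n))
    l₂ = solve-∀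
    l₃ : ∀ n c f → suc (suc (2 * n)) * (suc (2 * n) * (c * f)) ≡ 2 * (2 * n + 1) * c * (suc n * f)
    l₃ = solve-∀

  4^n≤2nCB : ∀ n → 4 ^ suc n ≤ 2 * suc n * CB (suc n)
  4^n≤2nCB zero    = ≤-refl
  4^n≤2nCB (suc n) = begin
    4 * 4 ^ suc n                              ≤⟨ *-monoʳ-≤ 4 (4^n≤2nCB n) ⟩
    4 * (2 * suc n * CB (suc n))               ≤⟨ m≤m+n (4 * (2 * suc n * CB (suc n))) (4 * CB (suc n)) ⟩
    4 * (2 * suc n * CB (suc n)) + 4 * CB (suc n) ≡⟨ l (suc n) (CB (suc n)) ⟩
    2 * (2 * (2 * suc n + 1) * CB (suc n))     ≡⟨ cong (2 *_) (sym (CB-suc (suc n))) ⟩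
    2 * (CB (suc (suc n)) * suc (suc n))       ≡⟨ l₂ (CB (suc (suc n))) (suc (suc n)) ⟩
    2 * suc (suc n) * CB (suc (suc n))         ∎
    where
    open ≤-Reasoning
    l : ∀ n c → 4 * (2 * n * c) + 4 * c ≡ 2 * (2 * (2 * n + 1) * c)
    l = solve-∀
    l₂ : ∀ c n → 2 * (c * n) ≡ 2 * n * c
    l₂ = solve-∀

  CB≤ : ∀ n → CB (suc n) ≤ 2 * 4 ^ n
  CB≤ zero    = ≤-refl
  CB≤ (suc n) = *-cancelʳ-≤ (CB (suc (suc n))) (2 * 4 ^ suc n) (suc (suc n)) (begin
    CB (suc (suc n)) * suc (suc n)             ≡⟨ CB-suc (suc n) ⟩
    2 * (2 * suc n + 1) * CB (suc n)           ≤⟨ *-monoʳ-≤ (2 * (2 * suc n + 1)) (CB≤ n) ⟩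
    2 * (2 * suc n + 1) * (2 * 4 ^ n)          ≤⟨ m≤m+n (2 * (2 * suc n + 1) * (2 * 4 ^ n)) (4 * 4 ^ n) ⟩
    2 * (2 * suc n + 1) * (2 * 4 ^ n) + 4 * 4 ^ n ≡⟨ l n (4 ^ n) ⟩
    2 * 4 ^ suc n * suc (suc n)                ∎)
    where
    open ≤-Reasoning
    l : ∀ n x → 2 * (2 * suc n + 1) * (2 * x) + 4 * x ≡ 2 * (4 * x) * suc (suc n)
    l = solve-∀

  0<CB : ∀ n → 0 < CB n
  0<CB n = n≢0⇒n>0 λ CB≡0 → ≢-nonZero⁻¹ ((2 * n) !) {{(2 * n) !≢0}} (trans (sym (CB-! n)) (cong (_* (n ! * n !)) CB≡0))

  prime-∤-! : ∀ {p} → Prime p → ∀ n → n < p → ¬ (p ∣ n !)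
  prime-∤-! pp zero    _   p∣1 = contradiction (∣1⇒≡1 p∣1) (>⇒≢ (1<prime pp))
  prime-∤-! pp (suc n) n<p p∣ with euclidsLemma (suc n) (n !) pp p∣
  ... | inj₁ p∣1+n = contradiction (∣⇒≤ p∣1+n) (<⇒≱ n<p)
  ... | inj₂ p∣n!  = prime-∤-! pp n (<-trans (n<1+n n) n<p) p∣n!

  ∣-! : ∀ m n → 0 < m → m ≤ n → m ∣ n !
  ∣-! m zero    0<m m≤0 = contradiction m≤0 (<⇒≱ 0<m)
  ∣-! m (suc n) 0<m m≤1+n with m ≟ suc n
  ... | yes refl = m∣m*n (n !)
  ... | no  m≢   = ∣n⇒∣m*n (suc n) (∣-! m n 0<m (≤-pred (≤∧≢⇒< m≤1+n m≢)))

  -- The prime p occurs in (2 n)! but not in n!, since n < p ≤ 2 n.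
  prime-∣-CB : ∀ {p} → Prime p → ∀ n → n < p → p ≤ 2 * n → p ∣ CB n
  prime-∣-CB {p} pp n n<p p≤2n with euclidsLemma (CB n) (n ! * n !) pp (subst (p ∣_) (sym (CB-! n)) (∣-! p (2 * n) (<-trans (s≤s z≤n) (1<prime pp)) p≤2n))
  ... | inj₁ h = h
  ... | inj₂ h with euclidsLemma (n !) (n !) pp h
  ...   | inj₁ h = contradiction h (prime-∤-! pp n n<p)
  ...   | inj₂ h = contradiction h (prime-∤-! pp n n<p)

  -- The factor p or 1, so that a product over a range becomes the product of the selected p.
  sel : ∀ {Q : ℕ → Set} → (∀ p → Dec (Q p)) → ℕ → ℕ
  sel Q? p = p ^ tick (Q? p)

  sel-yes : ∀ {Q : ℕ → Set} (Q? : ∀ p → Dec (Q p)) p → Q p → sel Q? p ≡ p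
  sel-yes Q? p q = trans (cong (p ^_) (tick-yes (Q? p) q)) (*-identityʳ p)

  sel-no : ∀ {Q : ℕ → Set} (Q? : ∀ p → Dec (Q p)) p → ¬ Q p → sel Q? p ≡ 1
  sel-no Q? p ¬q = cong (p ^_) (tick-no (Q? p) ¬q)

  ∏-∣ : ∀ {Q : ℕ → Set} (Q? : ∀ p → Dec (Q p)) m → (∀ {p} → Q p → Prime p × p ∣ m) → ∀ N →
        ∏ N (sel Q?) ∣ m × (∀ {p} → Prime p → p ∣ ∏ N (sel Q?) → p < N)
  ∏-∣ Q? m spec zero = 1∣ m , λ pp p∣1 → contradiction (∣1⇒≡1 p∣1) (>⇒≢ (1<prime pp))
  ∏-∣ {Q} Q? m spec (suc N) = go (Q? N)
    where
    ih = ∏-∣ Q? m spec N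
    d = ∏ N (sel Q?)
    go : Dec (Q N) → d * sel Q? N ∣ m × (∀ {p} → Prime p → p ∣ d * sel Q? N → p < suc N)
    go (no ¬q) = subst (λ w → d * w ∣ m × (∀ {p} → Prime p → p ∣ d * w → p < suc N)) (sym (sel-no Q? N ¬q))
      (subst (_∣ m) (sym (*-identityʳ d)) (proj₁ ih) , λ {p} pp h → m<n⇒m<1+n (proj₂ ih pp (subst (p ∣_) (*-identityʳ d) h)))
    go (yes q) = subst (λ w → d * w ∣ m × (∀ {p} → Prime p → p ∣ d * w → p < suc N)) (sym (sel-yes Q? N q))
        (coprime-*∣ (λ (x , y) → prime-coprime pN (λ N∣d → <-irrefl refl (proj₂ ih pN N∣d)) (y , x)) (proj₁ ih) (proj₂ (spec q)) , below)
      where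
      pN = proj₁ (spec q)
      below : ∀ {p} → Prime p → p ∣ d * N → p < suc N
      below pp h with euclidsLemma d N pp h
      ... | inj₁ p∣d = m<n⇒m<1+n (proj₂ ih pp p∣d)
      ... | inj₂ p∣N = s≤s (∣⇒≤ {{prime⇒nonZero pN}} p∣N)

  ∏-mono : ∀ N {f g : ℕ → ℕ} → (∀ i → i < N → f i ≤ g i) → ∏ N f ≤ ∏ N g
  ∏-mono zero    le = ≤-refl
  ∏-mono (suc N) le = *-mono-≤ (∏-mono N λ i i<N → le i (m<n⇒m<1+n i<N)) (le N (n<1+n N))

  ∏-* : ∀ N (f g : ℕ → ℕ) → ∏ N (λ i → f i * g i) ≡ ∏ N f * ∏ N g
  ∏-* zero    f g = refl
  ∏-* (suc N) f g = trans (cong (_* (f N * g N)) (∏-* N f g)) (l (∏ N f) (∏ N g) (f N) (g N))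
    where
    l : ∀ a b c d → a * b * (c * d) ≡ a * c * (b * d)
    l = solve-∀

  ∏-ext : ∀ a b f → a ≤ b → (∀ i → a ≤ i → i < b → f i ≡ 1) → ∏ b f ≡ ∏ a f
  ∏-ext zero zero f _ _ = refl
  ∏-ext a (suc b) f a≤1+b ones with a ≟ suc b
  ... | yes refl = refl
  ... | no  a≢   = trans (cong₂ _*_ (∏-ext a b f a≤b λ i a≤i i<b → ones i a≤i (m<n⇒m<1+n i<b)) (ones b a≤b (n<1+n b))) (*-identityʳ (∏ a f))
    where
    a≤b : a ≤ b
    a≤b = ≤-pred (≤∧≢⇒< a≤1+b a≢)

  primorial : ℕ → ℕ
  primorial n = ∏ (suc n) (sel prime?)

  private
    between? : ∀ a b p → Dec (Prime p × a < p × p ≤ b)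
    between? a b p = prime? p ×-dec (a <? p ×-dec p ≤? b)

  1≤sel : ∀ {Q : ℕ → Set} (Q? : ∀ p → Dec (Q p)) → (∀ {p} → Q p → Prime p) → ∀ p → 1 ≤ sel Q? p
  1≤sel {Q} Q? spec p = go (Q? p)
    where
    go : Dec (Q p) → 1 ≤ sel Q? p
    go (yes q) = ≤-trans (<⇒≤ (1<prime (spec q))) (≤-reflexive (sym (sel-yes Q? p q)))
    go (no ¬q) = ≤-reflexive (sym (sel-no Q? p ¬q))

  primorial-split : ∀ a b → a ≤ b → primorial b ≤ primorial a * ∏ (suc b) (sel (between? a b))
  primorial-split a b a≤b = begin
    ∏ (suc b) (sel prime?)                                  ≤⟨ ∏-mono (suc b) each ⟩
    ∏ (suc b) (λ p → sel low? p * sel (between? a b) p)     ≡⟨ ∏-* (suc b) (sel low?) (sel (between? a b)) ⟩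
    ∏ (suc b) (sel low?) * ∏ (suc b) (sel (between? a b))   ≡⟨ cong (_* ∏ (suc b) (sel (between? a b))) (∏-ext (suc a) (suc b) (sel low?) (s≤s a≤b) λ p a<p _ → sel-no low? p λ (_ , p≤a) → <⇒≱ a<p p≤a) ⟩
    ∏ (suc a) (sel low?) * ∏ (suc b) (sel (between? a b))   ≤⟨ *-monoˡ-≤ (∏ (suc b) (sel (between? a b))) (∏-mono (suc a) λ p _ → drop p) ⟩
    primorial a * ∏ (suc b) (sel (between? a b))            ∎
    where
    open ≤-Reasoning
    low? : ∀ p → Dec (Prime p × p ≤ a)
    low? p = prime? p ×-dec p ≤? a
    drop : ∀ p → sel low? p ≤ sel prime? p
    drop p = go (low? p)
      where
      go : Dec (Prime p × p ≤ a) → sel low? p ≤ sel prime? p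
      go (yes (pp , p≤a)) = ≤-reflexive (trans (sel-yes low? p (pp , p≤a)) (sym (sel-yes prime? p pp)))
      go (no h) = ≤-trans (≤-reflexive (sel-no low? p h)) (1≤sel prime? (λ pp → pp) p)
    each : ∀ p → p < suc b → sel prime? p ≤ sel low? p * sel (between? a b) p
    each p p≤b = go (prime? p) (p ≤? a)
      where
      one₁ = 1≤sel low? proj₁ p
      one₂ = 1≤sel (between? a b) proj₁ p
      go : Dec (Prime p) → Dec (p ≤ a) → sel prime? p ≤ sel low? p * sel (between? a b) p
      go (no ¬pp) _ = ≤-trans (≤-reflexive (sel-no prime? p ¬pp)) (*-mono-≤ one₁ one₂)
      go (yes pp) (yes p≤a) = ≤-trans (≤-reflexive (trans (sel-yes prime? p pp) (sym (sel-yes low? p (pp , p≤a))))) (m≤m*n (sel low? p) (sel (between? a b) p) {{>-nonZero one₂}})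
      go (yes pp) (no p≰a) = ≤-trans (≤-reflexive (trans (sel-yes prime? p pp) (sym (sel-yes (between? a b) p (pp , ≰⇒> p≰a , ≤-pred p≤b))))) (m≤n*m (sel (between? a b) p) (sel low? p) {{>-nonZero one₁}})

  -- The middle binomial coefficient of an odd number. It is half of the next central one, and this
  -- halving keeps the odd step of the primorial bound at a power of 4.
  MB : ℕ → ℕ
  MB n = suc (2 * n) C n

  CB≡2MB : ∀ n → CB (suc n) ≡ 2 * MB n
  CB≡2MB n = trans (cong (_C suc n) (l n)) (trans (sym (nCk+nC[k+1]≡[n+1]C[k+1] (suc (2 * n)) n))
      (trans (cong (MB n +_) symm) (cong (MB n +_) (sym (+-identityʳ (MB n))))))
    where
    l : ∀ n → 2 * suc n ≡ suc (suc (2 * n))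
    l = solve-∀
    symm : suc (2 * n) C suc n ≡ MB n
    symm = trans (nCk≡nC[n∸k] {suc n} {suc (2 * n)} (s≤s (m≤m+n n (n + 0)))) (cong (suc (2 * n) C_) (trans (m+n∸m≡n n (n + 0)) (+-identityʳ n)))

  -- Erdős's induction: the primes in the upper half of the range divide a middle binomial
  -- coefficient, which is a power of 4 at most, and the lower half is handled by the induction
  -- hypothesis. Odd numbers use `MB`, because the central coefficient would be too large by a
  -- factor 2.
  primorial-≤ : ∀ n → primorial n ≤ 4 ^ n
  primorial-≤ n = go n (<-wellFounded n)
    where
    halve : ∀ n → ∃[ k ] (n ≡ 2 * k ⊎ n ≡ suc (2 * k))
    halve zero = 0 , inj₁ refl
    halve (suc n) with halve n
    ... | k , inj₁ refl = k , inj₂ refl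
    ... | k , inj₂ refl = suc k , inj₁ (l k)
      where
      l : ∀ k → suc (suc (2 * k)) ≡ 2 * suc k
      l = solve-∀
    small : ∀ n → n < 2 → primorial n ≤ 1
    small n n<2 = ≤-reflexive (trans (∏-ext 0 (suc n) (sel prime?) z≤n λ p _ p<1+n → sel-no prime? p λ pp →
      <⇒≱ (1<prime pp) (≤-trans (≤-pred p<1+n) (≤-pred n<2))) refl)
    go : ∀ n → Acc _<_ n → primorial n ≤ 4 ^ n
    go n (acc rec) with halve n
    ... | zero  , inj₁ refl = small 0 (s≤s z≤n)
    ... | suc k , inj₁ refl = begin
      primorial (2 * suc k)                                         ≤⟨ primorial-split (suc k) (2 * suc k) (m≤m+n (suc k) (suc k + 0)) ⟩
      primorial (suc k) * ∏ (suc (2 * suc k)) (sel (between? (suc k) (2 * suc k)))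
        ≤⟨ *-mono-≤ (go (suc k) (rec (m<m+n (suc k) (s≤s z≤n)))) (∣⇒≤ {{>-nonZero (0<CB (suc k))}} (proj₁ (∏-∣ (between? (suc k) (2 * suc k)) (CB (suc k)) (λ (pp , lo , hi) → pp , prime-∣-CB pp (suc k) lo hi) (suc (2 * suc k))))) ⟩
      4 ^ suc k * CB (suc k)                                        ≤⟨ *-monoʳ-≤ (4 ^ suc k) (≤-trans (CB≤ k) (*-monoˡ-≤ (4 ^ k) {2} {4} (s≤s (s≤s z≤n)))) ⟩
      4 ^ suc k * 4 ^ suc k                                         ≡⟨ trans (sym (^-distribˡ-+-* 4 (suc k) (suc k))) (cong (4 ^_) (cong (suc k +_) (sym (+-identityʳ (suc k))))) ⟩
      4 ^ (2 * suc k) ∎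
      where open ≤-Reasoning
    ... | zero  , inj₂ refl = ≤-trans (small 1 (s≤s (s≤s z≤n))) (s≤s z≤n)
    ... | suc k , inj₂ refl = begin
      primorial m                                                   ≤⟨ primorial-split (suc (suc k)) m 2+k≤m ⟩
      primorial (suc (suc k)) * ∏ (suc m) (sel (between? (suc (suc k)) m))
        ≤⟨ *-mono-≤ (go (suc (suc k)) (rec (s≤s 2+k≤2k))) (∣⇒≤ {{>-nonZero 0<MB}} (proj₁ (∏-∣ (between? (suc (suc k)) m) (MB (suc k)) divides-MB (suc m)))) ⟩
      4 ^ suc (suc k) * MB (suc k)                                  ≤⟨ *-monoʳ-≤ (4 ^ suc (suc k)) MB≤ ⟩
      4 ^ suc (suc k) * 4 ^ suc k                                   ≡⟨ trans (sym (^-distribˡ-+-* 4 (suc (suc k)) (suc k))) (cong (4 ^_) (l k)) ⟩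
      4 ^ m ∎
      where
      open ≤-Reasoning
      m = suc (2 * suc k)
      l : ∀ k → suc (suc k) + suc k ≡ suc (2 * suc k)
      l = solve-∀
      2+k≤2k : suc (suc k) ≤ 2 * suc k
      2+k≤2k = s≤s (≤-trans (≤-reflexive (+-comm 1 k)) (+-monoʳ-≤ k (s≤s z≤n)))
      2+k≤m : suc (suc k) ≤ m
      2+k≤m = m≤n⇒m≤1+n 2+k≤2k
      MB≤ : MB (suc k) ≤ 4 ^ suc k
      MB≤ = *-cancelˡ-≤ 2 (subst (_≤ 2 * 4 ^ suc k) (CB≡2MB (suc k)) (CB≤ (suc k)))
      0<MB : 0 < MB (suc k)
      0<MB = n≢0⇒n>0 λ z → >⇒≢ (0<CB (suc (suc k))) (trans (CB≡2MB (suc k)) (cong (2 *_) z))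
      l₂ : ∀ k → suc (suc (2 * suc k)) ≡ 2 * suc (suc k)
      l₂ = solve-∀
      divides-MB : ∀ {p} → Prime p × suc (suc k) < p × p ≤ m → Prime p × p ∣ MB (suc k)
      divides-MB {p} (pp , lo , hi) with euclidsLemma 2 (MB (suc k)) pp (subst (p ∣_) (CB≡2MB (suc k)) (prime-∣-CB pp (suc (suc k)) lo (≤-trans hi (≤-trans (n≤1+n m) (≤-reflexive (l₂ k))))))
      ... | inj₁ p∣2 = contradiction (∣⇒≤ p∣2) (<⇒≱ (≤-trans (s≤s (s≤s (s≤s z≤n))) lo))
      ... | inj₂ h   = pp , h

  double-/ : ∀ n d .{{_ : NonZero d}} → 2 * n / d ≡ n / d + n / d + 2 * (n % d) / d
  double-/ n d = trans (/-congˡ {o = d} (trans (cong (2 *_) (m≡m%n+[m/n]*n n d)) (l (n % d) (n / d) d)))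
      (trans (+-distrib-/-∣ʳ (2 * (n % d)) (n∣m*n (n / d + n / d))) (trans (cong (2 * (n % d) / d +_) (m*n/n≡m (n / d + n / d) d)) (+-comm (2 * (n % d) / d) (n / d + n / d))))
    where
    l : ∀ r q d → 2 * (r + q * d) ≡ 2 * r + (q + q) * d
    l = solve-∀

  module Exponent {p} (pp : Prime p) (n : ℕ) where
    instance
      p≢0 = prime⇒nonZero pp

    -- Whether doubling n carries at d.
    carryAt : ∀ d .{{_ : NonZero d}} → ℕ
    carryAt d = 2 * (n % d) / d

    carry : ℕ → ℕ
    carry i = carryAt (p ^ suc i) {{m^n≢0 p (suc i)}}

    carryAt≤1 : ∀ d .{{_ : NonZero d}} → carryAt d ≤ 1
    carryAt≤1 d = ≤-pred (m<n*o⇒m/o<n {2 * (n % d)} {2} {d} (*-monoʳ-< 2 (m%n<n n d)))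

    carry≤1 : ∀ i → carry i ≤ 1
    carry≤1 i = carryAt≤1 (p ^ suc i) {{m^n≢0 p (suc i)}}

    part : ℕ → ℕ
    part i = _/_ n (p ^ suc i) {{m^n≢0 p (suc i)}}

    -- Kummer's theorem: Legendre's formula for (2 n)! exceeds twice the one for n! by one unit for
    -- every carry in the addition n + n in base p.
    exact-CB : ∀ {e} → Exact p e (CB n) → e ≡ ∑ℕ (2 * n) carry
    exact-CB {e} ex = +-cancelʳ-≡ (ℓ + ℓ) e (∑ℕ (2 * n) carry) (trans (exact-unique pp
        (subst (Exact p (e + (ℓ + ℓ))) (CB-! n) (exact-* pp ex (exact-* pp exn exn))) (exact-! pp (2 * n) (2 * n) ≤-refl))
      (trans (∑ℕ-cong (2 * n) λ i → double-/ n (p ^ suc i) {{m^n≢0 p (suc i)}}) (trans (∑ℕ-+ (2 * n) (λ i → part i + part i) carry)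
        (trans (cong (_+ ∑ℕ (2 * n) carry) (∑ℕ-+ (2 * n) part part)) (+-comm (ℓ + ℓ) (∑ℕ (2 * n) carry))))))
      where
      ℓ = legendre p (2 * n) n
      exn = exact-! pp (2 * n) n (m≤m+n n (n + 0))

    carryAt-0 : ∀ d .{{_ : NonZero d}} → 2 * n < d → carryAt d ≡ 0
    carryAt-0 d 2n<d = m<n⇒m/n≡0 (≤-<-trans (*-monoʳ-≤ 2 (m%n≤m n d)) 2n<d)

    carry-0 : ∀ j → 2 * n < p ^ suc j → ∀ i → j ≤ i → carry i ≡ 0
    carry-0 j 2n<p i j≤i = carryAt-0 (p ^ suc i) {{m^n≢0 p (suc i)}} (<-≤-trans 2n<p (^-monoʳ-≤ p (s≤s j≤i)))

    exponent-≤ : ∀ {e} j → 2 * n < p ^ suc j → Exact p e (CB n) → e ≤ j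
    exponent-≤ j 2n<p ex = subst (_≤ j) (sym (exact-CB ex)) (∑ℕ-≤-support (2 * n) j carry carry≤1 (carry-0 j 2n<p))

    -- Each power of p up to 2 n yields at most one carry and the larger ones none; with pʲ ≤ 2 n <
    -- pʲ⁺¹ the exponent is thus at most j.
    power-≤ : ∀ {e} → 0 < n → Exact p e (CB n) → p ^ e ≤ 2 * n
    power-≤ {e} 0<n ex with bracket (2 * n) (n<p^n (1<prime pp) (2 * n))
      where
      bracket : ∀ k → 2 * n < p ^ k → ∃[ j ] p ^ j ≤ 2 * n × 2 * n < p ^ suc j
      bracket zero 2n<1 = contradiction (≤-trans 0<n (m≤m+n n (n + 0))) (<⇒≱ 2n<1)
      bracket (suc k) h with 2 * n <? p ^ k
      ... | yes h′ = bracket k h′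
      ... | no  h′ = k , ≮⇒≥ h′ , h
    ... | j , lo , hi = ≤-trans (^-monoʳ-≤ p (exponent-≤ j hi ex)) lo

    -- From p ≤ n and 2 n < 3 p the remainder of n is n - p, and its double is still below p, so
    -- there is no carry at p; 2 n < p² excludes the higher powers.
    exponent-0 : ∀ {e} → 2 * n < p * p → 2 * n < 3 * p → p ≤ n → Exact p e (CB n) → e ≡ 0
    exponent-0 {e} 2n<p² 2n<3p p≤n ex = trans (exact-CB ex) (n≤0⇒n≡0 (∑ℕ-≤-support (2 * n) 0 carry carry≤1 all-0))
      where
      n<2p : n < 2 * p
      n<2p = *-cancelˡ-< 2 n (2 * p) (<-≤-trans 2n<3p (≤-trans (*-monoˡ-≤ p {3} {4} (s≤s (s≤s (s≤s z≤n)))) (≤-reflexive (*-assoc 2 2 p))))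
      n%p : n % p ≡ n ∸ p
      n%p = trans (cong (_% p) (trans (sym (m+[n∸m]≡n p≤n)) (+-comm p (n ∸ p)))) (trans ([m+n]%n≡m%n (n ∸ p) p)
        (m<n⇒m%n≡m (+-cancelˡ-< p (n ∸ p) p (subst₂ _<_ (sym (m+[n∸m]≡n p≤n)) (cong (p +_) (+-identityʳ p)) n<2p))))
      first : 2 * (n % p) < p
      first = +-cancelˡ-< (2 * p) (2 * (n % p)) p (subst₂ _<_ (trans (cong (2 *_) (trans (sym (m+[n∸m]≡n p≤n)) (cong (p +_) (sym n%p)))) (*-distribˡ-+ 2 p (n % p))) (l p) 2n<3p)
        where
        l : ∀ p → 3 * p ≡ 2 * p + p
        l = solve-∀
      all-0 : ∀ i → 0 ≤ i → carry i ≡ 0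
      all-0 zero    _ = at (p ^ 1) {{m^n≢0 p 1}} (sym (*-identityʳ p))
        where
        at : ∀ d .{{_ : NonZero d}} → p ≡ d → carryAt d ≡ 0
        at d refl = m<n⇒m/n≡0 first
      all-0 (suc i) _ = carry-0 1 (subst (2 * n <_) (cong (p *_) (sym (*-identityʳ p))) 2n<p²) (suc i) (s≤s z≤n)

  prime-of-CB : ∀ n {p} → Prime p → p ∣ CB n → p < suc (2 * n)
  prime-of-CB n pp p∣ = ≰⇒> λ 2n<p → prime-∤-! pp (2 * n) 2n<p (subst (_ ∣_) (CB-! n) (∣m⇒∣m*n (n ! * n !) p∣))

  ∏-^-tick : ∀ X {Q : ℕ → Set} (Q? : ∀ p → Dec (Q p)) N → ∏ N (λ p → X ^ tick (Q? p)) ≡ X ^ count Q? N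
  ∏-^-tick X Q? zero    = refl
  ∏-^-tick X Q? (suc N) = trans (cong (_* X ^ tick (Q? N)) (∏-^-tick X Q? N)) (sym (^-distribˡ-+-* X (count Q? N) (tick (Q? N))))

  2^-cancel-≤ : ∀ {a b} → 2 ^ a ≤ 2 ^ b → a ≤ b
  2^-cancel-≤ {a} {b} h = ≮⇒≥ λ b<a → <⇒≱ (^-monoʳ-< 2 (s≤s (s≤s z≤n)) b<a) h

  4^n≡2^2n : ∀ n → 4 ^ n ≡ 2 ^ (2 * n)
  4^n≡2^2n n = ^-*-assoc 2 2 n

  4^n≤2nCB′ : ∀ n → 0 < n → 4 ^ n ≤ 2 * n * CB n
  4^n≤2nCB′ (suc n) _ = 4^n≤2nCB n

  tick-power : ∀ X {Q : Set} (d : Dec Q) → 0 < X → 1 ≤ X ^ tick d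
  tick-power X d 0<X = m^n>0 X {{>-nonZero 0<X}} (tick d)

  -- Every prime power in the central coefficient is at most 2 n, hence so is the contribution of
  -- each prime; the extra 1 is the factor 2 n in 4ⁿ ≤ 2 n `CB` n. The exponent k replaces the
  -- logarithm of 2 n.
  chebyshev : ∀ n k → 0 < n → 2 * n ≤ 2 ^ k → 2 * n ≤ k * suc (count prime? (suc (2 * n)))
  chebyshev n k 0<n X≤2^k = 2^-cancel-≤ (begin
    2 ^ (2 * n)                    ≡⟨ sym (4^n≡2^2n n) ⟩
    4 ^ n                          ≤⟨ 4^n≤2nCB′ n 0<n ⟩
    X * CB n                       ≤⟨ *-monoʳ-≤ X (prime-power-bound (suc X) (CB n) g (0<CB n) (λ p → tick-power X (prime? p) 0<X) (prime-of-CB n) bound) ⟩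
    X * ∏ (suc X) g                ≡⟨ cong (X *_) (∏-^-tick X prime? (suc X)) ⟩
    X ^ suc π                      ≤⟨ ^-monoˡ-≤ (suc π) X≤2^k ⟩
    (2 ^ k) ^ suc π                ≡⟨ ^-*-assoc 2 k (suc π) ⟩
    2 ^ (k * suc π)                ∎)
    where
    open ≤-Reasoning
    X = 2 * n
    0<X : 0 < X
    0<X = <-≤-trans 0<n (m≤m+n n (n + 0))
    g : ℕ → ℕ
    g p = X ^ tick (prime? p)
    π = count prime? (suc X)
    bound : ∀ {p e} → Prime p → Exact p e (CB n) → p ^ e ≤ g p
    bound {p} pp ex = ≤-trans (Exponent.power-≤ pp n 0<n ex) (≤-reflexive (sym (trans (cong (X ^_) (tick-yes (prime? p) pp)) (*-identityʳ X))))

  upper? : ∀ n p → Dec (Prime p × n < p)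
  upper? n p = prime? p ×-dec n <? p

  count-≤ : ∀ {Q : ℕ → Set} (Q? : ∀ m → Dec (Q m)) r N → (∀ {m} → Q m → m ≤ r) → count Q? N ≤ suc r
  count-≤ Q? r zero    spec = z≤n
  count-≤ {Q} Q? r (suc N) spec = go (Q? N)
    where
    crude : ∀ N → count Q? N ≤ N
    crude zero    = z≤n
    crude (suc N) = ≤-trans (+-mono-≤ (crude N) (tick≤1 (Q? N))) (≤-reflexive (+-comm N 1))
      where
      tick≤1 : ∀ {A : Set} (d : Dec A) → tick d ≤ 1
      tick≤1 d@(yes a) = ≤-reflexive (tick-yes d a)
      tick≤1 d@(no ¬a) = ≤-trans (≤-reflexive (tick-no d ¬a)) z≤n
    go : Dec (Q N) → count Q? (suc N) ≤ suc r
    go (yes q) = ≤-trans (crude (suc N)) (s≤s (spec q))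
    go (no ¬q) = subst (_≤ suc r) (sym (trans (cong (count Q? N +_) (tick-no (Q? N) ¬q)) (+-identityʳ (count Q? N)))) (count-≤ Q? r N spec)

  -- Erdős's argument: in the central binomial coefficient, of size about 4ⁿ, every prime
  -- power is at most 2n, primes beyond √(2n) occur at most once, those in (2n/3 , n] not at
  -- all, and those up to 2n/3 have a product of at most 4^(2n/3).
  bertrand : ∀ n k r → 0 < n → 2 * n ≤ 2 ^ k → 2 * n < suc r * suc r →
             2 * n ≤ 3 * (k * (suc (suc r) + count (upper? n) (suc (2 * n))))
  bertrand n k r 0<n X≤2^k X<r² = +-cancelʳ-≤ (4 * n) (2 * n) (3 * (k * E)) (begin
    2 * n + 4 * n                          ≡⟨ l₁ n ⟩
    3 * (2 * n)                            ≤⟨ *-monoʳ-≤ 3 main ⟩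
    3 * (k * E + 2 * m)                    ≡⟨ l₂ (k * E) m ⟩
    3 * (k * E) + 2 * (m * 3)              ≤⟨ +-monoʳ-≤ (3 * (k * E)) (*-monoʳ-≤ 2 (m/n*n≤m X 3)) ⟩
    3 * (k * E) + 2 * X                    ≡⟨ cong (3 * (k * E) +_) (l₃ n) ⟩
    3 * (k * E) + 4 * n                    ∎)
    where
    open ≤-Reasoning
    X = 2 * n
    m = X / 3
    Q = count (upper? n) (suc X)
    -- Powers of 2 n in the estimate: one from 4ⁿ ≤ 2 n `CB` n, r + 1 for the numbers 0 , ... , r,
    -- and one for each prime beyond n.
    E = suc (suc r) + Q
    l₁ : ∀ n → 2 * n + 4 * n ≡ 3 * (2 * n)
    l₁ = solve-∀
    l₂ : ∀ x m → 3 * (x + 2 * m) ≡ 3 * x + 2 * (m * 3)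
    l₂ = solve-∀
    l₃ : ∀ n → 2 * (2 * n) ≡ 4 * n
    l₃ = solve-∀
    0<X : 0 < X
    0<X = <-≤-trans 0<n (m≤m+n n (n + 0))
    low? : ∀ p → Dec (p ≤ r)
    low? p = p ≤? r
    mid? : ∀ p → Dec (Prime p × p ≤ m)
    mid? p = prime? p ×-dec p ≤? m
    f₁ f₂ f₃ g : ℕ → ℕ
    f₁ p = X ^ tick (low? p)
    f₂ p = X ^ tick (upper? n p)
    f₃ = sel mid?
    g p = f₁ p * f₂ p * f₃ p
    1≤f₁ : ∀ p → 1 ≤ f₁ p
    1≤f₁ p = tick-power X (low? p) 0<X
    1≤f₂ : ∀ p → 1 ≤ f₂ p
    1≤f₂ p = tick-power X (upper? n p) 0<X
    1≤f₃ : ∀ p → 1 ≤ f₃ p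
    1≤f₃ p = 1≤sel mid? proj₁ p
    X<3m+3 : X < 3 * suc m
    X<3m+3 = subst₂ _<_ (sym (m≡m%n+[m/n]*n X 3)) (l m) (+-monoˡ-< (m * 3) (m%n<n X 3))
      where
      l : ∀ m → 3 + m * 3 ≡ 3 * suc m
      l = solve-∀
    bound : ∀ {p e} → Prime p → Exact p e (CB n) → p ^ e ≤ g p
    bound {p} {e} pp ex = go (low? p) (n <? p) (p ≤? m)
      where
      open Exponent pp n
      1≤f₁f₂ : 1 ≤ f₁ p * f₂ p
      1≤f₁f₂ = *-mono-≤ (1≤f₁ p) (1≤f₂ p)
      go : Dec (p ≤ r) → Dec (n < p) → Dec (p ≤ m) → p ^ e ≤ g p
      go (yes p≤r) _ _ = ≤-trans (power-≤ 0<n ex) (≤-trans (≤-reflexive (sym (trans (cong (X ^_) (tick-yes (low? p) p≤r)) (*-identityʳ X))))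
        (≤-trans (m≤m*n (f₁ p) (f₂ p) {{>-nonZero (1≤f₂ p)}}) (m≤m*n (f₁ p * f₂ p) (f₃ p) {{>-nonZero (1≤f₃ p)}})))
      go (no _) (yes n<p) _ = ≤-trans (power-≤ 0<n ex) (≤-trans (≤-reflexive (sym (trans (cong (X ^_) (tick-yes (upper? n p) (pp , n<p))) (*-identityʳ X))))
        (≤-trans (m≤n*m (f₂ p) (f₁ p) {{>-nonZero (1≤f₁ p)}}) (m≤m*n (f₁ p * f₂ p) (f₃ p) {{>-nonZero (1≤f₃ p)}})))
      go (no p≰r) (no _) (yes p≤m) = ≤-trans (^-monoʳ-≤ p (exponent-≤ 1 (subst (X <_) (cong (p *_) (sym (*-identityʳ p))) X<p²) ex))
          (≤-trans (≤-reflexive (trans (*-identityʳ p) (sym (sel-yes mid? p (pp , p≤m))))) (m≤n*m (f₃ p) (f₁ p * f₂ p) {{>-nonZero 1≤f₁f₂}}))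
        where
        X<p² : X < p * p
        X<p² = <-≤-trans X<r² (*-mono-≤ (≰⇒> p≰r) (≰⇒> p≰r))
      go (no p≰r) (no n≮p) (no p≰m) = ≤-trans (≤-reflexive (cong (p ^_) (exponent-0 X<p² (<-≤-trans X<3m+3 (*-monoʳ-≤ 3 (≰⇒> p≰m))) (≮⇒≥ n≮p) ex)))
          (*-mono-≤ 1≤f₁f₂ (1≤f₃ p))
        where
        X<p² : X < p * p
        X<p² = <-≤-trans X<r² (*-mono-≤ (≰⇒> p≰r) (≰⇒> p≰r))
    m≤X : m ≤ X
    m≤X = m/n≤m X 3
    ∏f₃ : ∏ (suc X) f₃ ≤ 4 ^ m
    ∏f₃ = ≤-trans (≤-reflexive (∏-ext (suc m) (suc X) f₃ (s≤s m≤X) λ p m<p _ → sel-no mid? p λ (_ , p≤m) → <⇒≱ m<p p≤m))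
      (≤-trans (∏-mono (suc m) λ p p≤m → drop p) (primorial-≤ m))
      where
      drop : ∀ p → sel mid? p ≤ sel prime? p
      drop p = go (mid? p)
        where
        go : Dec (Prime p × p ≤ m) → sel mid? p ≤ sel prime? p
        go (yes (pp , p≤a)) = ≤-reflexive (trans (sel-yes mid? p (pp , p≤a)) (sym (sel-yes prime? p pp)))
        go (no h) = ≤-trans (≤-reflexive (sel-no mid? p h)) (1≤sel prime? (λ pp → pp) p)
    c₁ = count low? (suc X)
    main : 2 * n ≤ k * E + 2 * m
    main = 2^-cancel-≤ (begin
      2 ^ (2 * n)                            ≡⟨ sym (4^n≡2^2n n) ⟩
      4 ^ n                                  ≤⟨ 4^n≤2nCB′ n 0<n ⟩
      X * CB n                               ≤⟨ *-monoʳ-≤ X (prime-power-bound (suc X) (CB n) g (0<CB n) (λ p → *-mono-≤ (*-mono-≤ (1≤f₁ p) (1≤f₂ p)) (1≤f₃ p)) (prime-of-CB n) bound) ⟩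
      X * ∏ (suc X) g                        ≡⟨ cong (X *_) (trans (∏-* (suc X) (λ p → f₁ p * f₂ p) f₃) (cong (_* ∏ (suc X) f₃)
                                                  (trans (∏-* (suc X) f₁ f₂) (cong₂ _*_ (∏-^-tick X low? (suc X)) (∏-^-tick X (upper? n) (suc X)))))) ⟩
      X * (X ^ c₁ * X ^ Q * ∏ (suc X) f₃)    ≤⟨ *-monoʳ-≤ X (*-mono-≤ (*-monoˡ-≤ (X ^ Q) (^-monoʳ-≤ X {{>-nonZero 0<X}} (count-≤ low? r (suc X) (λ h → h)))) ∏f₃) ⟩
      X * (X ^ suc r * X ^ Q * 4 ^ m)        ≡⟨ trans (sym (*-assoc X (X ^ suc r * X ^ Q) (4 ^ m))) (cong₂ _*_ (cong (X *_) (sym (^-distribˡ-+-* X (suc r) Q))) (4^n≡2^2n m)) ⟩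
      X ^ E * 2 ^ (2 * m)                    ≤⟨ *-monoˡ-≤ (2 ^ (2 * m)) (^-monoˡ-≤ E X≤2^k) ⟩
      (2 ^ k) ^ E * 2 ^ (2 * m)              ≡⟨ cong (_* 2 ^ (2 * m)) (^-*-assoc 2 k E) ⟩
      2 ^ (k * E) * 2 ^ (2 * m)              ≡⟨ sym (^-distribˡ-+-* 2 (k * E) (2 * m)) ⟩
      2 ^ (k * E + 2 * m)                    ∎)

-- Counting by cases.

module Counting where
  open import Data.Nat
  open import Data.Nat.Properties
  open import Data.Nat.Tactic.RingSolver using (solve-∀)
  open import Data.Sum using (_⊎_; inj₁; inj₂)
  open import Relation.Nullary using (Dec; yes; no)
  open import Relation.Binary.PropositionalEquality
  open FiniteSums using (tick; tick-yes; tick-no; count; count-0)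

  count-split : ∀ {Q A B : ℕ → Set} (Q? : ∀ m → Dec (Q m)) (A? : ∀ m → Dec (A m)) (B? : ∀ m → Dec (B m)) N →
                (∀ m → m < N → Q m → A m ⊎ B m) → count Q? N ≤ count A? N + count B? N
  count-split Q? A? B? zero    cover = z≤n
  count-split {Q} {A} {B} Q? A? B? (suc N) cover = begin
    count Q? N + tick (Q? N)                                          ≤⟨ +-mono-≤ (count-split Q? A? B? N λ m m<N → cover m (m<n⇒m<1+n m<N)) last ⟩
    count A? N + count B? N + (tick (A? N) + tick (B? N))             ≡⟨ l (count A? N) (count B? N) (tick (A? N)) (tick (B? N)) ⟩
    count A? N + tick (A? N) + (count B? N + tick (B? N))             ∎
    where
    open ≤-Reasoning
    l : ∀ a b c d → a + b + (c + d) ≡ a + c + (b + d)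
    l = solve-∀
    last : tick (Q? N) ≤ tick (A? N) + tick (B? N)
    last = go (Q? N)
      where
      go : Dec (Q N) → tick (Q? N) ≤ tick (A? N) + tick (B? N)
      go (no ¬q) = ≤-trans (≤-reflexive (tick-no (Q? N) ¬q)) z≤n
      go (yes q) with cover N (n<1+n N) q
      ... | inj₁ a = ≤-trans (≤-reflexive (trans (tick-yes (Q? N) q) (sym (tick-yes (A? N) a)))) (m≤m+n (tick (A? N)) (tick (B? N)))
      ... | inj₂ b = ≤-trans (≤-reflexive (trans (tick-yes (Q? N) q) (sym (tick-yes (B? N) b)))) (m≤n+m (tick (B? N)) (tick (A? N)))

  count-≟ : ∀ c N → count (_≟ c) N ≤ 1
  count-≟ c zero    = z≤n
  count-≟ c (suc N) = go (N ≟ c)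
    where
    go : Dec (N ≡ c) → count (_≟ c) N + tick (N ≟ c) ≤ 1
    go (yes refl) = ≤-reflexive (cong₂ _+_ (count-0 (_≟ N) N λ m m<N → <⇒≢ m<N) (tick-yes (N ≟ N) refl))
    go (no N≢c) = ≤-trans (≤-reflexive (trans (cong (count (_≟ c) N +_) (tick-no (N ≟ c) N≢c)) (+-identityʳ (count (_≟ c) N)))) (count-≟ c N)

-- Numerical estimates for h ≥ 58.

module Growth where
  open import Data.Nat
  open import Data.Nat.Properties
  open import Data.Nat.Tactic.RingSolver using (solve-∀)
  open import Data.Product using (∃-syntax; _×_; _,_)
  open import Data.Sum using (_⊎_; inj₁; inj₂)
  open import Relation.Nullary using (yes; no; contradiction)
  open import Relation.Binary.PropositionalEquality

  square-cancel-≤ : ∀ {a b} → a * a ≤ b * b → a ≤ b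
  square-cancel-≤ h = ≮⇒≥ λ b<a → <⇒≱ (*-mono-< b<a b<a) h

  abstract
    -- 2 ^ 14, sealed so that it is never unfolded into a unary numeral.
    c14 : ℕ
    c14 = 2 ^ 14

    59^7 60^7 : ℕ
    59^7 = 59 ^ 7
    60^7 = 60 ^ 7

    59^7≡ : 59^7 ≡ 59 ^ 7
    59^7≡ = refl

    60^7≡ : 60^7 ≡ 60 ^ 7
    60^7≡ = refl

    60^7≤2*59^7 : 60^7 ≤ 59^7 * 2
    60^7≤2*59^7 = ≤ᵇ⇒≤ 60^7 (59^7 * 2) _

    16128≤c14 : 4 * (144 * 28) ≤ c14
    16128≤c14 = ≤ᵇ⇒≤ (4 * (144 * 28)) c14 _

    14400≤c14 : 4 * (60 * 60) ≤ c14
    14400≤c14 = ≤ᵇ⇒≤ (4 * (60 * 60)) c14 _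

    growth-59 : 2 * c14 * 59 ^ 7 ≤ 2 ^ 59
    growth-59 = ≤ᵇ⇒≤ (2 * c14 * 59 ^ 7) (2 ^ 59) _

    59^7≢0 : NonZero 59^7
    59^7≢0 = _

  private
    ^-distribʳ-* : ∀ n a b → (a * b) ^ n ≡ a ^ n * b ^ n
    ^-distribʳ-* zero    a b = refl
    ^-distribʳ-* (suc n) a b = trans (cong (a * b *_) (^-distribʳ-* n a b)) (l a b (a ^ n) (b ^ n))
      where
      l : ∀ a b c d → a * b * (c * d) ≡ a * c * (b * d)
      l = solve-∀

    ^7-step : ∀ x → 59 ≤ x → suc x ^ 7 ≤ 2 * x ^ 7
    ^7-step x 59≤x = *-cancelˡ-≤ {suc x ^ 7} {2 * x ^ 7} 59^7 {{59^7≢0}} (begin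
      59^7 * suc x ^ 7         ≡⟨ trans (cong (λ w → w * suc x ^ 7) {59^7} {59 ^ 7} 59^7≡) (sym (^-distribʳ-* 7 59 (suc x))) ⟩
      (59 * suc x) ^ 7         ≤⟨ ^-monoˡ-≤ 7 (≤-trans (≤-reflexive (*-suc 59 x)) (+-monoˡ-≤ (59 * x) 59≤x)) ⟩
      (60 * x) ^ 7             ≡⟨ trans (^-distribʳ-* 7 60 x) (cong (λ w → w * x ^ 7) {60 ^ 7} {60^7} (sym 60^7≡)) ⟩
      60^7 * x ^ 7             ≤⟨ *-monoˡ-≤ (x ^ 7) 60^7≤2*59^7 ⟩
      59^7 * 2 * x ^ 7         ≡⟨ *-assoc 59^7 2 (x ^ 7) ⟩
      59^7 * (2 * x ^ 7)       ∎)
      where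
      open ≤-Reasoning

  -- The step compares 60⁷ with 2 · 59⁷: from 59 on, a seventh power at most doubles when x grows by
  -- 1. The seventh power is the sixth of `enough` times the logarithm in the number of primes; 2¹⁴
  -- exceeds 4 · 144 · 28.
  growth : ∀ x → 59 ≤ x → 2 * c14 * x ^ 7 ≤ 2 ^ x
  growth (suc x) 59≤1+x = go (m≤n⇒m<n∨m≡n 59≤1+x)
    where
    l : ∀ a b → a * (2 * b) ≡ 2 * (a * b)
    l = solve-∀
    step : 59 ≤ x → 2 * c14 * suc x ^ 7 ≤ 2 * 2 ^ x
    step 59≤x = begin
      2 * c14 * suc x ^ 7       ≤⟨ *-monoʳ-≤ (2 * c14) (^7-step x 59≤x) ⟩
      2 * c14 * (2 * x ^ 7)     ≡⟨ l (2 * c14) (x ^ 7) ⟩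
      2 * (2 * c14 * x ^ 7)     ≤⟨ *-monoʳ-≤ 2 (growth x 59≤x) ⟩
      2 * 2 ^ x                 ∎
      where open ≤-Reasoning
    go : 59 < suc x ⊎ 59 ≡ suc x → 2 * c14 * suc x ^ 7 ≤ 2 ^ suc x
    go (inj₁ 59<1+x) = step (≤-pred 59<1+x)
    go (inj₂ 59≡1+x) = subst (λ w → 2 * c14 * w ^ 7 ≤ 2 ^ w) 59≡1+x growth-59

  isqrt : ∀ n → ∃[ s ] n ≤ s * s × (∀ t → s ≡ suc t → t * t < n)
  isqrt zero    = 0 , z≤n , λ t ()
  isqrt (suc n) with isqrt n
  ... | s , n≤s² , least with suc n ≤? s * s
  ...   | yes h = s , h , λ t s≡ → m<n⇒m<1+n (least t s≡)
  ...   | no  h = suc s , ≤-trans (s≤s n≤s²) (≤-trans (m≤m+n (suc (s * s)) (2 * s)) (≤-reflexive (l s))) , λ { t refl → ≰⇒> λ 1+n≤ → h 1+n≤ }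
    where
    l : ∀ s → suc (s * s) + 2 * s ≡ suc s * suc s
    l = solve-∀

  -- s is √(27 p) rounded up. Rounding adds at most 2 √(27 p) = √(108 p) to the square, which is at
  -- most p once 108 ≤ p.
  root-27 : ∀ p → 108 ≤ p → ∃[ s ] 0 < s × 27 * p ≤ s * s × s * s ≤ 28 * p
  root-27 p 108≤p with isqrt (27 * p)
  ... | zero  , le , _ = contradiction (≤-trans (≤-trans (s≤s z≤n) 108≤p) (≤-trans (m≤n*m p 27) le)) λ ()
  ... | suc t , le , least = suc t , s≤s z≤n , le , ≤-trans (≤-reflexive (l t)) (≤-trans (+-mono-≤ (least t refl) 2t≤p) (≤-reflexive (+-comm (27 * p) p)))
    where
    l : ∀ t → suc t * suc t ≡ suc (t * t) + 2 * t
    l = solve-∀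
    2t≤p : 2 * t ≤ p
    2t≤p = square-cancel-≤ (begin
      2 * t * (2 * t)     ≡⟨ l₂ t ⟩
      4 * (t * t)         ≤⟨ *-monoʳ-≤ 4 (<⇒≤ (least t refl)) ⟩
      4 * (27 * p)        ≡⟨ sym (*-assoc 4 27 p) ⟩
      108 * p             ≤⟨ *-monoˡ-≤ p 108≤p ⟩
      p * p               ∎)
      where
      open ≤-Reasoning
      l₂ : ∀ t → 2 * t * (2 * t) ≡ 4 * (t * t)
      l₂ = solve-∀

  module _ (h : ℕ) (58≤h : 58 ≤ h) where
    private
      x = suc h
      big : 2 * c14 * x ^ 7 ≤ 2 * 2 ^ h
      big = growth x (s≤s 58≤h)

      big′ : c14 * x ^ 7 ≤ 2 ^ h
      big′ = *-cancelˡ-≤ 2 (≤-trans (≤-reflexive (sym (*-assoc 2 c14 (x ^ 7)))) big)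

      x²≤x^7 : x * x ≤ x ^ 7
      x²≤x^7 = ≤-trans (m≤m*n (x * x) (x ^ 5) {{m^n≢0 x 5}}) (≤-reflexive (*-assoc x x (x ^ 5)))

    -- The left side is of order h √(2ʰ). Comparing squares removes the root, and 60 is 12 · 5
    -- because 2ᵍ + 4 ≤ 5 · 2ᵍ.
    negligible : ∀ g → g + g ≤ suc (suc h) → 12 * x * (2 ^ g + 4) ≤ 2 ^ h
    negligible g 2g≤ = square-cancel-≤ (begin
      12 * x * (2 ^ g + 4) * (12 * x * (2 ^ g + 4))   ≤⟨ *-mono-≤ bound bound ⟩
      60 * x * 2 ^ g * (60 * x * 2 ^ g)               ≡⟨ l 60 x (2 ^ g) ⟩
      60 * 60 * (x * x) * (2 ^ g * 2 ^ g)             ≡⟨ cong (60 * 60 * (x * x) *_) (sym (^-distribˡ-+-* 2 g g)) ⟩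
      60 * 60 * (x * x) * 2 ^ (g + g)                 ≤⟨ *-monoʳ-≤ (60 * 60 * (x * x)) (^-monoʳ-≤ 2 2g≤) ⟩
      60 * 60 * (x * x) * (2 * (2 * 2 ^ h))           ≡⟨ l₂ (60 * 60) (x * x) (2 ^ h) ⟩
      4 * (60 * 60) * (x * x) * 2 ^ h                 ≤⟨ *-monoˡ-≤ (2 ^ h) (≤-trans (*-mono-≤ 14400≤c14 x²≤x^7) big′) ⟩
      2 ^ h * 2 ^ h                                   ∎)
      where
      open ≤-Reasoning
      l : ∀ c x a → c * x * a * (c * x * a) ≡ c * c * (x * x) * (a * a)
      l = solve-∀
      l₂ : ∀ c x a → c * x * (2 * (2 * a)) ≡ 4 * c * x * a
      l₂ = solve-∀
      l₃ : ∀ x a → 12 * x * (a + 4 * a) ≡ 60 * x * a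
      l₃ = solve-∀
      bound : 12 * x * (2 ^ g + 4) ≤ 60 * x * 2 ^ g
      bound = ≤-trans (*-monoʳ-≤ (12 * x) (+-monoʳ-≤ (2 ^ g) (*-monoʳ-≤ 4 (m^n>0 2 g)))) (≤-reflexive (l₃ x (2 ^ g)))

    -- The terms other than c in the Bertrand type bound take up at most a quarter after
    -- multiplication by 4, so three quarters are left for c.
    many-primes : ∀ g c → g + g ≤ suc (suc h) → 2 ^ h ≤ 3 * (x * (2 ^ g + 4 + c)) → 2 ^ h ≤ 4 * x * c
    many-primes g c 2g≤ hyp = *-cancelˡ-≤ 3 (+-cancelˡ-≤ (2 ^ h) (3 * 2 ^ h) (3 * (4 * x * c)) (begin
      2 ^ h + 3 * 2 ^ h                                ≡⟨ l₁ (2 ^ h) ⟩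
      4 * 2 ^ h                                        ≤⟨ *-monoʳ-≤ 4 hyp ⟩
      4 * (3 * (x * (2 ^ g + 4 + c)))                  ≡⟨ l₂ x (2 ^ g + 4) c ⟩
      12 * x * (2 ^ g + 4) + 3 * (4 * x * c)           ≤⟨ +-monoˡ-≤ (3 * (4 * x * c)) (negligible g 2g≤) ⟩
      2 ^ h + 3 * (4 * x * c)                          ∎))
      where
      open ≤-Reasoning
      l₁ : ∀ a → a + 3 * a ≡ 4 * a
      l₁ = solve-∀
      l₂ : ∀ x a c → 4 * (3 * (x * (a + c))) ≡ 12 * x * a + 3 * (4 * x * c)
      l₂ = solve-∀

    enough : ∀ c → 2 ^ h ≤ 4 * x * c → 144 * 28 * (x * x * (x * x * (x * x))) ≤ c
    enough c hc = *-cancelˡ-≤ (4 * x) (begin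
      4 * x * (144 * 28 * (x * x * (x * x * (x * x))))  ≡⟨ l (144 * 28) x ⟩
      4 * (144 * 28) * x ^ 7                            ≤⟨ *-monoˡ-≤ (x ^ 7) 16128≤c14 ⟩
      c14 * x ^ 7                                       ≤⟨ big′ ⟩
      2 ^ h                                             ≤⟨ hc ⟩
      4 * x * c                                         ∎)
      where
      open ≤-Reasoning
      l : ∀ a x → 4 * x * (a * (x * x * (x * x * (x * x)))) ≡ 4 * a * (x * (x * (x * (x * (x * (x * (x * 1)))))))
      l = solve-∀

    -- The bilinear errors amount to h³ s with s of order √c, so c has to exceed a constant times
    -- h⁶. The constant 144 · 28 of `enough` is 12² times the 28 of `root-27`.
    beats-root : ∀ c s → 2 ^ h ≤ 4 * x * c → s * s ≤ 28 * c → 12 * h * (x * x) * s ≤ c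
    beats-root c s hc hs = square-cancel-≤ (begin
      12 * h * (x * x) * s * (12 * h * (x * x) * s)      ≡⟨ l₁ h x s ⟩
      144 * (h * h) * (x * x * (x * x)) * (s * s)        ≤⟨ *-mono-≤ (*-monoˡ-≤ (x * x * (x * x)) (*-monoʳ-≤ 144 (*-mono-≤ (n≤1+n h) (n≤1+n h)))) hs ⟩
      144 * (x * x) * (x * x * (x * x)) * (28 * c)       ≡⟨ l₂ 144 28 x c ⟩
      144 * 28 * (x * x * (x * x * (x * x))) * c         ≤⟨ *-monoˡ-≤ c (enough c hc) ⟩
      c * c                                              ∎)
      where
      open ≤-Reasoning
      l₁ : ∀ h x s → 12 * h * (x * x) * s * (12 * h * (x * x) * s) ≡ 144 * (h * h) * (x * x * (x * x)) * (s * s)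
      l₁ = solve-∀
      l₂ : ∀ a b x c → a * (x * x) * (x * x * (x * x)) * (b * c) ≡ a * b * (x * x * (x * x * (x * x))) * c
      l₂ = solve-∀

    at-least-108 : ∀ c → 2 ^ h ≤ 4 * x * c → 108 ≤ c
    at-least-108 c hc = ≤-trans (≤-trans (≤ᵇ⇒≤ 108 (144 * 28) _) (m≤m*n (144 * 28) (x * x * (x * x * (x * x))))) (enough c hc)

    100x²≤half : ∀ z → 2 ^ h ≤ 2 * z → 100 * (x * x) ≤ z
    100x²≤half z 2^h≤2z = *-cancelˡ-≤ 2 (begin
      2 * (100 * (x * x))      ≡⟨ sym (*-assoc 2 100 (x * x)) ⟩
      200 * (x * x)            ≤⟨ *-mono-≤ (≤-trans (≤ᵇ⇒≤ 200 (4 * (60 * 60)) _) 14400≤c14) x²≤x^7 ⟩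
      c14 * x ^ 7              ≤⟨ big′ ⟩
      2 ^ h                    ≤⟨ 2^h≤2z ⟩
      2 * z                    ∎)
      where open ≤-Reasoning

-- The number of pairs (p , q).

module PairCount (z h : ℕ) (58≤h : 58 ℕ.≤ h) (z<2^h : z ℕ.< 2 ℕ.^ h) (2^h≤2z : 2 ℕ.^ h ℕ.≤ 2 ℕ.* z) where

  open import Data.Nat
  open import Data.Nat.Properties
  open import Data.Nat.Primality
  open import Data.Nat.Divisibility using (_∣_; _∣?_)
  open import Data.Nat.Tactic.RingSolver using (solve-∀)
  import Data.Integer as ℤ
  import Data.Integer.Properties as ℤ
  import Data.Integer.Divisibility.Signed as S
  open import Data.Product using (∃-syntax; _×_; _,_; proj₁; proj₂)
  open import Data.Sum using (_⊎_; inj₁; inj₂)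
  open import Relation.Nullary using (Dec; yes; no; contradiction)
  open import Relation.Nullary.Decidable using (_×-dec_; _⊎-dec_)
  open import Relation.Binary.PropositionalEquality
  open import Function using (_∘_)
  open FiniteSums using (tick; tick-no; count; +count; ⟦_⟧; 0≤⟦⟧; ⟦⟧-×; ∑; ∑-mono; ∑-cong′; ∑-*ˡ; *-monoˡ; 0≤-*)
  open Residues using (one; zer-yes; zer-no)
  open Chebyshev using (chebyshev; bertrand; upper?; count-≤)
  open Counting using (count-split; count-≟)
  open Growth

  -- The margins come from z ≤ λ ≤ z + 2: p > z + 2 ensures p > λ, and p < 2 z ensures p < 2 λ.
  Good : ℕ → Set
  Good p = Prime p × suc (suc z) < p × p < 2 * z

  good? : ∀ p → Dec (Good p)
  good? p = prime? p ×-dec (suc (suc z) <? p ×-dec p <? 2 * z)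

  good : ∀ {p} → Good p → Prime p × z < p × p < 2 * z
  good (pp , lo , hi) = pp , <-trans (n<1+n z) (<-trans (n<1+n (suc z)) lo) , hi

  private
    x : ℕ
    x = suc h

    100x²≤z : 100 * (x * x) ≤ z
    100x²≤z = 100x²≤half h 58≤h z 2^h≤2z

    100≤z : 100 ≤ z
    100≤z = ≤-trans (m≤m*n 100 (x * x)) 100x²≤z

    1<z : 1 < z
    1<z = ≤-trans (s≤s (s≤s z≤n)) 100≤z

    0<z : 0 < z
    0<z = <-trans (s≤s z≤n) 1<z

  Pn : ℕ
  Pn = count good? (2 * z)

  private
    exceptional? : ∀ p → Dec (p ≡ suc z ⊎ (p ≡ suc (suc z) ⊎ p ≡ 2 * z))
    exceptional? p = (p ≟ suc z) ⊎-dec ((p ≟ suc (suc z)) ⊎-dec (p ≟ 2 * z))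

    Q≤P+3 : count (upper? z) (suc (2 * z)) ≤ Pn + 3
    Q≤P+3 = ≤-trans (count-split (upper? z) good? exceptional? N cover) (+-mono-≤ (≤-reflexive last) few)
      where
      N = suc (2 * z)
      cover : ∀ p → p < N → Prime p × z < p → Good p ⊎ (p ≡ suc z ⊎ (p ≡ suc (suc z) ⊎ p ≡ 2 * z))
      cover p p<N (pp , z<p) with p ≟ suc z | p ≟ suc (suc z) | p ≟ 2 * z
      ... | yes e | _ | _ = inj₂ (inj₁ e)
      ... | no _  | yes e | _ = inj₂ (inj₂ (inj₁ e))
      ... | no _  | no _  | yes e = inj₂ (inj₂ (inj₂ e))
      ... | no a  | no b  | no c  = inj₁ (pp , ≤∧≢⇒< (≤∧≢⇒< z<p (a ∘ sym)) (b ∘ sym) , ≤∧≢⇒< (≤-pred p<N) c)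
      last : count good? N ≡ Pn
      last = trans (cong (Pn +_) (tick-no (good? (2 * z)) λ (_ , _ , lt) → <-irrefl refl lt)) (+-identityʳ Pn)
      few : count exceptional? N ≤ 3
      few = ≤-trans (count-split exceptional? (_≟ suc z) (λ p → (p ≟ suc (suc z)) ⊎-dec (p ≟ 2 * z)) N λ _ _ e → e)
        (+-mono-≤ (count-≟ (suc z) N) (≤-trans (count-split (λ p → (p ≟ suc (suc z)) ⊎-dec (p ≟ 2 * z)) (_≟ suc (suc z)) (_≟ 2 * z) N λ _ _ e → e)
          (+-mono-≤ (count-≟ (suc (suc z)) N) (count-≟ (2 * z) N))))

    halve : ∀ n → ∃[ k ] (n ≡ k + k ⊎ n ≡ suc (k + k))
    halve zero = 0 , inj₁ refl
    halve (suc n) with halve n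
    ... | k , inj₁ refl = k , inj₂ refl
    ... | k , inj₂ refl = suc k , inj₁ (cong suc (sym (+-suc k k)))

    -- Half of h + 1, rounded up: 2ᵍ then exceeds √(2 z), as the prime count demands, by a bounded
    -- factor only.
    half-exponent : ∃[ g ] g + g ≤ suc (suc h) × suc h ≤ g + g
    half-exponent with halve h
    ... | k , inj₁ h≡ = suc k , ≤-reflexive (trans (cong suc (+-suc k k)) (cong (suc ∘ suc) (sym h≡))) , ≤-trans (≤-reflexive (cong suc h≡)) (s≤s (+-monoʳ-≤ k (n≤1+n k)))
    ... | k , inj₂ h≡ = suc k , ≤-trans (≤-reflexive (trans (cong suc (+-suc k k)) (cong suc (sym h≡)))) (n≤1+n (suc h)) , ≤-reflexive (trans (cong suc h≡) (cong suc (sym (+-suc k k))))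

    many : 2 ^ h ≤ 4 * x * Pn
    many = many-primes h 58≤h g Pn 2g≤ (begin
      2 ^ h                                                          ≤⟨ 2^h≤2z ⟩
      2 * z                                                          ≤⟨ bertrand z x r 0<z (*-monoʳ-≤ 2 (<⇒≤ z<2^h)) 2z<r² ⟩
      3 * (x * (suc (suc r) + count (upper? z) (suc (2 * z))))       ≤⟨ *-monoʳ-≤ 3 (*-monoʳ-≤ x (+-mono-≤ (≤-reflexive (cong suc 1+r≡)) Q≤P+3)) ⟩
      3 * (x * (suc (2 ^ g) + (Pn + 3)))                             ≡⟨ cong (λ w → 3 * (x * w)) (l (2 ^ g) Pn) ⟩
      3 * (x * (2 ^ g + 4 + Pn))                                     ∎)
      where
      open ≤-Reasoning
      g = proj₁ half-exponent
      2g≤ = proj₁ (proj₂ half-exponent)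
      h<2g = proj₂ (proj₂ half-exponent)
      r = pred (2 ^ g)
      l : ∀ a p → suc a + (p + 3) ≡ a + 4 + p
      l = solve-∀
      1+r≡ : suc r ≡ 2 ^ g
      1+r≡ = suc-pred (2 ^ g) {{m^n≢0 2 g}}
      2z<r² : 2 * z < suc r * suc r
      2z<r² = subst (λ w → 2 * z < w * w) (sym 1+r≡) (<-≤-trans (*-monoʳ-< 2 z<2^h) (≤-trans (^-monoʳ-≤ 2 h<2g) (≤-reflexive (^-distribˡ-+-* 2 g g))))

    root = root-27 Pn (at-least-108 h 58≤h Pn many)
    s = proj₁ root

    P≡ : TypeII.P z good? good ≡ ℤ.+ Pn
    P≡ = sym (+count good? (2 * z))

    s-big : ℤ.+ 27 ℤ.* TypeII.P z good? good ℤ.≤ ℤ.+ s ℤ.* ℤ.+ s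
    s-big = subst₂ ℤ._≤_ (trans (ℤ.pos-* 27 Pn) (cong (ℤ.+ 27 ℤ.*_) (sym P≡))) (ℤ.pos-* s s) (ℤ.+≤+ (proj₁ (proj₂ (proj₂ root))))

  module D = Distribution z good? good 1<z s h (proj₁ (proj₂ root)) s-big z<2^h
  module B = Bilinear z good? good 1<z
  module R = Ramare z good? good 1<z
  module T = TypeII z good? good
  open B using (Y; z³) public
  open D using (z⁵) public
  open R using (Top; Top?) public

  πn : ℕ
  πn = count Top? (suc Y)

  link? : ∀ p n → Dec (Top n × p ∣ n ∸ 1)
  link? p n = Top? n ×-dec (p ∣? n ∸ 1)

  links : ℕ → ℕ
  links p = count (link? p) (suc Y)

  pairs : ℤ.ℤ
  pairs = ∑ (2 * z) λ p → ⟦ good? p ⟧ ℤ.* ℤ.+ links p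

  private
    aps-links : ∀ p → D.aps p ≡ ℤ.+ links p
    aps-links p = trans (∑-cong′ (suc Y) term) (sym (+count (link? p) (suc Y)))
      where
      indicator : ∀ n → one p (ℤ.+ suc n) ≡ ⟦ p ∣? n ⟧
      indicator n = go (p ∣? n)
        where
        open FiniteSums using (⟦⟧-yes; ⟦⟧-no)
        go : Dec (p ∣ n) → one p (ℤ.+ suc n) ≡ ⟦ p ∣? n ⟧
        go (yes d) = trans (zer-yes p (ℤ.+ n) (S.∣ᵤ⇒∣ d)) (sym (⟦⟧-yes (p ∣? n) d))
        go (no ¬d) = trans (zer-no p (ℤ.+ n) (¬d ∘ S.∣⇒∣ᵤ)) (sym (⟦⟧-no (p ∣? n) ¬d))
      term : ∀ n → R.κ n ℤ.* one p (ℤ.+ n) ≡ ⟦ link? p n ⟧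
      term zero    = trans (Sieve.⟦⟧*-zero z good? good 1<z (Top? 0) (one p (ℤ.+ 0)) λ (_ , z³≤0 , _) → contradiction z³≤0 (<⇒≱ B.0<z³))
        (sym (FiniteSums.⟦⟧-no (link? p 0) λ ((_ , z³≤0 , _) , _) → <⇒≱ B.0<z³ z³≤0))
      term (suc n) = trans (cong (R.κ (suc n) ℤ.*_) (indicator n)) (⟦⟧-× (Top? (suc n)) (p ∣? n))

    e₂ e : ℕ
    e₂ = 2 * z + ((h + h + h) * z⁵ + z³ * (2 * z))
    e = h * (h * (Y * s)) + suc (z * z) * (Pn * (2 * z * 2)) + (h + h) * (Y * s)

    tₙ : ℕ
    tₙ = ℤ.∣ pairs ∣

    0≤pairs : ℤ.+ 0 ℤ.≤ pairs
    0≤pairs = FiniteSums.∑-nonneg (2 * z) λ p → 0≤-* {⟦ good? p ⟧} {ℤ.+ links p} (0≤⟦⟧ (good? p)) (ℤ.+≤+ z≤n)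

    pairs≡ : pairs ≡ ℤ.+ tₙ
    pairs≡ = sym (ℤ.0≤i⇒+∣i∣≡i 0≤pairs)

    Err₂≡ : D.Err₂ ≡ ℤ.+ e₂
    Err₂≡ = cong (ℤ._+_ (ℤ.+ (2 * z))) (cong₂ ℤ._+_ (sym (ℤ.pos-* (h + h + h) z⁵)) (sym (ℤ.pos-* z³ (2 * z))))

    Err≡ : D.Err ≡ ℤ.+ e
    Err≡ = cong₂ ℤ._+_ (cong₂ ℤ._+_ (sym (ℤ.pos-* h (h * (Y * s))))
        (trans (cong (ℤ._*_ (ℤ.+ suc (z * z))) (trans (cong₂ ℤ._*_ P≡ (sym (ℤ.pos-* (2 * z) 2))) (sym (ℤ.pos-* Pn (2 * z * 2))))) (sym (ℤ.pos-* (suc (z * z)) (Pn * (2 * z * 2))))))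
      (trans (cong (ℤ._*_ (ℤ.+ (h + h))) (sym (ℤ.pos-* Y s))) (sym (ℤ.pos-* (h + h) (Y * s))))

    weighted : ∑ (2 * z) (λ p → ⟦ good? p ⟧ ℤ.* (ℤ.+ p ℤ.* D.aps p)) ℤ.≤ ℤ.+ (2 * z * tₙ)
    weighted = ℤ.≤-trans (∑-mono (2 * z) each) (ℤ.≤-reflexive (trans (∑-*ˡ (2 * z) (ℤ.+ (2 * z)) (λ p → ⟦ good? p ⟧ ℤ.* ℤ.+ links p))
        (trans (cong (ℤ._*_ (ℤ.+ (2 * z))) pairs≡) (sym (ℤ.pos-* (2 * z) tₙ)))))
      where
      each : ∀ p → p < 2 * z → ⟦ good? p ⟧ ℤ.* (ℤ.+ p ℤ.* D.aps p) ℤ.≤ ℤ.+ (2 * z) ℤ.* (⟦ good? p ⟧ ℤ.* ℤ.+ links p)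
      each p p<2z = ℤ.≤-trans (*-monoˡ {ℤ.+ p ℤ.* D.aps p} {ℤ.+ (2 * z) ℤ.* ℤ.+ links p} {⟦ good? p ⟧} (0≤⟦⟧ (good? p))
          (ℤ.≤-trans (ℤ.≤-reflexive (cong (ℤ._*_ (ℤ.+ p)) (aps-links p))) (FiniteSums.*-monoʳ {ℤ.+ p} {ℤ.+ (2 * z)} {ℤ.+ links p} (ℤ.+≤+ z≤n) (ℤ.+≤+ (<⇒≤ p<2z)))))
        (ℤ.≤-reflexive (l ⟦ good? p ⟧ (ℤ.+ (2 * z)) (ℤ.+ links p)))
        where
        open import Data.Integer.Tactic.RingSolver as ℤSolver using ()
        l : ∀ g w v → g ℤ.* (w ℤ.* v) ≡ w ℤ.* (g ℤ.* v)
        l = ℤSolver.solve-∀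

    main : Pn * πn ≤ 2 * z * tₙ + (Pn * e₂ + e)
    main = ℤ.drop‿+≤+ (ℤ.≤-trans (ℤ.≤-reflexive (trans (ℤ.pos-* Pn πn) (cong₂ ℤ._*_ (sym P≡) (+count Top? (suc Y)))))
      (ℤ.≤-trans D.progressions (ℤ.+-mono-≤ weighted (ℤ.≤-reflexive (cong₂ ℤ._+_ (trans (cong₂ ℤ._*_ P≡ Err₂≡) (sym (ℤ.pos-* Pn e₂))) Err≡)))))

    Y≤2^6h : Y ≤ 2 ^ (h * 6)
    Y≤2^6h = ≤-trans (*-mono-≤ cube cube) (≤-reflexive (trans (l (2 ^ h)) (^-*-assoc 2 h 6)))
      where
      l : ∀ a → a * a * a * (a * a * a) ≡ a * (a * (a * (a * (a * (a * 1)))))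
      l = solve-∀
      cube : z³ ≤ 2 ^ h * 2 ^ h * 2 ^ h
      cube = *-mono-≤ (*-mono-≤ (<⇒≤ z<2^h) (<⇒≤ z<2^h)) (<⇒≤ z<2^h)

    -- Chebyshev's bound at ⌊Y / 2⌋. The primes up to z³ are discarded in bulk by counting all
    -- numbers there, the end point Y is discarded separately, and the final 1 allows for odd Y.
    πn-bound : Y ≤ h * 6 * (z³ + 3 + πn) + 1
    πn-bound = ≤-trans Y≤2n+1 (+-monoˡ-≤ 1 (≤-trans (chebyshev n (h * 6) 0<n (≤-trans 2n≤Y Y≤2^6h)) (*-monoʳ-≤ (h * 6) (≤-trans (s≤s few) (≤-reflexive (l z³ πn))))))
      where
      l : ∀ a p → suc (suc a + (p + 1)) ≡ a + 3 + p
      l = solve-∀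
      split : ∃[ n ] 2 * n ≤ Y × Y ≤ 2 * n + 1
      split with halve Y
      ... | n , inj₁ Y≡ = n , ≤-reflexive 2n≡Y , ≤-trans (≤-reflexive (sym 2n≡Y)) (m≤m+n (2 * n) 1)
        where
        2n≡Y : 2 * n ≡ Y
        2n≡Y = trans (cong (n +_) (+-identityʳ n)) (sym Y≡)
      ... | n , inj₂ Y≡ = n , ≤-trans (n≤1+n (2 * n)) (≤-reflexive (sym Y≡′)) , ≤-reflexive (trans Y≡′ (+-comm 1 (2 * n)))
        where
        Y≡′ : Y ≡ suc (2 * n)
        Y≡′ = trans Y≡ (cong suc (cong (n +_) (sym (+-identityʳ n))))
      n = proj₁ split
      2n≤Y = proj₁ (proj₂ split)
      Y≤2n+1 = proj₂ (proj₂ split)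
      2≤Y : 2 ≤ Y
      2≤Y = ≤-trans 1<z (≤-trans B.z≤z³ (m≤m*n z³ z³ {{>-nonZero B.0<z³}}))
      0<n : 0 < n
      0<n = n≢0⇒n>0 λ n≡0 → contradiction (≤-trans 2≤Y (≤-trans Y≤2n+1 (≤-reflexive (cong (λ w → 2 * w + 1) n≡0)))) λ { (s≤s ()) }
      few : count prime? (suc (2 * n)) ≤ suc z³ + (πn + 1)
      few = ≤-trans (count-mono-bound (s≤s 2n≤Y)) (≤-trans (count-split prime? (_≤? z³) (λ p → Top? p ⊎-dec (p ≟ Y)) (suc Y) cover)
          (+-mono-≤ (count-≤ (_≤? z³) z³ (suc Y) (λ q → q)) (≤-trans (count-split (λ p → Top? p ⊎-dec (p ≟ Y)) Top? (_≟ Y) (suc Y) λ _ _ q → q) (+-monoʳ-≤ πn (count-≟ Y (suc Y))))))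
        where
        count-mono-bound : ∀ {a b} → a ≤ b → count prime? a ≤ count prime? b
        count-mono-bound {a} {zero} z≤n = z≤n
        count-mono-bound {a} {suc b} a≤1+b with a ≟ suc b
        ... | yes refl = ≤-refl
        ... | no  a≢   = ≤-trans (count-mono-bound (≤-pred (≤∧≢⇒< a≤1+b a≢))) (m≤m+n (count prime? b) (tick (prime? b)))
        cover : ∀ p → p < suc Y → Prime p → p ≤ z³ ⊎ (Top p ⊎ p ≡ Y)
        cover p p≤Y pp with p ≤? z³ | p ≟ Y
        ... | yes a | _ = inj₁ a
        ... | no _  | yes e = inj₂ (inj₂ e)
        ... | no a  | no b  = inj₂ (inj₁ (pp , <⇒≤ (≰⇒> a) , ≤∧≢⇒< (≤-pred p≤Y) b))

  -- An upper bound for the number of draws of a, ⌈12 ln (4 / ε) ln λ⌉, when both logarithms are at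
  -- most h + 2; the 1 is the rounding of the ceiling.
  draws : ℕ
  draws = 12 * (suc (suc h) * suc (suc h)) + 1

  private
    z⁴ : ℕ
    z⁴ = z³ * z

    z⁵≡ : z⁵ ≡ z⁴ * z
    z⁵≡ = l z
      where
      l : ∀ z → z * z * z * (z * z) ≡ z * z * z * z * z
      l = solve-∀

    Y≡ : Y ≡ z * z⁵
    Y≡ = l z
      where
      l : ∀ z → z * z * z * (z * z * z) ≡ z * (z * z * z * (z * z))
      l = solve-∀

    lower-order : z³ + 3 + (2 * z + z³ * (2 * z)) + suc (z * z) * (2 * z * 2) ≤ z⁵
    lower-order = begin
      z³ + 3 + (2 * z + z³ * (2 * z)) + suc (z * z) * (2 * z * 2)        ≡⟨ l z³ z ⟩
      z³ + 3 + 6 * z + 2 * (z³ * z) + 4 * (z * z * z)                    ≤⟨ +-mono-≤ (+-mono-≤ (+-mono-≤ (+-mono-≤ z³≤z⁴ 3≤z⁴) (*-monoʳ-≤ 6 z≤z⁴)) ≤-refl) (*-monoʳ-≤ 4 z³≤z⁴) ⟩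
      z⁴ + z⁴ + 6 * z⁴ + 2 * z⁴ + 4 * z⁴                                 ≡⟨ l₂ z⁴ ⟩
      z⁴ * 14                                                            ≤⟨ *-monoʳ-≤ z⁴ (≤-trans (≤ᵇ⇒≤ 14 100 _) 100≤z) ⟩
      z⁴ * z                                                             ≡⟨ sym z⁵≡ ⟩
      z⁵                                                                 ∎
      where
      open ≤-Reasoning
      l : ∀ a z → a + 3 + (2 * z + a * (2 * z)) + suc (z * z) * (2 * z * 2) ≡ a + 3 + 6 * z + 2 * (a * z) + 4 * (z * z * z)
      l = solve-∀
      l₂ : ∀ w → w + w + 6 * w + 2 * w + 4 * w ≡ w * 14
      l₂ = solve-∀
      z³≤z⁴ : z³ ≤ z⁴
      z³≤z⁴ = m≤m*n z³ z {{>-nonZero 0<z}}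
      z≤z⁴ : z ≤ z⁴
      z≤z⁴ = ≤-trans B.z≤z³ z³≤z⁴
      3≤z⁴ : 3 ≤ z⁴
      3≤z⁴ = ≤-trans (≤-trans (≤ᵇ⇒≤ 3 100 _) 100≤z) z≤z⁴

    minor : ℕ
    minor = 6 * h * (z³ + 3 + (2 * z + z³ * (2 * z)) + suc (z * z) * (2 * z * 2) + 3 * h * z⁵) + 1

    1≤h : 1 ≤ h
    1≤h = ≤-trans (s≤s z≤n) 58≤h

    minor-≤ : 4 * minor ≤ Y
    minor-≤ = begin
      4 * minor                                             ≤⟨ *-monoʳ-≤ 4 (+-mono-≤ (*-monoʳ-≤ (6 * h) (+-mono-≤ lower-order (≤-refl {3 * h * z⁵}))) 1≤hhz⁵) ⟩
      4 * (6 * h * (z⁵ + 3 * h * z⁵) + h * h * z⁵)          ≤⟨ *-monoʳ-≤ 4 (+-monoˡ-≤ (h * h * z⁵) (*-monoʳ-≤ (6 * h) (+-monoˡ-≤ (3 * h * z⁵) (m≤n*m z⁵ h {{>-nonZero 1≤h}})))) ⟩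
      4 * (6 * h * (h * z⁵ + 3 * h * z⁵) + h * h * z⁵)      ≡⟨ l h z⁵ ⟩
      100 * (h * h) * z⁵                                    ≤⟨ *-monoˡ-≤ z⁵ (≤-trans (*-monoʳ-≤ 100 (*-mono-≤ (n≤1+n h) (n≤1+n h))) 100x²≤z) ⟩
      z * z⁵                                                ≡⟨ sym Y≡ ⟩
      Y                                                     ∎
      where
      open ≤-Reasoning
      l : ∀ h w → 4 * (6 * h * (h * w + 3 * h * w) + h * h * w) ≡ 100 * (h * h) * w
      l = solve-∀
      0<z⁵ : 0 < z⁵
      0<z⁵ = *-mono-≤ B.0<z³ (*-mono-≤ 0<z 0<z)
      1≤hhz⁵ : 1 ≤ h * h * z⁵
      1≤hhz⁵ = *-mono-≤ (*-mono-≤ 1≤h 1≤h) 0<z⁵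

    major : ℕ
    major = 6 * h * ((h * h + 2 * h) * (Y * s))

    major-≤ : 2 * major ≤ Pn * Y
    major-≤ = begin
      2 * (6 * h * ((h * h + 2 * h) * (Y * s)))       ≡⟨ l h Y s ⟩
      12 * h * (h * h + 2 * h) * s * Y                ≤⟨ *-monoˡ-≤ Y (*-monoˡ-≤ s (*-monoʳ-≤ (12 * h) (≤-trans (m≤m+n (h * h + 2 * h) 1) (≤-reflexive (l₂ h))))) ⟩
      12 * h * (x * x) * s * Y                        ≤⟨ *-monoˡ-≤ Y (beats-root h 58≤h Pn s many (proj₂ (proj₂ (proj₂ root)))) ⟩
      Pn * Y                                          ∎
      where
      open ≤-Reasoning
      l : ∀ h y s → 2 * (6 * h * ((h * h + 2 * h) * (y * s))) ≡ 12 * h * (h * h + 2 * h) * s * y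
      l = solve-∀
      l₂ : ∀ h → h * h + 2 * h + 1 ≡ suc h * suc h
      l₂ = solve-∀

    -- Chebyshev's bound times P, with the progression estimate inserted. The errors are sorted by
    -- size: `minor` is of order h² z⁵ and loses almost a factor z against Y, while `major` collects
    -- the bilinear errors, which win only through s ≈ √(27 P).
    combined : Pn * Y ≤ 12 * h * (z * tₙ) + Pn * minor + major
    combined = begin
      Pn * Y                                                   ≤⟨ *-monoʳ-≤ Pn πn-bound ⟩
      Pn * (h * 6 * (z³ + 3 + πn) + 1)                         ≡⟨ l₁ Pn h (z³ + 3) πn ⟩
      Pn * (h * 6 * (z³ + 3) + 1) + h * 6 * (Pn * πn)          ≤⟨ +-monoʳ-≤ (Pn * (h * 6 * (z³ + 3) + 1)) (*-monoʳ-≤ (h * 6) main) ⟩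
      Pn * (h * 6 * (z³ + 3) + 1) + h * 6 * (2 * z * tₙ + (Pn * e₂ + e)) ≡⟨ l₂ Pn h z tₙ (z³ + 3) (2 * z) (z³ * (2 * z)) z⁵ (suc (z * z)) (2 * z * 2) (Y * s) ⟩
      12 * h * (z * tₙ) + Pn * minor + major                   ∎
      where
      open ≤-Reasoning
      l₁ : ∀ P h a p → P * (h * 6 * (a + p) + 1) ≡ P * (h * 6 * a + 1) + h * 6 * (P * p)
      l₁ = solve-∀
      l₂ : ∀ P h z t a b c w l m ys →
        P * (h * 6 * a + 1) + h * 6 * (2 * z * t + (P * (b + ((h + h + h) * w + c)) + (h * (h * ys) + l * (P * m) + (h + h) * ys))) ≡
        12 * h * (z * t) + P * (6 * h * (a + (b + c) + l * m + 3 * h * w) + 1) + 6 * h * ((h * h + 2 * h) * ys)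
      l₂ = solve-∀

    -- The minor errors take at most a quarter of P Y and the bilinear ones at most half of it. The
    -- remaining quarter turns the factor 12 into 48.
    density : Pn * z⁵ ≤ 48 * h * tₙ
    density = *-cancelˡ-≤ z {{>-nonZero 0<z}} (+-cancelʳ-≤ (3 * (Pn * Y)) (z * (Pn * z⁵)) (z * (48 * h * tₙ)) (begin
      z * (Pn * z⁵) + 3 * (Pn * Y)                                     ≡⟨ cong (_+ 3 * (Pn * Y)) (trans (l₁ z Pn z⁵) (cong (Pn *_) (sym Y≡))) ⟩
      Pn * Y + 3 * (Pn * Y)                                            ≡⟨ l₂ (Pn * Y) ⟩
      4 * (Pn * Y)                                                     ≤⟨ *-monoʳ-≤ 4 combined ⟩
      4 * (12 * h * (z * tₙ) + Pn * minor + major)                     ≡⟨ l₃ h z tₙ Pn minor major ⟩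
      z * (48 * h * tₙ) + (Pn * (4 * minor) + 2 * (2 * major))         ≤⟨ +-monoʳ-≤ (z * (48 * h * tₙ)) (+-mono-≤ (*-monoʳ-≤ Pn minor-≤) (*-monoʳ-≤ 2 major-≤)) ⟩
      z * (48 * h * tₙ) + (Pn * Y + 2 * (Pn * Y))                      ≡⟨ cong (z * (48 * h * tₙ) +_) (l₄ (Pn * Y)) ⟩
      z * (48 * h * tₙ) + 3 * (Pn * Y)                                 ∎))
      where
      open ≤-Reasoning
      l₁ : ∀ z p w → z * (p * w) ≡ p * (z * w)
      l₁ = solve-∀
      l₂ : ∀ a → a + 3 * a ≡ 4 * a
      l₂ = solve-∀
      l₃ : ∀ h z t p m j → 4 * (12 * h * (z * t) + p * m + j) ≡ z * (48 * h * t) + (p * (4 * m) + 2 * (2 * j))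
      l₃ = solve-∀
      l₄ : ∀ a → a + 2 * a ≡ 3 * a
      l₄ = solve-∀

    draws-≤ : 48 * h * draws ≤ Pn
    draws-≤ = begin
      48 * h * draws                                          ≤⟨ *-mono-≤ (*-monoʳ-≤ 48 (n≤1+n h)) (+-mono-≤ (*-monoʳ-≤ 12 (*-mono-≤ h+2≤2x h+2≤2x)) (*-mono-≤ {1} {x} {1} {x} (s≤s z≤n) (s≤s z≤n))) ⟩
      48 * x * (12 * (2 * x * (2 * x)) + x * x)               ≡⟨ l 12 x ⟩
      48 * (4 * 12 + 1) * (x * x * x)                         ≤⟨ *-mono-≤ (≤ᵇ⇒≤ (48 * (4 * 12 + 1)) (144 * 28) _) cube ⟩
      144 * 28 * (x * x * (x * x * (x * x)))                  ≤⟨ enough h 58≤h Pn many ⟩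
      Pn                                                      ∎
      where
      open ≤-Reasoning
      h+2≤2x : suc (suc h) ≤ 2 * x
      h+2≤2x = s≤s (≤-trans (≤-reflexive (+-comm 1 h)) (+-monoʳ-≤ h (s≤s z≤n)))
      l : ∀ c x → 48 * x * (c * (2 * x * (2 * x)) + x * x) ≡ 48 * (4 * c + 1) * (x * x * x)
      l = solve-∀
      cube : x * x * x ≤ x * x * (x * x * (x * x))
      cube = *-monoʳ-≤ (x * x) (m≤m*n x (x * (x * x)))  |> λ q → ≤-trans q (≤-reflexive (l₂ x))
        where
        open import Function using (_|>_)
        l₂ : ∀ x → x * x * (x * (x * (x * x))) ≡ x * x * (x * x * (x * x))
        l₂ = solve-∀

  -- The factor `draws` is built in because repeated drawing can favour a pair by that factor. It is
  -- of order h², and P exceeds a multiple of h⁶, so the pairs suffice for it.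
  many-pairs : ℤ.+ (draws * z⁵) ℤ.≤ pairs
  many-pairs = ℤ.≤-trans (ℤ.+≤+ (*-cancelˡ-≤ (48 * h) {{>-nonZero (*-mono-≤ {1} {48} {1} {h} (s≤s z≤n) 1≤h)}} (begin
      48 * h * (draws * z⁵)      ≡⟨ sym (*-assoc (48 * h) draws z⁵) ⟩
      48 * h * draws * z⁵        ≤⟨ *-monoˡ-≤ z⁵ draws-≤ ⟩
      Pn * z⁵                    ≤⟨ density ⟩
      48 * h * tₙ                ∎))) (ℤ.≤-reflexive (sym pairs≡))
    where open ≤-Reasoning

-- Roots of polynomials modulo a prime.

module Lagrange where
  open import Data.Nat as ℕ using (ℕ; zero; suc)
  import Data.Nat.Properties as ℕ
  open import Data.Nat.Primality using (Prime)
  open import Data.Integer hiding (suc) renaming (∣_∣ to abs)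
  open import Data.Integer.Properties
  open import Data.Integer.Divisibility.Signed
  open import Data.Integer.Tactic.RingSolver using (solve-∀)
  open import Data.List using (List; []; _∷_; length; replicate)
  open import Data.List.Properties using (length-replicate)
  open import Data.Product using (∃-syntax; _×_; _,_)
  open import Data.Sum using (_⊎_; inj₁; inj₂)
  open import Relation.Nullary using (Dec; yes; no)
  open import Relation.Binary.PropositionalEquality
  open FiniteSums using (count; count-0; tick-no)
  open Residues
  open Counting using (count-split; count-≟)

  -- A monic polynomial, given by its coefficients below the leading one.
  eval : List ℤ → ℤ → ℤ
  eval []       x = 1ℤ
  eval (c ∷ cs) x = c + x * eval cs x

  -- Synthetic division by x - r: the Horner values at r of the tails are the coefficients of the
  -- quotient.
  divide : ℤ → List ℤ → List ℤ
  divide r []       = []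
  divide r (d ∷ ds) = eval (d ∷ ds) r ∷ divide r ds

  divide-length : ∀ r cs → length (divide r cs) ≡ length cs
  divide-length r []       = refl
  divide-length r (d ∷ ds) = cong suc (divide-length r ds)

  divide-eval : ∀ r c cs x → eval (c ∷ cs) x - eval (c ∷ cs) r ≡ (x - r) * eval (divide r cs) x
  divide-eval r c []       x = l c x r
    where
    l : ∀ c x r → c + x * 1ℤ - (c + r * 1ℤ) ≡ (x - r) * 1ℤ
    l = solve-∀
  divide-eval r c (d ∷ ds) x = trans (l₁ c x r (eval (d ∷ ds) x) (eval (d ∷ ds) r))
      (trans (cong (λ w → (x - r) * eval (d ∷ ds) r + x * w) (divide-eval r d ds x)) (l₂ x r (eval (d ∷ ds) r) (eval (divide r ds) x)))
    where
    l₁ : ∀ c x r f g → c + x * f - (c + r * g) ≡ (x - r) * g + x * (f - g)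
    l₁ = solve-∀
    l₂ : ∀ x r g q → (x - r) * g + x * ((x - r) * q) ≡ (x - r) * (g + x * q)
    l₂ = solve-∀

  count-witness : ∀ {Q : ℕ → Set} (Q? : ∀ m → Dec (Q m)) N → count Q? N ≡ 0 ⊎ ∃[ m ] m ℕ.< N × Q m
  count-witness Q? zero = inj₁ refl
  count-witness {Q} Q? (suc N) = go (Q? N) (count-witness Q? N)
    where
    go : Dec (Q N) → count Q? N ≡ 0 ⊎ ∃[ m ] m ℕ.< N × Q m → count Q? (suc N) ≡ 0 ⊎ ∃[ m ] m ℕ.< suc N × Q m
    go (yes q) _                    = inj₂ (N , ℕ.n<1+n N , q)
    go (no _)  (inj₂ (m , m<N , q)) = inj₂ (m , ℕ.m<n⇒m<1+n m<N , q)
    go (no ¬q) (inj₁ c≡0)           = inj₁ (cong₂ ℕ._+_ c≡0 (tick-no (Q? N) ¬q))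

  root? : ∀ q cs x → Dec (+ q ∣ eval cs (+ x))
  root? q cs x = + q ∣? eval cs (+ x)

  -- Lagrange's theorem by induction on the degree: given one root r, every other root is a root of
  -- the quotient by x - r, since q is prime.
  roots-≤ : ∀ {q} → Prime q → ∀ cs n → length cs ≡ n → count (root? q cs) q ℕ.≤ n
  roots-≤ {q} pq []       n len = ℕ.≤-trans (ℕ.≤-reflexive (count-0 (root? q []) q λ _ _ → prime-∤1 pq)) ℕ.z≤n
  roots-≤ {q} pq (c ∷ cs) (suc n) len = go (count-witness (root? q (c ∷ cs)) q)
    where
    go : count (root? q (c ∷ cs)) q ≡ 0 ⊎ ∃[ r ] r ℕ.< q × (+ q ∣ eval (c ∷ cs) (+ r)) → count (root? q (c ∷ cs)) q ℕ.≤ suc n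
    go (inj₁ c≡0) = ℕ.≤-trans (ℕ.≤-reflexive c≡0) ℕ.z≤n
    go (inj₂ (r , r<q , q∣fr)) = ℕ.≤-trans (count-split (root? q (c ∷ cs)) (ℕ._≟ r) (root? q (divide (+ r) cs)) q cover)
        (ℕ.+-mono-≤ (count-≟ r q) (roots-≤ pq (divide (+ r) cs) n (trans (divide-length (+ r) cs) (ℕ.suc-injective len))))
      where
      cover : ∀ x → x ℕ.< q → + q ∣ eval (c ∷ cs) (+ x) → x ≡ r ⊎ + q ∣ eval (divide (+ r) cs) (+ x)
      cover x x<q q∣fx with prime-∣* pq (+ x - + r) (eval (divide (+ r) cs) (+ x))
        (subst (+ q ∣_) (divide-eval (+ r) c cs (+ x)) (∣-- (+ q) (eval (c ∷ cs) (+ x)) (eval (c ∷ cs) (+ r)) q∣fx q∣fr))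
      ... | inj₂ h = inj₂ h
      ... | inj₁ q∣x-r with ℕ.≤-total r x
      ...   | inj₁ r≤x = inj₁ (<p-∣-≡ x r x<q r≤x q∣x-r)
      ...   | inj₂ x≤r = inj₁ (sym (<p-∣-≡ r x r<q x≤r (subst (+ q ∣_) (l (+ x) (+ r)) (∣m⇒∣-m {+ q} {+ x - + r} q∣x-r))))
        where
        l : ∀ x r → - (x - r) ≡ r - x
        l = solve-∀

  unity : ℕ → List ℤ
  unity n = - 1ℤ ∷ replicate n 0ℤ

  unity-eval : ∀ n x → eval (unity n) (+ x) ≡ + (x ℕ.^ suc n) - 1ℤ
  unity-eval n x = trans (cong (λ w → - 1ℤ + + x * w) (power n)) (trans (cong (_+_ (- 1ℤ)) (sym (pos-* x (x ℕ.^ n)))) (+-comm (- 1ℤ) (+ (x ℕ.^ suc n))))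
    where
    power : ∀ n → eval (replicate n 0ℤ) (+ x) ≡ + (x ℕ.^ n)
    power zero    = refl
    power (suc n) = trans (+-identityˡ (+ x * eval (replicate n 0ℤ) (+ x))) (trans (cong (+ x *_) (power n)) (sym (pos-* x (x ℕ.^ n))))

  unity-roots-≤ : ∀ {q} → Prime q → ∀ n → count (root? q (unity n)) q ℕ.≤ suc n
  unity-roots-≤ pq n = roots-≤ pq (unity n) (suc n) (cong suc (length-replicate n))

-- Sums over lists compared with sums over ranges.

module ListSums where
  open import Data.Nat
  open import Data.Nat.Properties
  open import Data.List using (List; []; _∷_; applyUpTo)
  open import Data.List.Membership.Propositional using (_∈_)
  open import Data.List.Relation.Unary.Any using (here; there)
  open import Data.List.Relation.Unary.All as All using (All; []; _∷_)
  open import Data.List.Relation.Unary.AllPairs using ([]; _∷_)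
  open import Data.List.Relation.Unary.Unique.Propositional using (Unique)
  open import Data.Product using (∃-syntax; _×_; _,_)
  open import Data.Sum using (_⊎_; inj₁; inj₂)
  open import Relation.Nullary using (Dec; yes; no)
  open import Relation.Binary.PropositionalEquality
  open FiniteSums using (tick; tick-yes; tick-no; count)
  open Exact using (∑ℕ; ∑ℕ-+; ∑ℕ-zero)

  sumL : (ℕ → ℕ) → List ℕ → ℕ
  sumL f []       = 0
  sumL f (x ∷ xs) = f x + sumL f xs

  sumL-mono : ∀ {f g : ℕ → ℕ} xs → (∀ {x} → x ∈ xs → f x ≤ g x) → sumL f xs ≤ sumL g xs
  sumL-mono []       le = z≤n
  sumL-mono (x ∷ xs) le = +-mono-≤ (le (here refl)) (sumL-mono xs λ x∈ → le (there x∈))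

  ∑ℕ-mono : ∀ n {f g : ℕ → ℕ} → (∀ i → i < n → f i ≤ g i) → ∑ℕ n f ≤ ∑ℕ n g
  ∑ℕ-mono zero    le = z≤n
  ∑ℕ-mono (suc n) le = +-mono-≤ (∑ℕ-mono n λ i i<n → le i (m<n⇒m<1+n i<n)) (le n (n<1+n n))

  ∑ℕ-count : ∀ {Q : ℕ → Set} (Q? : ∀ m → Dec (Q m)) n → ∑ℕ n (λ m → tick (Q? m)) ≡ count Q? n
  ∑ℕ-count Q? zero    = refl
  ∑ℕ-count Q? (suc n) = cong (_+ tick (Q? n)) (∑ℕ-count Q? n)

  ∑ℕ-swap : ∀ m n (f : ℕ → ℕ → ℕ) → ∑ℕ m (λ i → ∑ℕ n (f i)) ≡ ∑ℕ n (λ j → ∑ℕ m (λ i → f i j))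
  ∑ℕ-swap zero    n f = sym (∑ℕ-zero n)
  ∑ℕ-swap (suc m) n f = trans (cong (_+ ∑ℕ n (f m)) (∑ℕ-swap m n f)) (sym (∑ℕ-+ n (λ j → ∑ℕ m (λ i → f i j)) (f m)))

  ∑ℕ-sumL : ∀ n xs (f : ℕ → ℕ → ℕ) → ∑ℕ n (λ i → sumL (f i) xs) ≡ sumL (λ x → ∑ℕ n (λ i → f i x)) xs
  ∑ℕ-sumL n []       f = ∑ℕ-zero n
  ∑ℕ-sumL n (x ∷ xs) f = trans (∑ℕ-+ n (λ i → f i x) (λ i → sumL (f i) xs)) (cong (∑ℕ n (λ i → f i x) +_) (∑ℕ-sumL n xs f))

  ∑ℕ-*ʳ : ∀ n c (f : ℕ → ℕ) → ∑ℕ n (λ i → f i * c) ≡ ∑ℕ n f * c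
  ∑ℕ-*ʳ zero    c f = refl
  ∑ℕ-*ʳ (suc n) c f = trans (cong (_+ f n * c) (∑ℕ-*ʳ n c f)) (sym (*-distribʳ-+ c (∑ℕ n f) (f n)))

  ∑ℕ-δ≤ : ∀ n k (f : ℕ → ℕ) → ∑ℕ n (λ i → tick (k ≟ i) * f i) ≤ f k
  ∑ℕ-δ≤ zero    k f = z≤n
  ∑ℕ-δ≤ (suc n) k f = go (k ≟ n)
    where
    below : ∀ n → n ≤ k → ∑ℕ n (λ i → tick (k ≟ i) * f i) ≡ 0
    below zero    _   = refl
    below (suc n) n<k = cong₂ _+_ (below n (<⇒≤ n<k)) (cong (_* f n) (tick-no (k ≟ n) λ e → <⇒≢ n<k (sym e)))
    go : Dec (k ≡ n) → ∑ℕ n (λ i → tick (k ≟ i) * f i) + tick (k ≟ n) * f n ≤ f k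
    go (yes refl) = ≤-reflexive (trans (cong₂ _+_ (below n ≤-refl) (trans (cong (_* f n) (tick-yes (n ≟ n) refl)) (*-identityˡ (f n)))) refl)
    go (no k≢n) = ≤-trans (≤-reflexive (trans (cong (λ w → ∑ℕ n (λ i → tick (k ≟ i) * f i) + w * f n) (tick-no (k ≟ n) k≢n)) (+-identityʳ (∑ℕ n (λ i → tick (k ≟ i) * f i))))) (∑ℕ-δ≤ n k f)

  ∑ℕ-δ≥ : ∀ n k (f : ℕ → ℕ) → k < n → f k ≤ ∑ℕ n (λ i → tick (k ≟ i) * f i)
  ∑ℕ-δ≥ (suc n) k f k<1+n = go (k ≟ n)
    where
    go : Dec (k ≡ n) → f k ≤ ∑ℕ n (λ i → tick (k ≟ i) * f i) + tick (k ≟ n) * f n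
    go (yes refl) = ≤-trans (≤-reflexive (sym (trans (cong (_* f n) (tick-yes (n ≟ n) refl)) (*-identityˡ (f n))))) (m≤n+m (tick (n ≟ n) * f n) (∑ℕ n (λ i → tick (n ≟ i) * f i)))
    go (no k≢n) = ≤-trans (∑ℕ-δ≥ n k f (≤∧≢⇒< (≤-pred k<1+n) k≢n)) (m≤m+n (∑ℕ n (λ i → tick (k ≟ i) * f i)) (tick (k ≟ n) * f n))

  sumL-member : ∀ (f : ℕ → ℕ) {x xs} → x ∈ xs → f x ≤ sumL f xs
  sumL-member f {xs = x ∷ xs} (here refl) = m≤m+n (f x) (sumL f xs)
  sumL-member f {xs = x ∷ xs} (there x∈)  = ≤-trans (sumL-member f x∈) (m≤n+m (sumL f xs) (f x))

  -- Each n is charged to a list element with key n; exchanging the sums shows that an element is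
  -- charged for one n only.
  cover-≤ : ∀ N xs (key f g : ℕ → ℕ) → (∀ n → n < N → f n ≡ 0 ⊎ (∃[ x ] x ∈ xs × key x ≡ n × f n ≤ g x)) → ∑ℕ N f ≤ sumL g xs
  cover-≤ N xs key f g cov = begin
    ∑ℕ N f                                                ≤⟨ ∑ℕ-mono N each ⟩
    ∑ℕ N (λ n → sumL (λ x → tick (key x ≟ n) * g x) xs)   ≡⟨ ∑ℕ-sumL N xs (λ n x → tick (key x ≟ n) * g x) ⟩
    sumL (λ x → ∑ℕ N (λ n → tick (key x ≟ n) * g x)) xs   ≤⟨ sumL-mono xs (λ {x} _ → ∑ℕ-δ≤ N (key x) (λ _ → g x)) ⟩
    sumL g xs                                             ∎
    where
    open ≤-Reasoning
    each : ∀ n → n < N → f n ≤ sumL (λ x → tick (key x ≟ n) * g x) xs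
    each n n<N with cov n n<N
    ... | inj₁ f≡0 = ≤-trans (≤-reflexive f≡0) z≤n
    ... | inj₂ (x , x∈ , k≡n , f≤g) = ≤-trans f≤g (≤-trans (≤-reflexive (sym (trans (cong (_* g x) (tick-yes (key x ≟ n) k≡n)) (*-identityˡ (g x)))))
      (sumL-member (λ x → tick (key x ≟ n) * g x) x∈))

  -- The converse of `cover-≤`: here several elements must not charge the same n, which needs
  -- distinct entries and an injective key.
  pack-≤ : ∀ N xs (key f g : ℕ → ℕ) → Unique xs → (∀ {x y} → key x ≡ key y → x ≡ y) →
           (∀ {x} → x ∈ xs → g x ≡ 0 ⊎ (key x < N × g x ≤ f (key x))) → sumL g xs ≤ ∑ℕ N f
  pack-≤ N xs key f g uniq inj packs = begin
    sumL g xs                                             ≤⟨ sumL-mono xs each ⟩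
    sumL (λ x → ∑ℕ N (λ n → tick (key x ≟ n) * f n)) xs   ≡⟨ sym (∑ℕ-sumL N xs (λ n x → tick (key x ≟ n) * f n)) ⟩
    ∑ℕ N (λ n → sumL (λ x → tick (key x ≟ n) * f n) xs)   ≤⟨ ∑ℕ-mono N (λ n _ → once n xs uniq) ⟩
    ∑ℕ N f                                                ∎
    where
    open ≤-Reasoning
    each : ∀ {x} → x ∈ xs → g x ≤ ∑ℕ N (λ n → tick (key x ≟ n) * f n)
    each {x} x∈ with packs x∈
    ... | inj₁ g≡0 = ≤-trans (≤-reflexive g≡0) z≤n
    ... | inj₂ (k<N , g≤f) = ≤-trans g≤f (∑ℕ-δ≥ N (key x) f k<N)
    none : ∀ n xs → All (λ y → key y ≢ n) xs → sumL (λ x → tick (key x ≟ n) * f n) xs ≡ 0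
    none n []       _            = refl
    none n (x ∷ xs) (x≢ ∷ rest) = cong₂ _+_ (cong (_* f n) (tick-no (key x ≟ n) x≢)) (none n xs rest)
    once : ∀ n xs → Unique xs → sumL (λ x → tick (key x ≟ n) * f n) xs ≤ f n
    once n []       _           = z≤n
    once n (x ∷ xs) (x∉ ∷ uniq) = go (key x ≟ n)
      where
      go : Dec (key x ≡ n) → tick (key x ≟ n) * f n + sumL (λ x → tick (key x ≟ n) * f n) xs ≤ f n
      go (yes e) = ≤-reflexive (trans (cong₂ _+_ (trans (cong (_* f n) (tick-yes (key x ≟ n) e)) (*-identityˡ (f n)))
        (none n xs (All.map (λ x≢y ky≡n → x≢y (inj (trans e (sym ky≡n)))) x∉))) (+-identityʳ (f n)))
      go (no ne) = ≤-trans (≤-reflexive (cong (λ w → w * f n + sumL (λ x → tick (key x ≟ n) * f n) xs) (tick-no (key x ≟ n) ne))) (once n xs uniq)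

  sumL-applyUpTo : ∀ f (g : ℕ → ℕ) n → sumL f (applyUpTo g n) ≡ ∑ℕ n (λ i → f (g i))
  sumL-applyUpTo f g zero    = refl
  sumL-applyUpTo f g (suc n) = trans (cong (f (g 0) +_) (sumL-applyUpTo f (λ i → g (suc i)) n)) (sym (front n (λ i → f (g i))))
    where
    front : ∀ n (h : ℕ → ℕ) → ∑ℕ (suc n) h ≡ h 0 + ∑ℕ n (λ i → h (suc i))
    front zero    h = sym (+-identityʳ (h 0))
    front (suc n) h = trans (cong (_+ h (suc n)) (front n h)) (+-assoc (h 0) (∑ℕ n (λ i → h (suc i))) (h (suc n)))

-- Good and bad pairs in the sample spaces.

module Arithmetic (z h K : ℕ) (0<K : 0 ℕ.< K) (58≤h : 58 ℕ.≤ h) (z<2^h : z ℕ.< 2 ℕ.^ h) (2^h≤2z : 2 ℕ.^ h ℕ.≤ 2 ℕ.* z)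
  (os es : List ℕ) (os-unique : Unique os) (es-unique : Unique es)
  (os-≥ : ∀ {p} → p ∈ os → z ℕ.< p) (os-≤ : ∀ {p} → p ∈ os → p ℕ.≤ 2 ℕ.* z ℕ.+ 4)
  (∈-os : ∀ {p} → 2 ℕ.∤ p → 2 ℕ.+ z ℕ.< p → p ℕ.< 2 ℕ.* z → p ∈ os)
  (es-≤ : ∀ {a} → a ∈ es → a ℕ.≤ (z ℕ.+ 2) ℕ.^ 5)
  (∈-es : ∀ {a} → 2 ℕ.∣ a → 1 ℕ.≤ a → a ℕ.≤ z ℕ.* z ℕ.* z ℕ.* (z ℕ.* z) → a ∈ es) where

  open import Data.Nat
  open import Data.Nat.Properties
  open import Data.Nat.Divisibility
  open import Data.List using (List)
  open import Data.List.Membership.Propositional using (_∈_)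
  open import Data.List.Relation.Unary.Unique.Propositional using (Unique)
  open import Relation.Nullary using (Dec; yes; no; contradiction)
  open import Data.Nat.Primality
  open import Data.Nat.Tactic.RingSolver using (solve-∀)
  import Data.Integer as ℤ
  import Data.Integer.Properties as ℤ
  open import Data.Product using (∃-syntax; _×_; _,_; proj₁)
  open import Data.Sum using (_⊎_; inj₁; inj₂)
  open import Relation.Nullary.Decidable using (_×-dec_)
  open import Relation.Binary.PropositionalEquality
  open import Function using (id)
  open FiniteSums using (tick; tick-yes; tick-no; count; count-0; +tick; ∑)
  open PrimeDivisors using (power-count-≤; count-<)
  open Exact using (∑ℕ; 1<prime)
  open ListSums
  open Growth using (100x²≤half)
  open PairCount z h 58≤h z<2^h 2^h≤2z

  A B : ℕ → ℕ
  A p = sumL (λ a → tick (prime? (a * p + 1))) es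
  B p = sumL (λ a → tick (prime? (a * p + 1) ×-dec (a * p + 1 ∣? K))) es

  ΣA ΣB : ℕ
  ΣA = sumL (λ p → tick (prime? p) * A p) os
  ΣB = sumL (λ p → tick (prime? p) * B p) os

  PK? : ∀ n → Dec (Prime n × n ∣ K)
  PK? n = prime? n ×-dec (n ∣? K)

  divisors : ℕ
  divisors = count PK? (suc K)

  2^divisors≤K : 2 ^ divisors ≤ K
  2^divisors≤K = power-count-≤ {2} {K} {{>-nonZero 0<K}} PK? (λ (pn , n∣K) → pn , 1<prime pn , n∣K) (suc K)

  private
    tick-≤ : ∀ {X Y : Set} (d : Dec X) (e : Dec Y) → (X → Y) → tick d ≤ tick e
    tick-≤ d e f = go d
      where
      go : Dec _ → tick d ≤ tick e
      go (yes x) = ≤-reflexive (trans (tick-yes d x) (sym (tick-yes e (f x))))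
      go (no ¬x) = ≤-trans (≤-reflexive (tick-no d ¬x)) z≤n

    200≤z : 200 ≤ z
    200≤z = ≤-trans (*-monoʳ-≤ 100 {2} {suc h * suc h} (s≤s (≤-trans (≤-trans (s≤s z≤n) 58≤h) (m≤m+n h (h * suc h))))) (100x²≤half h 58≤h z 2^h≤2z)

    2≤z : 2 ≤ z
    2≤z = ≤-trans (s≤s (s≤s z≤n)) 200≤z

    0<z : 0 < z
    0<z = ≤-trans (s≤s z≤n) 2≤z

    odd-prime : ∀ {p} → Prime p → 2 < p → 2 ∤ p
    odd-prime pp 2<p 2∣p = <⇒≢ 2<p (distinct 2∣p)
      where
      distinct : 2 ∣ _ → 2 ≡ _
      distinct 2∣p with prime⇒irreducible pp 2∣p
      ... | inj₁ ()
      ... | inj₂ e = e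

    pred-even : ∀ n → 2 ∤ suc n → 2 ∣ n
    pred-even n 2∤1+n with even-or-odd n
      where
      even-or-odd : ∀ n → 2 ∣ n ⊎ 2 ∣ suc n
      even-or-odd zero    = inj₁ (2 ∣0)
      even-or-odd (suc n) with even-or-odd n
      ... | inj₁ e = inj₂ (∣m∣n⇒∣m+n (∣-refl {2}) e)
      ... | inj₂ o = inj₁ o
    ... | inj₁ e = e
    ... | inj₂ o = contradiction o 2∤1+n

    z³≥8 : 2 < z³
    z³≥8 = ≤-trans (s≤s (s≤s (s≤s z≤n))) (*-mono-≤ (*-mono-≤ 2≤z 2≤z) 2≤z)

    -- A prime q ≡ 1 (mod p) is a p + 1 with a = (q - 1) / p. As q and p are odd, a is even, and q <
    -- z⁶ with p > z gives a ≤ z⁵, so a lies in the sample space.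
    links-≤ : ∀ {p} → Good p → links p ≤ A p
    links-≤ {p} (pp , 2+z<p , _) = subst (_≤ A p) (∑ℕ-count (link? p) (suc Y))
        (cover-≤ (suc Y) es (λ a → a * p + 1) (λ n → tick (link? p n)) (λ a → tick (prime? (a * p + 1))) λ n _ → go n (link? p n))
      where
      z<p : z < p
      z<p = <-trans (n<1+n z) (<-trans (n<1+n (suc z)) 2+z<p)
      go : ∀ n → Dec (Top n × p ∣ n ∸ 1) → tick (link? p n) ≡ 0 ⊎ (∃[ a ] a ∈ es × a * p + 1 ≡ n × tick (link? p n) ≤ tick (prime? (a * p + 1)))
      go n (no ¬l) = inj₁ (tick-no (link? p n) ¬l)
      go zero (yes ((_ , z³≤0 , _) , _)) = contradiction (≤-trans z³≥8 z³≤0) λ ()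
      go (suc n) (yes ((pn , z³≤n , n<Y) , divides a n≡ap)) = inj₂ (a , ∈-es 2∣a 1≤a a≤z⁵ , key , tick-≤ (link? p (suc n)) (prime? (a * p + 1)) (λ ((pn , _) , _) → subst Prime (sym key) pn))
        where
        key : a * p + 1 ≡ suc n
        key = trans (+-comm (a * p) 1) (cong suc (sym n≡ap))
        2∣a : 2 ∣ a
        2∣a = resolve (euclidsLemma a p prime[2] (subst (2 ∣_) n≡ap (pred-even n (odd-prime pn (<-≤-trans z³≥8 z³≤n)))))
          where
          resolve : 2 ∣ a ⊎ 2 ∣ p → 2 ∣ a
          resolve (inj₁ h) = h
          resolve (inj₂ h) = contradiction h (odd-prime pp (≤-<-trans 2≤z z<p))
        1≤a : 1 ≤ a
        1≤a = n≢0⇒n>0 λ a≡0 → <⇒≱ (<-≤-trans z³≥8 z³≤n) (s≤s (≤-trans (≤-reflexive (trans n≡ap (cong (_* p) a≡0))) z≤n))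
        l : ∀ z → z * z * z * (z * z * z) ≡ z * z * z * (z * z) * z
        l = solve-∀
        a≤z⁵ : a ≤ z⁵
        a≤z⁵ = ≮⇒≥ λ z⁵<a → <⇒≱ n<Y (≤-trans (≤-reflexive (l z)) (≤-trans (*-mono-≤ (<⇒≤ z⁵<a) (<⇒≤ z<p)) (≤-trans (≤-reflexive (sym n≡ap)) (n≤1+n n))))

    +∑ℕ : ∀ n f → ℤ.+ ∑ℕ n f ≡ ∑ n (λ i → ℤ.+ f i)
    +∑ℕ zero    f = refl
    +∑ℕ (suc n) f = cong (λ w → w ℤ.+ ℤ.+ f n) (+∑ℕ n f)

  many-A : draws * z⁵ ≤ ΣA
  many-A = ≤-trans (ℤ.drop‿+≤+ (ℤ.≤-trans many-pairs (ℤ.≤-reflexive (sym eq))))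
      (cover-≤ (2 * z) os id (λ p → tick (good? p) * links p) (λ p → tick (prime? p) * A p) λ p _ → go p (good? p))
    where
    eq : ℤ.+ ∑ℕ (2 * z) (λ p → tick (good? p) * links p) ≡ pairs
    eq = trans (+∑ℕ (2 * z) (λ p → tick (good? p) * links p)) (FiniteSums.∑-cong′ (2 * z) λ p →
      trans (ℤ.pos-* (tick (good? p)) (links p)) (cong (λ w → w ℤ.* ℤ.+ links p) (+tick (good? p))))
    go : ∀ p → Dec (Good p) → tick (good? p) * links p ≡ 0 ⊎ (∃[ x ] x ∈ os × x ≡ p × tick (good? p) * links p ≤ tick (prime? x) * A x)
    go p (no ¬g) = inj₁ (cong (_* links p) (tick-no (good? p) ¬g))
    go p (yes g@(pp , lo , hi)) = inj₂ (p , ∈-os (odd-prime pp (≤-<-trans (≤-trans 2≤z (m≤n+m z 2)) lo)) lo hi , refl ,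
      *-mono-≤ (tick-≤ (good? p) (prime? p) proj₁) (links-≤ g))

  private
    -- A bad pair described through n = q alone, without a. Exchanging the sums then counts, for
    -- each prime n ∣ K, the p that divide n - 1.
    Hit : ℕ → ℕ → Set
    Hit p n = Prime p × z ≤ p × (Prime n × n ∣ K) × p ∣ n ∸ 1 × n ∸ 1 < z ^ 7

    hit? : ∀ p n → Dec (Hit p n)
    hit? p n = prime? p ×-dec (z ≤? p ×-dec (PK? n ×-dec ((p ∣? n ∸ 1) ×-dec (n ∸ 1 <? z ^ 7))))

    -- Seven primes p ≥ z dividing n - 1 would make it at least z⁷, so at most six exist.
    hits-≤ : ∀ n N → count (λ p → hit? p n) N ≤ tick (PK? n) * 6
    hits-≤ n N = go (PK? n) (n ∸ 1 <? z ^ 7)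
      where
      go : Dec (Prime n × n ∣ K) → Dec (n ∸ 1 < z ^ 7) → count (λ p → hit? p n) N ≤ tick (PK? n) * 6
      go (no ¬pk) _ = ≤-trans (≤-reflexive (count-0 (λ p → hit? p n) N λ p _ (_ , _ , pk , _) → ¬pk pk)) z≤n
      go (yes _) (no ¬b) = ≤-trans (≤-reflexive (count-0 (λ p → hit? p n) N λ p _ (_ , _ , _ , _ , b) → ¬b b)) z≤n
      go (yes pk) (yes b) = ≤-trans (≤-pred (count-< {z} {n ∸ 1} 2≤z {{>-nonZero (m<n⇒0<n∸m (1<prime (proj₁ pk)))}} (λ p → hit? p n)
          (λ (pp , z≤p , _ , p∣ , _) → pp , z≤p , p∣) N 7 b))
        (≤-reflexive (sym (trans (cong (_* 6) (tick-yes (PK? n) pk)) (*-identityˡ 6))))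

    -- The drawn a and p can exceed z⁵ and 2 z a little, as λ ≤ z + 2. Crudely a p ≤ 128 z⁶, and z ≥
    -- 200 absorbs the constant in one more factor z; hence the bound z⁷.
    size : ∀ {a p} → a ≤ (z + 2) ^ 5 → p ≤ 2 * z + 4 → a * p < z ^ 7
    size {a} {p} a≤ p≤ = begin-strict
      a * p                                       ≤⟨ *-mono-≤ a≤ p≤ ⟩
      (z + 2) ^ 5 * (2 * z + 4)                   ≤⟨ *-mono-≤ (^-monoˡ-≤ 5 z+2≤2z) 2z+4≤4z ⟩
      (2 * z) ^ 5 * (4 * z)                       ≡⟨ l z ⟩
      128 * (z * (z * (z * (z * (z * (z * 1)))))) <⟨ *-monoˡ-< (z ^ 6) {{m^n≢0 z 6 {{>-nonZero 0<z}}}} (≤-trans (≤ᵇ⇒≤ 129 200 _) 200≤z) ⟩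
      z * z ^ 6                                   ∎
      where
      open ≤-Reasoning
      z+2≤2z : z + 2 ≤ 2 * z
      z+2≤2z = ≤-trans (+-monoʳ-≤ z 2≤z) (≤-reflexive (cong (z +_) (sym (+-identityʳ z))))
      2z+4≤4z : 2 * z + 4 ≤ 4 * z
      2z+4≤4z = ≤-trans (+-monoʳ-≤ (2 * z) (*-monoʳ-≤ 2 2≤z)) (≤-reflexive (l₂ z))
        where
        l₂ : ∀ z → 2 * z + 2 * z ≡ 4 * z
        l₂ = solve-∀
      l : ∀ z → 2 * z * (2 * z * (2 * z * (2 * z * (2 * z * 1)))) * (4 * z) ≡ 128 * (z * (z * (z * (z * (z * (z * 1))))))
      l = solve-∀

  few-B : ΣB ≤ divisors * 6
  few-B = begin
    ΣB                                                                  ≤⟨ pack-≤ N os id (λ p → ∑ℕ (suc K) (λ n → tick (hit? p n))) (λ p → tick (prime? p) * B p) os-unique id row ⟩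
    ∑ℕ N (λ p → ∑ℕ (suc K) (λ n → tick (hit? p n)))                     ≡⟨ ∑ℕ-swap N (suc K) (λ p n → tick (hit? p n)) ⟩
    ∑ℕ (suc K) (λ n → ∑ℕ N (λ p → tick (hit? p n)))                     ≤⟨ ∑ℕ-mono (suc K) (λ n _ → ≤-trans (≤-reflexive (∑ℕ-count (λ p → hit? p n) N)) (hits-≤ n N)) ⟩
    ∑ℕ (suc K) (λ n → tick (PK? n) * 6)                                 ≡⟨ trans (∑ℕ-*ʳ (suc K) 6 (λ n → tick (PK? n))) (cong (_* 6) (∑ℕ-count PK? (suc K))) ⟩
    divisors * 6                                                        ∎
    where
    open ≤-Reasoning
    N = suc (2 * z + 4)
    row : ∀ {p} → p ∈ os → tick (prime? p) * B p ≡ 0 ⊎ (p < N × tick (prime? p) * B p ≤ ∑ℕ (suc K) (λ n → tick (hit? p n)))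
    row {p} p∈ = go (prime? p)
      where
      go : Dec (Prime p) → tick (prime? p) * B p ≡ 0 ⊎ (p < N × tick (prime? p) * B p ≤ ∑ℕ (suc K) (λ n → tick (hit? p n)))
      go (no ¬pp) = inj₁ (cong (_* B p) (tick-no (prime? p) ¬pp))
      go (yes pp) = inj₂ (s≤s (os-≤ p∈) , ≤-trans (≤-reflexive (trans (cong (_* B p) (tick-yes (prime? p) pp)) (*-identityˡ (B p))))
          (pack-≤ (suc K) es (λ a → a * p + 1) (λ n → tick (hit? p n)) (λ a → tick (prime? (a * p + 1) ×-dec (a * p + 1 ∣? K))) es-unique
            (λ {a} {b} e → *-cancelʳ-≡ a b p {{prime⇒nonZero pp}} (+-cancelʳ-≡ 1 (a * p) (b * p) e)) λ {a} a∈ → entry a a∈ (prime? (a * p + 1) ×-dec (a * p + 1 ∣? K))))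
        where
        entry : ∀ a → a ∈ es → (d : Dec (Prime (a * p + 1) × a * p + 1 ∣ K)) → tick (prime? (a * p + 1) ×-dec (a * p + 1 ∣? K)) ≡ 0 ⊎
                (a * p + 1 < suc K × tick (prime? (a * p + 1) ×-dec (a * p + 1 ∣? K)) ≤ tick (hit? p (a * p + 1)))
        entry a a∈ (no ¬d) = inj₁ (tick-no (prime? (a * p + 1) ×-dec (a * p + 1 ∣? K)) ¬d)
        entry a a∈ (yes (pn , n∣K)) = inj₂ (s≤s (∣⇒≤ {{>-nonZero 0<K}} n∣K) , tick-≤ (prime? (a * p + 1) ×-dec (a * p + 1 ∣? K)) (hit? p (a * p + 1)) λ pk →
            pp , <⇒≤ (os-≥ p∈) , pk , subst (p ∣_) (sym minus) (n∣m*n a) , subst (_< z ^ 7) (sym minus) (size (es-≤ a∈) (os-≤ p∈)))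
          where
          minus : a * p + 1 ∸ 1 ≡ a * p
          minus = m+n∸n≡m (a * p) 1

-- Natural numbers as rationals.

module Rationals where
  open import Data.Nat as ℕ using (ℕ; suc)
  import Data.Nat.Properties as ℕ
  import Data.Integer as ℤ
  import Data.Integer.Properties as ℤ
  open import Data.Rational
  open import Data.Rational.Properties
  import Data.Rational.Unnormalised as ℚᵘ
  import Data.Rational.Unnormalised.Properties as ℚᵘ
  open import Relation.Binary.PropositionalEquality
  open import Relation.Nullary using (yes; no; contradiction)
  open import Defs using (inv)

  q : ℕ → ℚ
  q n = ℤ.+ n / 1

  -- Rationals are kept in lowest terms; for unnormalised fractions the identities below become
  -- cross multiplications of integers.
  toℚᵘ-q : ∀ n → toℚᵘ (q n) ℚᵘ.≃ ℚᵘ.mkℚᵘ (ℤ.+ n) 0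
  toℚᵘ-q n = toℚᵘ-fromℚᵘ (ℚᵘ.mkℚᵘ (ℤ.+ n) 0)

  q-+ : ∀ m n → q (m ℕ.+ n) ≡ q m + q n
  q-+ m n = toℚᵘ-injective (begin
    toℚᵘ (q (m ℕ.+ n))                                   ≈⟨ toℚᵘ-q (m ℕ.+ n) ⟩
    ℚᵘ.mkℚᵘ (ℤ.+ (m ℕ.+ n)) 0                            ≈⟨ ℚᵘ.*≡* (cong (λ w → w ℤ.* ℤ.+ 1) (sym (cong₂ ℤ._+_ (ℤ.*-identityʳ (ℤ.+ m)) (ℤ.*-identityʳ (ℤ.+ n))))) ⟩
    ℚᵘ.mkℚᵘ (ℤ.+ m) 0 ℚᵘ.+ ℚᵘ.mkℚᵘ (ℤ.+ n) 0             ≈⟨ ℚᵘ.+-cong (ℚᵘ.≃-sym (toℚᵘ-q m)) (ℚᵘ.≃-sym (toℚᵘ-q n)) ⟩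
    toℚᵘ (q m) ℚᵘ.+ toℚᵘ (q n)                           ≈⟨ ℚᵘ.≃-sym (toℚᵘ-homo-+ (q m) (q n)) ⟩
    toℚᵘ (q m + q n)                                     ∎)
    where open ℚᵘ.≃-Reasoning

  q-* : ∀ m n → q (m ℕ.* n) ≡ q m * q n
  q-* m n = toℚᵘ-injective (begin
    toℚᵘ (q (m ℕ.* n))                                   ≈⟨ toℚᵘ-q (m ℕ.* n) ⟩
    ℚᵘ.mkℚᵘ (ℤ.+ (m ℕ.* n)) 0                            ≈⟨ ℚᵘ.*≡* (cong (λ w → w ℤ.* ℤ.+ 1) (ℤ.pos-* m n)) ⟩
    ℚᵘ.mkℚᵘ (ℤ.+ m) 0 ℚᵘ.* ℚᵘ.mkℚᵘ (ℤ.+ n) 0             ≈⟨ ℚᵘ.*-cong (ℚᵘ.≃-sym (toℚᵘ-q m)) (ℚᵘ.≃-sym (toℚᵘ-q n)) ⟩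
    toℚᵘ (q m) ℚᵘ.* toℚᵘ (q n)                           ≈⟨ ℚᵘ.≃-sym (toℚᵘ-homo-* (q m) (q n)) ⟩
    toℚᵘ (q m * q n)                                     ∎)
    where open ℚᵘ.≃-Reasoning

  q-mono : ∀ {m n} → m ℕ.≤ n → q m ≤ q n
  q-mono {m} {n} m≤n = toℚᵘ-cancel-≤ (ℚᵘ.≤-trans (ℚᵘ.≤-reflexive (toℚᵘ-q m)) (ℚᵘ.≤-trans
    (ℚᵘ.*≤* (ℤ.*-monoʳ-≤-nonNeg (ℤ.+ 1) (ℤ.+≤+ m≤n))) (ℚᵘ.≤-reflexive (ℚᵘ.≃-sym (toℚᵘ-q n)))))

  q-cancel : ∀ {m n} → q m ≤ q n → m ℕ.≤ n
  q-cancel {m} {n} h = ℤ.drop‿+≤+ (ℤ.*-cancelʳ-≤-pos (ℤ.+ m) (ℤ.+ n) (ℤ.+ 1) (ℚᵘ.drop-*≤* (ℚᵘ.≤-trans (ℚᵘ.≤-reflexive (ℚᵘ.≃-sym (toℚᵘ-q m)))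
    (ℚᵘ.≤-trans (toℚᵘ-mono-≤ h) (ℚᵘ.≤-reflexive (toℚᵘ-q n))))))

  q-reciprocal : ∀ n → q (suc n) * (ℤ.+ 1 / suc n) ≡ 1ℚ
  q-reciprocal n = toℚᵘ-injective (begin
    toℚᵘ (q (suc n) * (ℤ.+ 1 / suc n))                   ≈⟨ toℚᵘ-homo-* (q (suc n)) (ℤ.+ 1 / suc n) ⟩
    toℚᵘ (q (suc n)) ℚᵘ.* toℚᵘ (ℤ.+ 1 / suc n)           ≈⟨ ℚᵘ.*-cong (toℚᵘ-q (suc n)) (toℚᵘ-fromℚᵘ (ℚᵘ.mkℚᵘ (ℤ.+ 1) n)) ⟩
    ℚᵘ.mkℚᵘ (ℤ.+ suc n) 0 ℚᵘ.* ℚᵘ.mkℚᵘ (ℤ.+ 1) n         ≈⟨ ℚᵘ.*≡* (trans (ℤ.*-identityʳ (ℤ.+ suc n ℤ.* ℤ.+ 1)) (trans (ℤ.*-identityʳ (ℤ.+ suc n)) (sym (trans (ℤ.*-identityˡ (ℤ.+ suc (n ℕ.+ 0))) (cong (λ k → ℤ.+ suc k) (ℕ.+-identityʳ n)))))) ⟩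
    toℚᵘ 1ℚ                                              ∎)
    where open ℚᵘ.≃-Reasoning

  0≤q : ∀ n → 0ℚ ≤ q n
  0≤q n = q-mono {0} {n} ℕ.z≤n

  *-monoˡ : ∀ {a b c} → 0ℚ ≤ c → a ≤ b → c * a ≤ c * b
  *-monoˡ {c = c} 0≤c = *-monoˡ-≤-nonNeg c {{nonNegative 0≤c}}

  *-monoʳ : ∀ {a b c} → 0ℚ ≤ c → a ≤ b → a * c ≤ b * c
  *-monoʳ {c = c} 0≤c = *-monoʳ-≤-nonNeg c {{nonNegative 0≤c}}

  0≤-* : ∀ {a b} → 0ℚ ≤ a → 0ℚ ≤ b → 0ℚ ≤ a * b
  0≤-* {a} {b} 0≤a 0≤b = subst (_≤ a * b) (*-zeroʳ a) (*-monoˡ 0≤a 0≤b)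

  *-mono : ∀ {a b c d} → 0ℚ ≤ a → a ≤ b → 0ℚ ≤ c → c ≤ d → a * c ≤ b * d
  *-mono 0≤a a≤b 0≤c c≤d = ≤-trans (*-monoʳ 0≤c a≤b) (*-monoˡ (≤-trans 0≤a a≤b) c≤d)

  0≤-+ : ∀ {a b} → 0ℚ ≤ a → 0ℚ ≤ b → 0ℚ ≤ a + b
  0≤-+ {a} {b} 0≤a 0≤b = subst (_≤ a + b) (+-identityʳ 0ℚ) (+-mono-≤ 0≤a 0≤b)

  0≤reciprocal : ∀ n → 0ℚ ≤ ℤ.+ 1 / suc n
  0≤reciprocal n = nonNegative⁻¹ (ℤ.+ 1 / suc n) {{normalize-nonNeg 1 (suc n)}}

  0≤1 : 0ℚ ≤ 1ℚ
  0≤1 = 0≤q 1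

  inv-inverse : ∀ {x} → 0ℚ < x → inv x * x ≡ 1ℚ
  inv-inverse {x} 0<x with x ≟ 0ℚ
  ... | yes x≡0 = contradiction (sym x≡0) (<⇒≢ 0<x)
  ... | no  x≢0 = *-inverseˡ x {{≢-nonZero x≢0}}

-- Uniform draws and repeated sampling.

module Expectation where
  open import Data.Bool using (true; false)
  open import Data.List as List using (List; []; _∷_)
  open import Data.List.Properties using (length-map)
  open import Data.List.NonEmpty as List⁺ using (List⁺; _∷_; toList)
  open import Data.List.Membership.Propositional using (_∈_)
  open import Data.List.Relation.Unary.Any using (here; there)
  open import Data.Maybe using (Maybe; nothing)
  open import Data.Nat as ℕ using (ℕ; zero; suc)
  import Data.Integer as ℤ
  open import Data.Product using (∃; _×_; _,_; proj₁; proj₂)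
  open import Data.Rational
  open import Data.Rational.Properties
  open import Data.Rational.Solver using (module +-*-Solver)
  open import Level using (0ℓ)
  open import Relation.Binary.PropositionalEquality
  open import Relation.Nullary using (Dec; yes; no; does; ¬_; contradiction)
  open import Relation.Unary using (Pred; Decidable)
  open Rationals renaming (q to ι)
  open ListSums using (sumL)
  open import Defs using (Rand; return; draw; mean; Pr; drawUntil; orFail; _>>=_)

  open +-*-Solver

  sumQ : (ℕ → ℚ) → List ℕ → ℚ
  sumQ f []       = 0ℚ
  sumQ f (x ∷ xs) = f x + sumQ f xs

  E : List⁺ ℕ → (ℕ → ℚ) → ℚ
  E xs f = mean (List⁺.map f xs)

  weight : List⁺ ℕ → ℚ
  weight (x ∷ xs) = ℤ.+ 1 / suc (List.length xs)

  0≤weight : ∀ xs → 0ℚ ≤ weight xs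
  0≤weight (x ∷ xs) = 0≤reciprocal (List.length xs)

  E-sum : ∀ xs f → E xs f ≡ sumQ f (toList xs) * weight xs
  E-sum (x ∷ xs) f = cong₂ (λ s n → (f x + s) * (ℤ.+ 1 / suc n)) (foldr-map xs) (length-map f xs)
    where
    foldr-map : ∀ xs → List.foldr _+_ 0ℚ (List.map f xs) ≡ sumQ f xs
    foldr-map []       = refl
    foldr-map (x ∷ xs) = cong (f x +_) (foldr-map xs)

  sumQ-mono : ∀ {f g : ℕ → ℚ} xs → (∀ {x} → x ∈ xs → f x ≤ g x) → sumQ f xs ≤ sumQ g xs
  sumQ-mono []       le = ≤-refl
  sumQ-mono (x ∷ xs) le = +-mono-≤ (le (here refl)) (sumQ-mono xs λ x∈ → le (there x∈))

  sumQ-cong : ∀ {f g : ℕ → ℚ} xs → (∀ x → f x ≡ g x) → sumQ f xs ≡ sumQ g xs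
  sumQ-cong []       eq = refl
  sumQ-cong (x ∷ xs) eq = cong₂ _+_ (eq x) (sumQ-cong xs eq)

  sumQ-linear : ∀ c (f g : ℕ → ℚ) xs → sumQ (λ x → f x + g x * c) xs ≡ sumQ f xs + sumQ g xs * c
  sumQ-linear c f g []       = solve 1 (λ c → con 0ℚ := con 0ℚ :+ con 0ℚ :* c) refl c
  sumQ-linear c f g (x ∷ xs) = trans (cong (f x + g x * c +_) (sumQ-linear c f g xs))
    (solve 5 (λ a b c d e → a :+ b :* c :+ (d :+ e :* c) := (a :+ d) :+ (b :+ e) :* c) refl (f x) (g x) c (sumQ f xs) (sumQ g xs))

  sumQ-*ˡ : ∀ c (g : ℕ → ℚ) xs → sumQ (λ x → c * g x) xs ≡ c * sumQ g xs
  sumQ-*ˡ c g []       = sym (*-zeroʳ c)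
  sumQ-*ˡ c g (x ∷ xs) = trans (cong (c * g x +_) (sumQ-*ˡ c g xs)) (sym (*-distribˡ-+ c (g x) (sumQ g xs)))

  sumQ-ι : ∀ (f : ℕ → ℕ) xs → sumQ (λ x → ι (f x)) xs ≡ ι (sumL f xs)
  sumQ-ι f []       = refl
  sumQ-ι f (x ∷ xs) = trans (cong (ι (f x) +_) (sumQ-ι f xs)) (sym (q-+ (f x) (sumL f xs)))

  E-mono : ∀ xs {f g : ℕ → ℚ} → (∀ {x} → x ∈ toList xs → f x ≤ g x) → E xs f ≤ E xs g
  E-mono xs {f} {g} le = subst₂ _≤_ (sym (E-sum xs f)) (sym (E-sum xs g)) (*-monoʳ (0≤weight xs) (sumQ-mono (toList xs) le))

  E-cong : ∀ xs {f g : ℕ → ℚ} → (∀ x → f x ≡ g x) → E xs f ≡ E xs g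
  E-cong xs {f} {g} eq = trans (E-sum xs f) (trans (cong (_* weight xs) (sumQ-cong (toList xs) eq)) (sym (E-sum xs g)))

  E-linear : ∀ xs c (f g : ℕ → ℚ) → E xs (λ x → f x + g x * c) ≡ E xs f + E xs g * c
  E-linear xs c f g = trans (E-sum xs (λ x → f x + g x * c)) (trans (cong (_* weight xs) (sumQ-linear c f g (toList xs)))
    (trans (solve 4 (λ a b c w → (a :+ b :* c) :* w := a :* w :+ b :* w :* c) refl (sumQ f (toList xs)) (sumQ g (toList xs)) c (weight xs))
      (cong₂ (λ a b → a + b * c) (sym (E-sum xs f)) (sym (E-sum xs g)))))

  E-*ˡ : ∀ xs c (g : ℕ → ℚ) → E xs (λ x → c * g x) ≡ c * E xs g
  E-*ˡ xs c g = trans (E-sum xs (λ x → c * g x)) (trans (cong (_* weight xs) (sumQ-*ˡ c g (toList xs)))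
    (trans (*-assoc c (sumQ g (toList xs)) (weight xs)) (cong (c *_) (sym (E-sum xs g)))))

  E-ι : ∀ xs (f : ℕ → ℕ) → E xs (λ x → ι (f x)) ≡ ι (sumL f (toList xs)) * weight xs
  E-ι xs f = trans (E-sum xs (λ x → ι (f x))) (cong (_* weight xs) (sumQ-ι f (toList xs)))

  mean-bounds : ∀ {a b} xs → (∀ {y} → y ∈ toList xs → a ≤ y × y ≤ b) → a ≤ mean xs × mean xs ≤ b
  mean-bounds {a} {b} (x ∷ xs) h = subst (_≤ mean (x ∷ xs)) (unit a) (*-monoʳ 0≤w (lower (x ∷ xs) λ y∈ → proj₁ (h y∈))) ,
      subst (mean (x ∷ xs) ≤_) (unit b) (*-monoʳ 0≤w (upper (x ∷ xs) λ y∈ → proj₂ (h y∈)))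
    where
    n = List.length xs
    w = ℤ.+ 1 / suc n
    0≤w = 0≤reciprocal n
    unit : ∀ c → ι (suc n) * c * w ≡ c
    unit c = trans (solve 3 (λ n c w → n :* c :* w := n :* w :* c) refl (ι (suc n)) c w) (trans (cong (_* c) (q-reciprocal n)) (*-identityˡ c))
    step : ∀ m c → ι (suc m) * c ≡ c + ι m * c
    step m c = trans (cong (_* c) (q-+ 1 m)) (solve 2 (λ m c → (con 1ℚ :+ m) :* c := c :+ m :* c) refl (ι m) c)
    lower : ∀ xs → (∀ {y} → y ∈ xs → a ≤ y) → ι (List.length xs) * a ≤ List.foldr _+_ 0ℚ xs
    lower []       _ = ≤-reflexive (*-zeroˡ a)
    lower (x ∷ xs) h = ≤-trans (≤-reflexive (step (List.length xs) a)) (+-mono-≤ (h (here refl)) (lower xs λ y∈ → h (there y∈)))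
    upper : ∀ xs → (∀ {y} → y ∈ xs → y ≤ b) → List.foldr _+_ 0ℚ xs ≤ ι (List.length xs) * b
    upper []       _ = ≤-reflexive (sym (*-zeroˡ b))
    upper (x ∷ xs) h = ≤-trans (+-mono-≤ (h (here refl)) (upper xs λ y∈ → h (there y∈))) (≤-reflexive (sym (step (List.length xs) b)))

  E-bounds : ∀ {a b} xs f → (∀ x → a ≤ f x × f x ≤ b) → a ≤ E xs f × E xs f ≤ b
  E-bounds {a} {b} xs f h = mean-bounds (List⁺.map f xs) (go (toList xs))
    where
    go : ∀ xs {y} → y ∈ List.map f xs → a ≤ y × y ≤ b
    go (x ∷ xs) (here refl) = h x
    go (x ∷ xs) (there y∈)  = go xs y∈

  Pr-bounds : ∀ {A : Set} {P : Pred A 0ℓ} (P? : Decidable P) r → 0ℚ ≤ Pr P? r × Pr P? r ≤ 1ℚ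
  Pr-bounds P? (return a) with does (P? a)
  ... | true  = 0≤1 , ≤-refl
  ... | false = ≤-refl , 0≤1
  Pr-bounds P? (draw xs k) = E-bounds xs (λ x → Pr P? (k x)) λ x → Pr-bounds P? (k x)

  Pr-return-no : ∀ {A : Set} {P : Pred A 0ℓ} (P? : Decidable P) a → ¬ P a → Pr P? (return a) ≡ 0ℚ
  Pr-return-no P? a ¬p with P? a
  ... | yes p = contradiction p ¬p
  ... | no  _ = refl

  -- The geometric sum 1 + b + ... + bⁿ⁻¹, in Horner form to follow the recursion of `drawUntil`.
  geo : ℕ → ℚ → ℚ
  geo zero    b = 0ℚ
  geo (suc n) b = 1ℚ + b * geo n b

  0≤geo : ∀ n {b} → 0ℚ ≤ b → 0ℚ ≤ geo n b
  0≤geo zero    0≤b = ≤-refl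
  0≤geo (suc n) 0≤b = 0≤-+ 0≤1 (0≤-* 0≤b (0≤geo n 0≤b))

  1≤geo : ∀ n {b} → 0ℚ ≤ b → 1 ℕ.≤ n → 1ℚ ≤ geo n b
  1≤geo (suc n) {b} 0≤b _ = subst (_≤ geo (suc n) b) (+-identityʳ 1ℚ) (+-monoʳ-≤ 1ℚ (0≤-* 0≤b (0≤geo n 0≤b)))

  geo≤ : ∀ n {b} → 0ℚ ≤ b → b ≤ 1ℚ → geo n b ≤ ι n
  geo≤ zero    _   _   = ≤-refl
  geo≤ (suc n) {b} 0≤b b≤1 = ≤-trans (+-monoʳ-≤ 1ℚ (≤-trans (*-mono 0≤b b≤1 (0≤geo n 0≤b) (geo≤ n 0≤b b≤1)) (≤-reflexive (*-identityˡ (ι n))))) (≤-reflexive (sym (q-+ 1 n)))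

  module Until {B : Set} {P : Pred ℕ 0ℓ} (P? : Decidable P) (xs : List⁺ ℕ) (f : ∃ P → Rand (Maybe B))
               {A : Pred (Maybe B) 0ℓ} (A? : Decidable A) (¬A : ¬ A nothing) where

    hit miss : ∀ x → Dec (P x) → ℚ
    hit x (yes Px) = Pr A? (f (x , Px))
    hit x (no _)   = 0ℚ
    miss x (yes _)  = 0ℚ
    miss x (no _)   = 1ℚ

    -- For a single draw: the probability that it is accepted and the continuation then ends in A,
    -- and the probability that it is rejected.
    gain loss : ℚ
    gain = E xs (λ x → hit x (P? x))
    loss = E xs (λ x → miss x (P? x))

    miss-bounds : ∀ x (d : Dec (P x)) → 0ℚ ≤ miss x d × miss x d ≤ 1ℚ
    miss-bounds x (yes _) = ≤-refl , 0≤1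
    miss-bounds x (no _)  = 0≤1 , ≤-refl

    loss-bounds : 0ℚ ≤ loss × loss ≤ 1ℚ
    loss-bounds = E-bounds xs (λ x → miss x (P? x)) λ x → miss-bounds x (P? x)

    -- The function that `drawUntil` applies to a drawn value is local to its definition; this reads
    -- it off from the resulting draw.
    continuation : ∀ {A : Set} → Rand A → ℕ → Rand A
    continuation (return a) _ = return a
    continuation (draw _ k) = k

    -- The i-th draw is reached after i rejections, with probability `loss` ^ i, and then succeeds
    -- with `gain`. Running out of draws gives `nothing`, which is outside A.
    until : ∀ n → Pr A? (drawUntil P? n xs >>= orFail f) ≡ geo n loss * gain
    until zero    = trans (Pr-return-no A? nothing ¬A) (sym (*-zeroˡ gain))
    until (suc n) = trans (E-cong xs one) (trans (E-linear xs v (λ x → hit x (P? x)) (λ x → miss x (P? x)))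
        (trans (cong (λ w → gain + loss * w) (until n)) (solve 3 (λ g b v → g :+ b :* (v :* g) := (con 1ℚ :+ b :* v) :* g) refl gain loss (geo n loss))))
      where
      v = Pr A? (drawUntil P? n xs >>= orFail f)
      one : ∀ x → Pr A? (continuation (drawUntil P? (suc n) xs) x >>= orFail f) ≡ hit x (P? x) + miss x (P? x) * v
      one x with P? x
      ... | yes Px = solve 2 (λ a v → a := a :+ con 0ℚ :* v) refl (Pr A? (f (x , Px))) v
      ... | no _   = solve 1 (λ v → v := con 0ℚ :+ con 1ℚ :* v) refl v

-- Success and failure of the three stages.

module Success (params : Defs.Parameters) (K : ℕ)
  (draws₃≥1 : ∀ {p} → Prime p → 1 ℕ.≤ Defs.Parameters.draws₃ params p) where

  open import Data.Nat as ℕ using (ℕ; zero; suc)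
  open import Data.Nat.Primality using (Prime; prime?; prime⇒nonZero)
  open import Defs using (Parameters)
  open Parameters params
  open import Data.List as List using (List; []; _∷_)
  open import Data.List.NonEmpty using (_∷_; toList)
  open import Data.List.Properties using (length-applyUpTo)
  open import Data.Maybe using (Maybe; just; nothing)
  open import Data.Maybe.Relation.Unary.Any as Maybe using ()
  import Data.Nat.Properties as ℕ
  open import Data.Nat.Divisibility using (_∣_; _∣?_)
  import Data.Nat.DivMod as ℕ
  import Data.Integer as ℤ
  import Data.Integer.Properties as ℤ
  import Data.Integer.Divisibility.Signed as S
  open import Data.Product using (∃; _×_; _,_; proj₁; proj₂)
  open import Data.Rational hiding (truncate)
  open import Data.Rational.Properties
  open import Data.Rational.Solver using (module +-*-Solver)
  open import Level using (0ℓ)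
  open import Relation.Binary.PropositionalEquality
  open import Relation.Nullary using (Dec; yes; no; ¬_)
  open import Relation.Nullary.Decidable using (¬?; _×-dec_)
  open import Relation.Unary using (Pred; Decidable)
  open import Relation.Unary.Properties using (_∩?_)
  open FiniteSums using (tick; tick-yes; tick-no)
  open Exact using (∑ℕ; 1<prime)
  open ListSums
  open Lagrange
  open Rationals renaming (q to ι)
  open Expectation
  open import Defs using (Rand; return; Pr; condPr; drawUntil; orFail; units; rootOfUnity; algorithm; Triple; triple?; qDivides; qDivides?; inv; _>>=_)

  open +-*-Solver using (solve; _:*_; _:=_; con)

  Output : Set
  Output = Maybe (ℕ × ℕ × ℕ)

  Success? : Decidable (Triple)
  Success? = triple?

  Bad : Pred Output 0ℓ
  Bad m = qDivides K m × Triple m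

  bad? : Decidable Bad
  bad? = qDivides? K ∩? triple?

  ¬triple : ¬ Triple nothing
  ¬triple ()

  ¬bad : ¬ Bad nothing
  ¬bad (() , _)

  module Unit {p a} (pp : Prime p) (pq : Prime (a ℕ.* p ℕ.+ 1)) where
    q : ℕ
    q = a ℕ.* p ℕ.+ 1

    root : ℕ → ℕ
    root = rootOfUnity pp pq

    nontrivial? : Decidable (λ ζ → ¬ (root ζ ≡ 1))
    nontrivial? ζ = ¬? (root ζ ℕ.≟ 1)

    f₃ : ∃ (λ ζ → ¬ (root ζ ≡ 1)) → Rand Output
    f₃ (ζ , _) = return (just (p , q , root ζ))

    stage₃ : Rand Output
    stage₃ = drawUntil nontrivial? (draws₃ p) (units q) >>= orFail f₃

    instance
      p≢0 = prime⇒nonZero pp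
      q≢0 = prime⇒nonZero pq

    0<a : 0 ℕ.< a
    0<a = ℕ.n≢0⇒n>0 λ a≡0 → ℕ.<⇒≢ (1<prime pq) (sym (cong (λ a → a ℕ.* p ℕ.+ 1) a≡0))

    2≤q : 2 ℕ.≤ q
    2≤q = 1<prime pq

    good : ℕ → ℕ
    good ζ = tick (nontrivial? ζ)

    a≡ : suc (ℕ.pred a) ≡ a
    a≡ = ℕ.suc-pred a {{ℕ.>-nonZero 0<a}}

    exponent : (q ℕ.∸ 1) ℕ./ p ≡ a
    exponent = trans (ℕ./-congˡ {o = p} (ℕ.m+n∸n≡m (a ℕ.* p) 1)) (ℕ.m*n/n≡m a p)

    Root? : ∀ ζ → Dec _
    Root? ζ = root? q (unity (ℕ.pred a)) ζ

    trivial⇒root : ∀ ζ → root ζ ≡ 1 → ℤ.+ q S.∣ eval (unity (ℕ.pred a)) (ℤ.+ ζ)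
    trivial⇒root ζ e = subst (ℤ.+ q S.∣_) (sym (unity-eval (ℕ.pred a) ζ)) (S.divides (ℤ.+ (w ℕ./ q)) eq)
      where
      w = ζ ℕ.^ suc (ℕ.pred a)
      w≡ : w ≡ 1 ℕ.+ (w ℕ./ q) ℕ.* q
      w≡ = trans (ℕ.m≡m%n+[m/n]*n w q) (cong (ℕ._+ (w ℕ./ q) ℕ.* q) (trans (cong (λ k → (ζ ℕ.^ k) ℕ.% q) (trans a≡ (sym exponent))) e))
      eq : ℤ.+ w ℤ.- ℤ.1ℤ ≡ ℤ.+ (w ℕ./ q) ℤ.* ℤ.+ q
      eq = trans (cong (λ k → ℤ.+ k ℤ.- ℤ.1ℤ) w≡) (ℤ.pos-* (w ℕ./ q) q)

    len : ℕ
    len = suc (q ℕ.∸ 2)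

    len≡ : len ≡ a ℕ.* p
    len≡ = trans (sym (ℕ.+-∸-assoc 1 2≤q)) (ℕ.m+n∸n≡m (a ℕ.* p) 1)

    q≡ : 2 ℕ.+ (q ℕ.∸ 2) ≡ q
    q≡ = ℕ.m+[n∸m]≡n 2≤q

    front : ∀ n (g : ℕ → ℕ) → ∑ℕ (suc n) g ≡ g 0 ℕ.+ ∑ℕ n (λ i → g (suc i))
    front zero    g = sym (ℕ.+-identityʳ (g 0))
    front (suc n) g = trans (cong (ℕ._+ g (suc n)) (front n g)) (ℕ.+-assoc (g 0) (∑ℕ n (λ i → g (suc i))) (g (suc n)))

    sumL-units : ∀ g → sumL g (toList (units q)) ≡ g 1 ℕ.+ ∑ℕ (q ℕ.∸ 2) (λ i → g (2 ℕ.+ i))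
    sumL-units g = cong (g 1 ℕ.+_) (sumL-applyUpTo g (2 ℕ.+_) (q ℕ.∸ 2))

    -- Since (q - 1) / p = a, the unsuitable ζ are roots of xᵃ - 1.
    roots-few : sumL (λ ζ → tick (Root? ζ)) (toList (units q)) ℕ.≤ a
    roots-few = ℕ.≤-trans (ℕ.≤-reflexive (sumL-units r)) (ℕ.≤-trans (ℕ.m≤n+m _ (r 0))
        (ℕ.≤-trans (ℕ.≤-reflexive (sym (trans (front (suc n) r) (cong (r 0 ℕ.+_) (front n (λ i → r (suc i)))))))
          (subst₂ ℕ._≤_ (trans (sym (∑ℕ-count Root? q)) (cong (λ k → ∑ℕ k r) (sym q≡))) a≡ (unity-roots-≤ pq (ℕ.pred a)))))
      where
      n = q ℕ.∸ 2
      r : ℕ → ℕ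
      r ζ = tick (Root? ζ)

    total : ∀ xs → List.length xs ℕ.≤ sumL good xs ℕ.+ sumL (λ ζ → tick (Root? ζ)) xs
    total []       = ℕ.z≤n
    total (ζ ∷ ζs) = ℕ.≤-trans (ℕ.+-mono-≤ (here (root ζ ℕ.≟ 1)) (total ζs))
        (ℕ.≤-reflexive (l (good ζ) (tick (Root? ζ)) (sumL good ζs) (sumL (λ ζ → tick (Root? ζ)) ζs)))
      where
      open import Data.Nat.Tactic.RingSolver using (solve-∀)
      l : ∀ a b c d → a ℕ.+ b ℕ.+ (c ℕ.+ d) ≡ a ℕ.+ c ℕ.+ (b ℕ.+ d)
      l = solve-∀
      here : Dec (root ζ ≡ 1) → 1 ℕ.≤ good ζ ℕ.+ tick (Root? ζ)
      here (yes e) = ℕ.≤-trans (ℕ.≤-reflexive (sym (tick-yes (Root? ζ) (trivial⇒root ζ e)))) (ℕ.m≤n+m (tick (Root? ζ)) (good ζ))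
      here (no ne) = ℕ.≤-trans (ℕ.≤-reflexive (sym (tick-yes (nontrivial? ζ) ne))) (ℕ.m≤m+n (good ζ) (tick (Root? ζ)))

    G : ℕ
    G = sumL good (toList (units q))

    -- The group has q - 1 = a p elements, of which at most a are unsuitable, and p ≥ 2.
    half : len ℕ.≤ 2 ℕ.* G
    half = ℕ.+-cancelʳ-≤ (2 ℕ.* a) len (2 ℕ.* G) (begin
      len ℕ.+ 2 ℕ.* a              ≤⟨ ℕ.+-monoʳ-≤ len (ℕ.≤-trans (ℕ.≤-reflexive (ℕ.*-comm 2 a)) (ℕ.≤-trans (ℕ.*-monoʳ-≤ a (1<prime pp)) (ℕ.≤-reflexive (sym len≡)))) ⟩
      len ℕ.+ len                  ≡⟨ cong (len ℕ.+_) (sym (ℕ.+-identityʳ len)) ⟩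
      2 ℕ.* len                    ≤⟨ ℕ.*-monoʳ-≤ 2 (ℕ.≤-trans (ℕ.≤-reflexive (cong suc (sym (length-applyUpTo (2 ℕ.+_) (q ℕ.∸ 2))))) (ℕ.≤-trans (total (toList (units q))) (ℕ.+-monoʳ-≤ G roots-few))) ⟩
      2 ℕ.* (G ℕ.+ a)              ≡⟨ ℕ.*-distribˡ-+ 2 G a ⟩
      2 ℕ.* G ℕ.+ 2 ℕ.* a          ∎)
      where open ℕ.≤-Reasoning

    weight-units : weight (units q) ≡ ℤ.+ 1 / suc (q ℕ.∸ 2)
    weight-units = cong (λ n → ℤ.+ 1 / suc n) (length-applyUpTo (2 ℕ.+_) (q ℕ.∸ 2))

    module T = Until nontrivial? (units q) f₃ Success? ¬triple

    hit-good : ∀ ζ (d : Dec (¬ (root ζ ≡ 1))) → ι (tick d) ≤ T.hit ζ d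
    hit-good ζ d@(yes e) = ≤-reflexive (cong ι (tick-yes d e))
    hit-good ζ d@(no ne) = ≤-reflexive (cong ι (tick-no d ne))

    half≤gain : ½ ≤ T.gain
    half≤gain = ≤-trans half≤ (≤-trans (≤-reflexive (sym (E-ι (units q) good))) (E-mono (units q) {λ ζ → ι (good ζ)} {λ ζ → T.hit ζ (nontrivial? ζ)} λ {ζ} _ → hit-good ζ (nontrivial? ζ)))
      where
      w = ℤ.+ 1 / suc (q ℕ.∸ 2)
      half≤ : ½ ≤ ι G * weight (units q)
      half≤ = subst (λ v → ½ ≤ ι G * v) (sym weight-units) (begin
        ½                        ≡⟨ sym (*-identityʳ ½) ⟩
        ½ * 1ℚ                   ≡⟨ cong (½ *_) (sym (q-reciprocal (q ℕ.∸ 2))) ⟩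
        ½ * (ι len * w)          ≤⟨ *-monoˡ {ι len * w} {ι (2 ℕ.* G) * w} (<⇒≤ (positive⁻¹ ½)) (*-monoʳ {ι len} {ι (2 ℕ.* G)} (0≤reciprocal (q ℕ.∸ 2)) (q-mono half)) ⟩
        ½ * (ι (2 ℕ.* G) * w)    ≡⟨ cong (λ v → ½ * (v * w)) (q-* 2 G) ⟩
        ½ * (ι 2 * ι G * w)      ≡⟨ solve 2 (λ g w → con ½ :* (con (ι 2) :* g :* w) := g :* w) refl (ι G) w ⟩
        ι G * w                  ∎)
        where open ≤-Reasoning

    half≤Pr : ½ ≤ Pr Success? stage₃
    half≤Pr = begin
      ½                                   ≡⟨ sym (*-identityˡ ½) ⟩
      1ℚ * ½                              ≤⟨ *-mono 0≤1 (1≤geo (draws₃ p) (proj₁ T.loss-bounds) (draws₃≥1 pp)) (<⇒≤ (positive⁻¹ ½)) half≤gain ⟩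
      geo (draws₃ p) T.loss * T.gain      ≡⟨ sym (T.until (draws₃ p)) ⟩
      Pr Success? stage₃                  ∎
      where open ≤-Reasoning

    module Q = Until nontrivial? (units q) f₃ bad? ¬bad

    Pr-bad : ¬ (q ∣ K) → Pr bad? stage₃ ≡ 0ℚ
    Pr-bad q∤K = trans (Q.until (draws₃ p)) (trans (cong (geo (draws₃ p) Q.loss *_) gain≡0) (*-zeroʳ (geo (draws₃ p) Q.loss)))
      where
      hit≡0 : ∀ ζ (d : Dec (¬ (root ζ ≡ 1))) → Q.hit ζ d ≡ 0ℚ
      hit≡0 ζ (no _) = refl
      hit≡0 ζ (yes _) = Pr-return-no bad? (just (p , q , root ζ)) λ { (Maybe.just q∣K , _) → q∤K q∣K }
      gain≡0 : Q.gain ≡ 0ℚ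
      gain≡0 = ≤-antisym (proj₂ both) (proj₁ both)
        where
        both = E-bounds (units q) (λ ζ → Q.hit ζ (nontrivial? ζ)) λ ζ → ≤-reflexive (sym (hit≡0 ζ (nontrivial? ζ))) , ≤-reflexive (hit≡0 ζ (nontrivial? ζ))

  os es : List ℕ
  os = toList odds
  es = toList evens

  A B : ℕ → ℕ
  A p = sumL (λ a → tick (prime? (a ℕ.* p ℕ.+ 1))) es
  B p = sumL (λ a → tick (prime? (a ℕ.* p ℕ.+ 1) ×-dec (a ℕ.* p ℕ.+ 1 ∣? K))) es

  ΣA ΣB : ℕ
  ΣA = sumL (λ p → tick (prime? p) ℕ.* A p) os
  ΣB = sumL (λ p → tick (prime? p) ℕ.* B p) os

  module Prime₁ {p} (pp : Prime p) where
    q-prime? : Decidable (λ a → Prime (a ℕ.* p ℕ.+ 1))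
    q-prime? a = prime? (a ℕ.* p ℕ.+ 1)

    f₂ : ∃ (λ a → Prime (a ℕ.* p ℕ.+ 1)) → Rand Output
    f₂ (a , pq) = Unit.stage₃ {p} {a} pp pq

    stage₂ : Rand Output
    stage₂ = drawUntil q-prime? draws₂ evens >>= orFail f₂

    module T = Until q-prime? evens f₂ Success? ¬triple
    module Q = Until q-prime? evens f₂ bad? ¬bad

    w : ℚ
    w = weight evens

    -- A union bound over the draws: the geometric sum is at most their number, and the third stage
    -- counts at most 1 if q ∣ K and 0 otherwise.
    bad-≤ : Pr bad? stage₂ ≤ ι draws₂ * (ι (B p) * w)
    bad-≤ = ≤-trans (≤-reflexive (Q.until draws₂)) (*-mono (0≤geo draws₂ (proj₁ Q.loss-bounds)) (geo≤ draws₂ (proj₁ Q.loss-bounds) (proj₂ Q.loss-bounds)) 0≤gain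
        (≤-trans (E-mono evens {λ a → Q.hit a (q-prime? a)} {λ a → ι (tick (q-prime? a ×-dec (a ℕ.* p ℕ.+ 1 ∣? K)))} λ {a} _ → hit-≤ a (q-prime? a)) (≤-reflexive (E-ι evens (λ a → tick (prime? (a ℕ.* p ℕ.+ 1) ×-dec (a ℕ.* p ℕ.+ 1 ∣? K)))))))
      where
      hit-bounds : ∀ a (d : Dec (Prime (a ℕ.* p ℕ.+ 1))) → 0ℚ ≤ Q.hit a d × Q.hit a d ≤ 1ℚ
      hit-bounds a (yes pq) = Pr-bounds bad? (f₂ (a , pq))
      hit-bounds a (no _)       = ≤-refl , 0≤1
      0≤gain : 0ℚ ≤ Q.gain
      0≤gain = proj₁ (E-bounds evens (λ a → Q.hit a (q-prime? a)) λ a → hit-bounds a (q-prime? a))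
      hit-≤ : ∀ a (d : Dec (Prime (a ℕ.* p ℕ.+ 1))) → Q.hit a d ≤ ι (tick (d ×-dec (a ℕ.* p ℕ.+ 1 ∣? K)))
      hit-≤ a d@(no _) = 0≤q (tick (d ×-dec (a ℕ.* p ℕ.+ 1 ∣? K)))
      hit-≤ a d@(yes pq) = go (a ℕ.* p ℕ.+ 1 ∣? K)
        where
        go : Dec (a ℕ.* p ℕ.+ 1 ∣ K) → Pr bad? (f₂ (a , pq)) ≤ ι (tick (d ×-dec (a ℕ.* p ℕ.+ 1 ∣? K)))
        go (yes q∣K) = ≤-trans (proj₂ (hit-bounds a d)) (≤-reflexive (sym (cong ι (tick-yes (d ×-dec (a ℕ.* p ℕ.+ 1 ∣? K)) (pq , q∣K)))))
        go (no q∤K)  = ≤-trans (≤-reflexive (Unit.Pr-bad {p} {a} pp pq q∤K)) (0≤q (tick (d ×-dec (a ℕ.* p ℕ.+ 1 ∣? K))))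

    -- One draw is enough for this direction: the geometric sum is at least 1. Against `bad-≤` the
    -- estimates thus differ by a factor draws₂, besides the ½ of the third stage.
    success-≥ : 1 ℕ.≤ draws₂ → ½ * (ι (A p) * w) ≤ Pr Success? stage₂
    success-≥ 1≤D = begin
      ½ * (ι (A p) * w)                                        ≡⟨ sym (trans (E-*ˡ evens ½ (λ a → ι (tick (q-prime? a)))) (cong (½ *_) (E-ι evens (λ a → tick (q-prime? a))))) ⟩
      E evens (λ a → ½ * ι (tick (q-prime? a)))                ≤⟨ E-mono evens {λ a → ½ * ι (tick (q-prime? a))} {λ a → T.hit a (q-prime? a)} (λ {a} _ → hit-≥ a (q-prime? a)) ⟩
      T.gain                                                   ≡⟨ sym (*-identityˡ T.gain) ⟩
      1ℚ * T.gain                                              ≤⟨ *-monoʳ 0≤gain (1≤geo draws₂ (proj₁ T.loss-bounds) 1≤D) ⟩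
      geo draws₂ T.loss * T.gain                               ≡⟨ sym (T.until draws₂) ⟩
      Pr Success? stage₂                                       ∎
      where
      open ≤-Reasoning
      hit-0 : ∀ a (d : Dec (Prime (a ℕ.* p ℕ.+ 1))) → 0ℚ ≤ T.hit a d × T.hit a d ≤ 1ℚ
      hit-0 a (yes pq) = Pr-bounds Success? (f₂ (a , pq))
      hit-0 a (no _)       = ≤-refl , 0≤1
      0≤gain : 0ℚ ≤ T.gain
      0≤gain = proj₁ (E-bounds evens (λ a → T.hit a (q-prime? a)) λ a → hit-0 a (q-prime? a))
      hit-≥ : ∀ a (d : Dec (Prime (a ℕ.* p ℕ.+ 1))) → ½ * ι (tick d) ≤ T.hit a d
      hit-≥ a d@(yes pq) = ≤-trans (≤-reflexive (trans (cong (λ k → ½ * ι k) (tick-yes d pq)) (*-identityʳ ½))) (Unit.half≤Pr {p} {a} pp pq)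
      hit-≥ a d@(no ¬q)  = ≤-reflexive (trans (cong (λ k → ½ * ι k) (tick-no d ¬q)) (*-zeroʳ ½))

  f₁ : ∃ Prime → Rand Output
  f₁ (p , pp) = Prime₁.stage₂ pp

  module T₁ = Until prime? odds f₁ Success? ¬triple
  module Q₁ = Until prime? odds f₁ bad? ¬bad

  private
    w₁ w₂ g : ℚ
    w₁ = weight odds
    w₂ = weight evens
    g = geo draws₁ T₁.loss

    0≤w₁ = 0≤weight odds
    0≤w₂ = 0≤weight evens
    0≤g : 0ℚ ≤ g
    0≤g = 0≤geo draws₁ (proj₁ T₁.loss-bounds)

    -- Rejections in the first stage do not depend on the event in question, so its geometric factor
    -- g is common to both probabilities.
    same-miss : ∀ x (d : Dec (Prime x)) → Q₁.miss x d ≡ T₁.miss x d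
    same-miss x (yes _) = refl
    same-miss x (no _)  = refl

  bad-total : Pr bad? (algorithm params) ≤ g * w₁ * w₂ * ι (draws₂ ℕ.* ΣB)
  bad-total = begin
    Pr bad? (algorithm params)                         ≡⟨ Q₁.until draws₁ ⟩
    geo draws₁ Q₁.loss * Q₁.gain                       ≡⟨ cong (λ b → geo draws₁ b * Q₁.gain) (E-cong odds {λ x → Q₁.miss x (prime? x)} {λ x → T₁.miss x (prime? x)} λ x → same-miss x (prime? x)) ⟩
    g * Q₁.gain                                        ≤⟨ *-monoˡ 0≤g (≤-trans (E-mono odds {λ p → Q₁.hit p (prime? p)} {λ p → ι draws₂ * w₂ * ι (tick (prime? p) ℕ.* B p)} λ {p} _ → hit-≤ p (prime? p)) (≤-reflexive (trans (E-*ˡ odds (ι draws₂ * w₂) (λ p → ι (tick (prime? p) ℕ.* B p)))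
                                                            (cong (ι draws₂ * w₂ *_) (E-ι odds (λ p → tick (prime? p) ℕ.* B p)))))) ⟩
    g * (ι draws₂ * w₂ * (ι ΣB * w₁))                  ≡⟨ solve 5 (λ g d v b w → g :* (d :* v :* (b :* w)) := g :* w :* v :* (d :* b)) refl g (ι draws₂) w₂ (ι ΣB) w₁ ⟩
    g * w₁ * w₂ * (ι draws₂ * ι ΣB)                    ≡⟨ cong (g * w₁ * w₂ *_) (sym (q-* draws₂ ΣB)) ⟩
    g * w₁ * w₂ * ι (draws₂ ℕ.* ΣB)                    ∎
    where
    open ≤-Reasoning
    0≤dw : 0ℚ ≤ ι draws₂ * w₂
    0≤dw = 0≤-* {ι draws₂} {w₂} (0≤q draws₂) 0≤w₂
    hit-≤ : ∀ p (d : Dec (Prime p)) → Q₁.hit p d ≤ ι draws₂ * w₂ * ι (tick d ℕ.* B p)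
    hit-≤ p d@(no _)   = 0≤-* {ι draws₂ * w₂} {ι (tick d ℕ.* B p)} 0≤dw (0≤q (tick d ℕ.* B p))
    hit-≤ p d@(yes pp) = ≤-trans (Prime₁.bad-≤ pp) (≤-reflexive (trans (solve 3 (λ d b w → d :* (b :* w) := d :* w :* b) refl (ι draws₂) (ι (B p)) w₂)
      (cong (λ k → ι draws₂ * w₂ * ι k) (sym (trans (cong (ℕ._* B p) (tick-yes d pp)) (ℕ.*-identityˡ (B p)))))))

  success-total : 1 ℕ.≤ draws₂ → g * w₁ * w₂ * (½ * ι ΣA) ≤ Pr Success? (algorithm params)
  success-total 1≤D = begin
    g * w₁ * w₂ * (½ * ι ΣA)                           ≡⟨ solve 4 (λ g w v a → g :* w :* v :* (con ½ :* a) := g :* (con ½ :* v :* (a :* w))) refl g w₁ w₂ (ι ΣA) ⟩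
    g * (½ * w₂ * (ι ΣA * w₁))                         ≡⟨ cong (g *_) (sym (trans (E-*ˡ odds (½ * w₂) (λ p → ι (tick (prime? p) ℕ.* A p))) (cong (½ * w₂ *_) (E-ι odds (λ p → tick (prime? p) ℕ.* A p))))) ⟩
    g * E odds (λ p → ½ * w₂ * ι (tick (prime? p) ℕ.* A p))  ≤⟨ *-monoˡ 0≤g (E-mono odds {λ p → ½ * w₂ * ι (tick (prime? p) ℕ.* A p)} {λ p → T₁.hit p (prime? p)} λ {p} _ → hit-≥ p (prime? p)) ⟩
    g * T₁.gain                                        ≡⟨ sym (T₁.until draws₁) ⟩
    Pr Success? (algorithm params)                     ∎
    where
    open ≤-Reasoning
    hit-≥ : ∀ p (d : Dec (Prime p)) → ½ * w₂ * ι (tick d ℕ.* A p) ≤ T₁.hit p d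
    hit-≥ p d@(yes pp) = ≤-trans (≤-reflexive (trans (cong (λ k → ½ * w₂ * ι k) (trans (cong (ℕ._* A p) (tick-yes d pp)) (ℕ.*-identityˡ (A p))))
      (solve 3 (λ h w a → h :* w :* a := h :* (a :* w)) refl ½ w₂ (ι (A p))))) (Prime₁.success-≥ pp 1≤D)
    hit-≥ p d@(no ¬p)  = ≤-reflexive (trans (cong (λ k → ½ * w₂ * ι (k ℕ.* A p)) (tick-no d ¬p)) (*-zeroʳ (½ * w₂)))

  inv-bounds : ∀ x → 0ℚ ≤ x → (0ℚ ≤ inv x) × (x * inv x ≤ 1ℚ)
  inv-bounds x 0≤x with x ≟ 0ℚ
  ... | yes refl = ≤-refl , 0≤1
  ... | no  x≢0  = <⇒≤ (positive⁻¹ ((1/ x) {{≢-nonZero x≢0}}) {{1/pos⇒pos x {{positive 0<x}}}}) , ≤-reflexive (*-inverseʳ x {{≢-nonZero x≢0}})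
    where
    0<x : 0ℚ < x
    0<x = ≰⇒> λ x≤0 → x≢0 (≤-antisym x≤0 0≤x)

  -- The two probabilities share the factor g w₁ w₂, so only ΣB and ΣA matter.
  condPr-bound : ∀ L M → 2 ℕ.* (draws₂ ℕ.* ΣB) ℕ.* M ℕ.≤ L ℕ.* ΣA → condPr (qDivides? K) triple? (algorithm params) * ι M ≤ ι L
  condPr-bound L M h = go (draws₂ ℕ.≟ 0)
    where
    N D c : ℚ
    N = Pr bad? (algorithm params)
    D = Pr Success? (algorithm params)
    c = g * w₁ * w₂
    0≤D = proj₁ (Pr-bounds Success? (algorithm params))
    0≤inv : 0ℚ ≤ inv D
    0≤inv = proj₁ (inv-bounds D 0≤D)
    0≤c : 0ℚ ≤ c
    0≤c = 0≤-* {g * w₁} {w₂} (0≤-* {g} {w₁} 0≤g 0≤w₁) 0≤w₂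
    go : Dec (draws₂ ≡ 0) → N * inv D * ι M ≤ ι L
    go (yes D₂≡0) = ≤-trans (≤-reflexive (trans (cong (λ n → n * inv D * ι M) N≡0) (trans (cong (_* ι M) (*-zeroˡ (inv D))) (*-zeroˡ (ι M))))) (0≤q L)
      where
      N≡0 : N ≡ 0ℚ
      N≡0 = ≤-antisym (≤-trans bad-total (≤-reflexive (trans (cong (λ k → c * ι (k ℕ.* ΣB)) D₂≡0) (*-zeroʳ c)))) (proj₁ (Pr-bounds bad? (algorithm params)))
    go (no D₂≢0) = begin
      N * inv D * ι M                                      ≤⟨ *-monoʳ (0≤q M) (*-monoʳ 0≤inv bad-total) ⟩
      c * ι (draws₂ ℕ.* ΣB) * inv D * ι M                  ≡⟨ solve 4 (λ c b i m → c :* b :* i :* m := c :* con ½ :* i :* (con (ι 2) :* b :* m)) refl c (ι (draws₂ ℕ.* ΣB)) (inv D) (ι M) ⟩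
      c * ½ * inv D * (ι 2 * ι (draws₂ ℕ.* ΣB) * ι M)      ≡⟨ cong (c * ½ * inv D *_) (sym (trans (q-* (2 ℕ.* (draws₂ ℕ.* ΣB)) M) (cong (_* ι M) (q-* 2 (draws₂ ℕ.* ΣB))))) ⟩
      c * ½ * inv D * ι (2 ℕ.* (draws₂ ℕ.* ΣB) ℕ.* M)      ≤⟨ *-monoˡ 0≤chi (q-mono h) ⟩
      c * ½ * inv D * ι (L ℕ.* ΣA)                         ≡⟨ cong (c * ½ * inv D *_) (q-* L ΣA) ⟩
      c * ½ * inv D * (ι L * ι ΣA)                         ≡⟨ solve 5 (λ c h i l a → c :* h :* i :* (l :* a) := l :* (c :* (h :* a) :* i)) refl c ½ (inv D) (ι L) (ι ΣA) ⟩
      ι L * (c * (½ * ι ΣA) * inv D)                       ≤⟨ *-monoˡ (0≤q L) (*-monoʳ 0≤inv (success-total (ℕ.n≢0⇒n>0 D₂≢0))) ⟩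
      ι L * (D * inv D)                                    ≤⟨ *-monoˡ (0≤q L) (proj₂ (inv-bounds D 0≤D)) ⟩
      ι L * 1ℚ                                             ≡⟨ *-identityʳ (ι L) ⟩
      ι L                                                  ∎
      where
      open ≤-Reasoning
      0≤chi : 0ℚ ≤ c * ½ * inv D
      0≤chi = 0≤-* {c * ½} {inv D} (0≤-* {c} {½} 0≤c (<⇒≤ (positive⁻¹ ½))) 0≤inv

-- Truncated exponential series.

module Exponential where
  open import Data.Nat as ℕ using (ℕ; zero; suc; _!)
  import Data.Nat.Properties as ℕ
  import Data.Integer as ℤ
  open import Data.Product using (_×_; _,_; proj₁; proj₂)
  open import Data.Rational hiding (truncate)
  open import Data.Rational.Properties
  open import Data.Rational.Solver using (module +-*-Solver)
  open import Relation.Binary.PropositionalEquality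
  open import Relation.Nullary using (yes; no)
  open Rationals renaming (q to ι)

  open +-*-Solver using (solve; _:+_; _:*_; _:-_; :-_; _:=_; con)

  ≤-+ : ∀ {a b} → 0ℚ ≤ b → a ≤ a + b
  ≤-+ {a} {b} 0≤b = subst (_≤ a + b) (+-identityʳ a) (+-monoʳ-≤ a 0≤b)

  pow : ℚ → ℕ → ℚ
  pow x zero    = ι 1
  pow x (suc k) = x * pow x k

  r : ℕ → ℚ
  r k = (ℤ.+ 1 / k !) {{k ℕ.!≢0}}

  e : ℕ → ℚ → ℚ
  e k x = pow x k * r k

  -- The first k terms of exp x. Logarithms are given only as limits of such sums, so facts about ln
  -- are proved as inequalities that hold for all long truncations.
  E : ℕ → ℚ → ℚ
  E zero    x = ι 0
  E (suc k) x = E k x + e k x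

  ι-r : ∀ k → ι (k !) * r k ≡ 1ℚ
  ι-r k = go (k !) {{k ℕ.!≢0}}
    where
    go : ∀ n .{{_ : ℕ.NonZero n}} → ι n * (ℤ.+ 1 / n) ≡ 1ℚ
    go (suc n) = q-reciprocal n

  r-suc : ∀ k → ι (suc k) * r (suc k) ≡ r k
  r-suc k = begin
    ι (suc k) * r (suc k)                              ≡⟨ sym (*-identityˡ (ι (suc k) * r (suc k))) ⟩
    1ℚ * (ι (suc k) * r (suc k))                       ≡⟨ cong (_* (ι (suc k) * r (suc k))) (sym (ι-r k)) ⟩
    ι (k !) * r k * (ι (suc k) * r (suc k))            ≡⟨ solve 4 (λ a b c d → a :* b :* (c :* d) := b :* (c :* a :* d)) refl (ι (k !)) (r k) (ι (suc k)) (r (suc k)) ⟩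
    r k * (ι (suc k) * ι (k !) * r (suc k))            ≡⟨ cong (λ w → r k * (w * r (suc k))) (sym (q-* (suc k) (k !))) ⟩
    r k * (ι (suc k !) * r (suc k))                    ≡⟨ cong (r k *_) (ι-r (suc k)) ⟩
    r k * 1ℚ                                           ≡⟨ *-identityʳ (r k) ⟩
    r k                                                ∎
    where open ≡-Reasoning

  0≤r : ∀ k → 0ℚ ≤ r k
  0≤r k = nonNegative⁻¹ (r k) {{normalize-nonNeg 1 (k !) {{k ℕ.!≢0}}}}

  e-suc : ∀ k x → ι (suc k) * e (suc k) x ≡ x * e k x
  e-suc k x = trans (solve 4 (λ n x p r → n :* (x :* p :* r) := x :* (p :* (n :* r))) refl (ι (suc k)) x (pow x k) (r (suc k)))
    (cong (λ w → x * (pow x k * w)) (r-suc k))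

  0≤pow : ∀ {x} k → 0ℚ ≤ x → 0ℚ ≤ pow x k
  0≤pow zero    0≤x = 0≤1
  0≤pow {x} (suc k) 0≤x = 0≤-* {x} {pow x k} 0≤x (0≤pow k 0≤x)

  0≤e : ∀ {x} k → 0ℚ ≤ x → 0ℚ ≤ e k x
  0≤e {x} k 0≤x = 0≤-* {pow x k} {r k} (0≤pow k 0≤x) (0≤r k)

  infix 4 _∣≤∣_
  _∣≤∣_ : ℚ → ℚ → Set
  x ∣≤∣ y = (- y ≤ x) × (x ≤ y)

  ∣≤∣⇒0≤ : ∀ {x y} → x ∣≤∣ y → 0ℚ ≤ y
  ∣≤∣⇒0≤ {x} {y} (l , u) = ≮⇒≥ λ y<0 → <-irrefl refl (<-≤-trans y<0 (≤-trans (neg-antimono-≤ (<⇒≤ y<0)) (≤-trans l u)))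

  ∣≤∣-* : ∀ {a b x y} → a ∣≤∣ x → b ∣≤∣ y → a * b ∣≤∣ x * y
  ∣≤∣-* {a} {b} {x} {y} p@(l , u) q@(l′ , u′) = by-sign (≤-total 0ℚ a)
    where
    open import Data.Sum using (_⊎_; inj₁; inj₂)
    0≤y = ∣≤∣⇒0≤ q
    scale : ∀ {c} → 0ℚ ≤ c → c ≤ x → c * b ∣≤∣ x * y
    scale {c} 0≤c c≤x = ≤-trans (neg-antimono-≤ {c * y} {x * y} (*-monoʳ 0≤y c≤x)) (≤-trans (≤-reflexive (neg-distribʳ-* c y)) (*-monoˡ 0≤c l′)) ,
      ≤-trans (*-monoˡ 0≤c u′) (*-monoʳ 0≤y c≤x)
    by-sign : 0ℚ ≤ a ⊎ a ≤ 0ℚ → a * b ∣≤∣ x * y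
    by-sign (inj₁ 0≤a) = scale 0≤a u
    by-sign (inj₂ a≤0) = subst (- (x * y) ≤_) flip (neg-antimono-≤ (proj₂ s)) ,
        subst (_≤ x * y) flip (≤-trans (neg-antimono-≤ (proj₁ s)) (≤-reflexive (neg-involutive (x * y))))
      where
      neg-involutive : ∀ a → - (- a) ≡ a
      neg-involutive a = solve 1 (λ a → :- (:- a) := a) refl a
      s = scale { - a} (neg-antimono-≤ a≤0) (≤-trans (neg-antimono-≤ l) (≤-reflexive (neg-involutive x)))
      flip : - (- a * b) ≡ a * b
      flip = solve 2 (λ a b → :- (:- a :* b) := a :* b) refl a b

  ∣≤∣-refl : ∀ {x} → 0ℚ ≤ x → x ∣≤∣ x
  ∣≤∣-refl 0≤x = ≤-trans (neg-antimono-≤ 0≤x) 0≤x , ≤-refl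

  ∣pow∣ : ∀ {x y} k → x ∣≤∣ y → pow x k ∣≤∣ pow y k
  ∣pow∣ zero    _ = ∣≤∣-refl 0≤1
  ∣pow∣ {x} {y} (suc k) h = ∣≤∣-* {x} {pow x k} {y} {pow y k} h (∣pow∣ k h)

  ∣e∣ : ∀ {x y} k → x ∣≤∣ y → e k x ∣≤∣ e k y
  ∣e∣ {x} {y} k h = ∣≤∣-* {pow x k} {r k} {pow y k} {r k} (∣pow∣ k h) (∣≤∣-refl (0≤r k))

  E-mono : ∀ {x y} k → x ∣≤∣ y → E k x ≤ E k y
  E-mono zero    h = ≤-refl
  E-mono (suc k) h = +-mono-≤ (E-mono k h) (proj₂ (∣e∣ k h))

  -- The linear terms alone differ by y - x, and every other term is monotone because |x| ≤ y. This
  -- inverts exp: close values of exp force close arguments.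
  E-gap : ∀ {x y} k → x ∣≤∣ y → E (suc (suc k)) x + (y - x) ≤ E (suc (suc k)) y
  E-gap {x} {y} zero h = ≤-reflexive (solve 2 (λ x y → con 0ℚ :+ con 1ℚ :* con 1ℚ :+ x :* con 1ℚ :* con 1ℚ :+ (y :- x) := con 0ℚ :+ con 1ℚ :* con 1ℚ :+ y :* con 1ℚ :* con 1ℚ) refl x y)
  E-gap {x} {y} (suc k) h = ≤-trans (≤-reflexive (solve 3 (λ a b c → a :+ b :+ c := a :+ c :+ b) refl (E (suc (suc k)) x) (e (suc (suc k)) x) (y - x)))
    (+-mono-≤ (E-gap k h) (proj₂ (∣e∣ (suc (suc k)) h)))

  0≤E : ∀ {x} k → 0ℚ ≤ x → 0ℚ ≤ E k x
  0≤E zero    0≤x = ≤-refl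
  0≤E (suc k) 0≤x = 0≤-+ (0≤E k 0≤x) (0≤e k 0≤x)

  E-grow : ∀ {x j k} → 0ℚ ≤ x → j ℕ.≤ k → E j x ≤ E k x
  E-grow {x} {j} {zero} 0≤x ℕ.z≤n = ≤-refl
  E-grow {x} {j} {suc k} 0≤x j≤1+k with j ℕ.≟ suc k
  ... | yes refl = ≤-refl
  ... | no  j≢   = ≤-trans (E-grow 0≤x (ℕ.≤-pred (ℕ.≤∧≢⇒< j≤1+k j≢))) (≤-+ (0≤e k 0≤x))

  1≤E : ∀ {x} k → 0ℚ ≤ x → 1ℚ ≤ E (suc k) x
  1≤E {x} k 0≤x = E-grow {x} {1} {suc k} 0≤x (ℕ.s≤s ℕ.z≤n)

  cancel-suc : ∀ k {a b} → ι (suc k) * a ≤ ι (suc k) * b → a ≤ b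
  cancel-suc k {a} {b} h = *-cancelˡ-≤-pos (ι (suc k)) {{normalize-pos (suc k) 1}} h

  -- The mean value inequality, term by term.
  e-upper : ∀ {x h} k → 0ℚ ≤ x → 0ℚ ≤ h → e (suc k) (x + h) ≤ e (suc k) x + h * e k (x + h)
  e-upper {x} {h} zero 0≤x 0≤h = ≤-reflexive (solve 2 (λ x h → (x :+ h) :* con 1ℚ :* con 1ℚ := x :* con 1ℚ :* con 1ℚ :+ h :* con 1ℚ) refl x h)
  e-upper {x} {h} (suc k) 0≤x 0≤h = cancel-suc (suc k) (begin
    n * e (suc (suc k)) y                                              ≡⟨ e-suc (suc k) y ⟩
    (x + h) * e (suc k) y                                              ≡⟨ *-distribʳ-+ (e (suc k) y) x h ⟩
    x * e (suc k) y + h * e (suc k) y                                  ≤⟨ +-monoˡ-≤ (h * e (suc k) y) (*-monoˡ 0≤x (e-upper k 0≤x 0≤h)) ⟩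
    x * (e (suc k) x + h * e k y) + h * e (suc k) y                    ≤⟨ +-monoˡ-≤ (h * e (suc k) y) (≤-+ {x * (e (suc k) x + h * e k y)} {h * (h * e k y)} (0≤-* {h} {h * e k y} 0≤h (0≤-* {h} {e k y} 0≤h (0≤e k 0≤y)))) ⟩
    x * (e (suc k) x + h * e k y) + h * (h * e k y) + h * e (suc k) y  ≡⟨ solve 5 (λ x a h b c → x :* (a :+ h :* b) :+ h :* (h :* b) :+ h :* c := x :* a :+ h :* ((x :+ h) :* b :+ c)) refl x (e (suc k) x) h (e k y) (e (suc k) y) ⟩
    x * e (suc k) x + h * (y * e k y + e (suc k) y)                    ≡⟨ cong₂ (λ a b → a + h * (b + e (suc k) y)) (sym (e-suc (suc k) x)) (sym (e-suc k y)) ⟩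
    n * e (suc (suc k)) x + h * (ι (suc k) * e (suc k) y + e (suc k) y) ≡⟨ cong (λ a → n * e (suc (suc k)) x + h * a) (trans (solve 2 (λ m a → m :* a :+ a := (con 1ℚ :+ m) :* a) refl (ι (suc k)) (e (suc k) y)) (cong (_* e (suc k) y) (sym (q-+ 1 (suc k))))) ⟩
    n * e (suc (suc k)) x + h * (n * e (suc k) y)                      ≡⟨ solve 4 (λ n a h b → n :* a :+ h :* (n :* b) := n :* (a :+ h :* b)) refl n (e (suc (suc k)) x) h (e (suc k) y) ⟩
    n * (e (suc (suc k)) x + h * e (suc k) y)                          ∎)
    where
    open ≤-Reasoning
    y = x + h
    n = ι (suc (suc k))
    0≤y = 0≤-+ 0≤x 0≤h

  -- The two leading terms of the binomial expansion of (x + 1)ᵏ⁺¹ / (k + 1)!.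
  e-lower : ∀ {x} k → 0ℚ ≤ x → e (suc k) x + e k x ≤ e (suc k) (x + 1ℚ)
  e-lower {x} zero 0≤x = ≤-reflexive (solve 1 (λ x → x :* con 1ℚ :* con 1ℚ :+ con 1ℚ := (x :+ con 1ℚ) :* con 1ℚ :* con 1ℚ) refl x)
  e-lower {x} (suc k) 0≤x = cancel-suc (suc k) (begin
    n * (e (suc (suc k)) x + e (suc k) x)                             ≡⟨ *-distribˡ-+ n (e (suc (suc k)) x) (e (suc k) x) ⟩
    n * e (suc (suc k)) x + n * e (suc k) x                           ≡⟨ cong₂ _+_ (e-suc (suc k) x) (trans (cong (_* e (suc k) x) (q-+ 1 (suc k))) (trans (*-distribʳ-+ (e (suc k) x) 1ℚ (ι (suc k))) (cong₂ _+_ (*-identityˡ (e (suc k) x)) (e-suc k x)))) ⟩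
    x * e (suc k) x + (e (suc k) x + x * e k x)                       ≤⟨ ≤-+ {x * e (suc k) x + (e (suc k) x + x * e k x)} {e k x} (0≤e k 0≤x) ⟩
    x * e (suc k) x + (e (suc k) x + x * e k x) + e k x               ≡⟨ solve 3 (λ x a b → x :* a :+ (a :+ x :* b) :+ b := (x :+ con 1ℚ) :* (a :+ b)) refl x (e (suc k) x) (e k x) ⟩
    (x + 1ℚ) * (e (suc k) x + e k x)                                  ≤⟨ *-monoˡ (0≤-+ 0≤x 0≤1) (e-lower k 0≤x) ⟩
    (x + 1ℚ) * e (suc k) (x + 1ℚ)                                     ≡⟨ sym (e-suc (suc k) (x + 1ℚ)) ⟩
    n * e (suc (suc k)) (x + 1ℚ)                                      ∎)
    where
    open ≤-Reasoning
    n = ι (suc (suc k))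

  E-upper : ∀ {x h} k → 0ℚ ≤ x → 0ℚ ≤ h → E (suc k) (x + h) ≤ E (suc k) x + h * E k (x + h)
  E-upper {x} {h} zero 0≤x 0≤h = ≤-reflexive (solve 1 (λ h → con 0ℚ :+ con 1ℚ :* con 1ℚ := con 0ℚ :+ con 1ℚ :* con 1ℚ :+ h :* con 0ℚ) refl h)
  E-upper {x} {h} (suc k) 0≤x 0≤h = ≤-trans (+-mono-≤ (E-upper k 0≤x 0≤h) (e-upper k 0≤x 0≤h))
    (≤-reflexive (solve 5 (λ a h b c d → a :+ h :* b :+ (c :+ h :* d) := a :+ c :+ h :* (b :+ d)) refl (E (suc k) x) h (E k (x + h)) (e (suc k) x) (e k (x + h))))

  -- A form of exp ½ ≤ 2: by the mean value inequality E (x + ½) ≤ E x + ½ E (x + ½), so half of the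
  -- left side is at most E x.
  E-half : ∀ {x} k → 0ℚ ≤ x → E k (x + ½) ≤ ι 2 * E k x
  E-half zero    0≤x = ≤-refl
  E-half {x} (suc k) 0≤x = *-cancelˡ-≤-pos ½ (begin
    ½ * a                       ≡⟨ solve 1 (λ a → con ½ :* a := a :- con ½ :* a) refl a ⟩
    a - ½ * a                   ≤⟨ +-monoˡ-≤ (- (½ * a)) (≤-trans (E-upper k 0≤x 0≤½) (+-monoʳ-≤ (E (suc k) x) (*-monoˡ 0≤½ (E-grow (0≤-+ 0≤x 0≤½) (ℕ.n≤1+n k))))) ⟩
    E (suc k) x + ½ * a - ½ * a ≡⟨ solve 2 (λ b a → b :+ con ½ :* a :- con ½ :* a := con ½ :* (con (ι 2) :* b)) refl (E (suc k) x) a ⟩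
    ½ * (ι 2 * E (suc k) x)     ∎)
    where
    open ≤-Reasoning
    a = E (suc k) (x + ½)
    0≤½ = <⇒≤ (positive⁻¹ ½)

  E-0 : ∀ k → E k 0ℚ ≤ 1ℚ
  E-0 zero          = 0≤1
  E-0 (suc zero)    = ≤-refl
  E-0 (suc (suc k)) = ≤-trans (≤-reflexive (trans (cong (E (suc k) 0ℚ +_) (solve 2 (λ p r → con 0ℚ :* p :* r := con 0ℚ) refl (pow 0ℚ k) (r (suc k)))) (+-identityʳ (E (suc k) 0ℚ)))) (E-0 (suc k))

  halves : ℕ → ℚ
  halves m = ι m * ½

  0≤halves : ∀ m → 0ℚ ≤ halves m
  0≤halves m = 0≤-* {ι m} {½} (0≤q m) (<⇒≤ (positive⁻¹ ½))

  -- exp (m / 2) ≤ 2ᵐ, that is ln 2 ≥ ½; it holds for truncations of any length.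
  E-halves : ∀ k m → E k (halves m) ≤ ι (2 ℕ.^ m)
  E-halves k zero    = E-0 k
  E-halves k (suc m) = begin
    E k (halves (suc m))         ≡⟨ cong (E k) (trans (cong (_* ½) (q-+ 1 m)) (solve 1 (λ m → (con 1ℚ :+ m) :* con ½ := m :* con ½ :+ con ½) refl (ι m))) ⟩
    E k (halves m + ½)           ≤⟨ E-half k (0≤halves m) ⟩
    ι 2 * E k (halves m)         ≤⟨ *-monoˡ (0≤q 2) (E-halves k m) ⟩
    ι 2 * ι (2 ℕ.^ m)            ≡⟨ sym (q-* 2 (2 ℕ.^ m)) ⟩
    ι (2 ℕ.^ suc m)              ∎
    where open ≤-Reasoning

  E-double : ∀ {x} k → 0ℚ ≤ x → E (suc k) x + E k x ≤ E (suc k) (x + 1ℚ)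
  E-double zero    0≤x = ≤-refl
  E-double {x} (suc k) 0≤x = ≤-trans (≤-reflexive (solve 4 (λ a b c d → a :+ b :+ (c :+ d) := a :+ c :+ (b :+ d)) refl (E (suc k) x) (e (suc k) x) (E k x) (e k x)))
    (+-mono-≤ (E-double k 0≤x) (e-lower k 0≤x))

  -- 2ᵐ ≤ exp m, that is ln 2 ≤ 1. A truncation of length m + 1 suffices, one more term for each
  -- doubling by `E-double`.
  E-powers : ∀ m → ι (2 ℕ.^ m) ≤ E (suc m) (ι m)
  E-powers zero    = ≤-refl
  E-powers (suc m) = begin
    ι (2 ℕ.* 2 ℕ.^ m)                            ≡⟨ q-* 2 (2 ℕ.^ m) ⟩
    ι 2 * ι (2 ℕ.^ m)                            ≤⟨ *-monoˡ (0≤q 2) (E-powers m) ⟩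
    ι 2 * E (suc m) (ι m)                        ≡⟨ solve 1 (λ a → con (ι 2) :* a := a :+ a) refl (E (suc m) (ι m)) ⟩
    E (suc m) (ι m) + E (suc m) (ι m)            ≤⟨ +-monoˡ-≤ (E (suc m) (ι m)) (E-grow (0≤q m) (ℕ.n≤1+n (suc m))) ⟩
    E (suc (suc m)) (ι m) + E (suc m) (ι m)      ≤⟨ E-double (suc m) (0≤q m) ⟩
    E (suc (suc m)) (ι m + 1ℚ)                   ≡⟨ cong (E (suc (suc m))) (trans (+-comm (ι m) 1ℚ) (sym (q-+ 1 m))) ⟩
    E (suc (suc m)) (ι (suc m))                  ∎
    where open ≤-Reasoning

  ∣≤∣-+ : ∀ {a b x y} → a ∣≤∣ x → b ∣≤∣ y → a + b ∣≤∣ x + y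
  ∣≤∣-+ {a} {b} {x} {y} (l , u) (l′ , u′) = subst (_≤ a + b) (sym (neg-distrib-+ x y)) (+-mono-≤ l l′) , +-mono-≤ u u′

  ∣≤∣-trans : ∀ {a x y} → a ∣≤∣ x → x ≤ y → a ∣≤∣ y
  ∣≤∣-trans (l , u) x≤y = ≤-trans (neg-antimono-≤ x≤y) l , ≤-trans u x≤y

  -- conv x y s m is the sum of the e a x * e b y with a + b = s + m and a ≥ s;
  -- partial x y s i is the sum of the e a x * e b y with a + b < s + i and a ≥ s.
  conv : ℚ → ℚ → ℕ → ℕ → ℚ
  conv x y s zero    = e s x * e 0 y
  conv x y s (suc m) = e s x * e (suc m) y + conv x y (suc s) m

  partial : ℚ → ℚ → ℕ → ℕ → ℚ
  partial x y s zero    = 0ℚ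
  partial x y s (suc i) = e s x * E (suc i) y + partial x y (suc s) i

  partial-suc : ∀ x y s i → partial x y s (suc i) ≡ partial x y s i + conv x y s i
  partial-suc x y s zero    = solve 2 (λ a b → a :* (con 0ℚ :+ b) :+ con 0ℚ := con 0ℚ :+ a :* b) refl (e s x) (e 0 y)
  partial-suc x y s (suc i) = trans (cong (e s x * E (suc (suc i)) y +_) (partial-suc x y (suc s) i))
    (solve 5 (λ a b c p q → a :* (b :+ c) :+ (p :+ q) := a :* b :+ p :+ (a :* c :+ q)) refl (e s x) (E (suc i) y) (e (suc i) y) (partial x y (suc s) i) (conv x y (suc s) i))

  -- A partial alternating sum of binomial coefficients has a closed form, and in this form it is
  -- proved by induction on m. Only s = 0 is wanted, where the right side vanishes: (x - x)ᴺ = 0 for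
  -- N > 0.
  conv-opposite : ∀ x s m → ι (s ℕ.+ suc m) * conv x (- x) s (suc m) ≡ ι s * (e s x * e (suc m) (- x))
  conv-opposite x s zero = begin
    ι (s ℕ.+ 1) * (a * e 1 y + e (suc s) x * e 0 y)    ≡⟨ cong (λ n → ι n * (a * e 1 y + e (suc s) x * e 0 y)) (ℕ.+-comm s 1) ⟩
    ι (suc s) * (a * e 1 y + e (suc s) x * e 0 y)      ≡⟨ solve 4 (λ n a b c → n :* (a :* b :+ c :* con 1ℚ) := n :* a :* b :+ n :* c) refl (ι (suc s)) a (e 1 y) (e (suc s) x) ⟩
    ι (suc s) * a * e 1 y + ι (suc s) * e (suc s) x    ≡⟨ cong₂ (λ u v → u * a * e 1 y + v) (q-+ 1 s) (e-suc s x) ⟩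
    (1ℚ + ι s) * a * e 1 y + x * a                     ≡⟨ solve 3 (λ n a x → (con 1ℚ :+ n) :* a :* (:- x :* con 1ℚ :* con 1ℚ) :+ x :* a := n :* (a :* (:- x :* con 1ℚ :* con 1ℚ))) refl (ι s) a x ⟩
    ι s * (a * e 1 y)                                  ∎
    where
    open ≡-Reasoning
    y = - x
    a = e s x
  conv-opposite x s (suc m) = begin
    N * (a * c + conv x y (suc s) (suc m))                       ≡⟨ *-distribˡ-+ N (a * c) (conv x y (suc s) (suc m)) ⟩
    N * (a * c) + N * conv x y (suc s) (suc m)                   ≡⟨ cong (λ w → N * (a * c) + w) (trans (cong (λ n → ι n * conv x y (suc s) (suc m)) (ℕ.+-suc s (suc m))) (conv-opposite x (suc s) m)) ⟩
    N * (a * c) + ι (suc s) * (e (suc s) x * b)                  ≡⟨ cong₂ _+_ (cong (_* (a * c)) (q-+ s (suc (suc m)))) (trans (sym (*-assoc (ι (suc s)) (e (suc s) x) b)) (cong (_* b) (e-suc s x))) ⟩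
    (ι s + M) * (a * c) + x * a * b                              ≡⟨ solve 6 (λ s m a c x b → (s :+ m) :* (a :* c) :+ x :* a :* b := s :* (a :* c) :+ a :* (m :* c) :+ x :* a :* b) refl (ι s) M a c x b ⟩
    ι s * (a * c) + a * (M * c) + x * a * b                      ≡⟨ cong (λ w → ι s * (a * c) + a * w + x * a * b) (e-suc (suc m) y) ⟩
    ι s * (a * c) + a * (y * b) + x * a * b                      ≡⟨ solve 4 (λ t a x b → t :+ a :* (:- x :* b) :+ x :* a :* b := t) refl (ι s * (a * c)) a x b ⟩
    ι s * (a * c)                                                ∎
    where
    open ≡-Reasoning
    y = - x
    a = e s x
    b = e (suc m) y
    c = e (suc (suc m)) y
    N = ι (s ℕ.+ suc (suc m))
    M = ι (suc (suc m))

  partial-opposite : ∀ x i → partial x (- x) 0 (suc i) ≡ 1ℚ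
  partial-opposite x zero    = refl
  partial-opposite x (suc i) = trans (partial-suc x (- x) 0 (suc i)) (cong₂ _+_ (partial-opposite x i) (*-cancelˡ-≡ (conv-opposite x 0 i)))
    where
    *-cancelˡ-≡ : ι (suc i) * conv x (- x) 0 (suc i) ≡ 0ℚ * (e 0 x * e (suc i) (- x)) → conv x (- x) 0 (suc i) ≡ 0ℚ
    *-cancelˡ-≡ h = ≤-antisym (cancel-suc i (≤-reflexive h′)) (cancel-suc i (≤-reflexive (sym h′)))
      where h′ = trans h (trans (*-zeroˡ (e 0 x * e (suc i) (- x))) (sym (*-zeroʳ (ι (suc i)))))

  -- Controls the part of E J x · E J y outside the triangle a + b < J. There βᵃ βᵇ = 2⁻⁽ᵃ⁺ᵇ⁾ (2 β)ᵃ
  -- (2 β)ᵇ has a factor of at most 2⁻ᴶ, while the series at 2 β stays bounded. Here ω n is 2⁻ⁿ.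
  module Product {β x y : ℚ} (∣x∣≤β : x ∣≤∣ β) (∣y∣≤β : y ∣≤∣ β) where

    0≤β = ∣≤∣⇒0≤ ∣x∣≤β
    2β = β + β

    0≤2β : 0ℚ ≤ 2β
    0≤2β = 0≤-+ 0≤β 0≤β

    ω : ℕ → ℚ
    ω = pow ½

    0≤ω : ∀ n → 0ℚ ≤ ω n
    0≤ω n = 0≤pow n (<⇒≤ (positive⁻¹ ½))

    ω-+ : ∀ m n → ω (m ℕ.+ n) ≡ ω m * ω n
    ω-+ zero    n = sym (*-identityˡ (ω n))
    ω-+ (suc m) n = trans (cong (½ *_) (ω-+ m n)) (sym (*-assoc ½ (ω m) (ω n)))

    ω≤1 : ∀ n → ω n ≤ 1ℚ
    ω≤1 zero    = ≤-refl
    ω≤1 (suc n) = ≤-trans (*-mono (<⇒≤ (positive⁻¹ ½)) ½≤1 (0≤ω n) (ω≤1 n)) ≤-refl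
      where
      ½≤1 : ½ ≤ 1ℚ
      ½≤1 = *≤* (ℤ.+≤+ (ℕ.s≤s ℕ.z≤n))

    halve : ∀ n → e n β ≡ ω n * e n 2β
    halve n = trans (cong (_* r n) (pow-halve n)) (*-assoc (ω n) (pow 2β n) (r n))
      where
      pow-halve : ∀ n → pow β n ≡ ω n * pow 2β n
      pow-halve zero    = refl
      pow-halve (suc n) = trans (cong (β *_) (pow-halve n)) (solve 3 (λ b w p → b :* (w :* p) := con ½ :* w :* ((b :+ b) :* p)) refl β (ω n) (pow 2β n))

    tail : ∀ b t → E (b ℕ.+ t) y - E b y ∣≤∣ ω b * (E (b ℕ.+ t) 2β - E b 2β)
    tail b zero = subst (λ c → E c y - E b y ∣≤∣ ω b * (E c 2β - E b 2β)) (sym (ℕ.+-identityʳ b))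
      (subst₂ _∣≤∣_ (sym (+-inverseʳ (E b y))) (sym (trans (cong (ω b *_) (+-inverseʳ (E b 2β))) (*-zeroʳ (ω b)))) (≤-refl , ≤-refl))
    tail b (suc t) = subst (λ c → E c y - E b y ∣≤∣ ω b * (E c 2β - E b 2β)) (sym (ℕ.+-suc b t))
      (subst₂ _∣≤∣_ (solve 3 (λ p q r → p :- q :+ r := p :+ r :- q) refl (E (b ℕ.+ t) y) (E b y) (e (b ℕ.+ t) y))
                    (solve 4 (λ w p q r → w :* (p :- q) :+ w :* r := w :* (p :+ r :- q)) refl (ω b) (E (b ℕ.+ t) 2β) (E b 2β) (e (b ℕ.+ t) 2β))
                    (∣≤∣-+ (tail b t) (∣≤∣-trans (∣e∣ (b ℕ.+ t) ∣y∣≤β) bound)))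
      where
      bound : e (b ℕ.+ t) β ≤ ω b * e (b ℕ.+ t) 2β
      bound = begin
        e (b ℕ.+ t) β                    ≡⟨ halve (b ℕ.+ t) ⟩
        ω (b ℕ.+ t) * e (b ℕ.+ t) 2β     ≤⟨ *-monoʳ (0≤e (b ℕ.+ t) 0≤2β) (≤-trans (≤-reflexive (ω-+ b t)) (≤-trans (*-monoˡ (0≤ω b) (ω≤1 t)) (≤-reflexive (*-identityʳ (ω b))))) ⟩
        ω b * e (b ℕ.+ t) 2β             ∎
        where open ≤-Reasoning

    -- Row a = s of the triangle is completed by the b from i on, if i is the row's length; then a +
    -- b ≥ J, so the tail estimate and `halve` together contribute 2⁻ᴶ in every row.
    remainder : ∀ J i s → i ℕ.+ s ≡ J →
      E J x * E J y - E s x * E J y - partial x y s i ≤ ω J * ((E J 2β - E s 2β) * E J 2β)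
    remainder J zero s refl = ≤-reflexive (solve 4 (λ a b w c → a :* b :- a :* b :- con 0ℚ := w :* ((c :- c) :* c)) refl (E s x) (E s y) (ω s) (E s 2β))
    remainder J (suc i) s eq = begin
      E J x * Y - E s x * Y - (a * E (suc i) y + partial x y (suc s) i)      ≡⟨ solve 6 (λ ej y es a b p → ej :* y :- es :* y :- (a :* b :+ p) := ej :* y :- (es :+ a) :* y :- p :+ a :* (y :- b)) refl (E J x) Y (E s x) a (E (suc i) y) (partial x y (suc s) i) ⟩
      E J x * Y - (E s x + a) * Y - partial x y (suc s) i + a * (Y - E (suc i) y) ≤⟨ +-mono-≤ (remainder J i (suc s) (trans (ℕ.+-suc i s) eq)) (proj₂ (∣≤∣-trans (∣≤∣-* (∣e∣ s ∣x∣≤β) (subst (λ j → E j y - E (suc i) y ∣≤∣ ω (suc i) * (E j 2β - E (suc i) 2β)) eq (tail (suc i) s))) bound)) ⟩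
      ω J * ((Z - (E s 2β + a′)) * Z) + ω J * (a′ * Z)                       ≡⟨ solve 4 (λ w z s a → w :* ((z :- (s :+ a)) :* z) :+ w :* (a :* z) := w :* ((z :- s) :* z)) refl (ω J) Z (E s 2β) a′ ⟩
      ω J * ((Z - E s 2β) * Z)                                               ∎
      where
      open ≤-Reasoning
      Y = E J y
      Z = E J 2β
      a = e s x
      a′ = e s 2β
      bound : e s β * (ω (suc i) * (Z - E (suc i) 2β)) ≤ ω J * (a′ * Z)
      bound = begin
        e s β * (ω (suc i) * (Z - E (suc i) 2β))          ≡⟨ cong (_* (ω (suc i) * (Z - E (suc i) 2β))) (halve s) ⟩
        ω s * a′ * (ω (suc i) * (Z - E (suc i) 2β))       ≡⟨ solve 4 (λ w a v d → w :* a :* (v :* d) := v :* w :* (a :* d)) refl (ω s) a′ (ω (suc i)) (Z - E (suc i) 2β) ⟩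
        ω (suc i) * ω s * (a′ * (Z - E (suc i) 2β))       ≡⟨ cong (_* (a′ * (Z - E (suc i) 2β))) (trans (sym (ω-+ (suc i) s)) (cong ω eq)) ⟩
        ω J * (a′ * (Z - E (suc i) 2β))                   ≤⟨ *-monoˡ (0≤ω J) (*-monoˡ (0≤e s 0≤2β) (≤-trans (+-monoʳ-≤ Z (neg-antimono-≤ (0≤E (suc i) 0≤2β))) (≤-reflexive (+-identityʳ Z)))) ⟩
        ω J * (a′ * Z)                                    ∎

  -- E j x * E j (- x) tends to 1, and E j (- x) ≥ 1.
  E-negative : ∀ {x} β t → - ι β ≤ x → x ≤ 0ℚ → E (suc (8 ℕ.* β) ℕ.+ t) x ≤ 1ℚ + ½
  E-negative {x} β t -β≤x x≤0 = resolve (≤-total (E j x) 0ℚ)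
    where
    open import Data.Sum using (_⊎_; inj₁; inj₂)
    j = suc (8 ℕ.* β) ℕ.+ t
    y = - x
    0≤y : 0ℚ ≤ y
    0≤y = neg-antimono-≤ x≤0
    y≤β : y ≤ ι β
    y≤β = ≤-trans (neg-antimono-≤ -β≤x) (≤-reflexive (solve 1 (λ b → :- (:- b) := b) refl (ι β)))
    open Product {ι β} {x} {y} (-β≤x , ≤-trans x≤0 (0≤q β)) (≤-trans (neg-antimono-≤ (0≤q β)) 0≤y , y≤β)
    -- exp (2 β) ≤ 2⁴ᵝ, so the remainder is at most 2⁻ʲ · 2⁸ᵝ; the length j > 8 β makes it at most
    -- ½.
    B = ι (2 ℕ.^ (4 ℕ.* β))
    2^ω : ∀ n → ω n * ι (2 ℕ.^ n) ≡ 1ℚ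
    2^ω zero    = refl
    2^ω (suc n) = trans (cong (½ * ω n *_) (q-* 2 (2 ℕ.^ n))) (trans (solve 2 (λ w v → con ½ :* w :* (con (ι 2) :* v) := w :* v) refl (ω n) (ι (2 ℕ.^ n))) (2^ω n))
    Z≤B : E j 2β ≤ B
    Z≤B = subst (λ w → E j w ≤ B) (trans (cong (_* ½) (q-* 4 β)) (solve 1 (λ b → con (ι 4) :* b :* con ½ := b :+ b) refl (ι β))) (E-halves j (4 ℕ.* β))
    small : ω j * ((E j 2β - 0ℚ) * E j 2β) ≤ ½
    small = begin
      ω j * ((E j 2β - 0ℚ) * E j 2β)                     ≡⟨ solve 2 (λ w z → w :* ((z :- con 0ℚ) :* z) := w :* (z :* z)) refl (ω j) (E j 2β) ⟩
      ω j * (E j 2β * E j 2β)                            ≤⟨ *-monoˡ (0≤ω j) (*-mono (0≤E j 0≤2β) Z≤B (0≤E j 0≤2β) Z≤B) ⟩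
      ω j * (B * B)                                      ≡⟨ cong (ω j *_) (trans (sym (q-* (2 ℕ.^ (4 ℕ.* β)) (2 ℕ.^ (4 ℕ.* β)))) (cong ι (trans (sym (ℕ.^-distribˡ-+-* 2 (4 ℕ.* β) (4 ℕ.* β))) (cong (2 ℕ.^_) (sym (ℕ.*-distribʳ-+ β 4 4)))))) ⟩
      ω j * ι (2 ℕ.^ (8 ℕ.* β))                          ≡⟨ cong (_* ι (2 ℕ.^ (8 ℕ.* β))) (ω-+ (suc (8 ℕ.* β)) t) ⟩
      ½ * ω (8 ℕ.* β) * ω t * ι (2 ℕ.^ (8 ℕ.* β))        ≡⟨ solve 3 (λ a b c → con ½ :* a :* b :* c := con ½ :* (a :* c) :* b) refl (ω (8 ℕ.* β)) (ω t) (ι (2 ℕ.^ (8 ℕ.* β))) ⟩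
      ½ * (ω (8 ℕ.* β) * ι (2 ℕ.^ (8 ℕ.* β))) * ω t      ≡⟨ cong (λ w → ½ * w * ω t) (2^ω (8 ℕ.* β)) ⟩
      ½ * 1ℚ * ω t                                       ≤⟨ *-monoˡ (<⇒≤ (positive⁻¹ ½)) (ω≤1 t) ⟩
      ½                                                  ∎
      where open ≤-Reasoning
    resolve : E j x ≤ 0ℚ ⊎ 0ℚ ≤ E j x → E j x ≤ 1ℚ + ½
    resolve (inj₁ h) = ≤-trans h (<⇒≤ (positive⁻¹ (1ℚ + ½)))
    resolve (inj₂ h) = begin
      E j x                                              ≡⟨ sym (*-identityʳ (E j x)) ⟩
      E j x * 1ℚ                                         ≤⟨ *-monoˡ h (1≤E (8 ℕ.* β ℕ.+ t) 0≤y) ⟩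
      E j x * E j y                                      ≡⟨ solve 3 (λ p a b → a :* b := p :+ (a :* b :- con 0ℚ :* b :- p)) refl (partial x y 0 j) (E j x) (E j y) ⟩
      partial x y 0 j + (E j x * E j y - 0ℚ * E j y - partial x y 0 j) ≤⟨ +-mono-≤ (≤-reflexive (partial-opposite x (8 ℕ.* β ℕ.+ t))) (≤-trans (remainder j j 0 (ℕ.+-identityʳ j)) small) ⟩
      1ℚ + ½                                             ∎
      where open ≤-Reasoning

-- Logarithms of real numbers.

module Reals where
  open import Data.Nat as ℕ using (ℕ; zero; suc)
  import Data.Nat.Properties as ℕ
  import Data.Integer as ℤ
  import Data.Integer.Properties as ℤ
  open import Data.Product using (∃; ∃-syntax; _×_; _,_; proj₁; proj₂)
  open import Data.Rational hiding (truncate)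
  open import Data.Rational.Properties
  import Data.Rational.Unnormalised as ℚᵘ
  import Data.Rational.Unnormalised.Properties as ℚᵘ
  open import Data.Rational.Solver using (module +-*-Solver)
  open import Data.Sum using (_⊎_; inj₁; inj₂)
  open import Relation.Binary.PropositionalEquality
  open import Relation.Nullary using (contradiction)
  open import Relation.Nullary.Decidable using (from-yes; from-no)
  open Rationals renaming (q to ι)
  open Exponential
  import Defs as R
  open R using (ℝ; expSum; IsLn)
  open ℝ

  open +-*-Solver using (solve; _:+_; _:*_; _:-_; :-_; _:=_; con)

  -- Reals are Cauchy sequences, so inequalities between them are handled as inequalities between
  -- their terms at all large indices.
  Eventually : (ℕ → Set) → Set
  Eventually P = ∃[ N ] ∀ {n} → N ℕ.≤ n → P n

  always : ∀ {P : ℕ → Set} → (∀ n → P n) → Eventually P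
  always f = 0 , λ {n} _ → f n

  map : ∀ {P Q : ℕ → Set} → (∀ {n} → P n → Q n) → Eventually P → Eventually Q
  map f (N , p) = N , λ N≤n → f (p N≤n)

  both : ∀ {P Q : ℕ → Set} → Eventually P → Eventually Q → Eventually (λ n → P n × Q n)
  both (M , p) (N , q) = M ℕ.⊔ N , λ h → p (ℕ.≤-trans (ℕ.m≤m⊔n M N) h) , q (ℕ.≤-trans (ℕ.m≤n⊔m M N) h)

  witness : ∀ {P : ℕ → Set} → Eventually P → ∃ P
  witness (N , p) = N , p ℕ.≤-refl

  seq-^ : ∀ x k n → seq (x R.^ k) n ≡ pow (seq x n) k
  seq-^ x zero    n = refl
  seq-^ x (suc k) n = cong (seq x n *_) (seq-^ x k n)

  pow-ι : ∀ m k → pow (ι m) k ≡ ι (m ℕ.^ k)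
  pow-ι m zero    = refl
  pow-ι m (suc k) = trans (cong (ι m *_) (pow-ι m k)) (sym (q-* m (m ℕ.^ k)))

  seq-expSum : ∀ l k n → seq (expSum l k) n ≡ E k (seq l n)
  seq-expSum l zero    n = refl
  seq-expSum l (suc k) n = cong₂ (λ a b → a + b * r k) (seq-expSum l k n) (seq-^ l k n)

  +-cancelˡ-≤ : ∀ c {a b} → c + a ≤ c + b → a ≤ b
  +-cancelˡ-≤ c {a} {b} h = subst₂ _≤_ (cancel a) (cancel b) (+-monoʳ-≤ (- c) h)
    where
    cancel : ∀ a → - c + (c + a) ≡ a
    cancel a = solve 2 (λ c a → :- c :+ (c :+ a) := a) refl c a

  ∣∣⇒∣≤∣ : ∀ {d e} → ∣ d ∣ ≤ e → d ∣≤∣ e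
  ∣∣⇒∣≤∣ {d} {e} h = by-sign (∣p∣≡p∨∣p∣≡-p d)
    where
    0≤bound = ≤-trans (0≤∣p∣ d) h
    by-sign : ∣ d ∣ ≡ d ⊎ ∣ d ∣ ≡ - d → d ∣≤∣ e
    by-sign (inj₁ eq) = ≤-trans (neg-antimono-≤ 0≤bound) (subst (0ℚ ≤_) eq (0≤∣p∣ d)) , subst (_≤ e) eq h
    by-sign (inj₂ eq) = subst (- e ≤_) (flip d) (neg-antimono-≤ -d≤e) , ≤-trans (subst (_≤ 0ℚ) (flip d) (neg-antimono-≤ (subst (0ℚ ≤_) eq (0≤∣p∣ d)))) 0≤bound
      where
      -d≤e = subst (_≤ e) eq h
      flip : ∀ a → - (- a) ≡ a
      flip = solve 1 (λ a → :- (:- a) := a) refl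

  approximation : ∀ x e .{{_ : Positive e}} → ∃[ c ] Eventually (λ n → (c - e ≤ seq x n) × (seq x n ≤ c + e))
  approximation x e = seq x N , N , λ {n} N≤n →
    let l , u = ∣∣⇒∣≤∣ (<⇒≤ (proj₂ C ℕ.≤-refl N≤n))
    in subst (seq x N - e ≤_) (solve 2 (λ c s → c :- (c :- s) := s) refl (seq x N) (seq x n)) (+-monoʳ-≤ (seq x N) (neg-antimono-≤ u)) ,
       subst₂ _≤_ (solve 3 (λ c s e → :- e :+ (s :+ e) := s) refl (seq x N) (seq x n) e) (solve 3 (λ c s e → c :- s :+ (s :+ e) := c :+ e) refl (seq x N) (seq x n) e) (+-monoˡ-≤ (seq x n + e) l)
    where
    C = cauchy x e
    N = proj₁ C

  archimedean : ∀ c → ∃[ n ] c ≤ ι n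
  archimedean c@(mkℚ k d _) = ℤ.∣ k ∣ , toℚᵘ-cancel-≤ (ℚᵘ.≤-trans (ℚᵘ.*≤* (begin
    k ℤ.* ℤ.+ 1                  ≡⟨ ℤ.*-identityʳ k ⟩
    k                            ≤⟨ k≤∣k∣ k ⟩
    ℤ.+ ℤ.∣ k ∣                  ≤⟨ ℤ.+≤+ (ℕ.m≤m*n ℤ.∣ k ∣ (suc d)) ⟩
    ℤ.+ (ℤ.∣ k ∣ ℕ.* suc d)      ≡⟨ ℤ.pos-* ℤ.∣ k ∣ (suc d) ⟩
    ℤ.+ ℤ.∣ k ∣ ℤ.* ℤ.+ suc d    ∎)) (ℚᵘ.≤-reflexive (ℚᵘ.≃-sym (toℚᵘ-q ℤ.∣ k ∣))))
    where
    open ℤ.≤-Reasoning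
    k≤∣k∣ : ∀ k → k ℤ.≤ ℤ.+ ℤ.∣ k ∣
    k≤∣k∣ (ℤ.+ n)      = ℤ.≤-refl
    k≤∣k∣ (ℤ.-[1+ n ]) = ℤ.-≤+

  bounded : ∀ x → ∃[ β ] Eventually (λ n → seq x n ∣≤∣ ι β)
  bounded x = around (proj₁ C) (proj₂ C) (archimedean (1ℚ - proj₁ C)) (archimedean (proj₁ C + 1ℚ))
    where
    C = approximation x 1ℚ
    around : ∀ c → Eventually (λ n → (c - 1ℚ ≤ seq x n) × (seq x n ≤ c + 1ℚ)) →
             ∃[ a ] 1ℚ - c ≤ ι a → ∃[ b ] c + 1ℚ ≤ ι b → ∃[ β ] Eventually (λ n → seq x n ∣≤∣ ι β)
    around c near (a , -c≤a) (b , c≤b) = a ℕ.+ b , map (λ {n} (l , u) → within (seq x n) l u) near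
      where
      within : ∀ s → c - 1ℚ ≤ s → s ≤ c + 1ℚ → s ∣≤∣ ι (a ℕ.+ b)
      within s l u =
        ≤-trans (neg-antimono-≤ (≤-trans -c≤a (q-mono (ℕ.m≤m+n a b)))) (subst (_≤ s) (solve 1 (λ c → c :- con 1ℚ := :- (con 1ℚ :- c)) refl c) l) ,
        ≤-trans u (≤-trans c≤b (q-mono (ℕ.m≤n+m b a)))

  -- The limit in `IsLn` allows one error and the order of reals another; each receives half of e.
  ln-bounds : ∀ {x l} → IsLn x l → ∀ e .{{_ : Positive e}} → ∃[ K ] ∀ k → K ℕ.≤ k →
    Eventually (λ n → (E k (seq l n) ≤ seq x n + e) × (seq x n ≤ E k (seq l n) + e))
  ln-bounds {x} {l} ln e {{e>0}} = halved (½ * e) (solve 1 (λ e → con ½ :* e :+ con ½ :* e := e) refl e) (pos*pos⇒pos ½ e {{e>0}})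
    where
    halved : ∀ h → h + h ≡ e → .(Positive h) → ∃[ K ] ∀ k → K ℕ.≤ k →
      Eventually (λ n → (E k (seq l n) ≤ seq x n + e) × (seq x n ≤ E k (seq l n) + e))
    halved h h+h h>0 = proj₁ L , λ k K≤k → map
        (λ {n} (u , v) → subst₂ _≤_ (seq-expSum l k n) (total (seq x n)) u ,
                         subst (seq x n ≤_) (trans (total (seq (expSum l k) n)) (cong (_+ e) (seq-expSum l k n))) v)
        (both (proj₁ (proj₂ L K≤k) h {{h>0}}) (proj₂ (proj₂ L K≤k) h {{h>0}}))
      where
      L = ln h {{h>0}}
      total : ∀ a → a + h + h ≡ a + e
      total a = trans (+-assoc a h h) (cong (a +_) h+h)

  -- Below ½ the exponential is too small for 3: it is at most 1 + ½ for arguments up to 0, by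
  -- `E-negative`, and at most exp ½ ≤ 2 between 0 and ½. The approximation error ½ fits into both
  -- gaps.
  ln-≥½ : ∀ {x l} → IsLn x l → Eventually (λ n → ι 3 ≤ seq x n) → Eventually (λ n → ½ ≤ seq l n)
  ln-≥½ {x} {l} ln x≥3 = map (λ {n} (b , (_ , u) , x≥3) → pointwise (seq l n) (proj₁ b) (≤-trans x≥3 u))
      (both (proj₂ B) (both (proj₂ L k (ℕ.m≤n+m K (suc (8 ℕ.* β)))) x≥3))
    where
    B = bounded l
    β = proj₁ B
    L = ln-bounds {x} {l} ln ½
    K = proj₁ L
    k = suc (8 ℕ.* β) ℕ.+ K
    pointwise : ∀ y → - ι β ≤ y → ι 3 ≤ E k y + ½ → ½ ≤ y
    pointwise y -β≤y 3≤ = resolve (≤-total ½ y) (≤-total y 0ℚ)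
      where
      resolve : ½ ≤ y ⊎ y ≤ ½ → y ≤ 0ℚ ⊎ 0ℚ ≤ y → ½ ≤ y
      resolve (inj₁ h) _        = h
      resolve (inj₂ h) (inj₁ n) = contradiction (≤-trans 3≤ (+-monoˡ-≤ ½ (E-negative β K -β≤y n))) (from-no (ι 3 ≤? 1ℚ + ½ + ½))
      resolve (inj₂ h) (inj₂ p) = contradiction (≤-trans 3≤ (+-monoˡ-≤ ½ (≤-trans (E-mono k (≤-trans (from-yes (- ½ ≤? 0ℚ)) p , h)) (E-halves k 1)))) (from-no (ι 3 ≤? ι 2 + ½))

  -- If l exceeded m, then 2ᵐ ≤ exp m ≤ exp l would be within ½ of x; the margin 1 in the hypothesis
  -- contradicts this.
  ln-≤ : ∀ {x l} m → IsLn x l → Eventually (λ n → seq x n + 1ℚ ≤ ι (2 ℕ.^ m)) → Eventually (λ n → seq l n ≤ ι m)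
  ln-≤ {x} {l} m ln x≤ = map (λ {n} ((u , _) , x≤) → pointwise (seq l n) (seq x n) u x≤) (both (proj₂ L k (ℕ.m≤n+m K (suc m))) x≤)
    where
    L = ln-bounds {x} {l} ln ½
    K = proj₁ L
    k = suc m ℕ.+ K
    pointwise : ∀ y x → E k y ≤ x + ½ → x + 1ℚ ≤ ι (2 ℕ.^ m) → y ≤ ι m
    pointwise y x u x≤ = resolve (≤-total y (ι m))
      where
      resolve : y ≤ ι m ⊎ ι m ≤ y → y ≤ ι m
      resolve (inj₁ h) = h
      resolve (inj₂ h) = contradiction (+-cancelˡ-≤ x {1ℚ} {½} (begin
        x + 1ℚ                ≤⟨ x≤ ⟩
        ι (2 ℕ.^ m)           ≤⟨ E-powers m ⟩
        E (suc m) (ι m)       ≤⟨ E-grow (0≤q m) (ℕ.m≤m+n (suc m) K) ⟩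
        E k (ι m)             ≤⟨ E-mono k (≤-trans (neg-antimono-≤ (≤-trans (0≤q m) h)) (0≤q m) , h) ⟩
        E k y                 ≤⟨ u ⟩
        x + ½                 ∎)) (from-no (1ℚ ≤? ½))
        where open ≤-Reasoning

  -- With y = (k + 1) / 2, exp y ≤ 2ᵏ⁺¹ ≤ x, and `E-gap` turns the comparison of exp l with exp y
  -- into one of l with y. The lower bound -½ on l provides |l| ≤ y, which it needs.
  ln-≥ : ∀ {x l} k → IsLn x l → Eventually (λ n → - ½ ≤ seq l n) → Eventually (λ n → ι (2 ℕ.^ suc k) ≤ seq x n) →
         ∀ e .{{_ : Positive e}} → Eventually (λ n → halves (suc k) ≤ seq l n + e)
  ln-≥ {x} {l} k ln -½≤l x≥ e {{e>0}} = map (λ {n} (l≥ , (_ , u) , x≥) → pointwise (seq l n) (seq x n) l≥ u x≥) (both -½≤l (both (proj₂ L (suc (suc K)) (ℕ.m≤n+m K 2)) x≥))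
    where
    L = ln-bounds {x} {l} ln e {{e>0}}
    K = proj₁ L
    j = suc (suc K)
    y = halves (suc k)
    ½≤y : ½ ≤ y
    ½≤y = *-monoʳ {ι 1} {ι (suc k)} {½} (<⇒≤ (positive⁻¹ ½)) (q-mono {1} {suc k} (ℕ.s≤s ℕ.z≤n))
    pointwise : ∀ l x → - ½ ≤ l → x ≤ E j l + e → ι (2 ℕ.^ suc k) ≤ x → y ≤ l + e
    pointwise l x l≥ u x≥ = resolve (≤-total l y)
      where
      open ≤-Reasoning
      resolve : l ≤ y ⊎ y ≤ l → y ≤ l + e
      resolve (inj₂ h) = ≤-trans h (≤-+ (<⇒≤ (positive⁻¹ e {{e>0}})))
      resolve (inj₁ h) = subst (_≤ l + e) (solve 2 (λ l y → l :+ (y :- l) := y) refl l y) (+-monoʳ-≤ l (+-cancelˡ-≤ (E j l) (begin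
        E j l + (y - l)       ≤⟨ E-gap K (≤-trans (neg-antimono-≤ ½≤y) l≥ , h) ⟩
        E j y                 ≤⟨ E-halves j (suc k) ⟩
        ι (2 ℕ.^ suc k)       ≤⟨ x≥ ⟩
        x                     ≤⟨ u ⟩
        E j l + e             ∎)))

-- Integers near the real parameters.

module Bounds where
  open import Data.Nat as ℕ using (ℕ; zero; suc)
  import Data.Nat.Properties as ℕ
  open import Data.Nat.Tactic.RingSolver using (solve-∀)
  open import Data.Product using (∃-syntax; _×_; _,_; proj₁; proj₂)
  open import Data.Rational hiding (truncate; floor)
  open import Data.Rational.Properties
  open import Data.Rational.Solver using (module +-*-Solver)
  open import Data.Sum using (_⊎_; inj₁; inj₂)
  open import Relation.Binary.PropositionalEquality
  open import Relation.Nullary using (¬_; contradiction)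
  open import Relation.Nullary.Decidable using (from-yes; from-no)
  open Rationals renaming (q to ι)
  open Exponential
  open Reals
  import Defs as R
  open R using (ℝ; fromℕ; inv)
  open ℝ

  open +-*-Solver using (solve; _:+_; _:*_; _:-_; :-_; _:=_; con)

  ι-cancel-½ : ∀ {a b} → ι a ≤ ι b + ½ → a ℕ.≤ b
  ι-cancel-½ {a} {b} h = ℕ.≮⇒≥ λ b<a → contradiction (+-cancelˡ-≤ (ι b) {1ℚ} {½}
    (≤-trans (≤-reflexive (trans (+-comm (ι b) 1ℚ) (sym (q-+ 1 b)))) (≤-trans (q-mono b<a) h))) (from-no (1ℚ ≤? ½))

  floor : ∀ {c} → 0ℚ ≤ c → ∃[ z ] (ι z ≤ c) × (c ≤ ι (suc z))
  floor {c} 0≤c = search (proj₁ (archimedean c)) (proj₂ (archimedean c))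
    where
    search : ∀ n → c ≤ ι n → ∃[ z ] (ι z ≤ c) × (c ≤ ι (suc z))
    search zero    c≤0 = 0 , 0≤c , ≤-trans c≤0 0≤1
    search (suc n) c≤  = resolve (≤-total c (ι n))
      where
      resolve : c ≤ ι n ⊎ ι n ≤ c → ∃[ z ] (ι z ≤ c) × (c ≤ ι (suc z))
      resolve (inj₁ h) = search n h
      resolve (inj₂ h) = n , h , c≤

  power-bracket : ∀ {z} → 1 ℕ.≤ z → ∃[ h ] (z ℕ.< 2 ℕ.^ h) × (2 ℕ.^ h ℕ.≤ 2 ℕ.* z)
  power-bracket {z} 1≤z = search z (n<2^n z)
    where
    n<2^n : ∀ n → n ℕ.< 2 ℕ.^ n
    n<2^n zero    = ℕ.≤-refl
    n<2^n (suc n) = ℕ.≤-trans (ℕ.s≤s (n<2^n n)) (ℕ.≤-trans (ℕ.+-monoˡ-≤ (2 ℕ.^ n) (ℕ.m^n>0 2 n)) (ℕ.≤-reflexive (cong (2 ℕ.^ n ℕ.+_) (sym (ℕ.+-identityʳ (2 ℕ.^ n))))))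
    search : ∀ h → z ℕ.< 2 ℕ.^ h → ∃[ h ] (z ℕ.< 2 ℕ.^ h) × (2 ℕ.^ h ℕ.≤ 2 ℕ.* z)
    search zero    z<1 = contradiction 1≤z (ℕ.<⇒≱ z<1)
    search (suc g) z<  = resolve (ℕ.≤-<-connex (2 ℕ.^ g) z)
      where
      resolve : 2 ℕ.^ g ℕ.≤ z ⊎ z ℕ.< 2 ℕ.^ g → ∃[ h ] (z ℕ.< 2 ℕ.^ h) × (2 ℕ.^ h ℕ.≤ 2 ℕ.* z)
      resolve (inj₁ 2^g≤z) = suc g , z< , ℕ.*-monoʳ-≤ 2 2^g≤z
      resolve (inj₂ z<2^g) = search g z<2^g

  -- If h < k, then z + 2 < 2ʰ + 2 ≤ 2ᵏ for h ≥ 1, a contradiction; h = 0 is excluded by k ≥ 2. So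
  -- the rounding of λ by 2 does not cost an exponent.
  exponent-≥ : ∀ {k z h} → 2 ℕ.≤ k → 2 ℕ.^ k ℕ.≤ z ℕ.+ 2 → z ℕ.< 2 ℕ.^ h → k ℕ.≤ h
  exponent-≥ {k} {z} {h} 2≤k 2^k≤ z<2^h = ℕ.≮⇒≥ λ h<k → too-small h h<k z<2^h
    where
    too-small : ∀ h → h ℕ.< k → ¬ z ℕ.< 2 ℕ.^ h
    too-small zero    h<k z<1 = ℕ.<⇒≱ (ℕ.≤-trans (ℕ.+-monoˡ-≤ 2 z<1) (ℕ.n≤1+n 3)) (ℕ.≤-trans (ℕ.^-monoʳ-≤ 2 2≤k) 2^k≤)
    too-small (suc h) h<k z<  = ℕ.<⇒≱ (begin-strict
      z ℕ.+ 2                          <⟨ ℕ.+-monoˡ-< 2 z< ⟩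
      2 ℕ.^ suc h ℕ.+ 2                ≤⟨ ℕ.+-monoʳ-≤ (2 ℕ.^ suc h) (ℕ.*-monoʳ-≤ 2 (ℕ.m^n>0 2 h)) ⟩
      2 ℕ.^ suc h ℕ.+ 2 ℕ.^ suc h      ≡⟨ cong (2 ℕ.^ suc h ℕ.+_) (sym (ℕ.+-identityʳ (2 ℕ.^ suc h))) ⟩
      2 ℕ.^ suc (suc h)                ≤⟨ ℕ.^-monoʳ-≤ 2 h<k ⟩
      2 ℕ.^ k                          ∎) 2^k≤
      where open ℕ.≤-Reasoning

  z+3≤2^2+h : ∀ {z h} → z ℕ.< 2 ℕ.^ h → z ℕ.+ 2 ℕ.+ 1 ℕ.≤ 2 ℕ.^ (2 ℕ.+ h)
  z+3≤2^2+h {z} {h} z<2^h = ℕ.≤-trans (ℕ.≤-reflexive (trans (ℕ.+-assoc z 2 1) (ℕ.+-suc z 2))) (ℕ.≤-trans (ℕ.+-mono-≤ z<2^h (ℕ.*-monoʳ-≤ 2 (ℕ.m^n>0 2 h)))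
    (ℕ.≤-trans (ℕ.m≤m+n (2 ℕ.^ h ℕ.+ 2 ℕ.* 2 ℕ.^ h) (2 ℕ.^ h)) (ℕ.≤-reflexive (quadruple (2 ℕ.^ h)))))
    where
    quadruple : ∀ P → P ℕ.+ 2 ℕ.* P ℕ.+ P ≡ 2 ℕ.* (2 ℕ.* P)
    quadruple = solve-∀

  unit-bounds : ∀ x → fromℕ 0 R.< x → x R.< fromℕ 1 → Eventually (λ n → (0ℚ < seq x n) × (seq x n ≤ 1ℚ))
  unit-bounds x 0<x x<1 = map
      (λ (l , u) → <-≤-trans (positive⁻¹ (gap 0<x) {{gap-pos 0<x}}) (≤-trans (≤-reflexive (sym (+-identityˡ (gap 0<x)))) l) ,
                   ≤-trans (≤-+ (<⇒≤ (positive⁻¹ (gap x<1) {{gap-pos x<1}}))) u)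
      (both (from 0<x , gap-separates 0<x) (from x<1 , gap-separates x<1))
    where open R._<_

  inv≥1 : ∀ {y} → 0ℚ < y → y ≤ 1ℚ → 1ℚ ≤ inv y
  inv≥1 {y} 0<y y≤1 = ≮⇒≥ λ v<1 → <-irrefl refl (begin-strict
    1ℚ           ≡⟨ sym (inv-inverse 0<y) ⟩
    inv y * y    <⟨ *-monoˡ-<-pos y {{positive 0<y}} v<1 ⟩
    1ℚ * y       ≡⟨ *-identityˡ y ⟩
    y            ≤⟨ y≤1 ⟩
    1ℚ           ∎)
    where open ≤-Reasoning

  inv≤inv² : ∀ {y} → 0ℚ < y → y ≤ 1ℚ → inv y ≤ inv (y * (y * 1ℚ))
  inv≤inv² {y} 0<y y≤1 = begin
    v                              ≡⟨ sym (*-identityˡ v) ⟩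
    1ℚ * v                         ≡⟨ cong (_* v) (sym (inv-inverse 0<yy)) ⟩
    w * (y * (y * 1ℚ)) * v         ≡⟨ solve 3 (λ w y v → w :* (y :* (y :* con 1ℚ)) :* v := w :* y :* (v :* y)) refl w y v ⟩
    w * y * (v * y)                ≡⟨ trans (cong (w * y *_) (inv-inverse 0<y)) (*-identityʳ (w * y)) ⟩
    w * y                          ≤⟨ *-monoˡ (≤-trans 0≤1 (inv≥1 0<yy yy≤1)) y≤1 ⟩
    w * 1ℚ                         ≡⟨ *-identityʳ w ⟩
    w                              ∎
    where
    open ≤-Reasoning
    v = inv y
    w = inv (y * (y * 1ℚ))
    0<yy : 0ℚ < y * (y * 1ℚ)
    0<yy = positive⁻¹ _ {{pos*pos⇒pos y {{positive 0<y}} (y * 1ℚ) {{pos*pos⇒pos y {{positive 0<y}} 1ℚ}}}}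
    yy≤1 : y * (y * 1ℚ) ≤ 1ℚ
    yy≤1 = *-mono {y} {1ℚ} {y * 1ℚ} {1ℚ} (<⇒≤ 0<y) y≤1 (0≤-* {y} {1ℚ} (<⇒≤ 0<y) 0≤1) (*-mono {y} {1ℚ} {1ℚ} {1ℚ} (<⇒≤ 0<y) y≤1 0≤1 ≤-refl)

  -- The floor of a real cannot be computed, so x is approximated to within ¼ by a rational c and z
  -- is the floor of c - ¼. The ambiguity of ½ widens the bracket from 1 to 2.
  integer-bracket : ∀ x → Eventually (λ n → ½ ≤ seq x n) → ∃[ z ] Eventually (λ n → (ι z ≤ seq x n) × (seq x n ≤ ι (z ℕ.+ 2)))
  integer-bracket x x≥½ = quarter (½ * ½) refl
    where
    around : ∀ q c → q + q ≡ ½ → Eventually (λ n → (c - q ≤ seq x n) × (seq x n ≤ c + q)) → ∃[ z ] Eventually (λ n → (ι z ≤ seq x n) × (seq x n ≤ ι (z ℕ.+ 2)))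
    around q c 2q near = z , map (λ {n} (l , u) → within (seq x n) l u) near
      where
      open ≤-Reasoning
      positive-at : ∀ s → s ≤ c + q → ½ ≤ s → 0ℚ ≤ c - q
      positive-at s u l = +-cancelˡ-≤ ½ {0ℚ} {c - q} (begin
        ½ + 0ℚ             ≡⟨ +-identityʳ ½ ⟩
        ½                  ≤⟨ l ⟩
        s                  ≤⟨ u ⟩
        c + q              ≡⟨ solve 2 (λ c q → c :+ q := q :+ q :+ (c :- q)) refl c q ⟩
        q + q + (c - q)    ≡⟨ cong (_+ (c - q)) 2q ⟩
        ½ + (c - q)        ∎)
      F = let n , ((_ , u) , l) = witness (both near x≥½) in floor (positive-at (seq x n) u l)
      z = proj₁ F
      within : ∀ s → c - q ≤ s → s ≤ c + q → (ι z ≤ s) × (s ≤ ι (z ℕ.+ 2))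
      within s l u = ≤-trans (proj₁ (proj₂ F)) l , (begin
        s                       ≤⟨ u ⟩
        c + q                   ≡⟨ solve 2 (λ c q → c :+ q := c :- q :+ (q :+ q)) refl c q ⟩
        c - q + (q + q)         ≤⟨ +-mono-≤ (proj₂ (proj₂ F)) (≤-trans (≤-reflexive 2q) (from-yes (½ ≤? 1ℚ))) ⟩
        ι (suc z) + ι 1         ≡⟨ sym (q-+ (suc z) 1) ⟩
        ι (suc z ℕ.+ 1)         ≡⟨ cong ι (sym (ℕ.+-suc z 1)) ⟩
        ι (z ℕ.+ 2)             ∎)
    quarter : ∀ q .{{_ : Positive q}} → q + q ≡ ½ → ∃[ z ] Eventually (λ n → (ι z ≤ seq x n) × (seq x n ≤ ι (z ℕ.+ 2)))
    quarter q 2q = around q (proj₁ C) 2q (proj₂ C)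
      where C = approximation x q

  record Range (k : ℕ) (lam ε : ℝ) : Set where
    field
      z h      : ℕ
      k≤h      : k ℕ.≤ h
      z<2^h    : z ℕ.< 2 ℕ.^ h
      2^h≤2z   : 2 ℕ.^ h ℕ.≤ 2 ℕ.* z
      2^k≤z+2  : 2 ℕ.^ k ℕ.≤ z ℕ.+ 2
      near     : Eventually (λ n → (ι z ≤ seq lam n) × (seq lam n ≤ ι (z ℕ.+ 2)))
      4/ε≤     : Eventually (λ n → ι 4 * inv (seq ε n) + 1ℚ ≤ ι (2 ℕ.^ (2 ℕ.+ h)))
      4/ε≥3    : Eventually (λ n → ι 3 ≤ ι 4 * inv (seq ε n))

  -- As ε < 1, the hypothesis on λ serves twice: 1 / ε² ≥ 1 gives λ ≥ 2ᵏ, and 1 / ε ≤ 1 / ε² bounds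
  -- 4 / ε by λ, so that ln (4 / ε) is of order h like ln λ.
  range : ∀ k → 6 ℕ.≤ k → ∀ lam ε {{0<ε : fromℕ 0 R.< ε}} → ε R.< fromℕ 1 →
    R._÷_ (fromℕ 2 R.^ k) (ε R.^ 2) {{R.^-positive ε 2}} R.≤ lam → Range k lam ε
  range k 6≤k lam ε {{0<ε}} ε<1 large = record
    { z = z ; h = h ; k≤h = exponent-≥ (ℕ.≤-trans (ℕ.m≤m+n 2 4) 6≤k) 2^k≤z+2 (proj₁ (proj₂ H)) ; z<2^h = proj₁ (proj₂ H) ; 2^h≤2z = proj₂ (proj₂ H)
    ; 2^k≤z+2 = 2^k≤z+2
    ; near = near
    ; 4/ε≤ = map (λ {n} ((l , u) , (_ , u′)) → ε-bound (seq ε n) (seq lam n) u u′ l) (both ε-facts near)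
    ; 4/ε≥3 = map (λ {n} (_ , 0<y , y≤1) → ≤-trans (from-yes (ι 3 ≤? ι 4 * 1ℚ)) (*-monoˡ {1ℚ} {inv (seq ε n)} (0≤q 4) (inv≥1 0<y y≤1))) ε-facts
    }
    where
    ε-facts : Eventually (λ n → (ι (2 ℕ.^ k) * inv (seq ε n * (seq ε n * 1ℚ)) ≤ seq lam n + ½) × (0ℚ < seq ε n) × (seq ε n ≤ 1ℚ))
    ε-facts = both (map (λ {n} l → subst (λ t → t * inv (seq ε n * (seq ε n * 1ℚ)) ≤ seq lam n + ½) (trans (seq-^ (fromℕ 2) k n) (pow-ι 2 k)) l) (large ½)) (unit-bounds ε 0<ε ε<1)
    lam≥ : Eventually (λ n → ι (2 ℕ.^ k) ≤ seq lam n + ½)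
    lam≥ = map (λ {n} (l , 0<y , y≤1) → ≤-trans (≤-trans (≤-reflexive (sym (*-identityʳ (ι (2 ℕ.^ k))))) (*-monoˡ (0≤q (2 ℕ.^ k)) (≤-trans (inv≥1 0<y y≤1) (inv≤inv² 0<y y≤1)))) l) ε-facts
    lam≥½ : Eventually (λ n → ½ ≤ seq lam n)
    lam≥½ = map (λ {n} l → +-cancelˡ-≤ ½ (≤-trans (q-mono {1} {2 ℕ.^ k} (ℕ.m^n>0 2 k)) (≤-trans l (≤-reflexive (+-comm (seq lam n) ½))))) lam≥
    Z = integer-bracket lam lam≥½
    z = proj₁ Z
    near : Eventually (λ n → (ι z ≤ seq lam n) × (seq lam n ≤ ι (z ℕ.+ 2)))
    near = proj₂ Z
    2^k≤z+2 : 2 ℕ.^ k ℕ.≤ z ℕ.+ 2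
    2^k≤z+2 = let n , ((_ , u) , l) = witness (both near lam≥) in ι-cancel-½ (≤-trans l (+-monoˡ-≤ ½ u))
    H = power-bracket {z} (ℕ.≤-trans (ℕ.m≤m+n 1 1) (ℕ.+-cancelʳ-≤ 2 2 z (ℕ.≤-trans (ℕ.^-monoʳ-≤ 2 {2} {k} (ℕ.≤-trans (ℕ.m≤m+n 2 4) 6≤k)) 2^k≤z+2)))
    h = proj₁ H
    ε-bound : ∀ y x → (0ℚ < y) × (y ≤ 1ℚ) → x ≤ ι (z ℕ.+ 2) → ι (2 ℕ.^ k) * inv (y * (y * 1ℚ)) ≤ x + ½ → ι 4 * inv y + 1ℚ ≤ ι (2 ℕ.^ (2 ℕ.+ h))
    ε-bound y x (0<y , y≤1) u l = begin
      ι 4 * inv y + 1ℚ                  ≤⟨ +-monoʳ-≤ (ι 4 * inv y) (inv≥1 0<y y≤1) ⟩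
      ι 4 * inv y + inv y               ≡⟨ solve 1 (λ v → con (ι 4) :* v :+ v := con (ι 5) :* v) refl (inv y) ⟩
      -- 5 is 4 plus the margin 1 demanded by `ln-≤`, enlarged to 1 / ε; it is far below 2ᵏ.
      ι 5 * inv y                       ≤⟨ *-monoˡ (0≤q 5) (inv≤inv² 0<y y≤1) ⟩
      ι 5 * inv (y * (y * 1ℚ))          ≤⟨ *-monoʳ (≤-trans 0≤1 (≤-trans (inv≥1 0<y y≤1) (inv≤inv² 0<y y≤1))) (q-mono {5} {2 ℕ.^ k} (ℕ.≤-trans (ℕ.m≤m+n 5 59) (ℕ.^-monoʳ-≤ 2 6≤k))) ⟩
      ι (2 ℕ.^ k) * inv (y * (y * 1ℚ))  ≤⟨ l ⟩
      x + ½                             ≤⟨ +-mono-≤ u (from-yes (½ ≤? 1ℚ)) ⟩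
      ι (z ℕ.+ 2) + ι 1                 ≡⟨ sym (q-+ (z ℕ.+ 2) 1) ⟩
      ι (z ℕ.+ 2 ℕ.+ 1)                 ≤⟨ q-mono (z+3≤2^2+h {z} {h} (proj₁ (proj₂ H))) ⟩
      ι (2 ℕ.^ (2 ℕ.+ h))               ∎
      where open ≤-Reasoning

-- From hypotheses on reals to inequalities between integers.

module Hypotheses where
  open import Data.List.Membership.Propositional using (_∈_)
  open import Data.List.NonEmpty using (toList)
  open import Data.List.Relation.Unary.Unique.Propositional using (Unique)
  open import Data.Nat as ℕ using (ℕ; zero; suc)
  import Data.Nat.Properties as ℕ
  open import Data.Nat.Divisibility using (_∣_; _∤_)
  open import Data.Nat.Primality using (Prime)
  open import Data.Nat.Tactic.RingSolver using (solve-∀)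
  import Data.Integer as ℤ
  open import Data.Product using (_×_; _,_; proj₁; proj₂)
  open import Data.Rational hiding (truncate; floor)
  open import Data.Rational.Properties
  open import Data.Rational.Solver using (module +-*-Solver)
  open import Data.Sum using (_⊎_; inj₁; inj₂)
  open import Function.Bundles using (Equivalence)
  open import Relation.Binary.PropositionalEquality
  open import Relation.Nullary using (contradiction)
  open import Relation.Nullary.Decidable using (from-yes; from-no)
  open Rationals renaming (q to ι)
  open Exponential
  open Reals
  open Bounds
  import Defs as R
  open R using (ℝ; fromℕ; fromℚ; IsLn; IsLog; IsRoot; inv; Parameters; PrescribedBy)
  open ℝ

  open +-*-Solver using (solve; _:+_; _:*_; _:=_; con)

  pow-mono : ∀ {x y} k → 0ℚ ≤ x → x ≤ y → pow x k ≤ pow y k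
  pow-mono k 0≤x x≤y = proj₂ (∣pow∣ k (≤-trans (neg-antimono-≤ (≤-trans 0≤x x≤y)) 0≤x , x≤y))

  seq-^-bounds : ∀ x k {a b} n → ι a ≤ seq x n → seq x n ≤ ι b → (ι (a ℕ.^ k) ≤ seq (x R.^ k) n) × (seq (x R.^ k) n ≤ ι (b ℕ.^ k))
  seq-^-bounds x k {a} {b} n l u = subst (λ w → (ι (a ℕ.^ k) ≤ w) × (w ≤ ι (b ℕ.^ k))) (sym (seq-^ x k n))
    (subst (_≤ pow (seq x n) k) (pow-ι a k) (pow-mono k (0≤q a) l) , subst (pow (seq x n) k ≤_) (pow-ι b k) (pow-mono k (≤-trans (0≤q a) l) u))

  ^5 : ∀ z → z ℕ.^ 5 ≡ z ℕ.* z ℕ.* z ℕ.* (z ℕ.* z)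
  ^5 z = expand z
    where
    expand : ∀ z → z ℕ.* (z ℕ.* (z ℕ.* (z ℕ.* (z ℕ.* 1)))) ≡ z ℕ.* z ℕ.* z ℕ.* (z ℕ.* z)
    expand = solve-∀

  -- The logarithm of x to base b is positive, though possibly tiny: ln x ≥ ½, and ln b is bounded
  -- by some β. Hence its ceiling is not 0 and the third stage draws at least once.
  log-ceiling≥1 : ∀ b x l D → IsLog b x l → Eventually (λ n → ι 3 ≤ seq x n) → l R.≤ fromℕ D → 1 ℕ.≤ D
  log-ceiling≥1 b x l (suc D) _ _ _ = ℕ.s≤s ℕ.z≤n
  log-ceiling≥1 b x l zero (lnb , lnx , 0<lnb , _ , ln-x , _ , l≥) x≥3 l≤0 = contradiction (proj₂ (witness impossible)) (from-no (ι 2 ≤? ι 1))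
    where
    open R._<_
    B = bounded lnb
    β = proj₁ B
    pointwise : ∀ d → ι (8 ℕ.* suc β) * d ≡ 1ℚ → 0ℚ ≤ d → ∀ X Y s → ½ ≤ X → 0ℚ < Y → Y ≤ ι β → X * inv Y ≤ s + d → s ≤ 0ℚ + d → ι 2 ≤ ι 1
    -- The slack d = 1 / (8 (β + 1)) is used twice. From ln x ≤ 2 d (β + 1) = ¼ and ln x ≥ ½ follows
    -- 2 ≤ 1.
    pointwise d md 0≤d X Y s X≥ 0<Y Y≤ h₁ h₂ = begin
      ι 4 * ½                        ≤⟨ *-monoˡ (0≤q 4) X≥ ⟩
      ι 4 * X                        ≡⟨ cong (ι 4 *_) (sym (trans (*-assoc X (inv Y) Y) (trans (cong (X *_) (inv-inverse 0<Y)) (*-identityʳ X)))) ⟩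
      ι 4 * (X * inv Y * Y)          ≤⟨ *-monoˡ (0≤q 4) (*-mono (0≤-* (≤-trans (<⇒≤ (positive⁻¹ ½)) X≥) 0≤inv) (≤-trans h₁ (+-monoˡ-≤ d h₂)) (<⇒≤ 0<Y) (≤-trans Y≤ (q-mono (ℕ.n≤1+n β)))) ⟩
      ι 4 * ((0ℚ + d + d) * ι (suc β))  ≡⟨ solve 2 (λ d b → con (ι 4) :* ((con 0ℚ :+ d :+ d) :* b) := con (ι 8) :* b :* d) refl d (ι (suc β)) ⟩
      ι 8 * ι (suc β) * d            ≡⟨ cong (_* d) (sym (q-* 8 (suc β))) ⟩
      ι (8 ℕ.* suc β) * d                  ≡⟨ md ⟩
      ι 1                            ∎
      where
      open ≤-Reasoning
      0≤inv : 0ℚ ≤ inv Y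
      0≤inv = *-cancelʳ-≤-pos Y {{positive 0<Y}} (subst₂ _≤_ (sym (*-zeroˡ Y)) (sym (inv-inverse 0<Y)) 0≤1)
    at : ∀ d .{{_ : Positive d}} → ι (8 ℕ.* suc β) * d ≡ 1ℚ → Eventually (λ _ → ι 2 ≤ ι 1)
    at d md = map (λ {n} (a , b , c , p , q) → pointwise d md (<⇒≤ (positive⁻¹ d)) (seq lnx n) (seq lnb n) (seq l n) a
        (<-≤-trans (positive⁻¹ (gap 0<lnb) {{gap-pos 0<lnb}}) (≤-trans (≤-reflexive (sym (+-identityˡ (gap 0<lnb)))) b)) (proj₂ c) p q)
      (both (ln-≥½ {x} {lnx} ln-x x≥3) (both (from 0<lnb , gap-separates 0<lnb) (both (proj₂ B) (both (l≥ d) (l≤0 d)))))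
    impossible : Eventually (λ _ → ι 2 ≤ ι 1)
    impossible = choose (7 ℕ.+ 8 ℕ.* β) (sym (ℕ.*-suc 8 β))
      where
      choose : ∀ m → suc m ≡ 8 ℕ.* suc β → Eventually (λ _ → ι 2 ≤ ι 1)
      choose m m≡ = at (ℤ.+ 1 / suc m) {{normalize-pos 1 (suc m)}} (trans (cong (λ n → ι n * (ℤ.+ 1 / suc m)) (sym m≡)) (q-reciprocal m))

  separated : ∀ x y → x R.< y → Eventually (λ n → seq x n < seq y n)
  separated x y x<y = from x<y , λ {n} N≤n → <-≤-trans (subst (_< seq x n + gap x<y) (+-identityʳ (seq x n)) (+-monoʳ-< (seq x n) (positive⁻¹ (gap x<y) {{gap-pos x<y}}))) (gap-separates x<y N≤n)
    where open R._<_

  draws-bound : ∀ a b D H → fromℕ D R.< fromℕ 12 R.* a R.* b R.+ fromℕ 1 →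
    Eventually (λ n → ½ ≤ seq a n) → Eventually (λ n → seq a n ≤ ι H) → Eventually (λ n → ½ ≤ seq b n) → Eventually (λ n → seq b n ≤ ι H) →
    D ℕ.≤ 12 ℕ.* (H ℕ.* H) ℕ.+ 1
  draws-bound a b D H D< a≥ a≤ b≥ b≤ =
    let n , D< , (a≥ , a≤) , (b≥ , b≤) = witness (both (separated (fromℕ D) (fromℕ 12 R.* a R.* b R.+ fromℕ 1) D<) (both (both a≥ a≤) (both b≥ b≤)))
    in pointwise (seq a n) (seq b n) D< (≤-trans (<⇒≤ (positive⁻¹ ½)) a≥) a≤ (≤-trans (<⇒≤ (positive⁻¹ ½)) b≥) b≤
    where
    pointwise : ∀ a b → ι D < ι 12 * a * b + ι 1 → 0ℚ ≤ a → a ≤ ι H → 0ℚ ≤ b → b ≤ ι H → D ℕ.≤ 12 ℕ.* (H ℕ.* H) ℕ.+ 1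
    pointwise a b D< 0≤a a≤ 0≤b b≤ = q-cancel (begin
      ι D                                      ≤⟨ <⇒≤ D< ⟩
      ι 12 * a * b + ι 1                       ≡⟨ cong (_+ ι 1) (*-assoc (ι 12) a b) ⟩
      ι 12 * (a * b) + ι 1                     ≤⟨ +-monoˡ-≤ (ι 1) (*-monoˡ (0≤q 12) (*-mono 0≤a a≤ 0≤b b≤)) ⟩
      ι 12 * (ι H * ι H) + ι 1                 ≡⟨ cong (_+ ι 1) (trans (cong (ι 12 *_) (sym (q-* H H))) (sym (q-* 12 (H ℕ.* H)))) ⟩
      ι (12 ℕ.* (H ℕ.* H)) + ι 1               ≡⟨ sym (q-+ (12 ℕ.* (H ℕ.* H)) 1) ⟩
      ι (12 ℕ.* (H ℕ.* H) ℕ.+ 1)               ∎)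
      where open ≤-Reasoning

  -- The margin 1 is absorbed by passing to z + 4, and 8 (z + 4) ≤ 9 z leaves (9 / 8)⁵ ≤ 2. The
  -- factor 72 = 3 · 3 · 8 pairs two uses of 3 a² ≤ 4 z² with one of 8 a ≤ 9 z.
  fifth-powers : ∀ {z} → 32 ℕ.≤ z → (z ℕ.+ 3) ℕ.^ 5 ℕ.+ 1 ℕ.≤ 2 ℕ.* (z ℕ.* z ℕ.* z ℕ.* (z ℕ.* z))
  fifth-powers {z} 32≤z = ℕ.≤-trans (ℕ.≤-reflexive (ℕ.+-comm ((z ℕ.+ 3) ℕ.^ 5) 1)) (ℕ.≤-trans (ℕ.^-monoˡ-< 5 (ℕ.+-monoʳ-< z (ℕ.n<1+n 3))) (ℕ.*-cancelˡ-≤ 72 (begin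
    72 ℕ.* a ℕ.^ 5                                      ≡⟨ cong (72 ℕ.*_) (^5 a) ⟩
    72 ℕ.* (a ℕ.* a ℕ.* a ℕ.* (a ℕ.* a))                ≡⟨ lemma₁ a ⟩
    3 ℕ.* (a ℕ.* a) ℕ.* (3 ℕ.* (a ℕ.* a)) ℕ.* (8 ℕ.* a) ≤⟨ ℕ.*-mono-≤ (ℕ.*-mono-≤ 3a²≤4z² 3a²≤4z²) 8a≤9z ⟩
    4 ℕ.* (z ℕ.* z) ℕ.* (4 ℕ.* (z ℕ.* z)) ℕ.* (9 ℕ.* z) ≡⟨ lemma₂ z ⟩
    72 ℕ.* (2 ℕ.* (z ℕ.* z ℕ.* z ℕ.* (z ℕ.* z)))        ∎)))
    where
    open ℕ.≤-Reasoning
    a = z ℕ.+ 4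
    8a≤9z : 8 ℕ.* a ℕ.≤ 9 ℕ.* z
    8a≤9z = ℕ.≤-trans (ℕ.≤-reflexive (ℕ.*-distribˡ-+ 8 z 4)) (ℕ.≤-trans (ℕ.+-monoʳ-≤ (8 ℕ.* z) 32≤z) (ℕ.≤-reflexive (ℕ.+-comm (8 ℕ.* z) z)))
    lemma₁ : ∀ a → 72 ℕ.* (a ℕ.* a ℕ.* a ℕ.* (a ℕ.* a)) ≡ 3 ℕ.* (a ℕ.* a) ℕ.* (3 ℕ.* (a ℕ.* a)) ℕ.* (8 ℕ.* a)
    lemma₁ = solve-∀
    lemma₂ : ∀ z → 4 ℕ.* (z ℕ.* z) ℕ.* (4 ℕ.* (z ℕ.* z)) ℕ.* (9 ℕ.* z) ≡ 72 ℕ.* (2 ℕ.* (z ℕ.* z ℕ.* z ℕ.* (z ℕ.* z)))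
    lemma₂ = solve-∀
    lemma₃ : ∀ a → 64 ℕ.* (3 ℕ.* (a ℕ.* a)) ≡ 3 ℕ.* (8 ℕ.* a ℕ.* (8 ℕ.* a))
    lemma₃ = solve-∀
    lemma₄ : ∀ z → 3 ℕ.* (9 ℕ.* z ℕ.* (9 ℕ.* z)) ℕ.+ 13 ℕ.* (z ℕ.* z) ≡ 64 ℕ.* (4 ℕ.* (z ℕ.* z))
    lemma₄ = solve-∀
    3a²≤4z² : 3 ℕ.* (a ℕ.* a) ℕ.≤ 4 ℕ.* (z ℕ.* z)
    3a²≤4z² = ℕ.*-cancelˡ-≤ 64 (ℕ.≤-trans (ℕ.≤-reflexive (lemma₃ a)) (ℕ.≤-trans (ℕ.*-monoʳ-≤ 3 (ℕ.*-mono-≤ 8a≤9z 8a≤9z))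
      (ℕ.≤-trans (ℕ.m≤m+n (3 ℕ.* (9 ℕ.* z ℕ.* (9 ℕ.* z))) (13 ℕ.* (z ℕ.* z))) (ℕ.≤-reflexive (lemma₄ z)))))

  module RootBound {K : ℕ} {μ lam lnK r : ℝ} {{0<μ : fromℕ 0 R.< μ}} (μ<1 : μ R.< fromℕ 1) (ln : IsLn (fromℕ K) lnK)
    (root : IsRoot 5 (fromℕ 48 R.÷ μ R.* lnK) r) (r≤lam : r R.≤ lam)
    {z : ℕ} (32≤z : 32 ℕ.≤ z) (near : Eventually (λ n → (ι z ≤ seq lam n) × (seq lam n ≤ ι (z ℕ.+ 2)))) where

    Z : ℕ
    Z = z ℕ.* z ℕ.* z ℕ.* (z ℕ.* z)

    pow≥-1 : ∀ x k → - 1ℚ ≤ x → - 1ℚ ≤ pow x k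
    pow≥-1 x k -1≤x = resolve (≤-total x 0ℚ)
      where
      pow-1 : ∀ k → pow 1ℚ k ≡ 1ℚ
      pow-1 zero    = refl
      pow-1 (suc k) = trans (*-identityˡ (pow 1ℚ k)) (pow-1 k)
      resolve : x ≤ 0ℚ ⊎ 0ℚ ≤ x → - 1ℚ ≤ pow x k
      resolve (inj₁ h) = subst (λ w → - w ≤ pow x k) (pow-1 k) (proj₁ (∣pow∣ k (-1≤x , ≤-trans h 0≤1)))
      resolve (inj₂ h) = ≤-trans (from-yes (- 1ℚ ≤? 0ℚ)) (0≤pow k h)

    root-bounds : Eventually (λ n → (- 1ℚ ≤ seq (r R.^ 5) n) × (seq (r R.^ 5) n ≤ ι ((z ℕ.+ 3) ℕ.^ 5)))
    root-bounds = map (λ {n} (l , u , (_ , u′)) → power 5 n l u u′) (both (proj₁ root 1ℚ) (both (r≤lam 1ℚ) near))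
      where
      power : ∀ k n → 0ℚ ≤ seq r n + 1ℚ → seq r n ≤ seq lam n + 1ℚ → seq lam n ≤ ι (z ℕ.+ 2) →
              (- 1ℚ ≤ seq (r R.^ k) n) × (seq (r R.^ k) n ≤ ι ((z ℕ.+ 3) ℕ.^ k))
      power k n l u u′ = subst (λ w → (- 1ℚ ≤ w) × (w ≤ ι ((z ℕ.+ 3) ℕ.^ k))) (sym (seq-^ r k n))
          (pow≥-1 (seq r n) k -1≤r , subst (pow (seq r n) k ≤_) (pow-ι (z ℕ.+ 3) k) (proj₂ (∣pow∣ k (≤-trans (neg-antimono-≤ (q-mono {1} {z ℕ.+ 3} (ℕ.≤-trans (ℕ.s≤s ℕ.z≤n) (ℕ.m≤n+m 3 z)))) -1≤r , r≤))))
        where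
        -1≤r : - 1ℚ ≤ seq r n
        -1≤r = +-cancelˡ-≤ 1ℚ (≤-trans l (≤-reflexive (+-comm (seq r n) 1ℚ)))
        r≤ : seq r n ≤ ι (z ℕ.+ 3)
        r≤ = ≤-trans u (≤-trans (+-monoˡ-≤ 1ℚ u′) (≤-reflexive (trans (sym (q-+ (z ℕ.+ 2) 1)) (cong ι (ℕ.+-assoc z 2 1)))))

    -- Read off from the root: r ≥ -1 up to the slack gives r⁵ ≥ -1, and 48 ln K / μ is close to r⁵,
    -- so ln K cannot lie below -½. This is the starting bound for `ln-≥`.
    ln-lower : Eventually (λ n → - ½ ≤ seq lnK n)
    ln-lower = map (λ {n} (u , (l , _) , (0<y , y≤1)) → pointwise (inv (seq μ n)) (seq lnK n) (seq (r R.^ 5) n) (inv≥1 0<y y≤1) l u)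
      (both (proj₁ (proj₂ root) 1ℚ) (both root-bounds (unit-bounds μ 0<μ μ<1)))
      where
      pointwise : ∀ v L s → 1ℚ ≤ v → - 1ℚ ≤ s → s ≤ ι 48 * v * L + 1ℚ → - ½ ≤ L
      pointwise v L s 1≤v -1≤s s≤ = ≮⇒≥ λ L<-½ → contradiction (begin
        - 1ℚ                      ≤⟨ ≤-trans -1≤s s≤ ⟩
        ι 48 * v * L + 1ℚ         ≤⟨ +-monoˡ-≤ 1ℚ (*-monoˡ (0≤-* (0≤q 48) (≤-trans 0≤1 1≤v)) (<⇒≤ L<-½)) ⟩
        ι 48 * v * - ½ + 1ℚ       ≡⟨ solve 1 (λ v → con (ι 48) :* v :* con (- ½) :+ con 1ℚ := con (- ι 24) :* v :+ con 1ℚ) refl v ⟩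
        - ι 24 * v + 1ℚ           ≡⟨ cong (_+ 1ℚ) (sym (neg-distribˡ-* (ι 24) v)) ⟩
        - (ι 24 * v) + 1ℚ         ≤⟨ +-monoˡ-≤ 1ℚ (neg-antimono-≤ (*-monoˡ (0≤q 24) 1≤v)) ⟩
        - (ι 24 * 1ℚ) + 1ℚ        ∎) (from-no (- 1ℚ ≤? - (ι 24 * 1ℚ) + 1ℚ))
        where open ≤-Reasoning

    -- From K ≥ 2ᵈ follows ln K ≥ d / 2, so 12 d ≤ 24 ln K, which is half of μ r⁵ up to the slack.
    -- Since r ≤ λ, it is at most μ (z + 3)⁵ / 2, and `fifth-powers` spends the remaining factor 2.
    divisors-bound : ∀ d → 2 ℕ.^ d ℕ.≤ K → ∀ e .{{_ : Positive e}} → Eventually (λ n → ι (12 ℕ.* d) ≤ ι Z * seq μ n + ι 24 * e)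
    divisors-bound zero    _    e {{e>0}} = map (λ {n} (0<y , _) → 0≤-+ {ι Z * seq μ n} {ι 24 * e} (0≤-* (0≤q Z) (<⇒≤ 0<y)) (0≤-* (0≤q 24) (<⇒≤ (positive⁻¹ e {{e>0}})))) (unit-bounds μ 0<μ μ<1)
    divisors-bound (suc d) 2^d≤K e {{e>0}} = map (λ {n} (l , u , (_ , s≤) , (0<y , y≤1)) → pointwise (seq μ n) (seq lnK n) (seq (r R.^ 5) n) 0<y l u s≤)
        (both (ln-≥ {fromℕ K} {lnK} d ln ln-lower (always λ _ → q-mono 2^d≤K) e {{e>0}}) (both (proj₂ (proj₂ root) 1ℚ) (both root-bounds (unit-bounds μ 0<μ μ<1))))
      where
      pointwise : ∀ y L s → 0ℚ < y → halves (suc d) ≤ L + e → ι 48 * inv y * L ≤ s + 1ℚ → s ≤ ι ((z ℕ.+ 3) ℕ.^ 5) → ι (12 ℕ.* suc d) ≤ ι Z * y + ι 24 * e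
      pointwise y L s 0<y l u s≤ = begin
        ι (12 ℕ.* suc d)                                ≡⟨ trans (q-* 12 (suc d)) (solve 1 (λ d → con (ι 12) :* d := con (ι 24) :* (d :* con ½)) refl (ι (suc d))) ⟩
        ι 24 * halves (suc d)                           ≤⟨ *-monoˡ (0≤q 24) l ⟩
        ι 24 * (L + e)                                  ≡⟨ *-distribˡ-+ (ι 24) L e ⟩
        ι 24 * L + ι 24 * e                             ≡⟨ cong (λ w → ι 24 * w + ι 24 * e) (sym (trans (cong (_* L) (inv-inverse 0<y)) (*-identityˡ L))) ⟩
        ι 24 * (inv y * y * L) + ι 24 * e               ≡⟨ cong (_+ ι 24 * e) (solve 3 (λ v y l → con (ι 24) :* (v :* y :* l) := con ½ :* (con (ι 48) :* v :* l) :* y) refl (inv y) y L) ⟩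
        ½ * (ι 48 * inv y * L) * y + ι 24 * e           ≤⟨ +-monoˡ-≤ (ι 24 * e) (*-monoʳ (<⇒≤ 0<y) (*-monoˡ (<⇒≤ (positive⁻¹ ½)) (≤-trans u s+1≤))) ⟩
        ½ * (ι 2 * ι Z) * y + ι 24 * e                  ≡⟨ cong (_+ ι 24 * e) (solve 2 (λ z y → con ½ :* (con (ι 2) :* z) :* y := z :* y) refl (ι Z) y) ⟩
        ι Z * y + ι 24 * e                              ∎
        where
        open ≤-Reasoning
        s+1≤ : s + 1ℚ ≤ ι 2 * ι Z
        s+1≤ = begin
          s + 1ℚ                            ≤⟨ +-monoˡ-≤ 1ℚ s≤ ⟩
          ι ((z ℕ.+ 3) ℕ.^ 5) + ι 1         ≡⟨ sym (q-+ ((z ℕ.+ 3) ℕ.^ 5) 1) ⟩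
          ι ((z ℕ.+ 3) ℕ.^ 5 ℕ.+ 1)         ≤⟨ q-mono (fifth-powers 32≤z) ⟩
          ι (2 ℕ.* Z)                       ≡⟨ q-* 2 Z ⟩
          ι 2 * ι Z                         ∎

    probability-bound : ∀ c d → 2 ℕ.^ d ℕ.≤ K → c * ι Z ≤ ι (12 ℕ.* d) → fromℚ c R.≤ μ
    probability-bound c d 2^d≤K c≤ e {{e>0}} = scaled (e * (ℤ.+ 1 / 24)) (solve 1 (λ e → con (ι 24) :* (e :* con (ℤ.+ 1 / 24)) := e) refl e) (pos*pos⇒pos e {{e>0}} (ℤ.+ 1 / 24))
      where
      1≤Z : 1 ℕ.≤ Z
      1≤Z = ℕ.*-mono-≤ (ℕ.*-mono-≤ (ℕ.*-mono-≤ 1≤z 1≤z) 1≤z) (ℕ.*-mono-≤ 1≤z 1≤z)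
        where
        1≤z : 1 ℕ.≤ z
        1≤z = ℕ.≤-trans (ℕ.s≤s ℕ.z≤n) 32≤z
      pointwise : ∀ y → ι (12 ℕ.* d) ≤ ι Z * y + e → c ≤ y + e
      pointwise y h = *-cancelʳ-≤-pos (ι Z) {{positive (<-≤-trans (positive⁻¹ 1ℚ) (q-mono 1≤Z))}} (begin
        c * ι Z               ≤⟨ c≤ ⟩
        ι (12 ℕ.* d)          ≤⟨ h ⟩
        ι Z * y + e           ≡⟨ cong₂ _+_ (*-comm (ι Z) y) (sym (*-identityʳ e)) ⟩
        y * ι Z + e * 1ℚ      ≤⟨ +-monoʳ-≤ (y * ι Z) (*-monoˡ (<⇒≤ (positive⁻¹ e {{e>0}})) (q-mono 1≤Z)) ⟩
        y * ι Z + e * ι Z     ≡⟨ sym (*-distribʳ-+ (ι Z) y e) ⟩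
        (y + e) * ι Z         ∎)
        where open ≤-Reasoning
      scaled : ∀ e′ → ι 24 * e′ ≡ e → .(Positive e′) → Eventually (λ n → c ≤ seq μ n + e)
      scaled e′ eq e′>0 = map (λ {n} h → pointwise (seq μ n) (subst (λ w → ι (12 ℕ.* d) ≤ ι Z * seq μ n + w) eq h)) (divisors-bound d 2^d≤K e′ {{e′>0}})

  module Prescribed {k : ℕ} {lam ε : ℝ} {{0<ε : fromℕ 0 R.< ε}} (large : 6 ℕ.≤ k) (ran : Range k lam ε)
    {params : Parameters} (prescribed : PrescribedBy lam ε params) where

    open Range ran
    open Parameters params

    os-unique : Unique (toList odds)
    os-unique = proj₁ (proj₁ prescribed)

    es-unique : Unique (toList evens)
    es-unique = proj₁ (proj₁ (proj₂ prescribed))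

    odd-iff = proj₂ (proj₁ prescribed)
    even-iff = proj₂ (proj₁ (proj₂ prescribed))

    os-≥ : ∀ {p} → p ∈ toList odds → z ℕ.< p
    os-≥ {p} p∈ =
      let _ , lam<p , _ = Equivalence.to (odd-iff p) p∈
          n , h , l , u = witness (both (separated lam (fromℕ p) lam<p) near)
      in ℕ.≰⇒> λ p≤z → <-irrefl refl (<-≤-trans h (≤-trans (q-mono p≤z) l))

    os-≤ : ∀ {p} → p ∈ toList odds → p ℕ.≤ 2 ℕ.* z ℕ.+ 4
    os-≤ {p} p∈ =
      let _ , _ , p<2lam = Equivalence.to (odd-iff p) p∈
          n , h , l , u = witness (both (separated (fromℕ p) (fromℕ 2 R.* lam) p<2lam) near)
      in q-cancel (≤-trans (<⇒≤ h) (≤-trans (*-monoˡ (0≤q 2) u) (≤-reflexive (trans (sym (q-* 2 (z ℕ.+ 2))) (cong ι (ℕ.*-distribˡ-+ 2 z 2))))))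

    -- The order < of reals asks for a positive gap between the sequences; strict inequalities of
    -- integers provide the gap 1 on either side.
    ∈-os : ∀ {p} → 2 ∤ p → 2 ℕ.+ z ℕ.< p → p ℕ.< 2 ℕ.* z → p ∈ toList odds
    ∈-os {p} 2∤p z<p p<2z = Equivalence.from (odd-iff p) (2∤p , below , above)
      where
      N = proj₁ near
      below : lam R.< fromℕ p
      below = record { gap = 1ℚ ; gap-pos = _ ; from = N ; gap-separates = λ {n} N≤n →
        ≤-trans (+-monoˡ-≤ 1ℚ (proj₂ (proj₂ near N≤n))) (≤-trans (≤-reflexive (sym (q-+ (z ℕ.+ 2) 1))) (q-mono (ℕ.≤-trans (ℕ.≤-reflexive (trans (ℕ.+-comm (z ℕ.+ 2) 1) (cong suc (ℕ.+-comm z 2)))) z<p))) }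
      above : fromℕ p R.< fromℕ 2 R.* lam
      above = record { gap = 1ℚ ; gap-pos = _ ; from = N ; gap-separates = λ {n} N≤n →
        ≤-trans (≤-reflexive (sym (q-+ p 1))) (≤-trans (q-mono (ℕ.≤-trans (ℕ.≤-reflexive (ℕ.+-comm p 1)) p<2z)) (≤-trans (≤-reflexive (q-* 2 z)) (*-monoˡ {ι z} {seq lam n} (0≤q 2) (proj₁ (proj₂ near N≤n))))) }

    es-≤ : ∀ {a} → a ∈ toList evens → a ℕ.≤ (z ℕ.+ 2) ℕ.^ 5
    es-≤ {a} a∈ =
      let _ , _ , a≤ = Equivalence.to (even-iff a) a∈
          n , h , l , u = witness (both (a≤ ½) near)
      in ι-cancel-½ (≤-trans h (+-monoˡ-≤ ½ (proj₂ (seq-^-bounds lam 5 {z} {z ℕ.+ 2} n l u))))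

    ∈-es : ∀ {a} → 2 ∣ a → 1 ℕ.≤ a → a ℕ.≤ z ℕ.* z ℕ.* z ℕ.* (z ℕ.* z) → a ∈ toList evens
    ∈-es {a} 2∣a 1≤a a≤ = Equivalence.from (even-iff a) (2∣a , 1≤ , ≤lam⁵)
      where
      1≤ : fromℕ 1 R.≤ fromℕ a
      1≤ e = always λ _ → ≤-trans (q-mono 1≤a) (≤-+ (<⇒≤ (positive⁻¹ e)))
      ≤lam⁵ : fromℕ a R.≤ lam R.^ 5
      ≤lam⁵ e = map (λ {n} (l , u) → ≤-trans (≤-trans (q-mono (ℕ.≤-trans a≤ (ℕ.≤-reflexive (sym (^5 z))))) (proj₁ (seq-^-bounds lam 5 {z} {z ℕ.+ 2} n l u))) (≤-+ {seq (lam R.^ 5) n} {e} (<⇒≤ (positive⁻¹ e)))) near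

    1≤draws₃ : ∀ {p} → Prime p → 1 ℕ.≤ draws₃ p
    1≤draws₃ {p} pp = let _ , _ , _ , _ , _ , _ , _ , _ , logs = prescribed ; l , log , l≤ , _ = logs pp in log-ceiling≥1 (fromℕ p) (fromℕ 4 R.÷ ε) l (draws₃ p) log 4/ε≥3 l≤

    2^6≤z+2 : 2 ℕ.^ 6 ℕ.≤ z ℕ.+ 2
    2^6≤z+2 = ℕ.≤-trans (ℕ.^-monoʳ-≤ 2 large) 2^k≤z+2

    draws₂≤ : draws₂ ℕ.≤ 12 ℕ.* (suc (suc h) ℕ.* suc (suc h)) ℕ.+ 1
    draws₂≤ = let _ , _ , lnλ , ln4/ε , ln-lam , ln-4/ε , _ , (_ , ceiling) , _ = prescribed in bound lnλ ln4/ε ln-lam ln-4/ε ceiling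
      where
      lam≥3 : Eventually (λ n → ι 3 ≤ seq lam n)
      lam≥3 = map (λ (l , _) → ≤-trans (q-mono {3} {z} 3≤z) l) near
        where
        3≤z : 3 ℕ.≤ z
        3≤z = ℕ.+-cancelʳ-≤ 2 3 z (ℕ.≤-trans (ℕ.m≤m+n 5 59) 2^6≤z+2)
      lam≤ : Eventually (λ n → seq lam n + 1ℚ ≤ ι (2 ℕ.^ (2 ℕ.+ h)))
      lam≤ = map (λ (_ , u) → ≤-trans (+-monoˡ-≤ 1ℚ u) (≤-trans (≤-reflexive (sym (q-+ (z ℕ.+ 2) 1))) (q-mono {z ℕ.+ 2 ℕ.+ 1} {2 ℕ.^ (2 ℕ.+ h)} (z+3≤2^2+h {z} {h} z<2^h)))) near
      bound : ∀ lnλ ln4/ε → IsLn lam lnλ → IsLn (fromℕ 4 R.÷ ε) ln4/ε → fromℕ draws₂ R.< fromℕ 12 R.* ln4/ε R.* lnλ R.+ fromℕ 1 → draws₂ ℕ.≤ 12 ℕ.* (suc (suc h) ℕ.* suc (suc h)) ℕ.+ 1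
      bound lnλ ln4/ε ln-lam ln-4/ε ceiling = draws-bound ln4/ε lnλ draws₂ (2 ℕ.+ h) ceiling
        (ln-≥½ {fromℕ 4 R.÷ ε} {ln4/ε} ln-4/ε 4/ε≥3) (ln-≤ {fromℕ 4 R.÷ ε} {ln4/ε} (2 ℕ.+ h) ln-4/ε 4/ε≤)
        (ln-≥½ {lam} {lnλ} ln-lam lam≥3) (ln-≤ {lam} {lnλ} (2 ℕ.+ h) ln-lam lam≤)

-- Combination of the counts with the probabilities.

open import Data.Nat using (ℕ; NonZero)
open import Defs

module Combination (K : ℕ) .{{_ : NonZero K}}
  {μ : ℝ} {{0<μ : fromℕ 0 < μ}} (μ<1 : μ < fromℕ 1)
  {ε : ℝ} {{0<ε : fromℕ 0 < ε}} {lam : ℝ} {lnK : ℝ} (ln : IsLn (fromℕ K) lnK)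
  {r : ℝ} (root : IsRoot 5 (fromℕ 48 ÷ μ * lnK) r) (r≤lam : r ≤ lam)
  {params : Parameters} (prescribed : PrescribedBy lam ε params) where

  import Data.Nat as ℕ
  import Data.Nat.Properties as ℕ
  open import Data.Nat.Tactic.RingSolver using (solve-∀)
  open import Data.List.NonEmpty using (toList)
  open import Relation.Binary.PropositionalEquality

  bound : ∀ {k} → 58 ℕ.≤ k → Bounds.Range k lam ε → fromℚ (condPr (qDivides? K) triple? (algorithm params)) ≤ μ
  bound {k} 58≤k ran = probability-bound (condPr (qDivides? K) triple? (algorithm params)) divisors 2^divisors≤K
      (condPr-bound (12 ℕ.* divisors) Z count)
    where
    open Parameters params
    open Bounds.Range ran
    58≤h = ℕ.≤-trans 58≤k k≤h
    open Hypotheses.Prescribed {k} {lam} {ε} (ℕ.≤-trans (ℕ.m≤m+n 6 52) 58≤k) ran {params} prescribed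
    32≤z : 32 ℕ.≤ z
    32≤z = ℕ.+-cancelʳ-≤ 2 32 z (ℕ.≤-trans (ℕ.m≤m+n 34 30) 2^6≤z+2)
    open Hypotheses.RootBound {K} {μ} {lam} {lnK} {r} μ<1 ln root r≤lam {z} 32≤z near
    open Success params K 1≤draws₃ using (ΣA; ΣB; condPr-bound)
    open Arithmetic z h K (ℕ.>-nonZero⁻¹ K) 58≤h z<2^h 2^h≤2z (toList odds) (toList evens) os-unique es-unique os-≥ os-≤ ∈-os es-≤ ∈-es
      using (many-A; few-B; 2^divisors≤K; divisors)
    open PairCount z h 58≤h z<2^h 2^h≤2z using (draws)
    -- 12 = 2 · 6: the 2 is the success probability ½ of the third stage, the 6 the number of p for
    -- one prime q. The factor `draws` inside `many-A` cancels draws₂.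
    count : 2 ℕ.* (draws₂ ℕ.* ΣB) ℕ.* Z ℕ.≤ 12 ℕ.* divisors ℕ.* ΣA
    count = begin
      2 ℕ.* (draws₂ ℕ.* ΣB) ℕ.* Z             ≤⟨ ℕ.*-monoˡ-≤ Z (ℕ.*-monoʳ-≤ 2 (ℕ.*-mono-≤ draws₂≤ few-B)) ⟩
      2 ℕ.* (draws ℕ.* (divisors ℕ.* 6)) ℕ.* Z ≡⟨ rearrange draws divisors Z ⟩
      12 ℕ.* divisors ℕ.* (draws ℕ.* Z)       ≤⟨ ℕ.*-monoʳ-≤ (12 ℕ.* divisors) many-A ⟩
      12 ℕ.* divisors ℕ.* ΣA                  ∎
      where
      open ℕ.≤-Reasoning
      rearrange : ∀ a b c → 2 ℕ.* (a ℕ.* (b ℕ.* 6)) ℕ.* c ≡ 12 ℕ.* b ℕ.* (a ℕ.* c)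
      rearrange = solve-∀

theorem2 : (K : ℕ) .{{_ : NonZero K}}
    (μ : ℝ) {{_ : fromℕ 0 < μ}} → μ < fromℕ 1 →
    (ε : ℝ) {{_ : fromℕ 0 < ε}} → ε < fromℕ 1 →
    (lam : ℝ) → _÷_ (fromℕ 2 ^ 58) (ε ^ 2) {{^-positive ε 2}} ≤ lam →
    (lnK : ℝ) → IsLn (fromℕ K) lnK →
    (r : ℝ) → IsRoot 5 (fromℕ 48 ÷ μ * lnK) r →
    _÷_ (fromℕ 2 ^ 56) (μ ^ 2) {{^-positive μ 2}} ≤ lam → r ≤ lam →
    (params : Parameters) → PrescribedBy lam ε params →
    fromℚ (condPr (qDivides? K) triple? (algorithm params)) ≤ μ
theorem2 K μ μ<1 ε ε<1 lam large lnK ln r root _ r≤lam params prescribed =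
  Combination.bound K {μ} μ<1 {ε} {lam} {lnK} ln {r} root r≤lam {params} prescribed (ℕ.m≤m+n 58 0) (Bounds.range 58 (ℕ.m≤m+n 6 52) lam ε ε<1 large)
  where
  import Data.Nat as ℕ
  import Data.Nat.Properties as ℕ
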